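{- There is a universal constant $\varepsilon_0>0$ and a randomized algorithm that, given query access to an $n$-point metric $w$ with positive integer entries together with an arbitrary minimum spanning tree of the complete graph $G_w$ (including its edge weights), performs $\tilde O(n^{1.5})$ distance queries and with high probability outputs a value $X$ with $\mathsf{TSP}(w)\le X\le(2-\varepsilon_0)\,\mathsf{TSP}(w)$.
   Context: Query access means that the algorithm may query any entry $w(u,v)$ of the $n\times n$ distance matrix. $G_w$ is the complete graph on the $n$ points with edge weights $w$; $\mathsf{TSP}(w)$ is the minimum weight of a Hamiltonian cycle in $G_w$. $\tilde O$ hides polylogarithmic factors in $n$. -}

module Defs where

open import Data.Bool.Base using (if_then_else_)
open import Data.Fin.Base as Fin using (Fin)
open import Data.Integer.Base using (+_)
open import Data.List.Base using (List; []; _∷_; _∷ʳ_; length; map; sum; zip)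
open import Data.List.Membership.Propositional using (_∈_)
open import Data.List.Relation.Unary.All using (All)
open import Data.List.Relation.Unary.Unique.Propositional using (Unique)
open import Data.Nat.Base using (ℕ; suc; _+_; _*_; _^_; _≤_; _⊔_)
open import Data.Nat.Logarithm using (⌈log₂_⌉)
open import Data.Product.Base using (_×_; _,_; ∃-syntax; uncurry)
open import Data.Rational as ℚ using (ℚ; 0ℚ; 1ℚ)
open import Data.Vec.Functional using (foldr)
open import Level using (Level)
open import Relation.Binary.Core using (Rel)
open import Relation.Binary.Construct.Closure.ReflexiveTransitive using (Star)
open import Relation.Binary.Construct.Closure.Symmetric using (SymClosure)
open import Relation.Binary.PropositionalEquality using (_≡_; _≢_)
open import Relation.Nullary using (¬_; does)
open import Relation.Unary using (Pred; Decidable)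

private
  variable
    a ℓ : Level
    A   : Set a
    n   : ℕ

fromℕ : ℕ → ℚ
fromℕ m = + m ℚ./ 1

Weights : ℕ → Set
Weights n = Fin n → Fin n → ℕ

-- [v₁,…,vₖ] ↦ [(v₁,v₂),…,(vₖ₋₁,vₖ),(vₖ,v₁)]
closedSteps : List A → List (A × A)
closedSteps []       = []
closedSteps (v ∷ vs) = zip (v ∷ vs) (vs ∷ʳ v)

IsCycle : {A : Set a} → Rel A ℓ → List A → Set _
IsCycle _~_ vs = 3 ≤ length vs × Unique vs × All (uncurry _~_) (closedSteps vs)

-- Adjacency in the complete graph is _≢_.
IsHamiltonianCycle : List (Fin n) → Set
IsHamiltonianCycle vs = IsCycle _≢_ vs × (∀ v → v ∈ vs)

cycleWeight : Weights n → List (Fin n) → ℕ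
cycleWeight w vs = sum (map (uncurry w) (closedSteps vs))

-- TSP(w) = t
IsTSP : Weights n → ℕ → Set
IsTSP w t =
  (∃[ vs ] IsHamiltonianCycle vs × cycleWeight w vs ≡ t) ×
  (∀ vs → IsHamiltonianCycle vs → t ≤ cycleWeight w vs)

Edge : ℕ → Set
Edge n = Fin n × Fin n

Adjacent : List (Edge n) → Rel (Fin n) _
Adjacent es = SymClosure (λ u v → (u , v) ∈ es)

-- An undirected edge is listed once, as the pair with its smaller
-- endpoint first; the order of the list is irrelevant.
record IsSpanningTree (es : List (Edge n)) : Set where
  field
    ordered   : All (uncurry Fin._<_) es
    simple    : Unique es
    connected : ∀ u v → Star (Adjacent es) u v
    acyclic   : ∀ vs → ¬ IsCycle (Adjacent es) vs

treeWeight : Weights n → List (Edge n) → ℕ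
treeWeight w es = sum (map (uncurry w) es)

IsMST : Weights n → List (Edge n) → Set
IsMST w es =
  IsSpanningTree es ×
  (∀ es′ → IsSpanningTree es′ → treeWeight w es ≤ treeWeight w es′)

WeightedEdge : ℕ → Set
WeightedEdge n = Edge n × ℕ

withWeights : Weights n → List (Edge n) → List (WeightedEdge n)
withWeights w = map (λ e → e , uncurry w e)

-- The matrix is accessible only through `query`, whose continuation
-- receives the entry. `random k` draws a uniform element of Fin (suc k).
-- Computation between queries is not charged.
data QueryAlg (n : ℕ) (A : Set) : Set where
  return : A → QueryAlg n A
  query  : (u v : Fin n) → (ℕ → QueryAlg n A) → QueryAlg n A
  random : (k : ℕ) → (Fin (suc k) → QueryAlg n A) → QueryAlg n A

-- Worst case over the random choices.
queries : {A : Set} → Weights n → QueryAlg n A → ℕ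
queries w (return _)    = 0
queries w (query u v f) = suc (queries w (f (w u v)))
queries w (random k f)  = foldr _⊔_ 0 (λ i → queries w (f i))

-- The probability that the output of the algorithm, run on w, satisfies P.
Pr : {A : Set} → Weights n → {P : Pred A ℓ} → Decidable P → QueryAlg n A → ℚ
Pr w P? (return x)    = if does (P? x) then 1ℚ else 0ℚ
Pr w P? (query u v f) = Pr w P? (f (w u v))
Pr w P? (random k f)  =
  foldr ℚ._+_ 0ℚ (λ i → Pr w P? (f i)) ℚ.* (+ 1 ℚ./ suc k)

-- p ≥ 1 − 1/n, with the denominator cleared.
HighProbability : ℕ → ℚ → Set
HighProbability n p = (1ℚ ℚ.- p) ℚ.* fromℕ n ℚ.≤ 1ℚ

-- q(n) = Õ(n^1.5), squared to avoid the fractional exponent: for n ≥ 2,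
-- q(n) ≤ √C · n^1.5 · ⌈log₂ n⌉^(k/2).
Õ[n^1·5] : (ℕ → ℕ) → Set
Õ[n^1·5] q = ∃[ C ] ∃[ k ] ∀ n → 2 ≤ n → q n ^ 2 ≤ C * n ^ 3 * ⌈log₂ n ⌉ ^ k

{-# OPTIONS --safe #-}
module Submission where

-- Let M be the weight of the given minimum spanning tree T, so that M ≤ TSP ≤ 2 M.  It suffices to
-- tell TSP ≤ (2 − η₀) M from TSP ≥ 1.1 M for a small constant η₀.
--
-- Certificates.  For a list S of pairs, T and S carry a closed walk through all points that takes
-- the pairs of S once and a tree edge once or twice, according to the parity of the number of pairs
-- crossing it.  A cheap S crossing much of T oddly therefore certifies a tour below 2 M, and by
-- averaging such an S is found in any fractional choice of pairs.
--
-- Far pairs.  Marked edges cut T such that each edge has at most b ≈ n^¼ points below it in its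
-- component.  Sort the pairs of a tour by how high they reach and assign every tree edge to the
-- first two pairs crossing it.  At most O(b³) pairs are assigned an edge outside of their
-- components; certificates of that size are searched for exhaustively, with all distances known up
-- to M / O(b³) from the O(b⁶) distances within a net of O(b³) points.
--
-- Near pairs.  Every other pair f is assigned a subpath of the local part of its tree path.  Call a
-- subpath of length 4/3 d(f) of that part a window.  In round i a unit of tree length dies when one
-- of N i ∼ cⁱ random windows through it is active, that is, when random units of the window
-- survived all earlier rounds.  Active windows form a fractional certificate covering the dead
-- units, and after J ≈ log_z b rounds every window contains a constant fraction of dead units.  So
-- if TSP ≤ 1.1 M and no far certificate exists, then a constant fraction of T is dead, and if many
-- units are dead, then TSP ≤ (2 − η₀) M.
--
-- Whether a random unit is dead is tested by simulating its history recursively, which takes O(b⁶)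
-- = O(n^1.5) expected queries; runs that exceed a multiple of this are aborted, and O(log n) runs
-- are combined by a Chernoff bound.

open import Defs
open import Data.Bool.Base using (Bool; true; false; if_then_else_; not; _∧_; _∨_; _xor_)
import Data.Bool.Base as Bool
import Data.Bool.Properties as Bool
open import Data.Empty using (⊥; ⊥-elim)
open import Data.Fin.Base as Fin using (Fin; zero; suc; toℕ)
import Data.Fin.Properties as Fin
open import Data.Integer.Base as ℤ using ()
import Data.Integer.Properties as ℤ
open import Data.List.Base using (List; []; _∷_; _++_; _∷ʳ_; length; map; concatMap; zip; reverse; filterᵇ; take; drop; upTo; downFrom; cartesianProduct; lookup; replicate; deduplicate)
import Data.List.Membership.DecPropositional as DecMembership
open import Data.List.Membership.Propositional using (_∈_)
open import Data.List.Membership.Propositional.Properties as ∈ using ()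
import Data.List.Properties as List
open import Data.List.Relation.Binary.Permutation.Propositional as ↭ using (_↭_; ↭-sym)
open import Data.List.Relation.Binary.Permutation.Propositional.Properties as ↭ using (∈-resp-↭)
import Data.List.Relation.Binary.Permutation.Setoid.Properties as ↭ₛ
open import Data.List.Relation.Binary.Sublist.Propositional using (_⊆_; []; _∷_) renaming (_∷ʳ_ to _∷ˢ_)
import Data.List.Relation.Binary.Sublist.Propositional as Sublist
import Data.List.Relation.Binary.Sublist.Propositional.Properties as Sublist
open import Data.List.Relation.Unary.All as All using (All; []; _∷_)
import Data.List.Relation.Unary.All.Properties as All
open import Data.List.Relation.Unary.AllPairs as AllPairs using (AllPairs; []; _∷_)
import Data.List.Relation.Unary.AllPairs.Properties as AllPairs
open import Data.List.Relation.Unary.Any as Any using (Any; here; there)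
import Data.List.Relation.Unary.Any.Properties as Any
import Data.List.Relation.Unary.Linked.Properties as Linked
open import Data.List.Relation.Unary.Unique.DecPropositional.Properties using (deduplicate-!)
open import Data.List.Relation.Unary.Unique.Propositional using (Unique)
import Data.List.Relation.Unary.Unique.Propositional.Properties as Unique
import Data.List.Sort as Sort
open import Data.Maybe.Base using (Maybe; just; nothing; maybe)
open import Data.Nat.Base using (ℕ; zero; suc; ⌈_/2⌉; _+_; _*_; _∸_; _^_; _≤_; _<_; _⊔_; _≤′_; ≤′-refl; ≤′-step; z≤n; s≤s; NonZero; ≢-nonZero)
import Data.Nat.Base as ℕ
open import Data.Nat.Coprimality as Coprimality using (1-coprimeTo)
import Data.Nat.DivMod as ℕ
open import Data.Nat.Induction using (<-rec)
open import Data.Nat.ListAction using (sum)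
open import Data.Nat.Logarithm using (⌈log₂_⌉; ⌈log₂⌉-mono-≤; ⌈log₂⌈n/2⌉⌉≡⌈log₂n⌉∸1)
import Data.Nat.Properties as ℕ
open import Data.Nat.Tactic.RingSolver using () renaming (solve-∀ to ℕ-solve-∀)
open import Data.Product.Base using (_×_; _,_; proj₁; proj₂; ∃-syntax; Σ-syntax; uncurry)
open import Data.Product.Properties using (≡-dec)
open import Data.Rational as ℚ using (ℚ; 0ℚ; 1ℚ; ½)
import Data.Rational.Properties as ℚ
open import Data.Sum.Base as Sum using (_⊎_; inj₁; inj₂; [_,_]′)
open import Data.Vec.Functional using () renaming (foldr to vfoldr)
open import Function.Base using (_∘_; _∋_; id; case_of_; const)
open import Function.Metric.Nat using (IsMetric)
open import Relation.Binary.Construct.Closure.ReflexiveTransitive using (Star; _◅_; _◅◅_) renaming (ε to ε⋆)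
open import Relation.Binary.Construct.Closure.Symmetric using (fwd; bwd)
import Relation.Binary.Construct.On as On
open import Relation.Binary.PropositionalEquality using (_≡_; _≢_; refl; sym; trans; cong; cong₂; subst; module ≡-Reasoning)
import Relation.Binary.PropositionalEquality.Properties as ≡
open import Relation.Nullary using (¬_; Dec; yes; no; does; contradiction)
open import Relation.Nullary.Decidable using (_×-dec_; _⊎-dec_; dec-true; ¬?; ⌊_⌋; dec⇒maybe)
open import Relation.Unary using (Pred; Decidable)
open import Tactic.RingSolver using (solve-∀)
import Tactic.RingSolver.Core.AlmostCommutativeRing as ACR

-- Two inequalities fix the constants. Keeping a pair with small probability s lowers the expected
-- sign of each edge it crosses by 2 s, and half of that is saved. So a window of length 4/3 d saves
-- about 4/3 s d for the price s d, a profit. On the other side, a near pair without dead units is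
-- assigned at most 5/3 of its distance (four grid cells of length d/3 that form no full window, and
-- one more to reach the grid). As every edge is assigned to two pairs, a tour then costs at least 2
-- M / (5/3) = 6/5 M, above the threshold 1.1 M.
--
-- The obstacle is that a window is worth using only if its units are not yet covered by other
-- windows, whose distances are unread. Rounds of slowly growing intensity resolve this: the load of
-- a unit stays bounded, and a unit that survives has met few active windows, which keeps its
-- simulated history short.
--
-- The exponent balances two costs. About b n pairs lie near a unit, and reaching that intensity
-- costs a further factor b in the recursion, n b² in all; the net has O(n/b) points and (n/b)²
-- distances. Both are n^1.5 at b = n^¼.

-- Rational arithmetic and finite sums

ℚ-ring : ACR.AlmostCommutativeRing _ _
ℚ-ring = ACR.fromCommutativeRing ℚ.+-*-commutativeRing λ x → dec⇒maybe (0ℚ ℚ.≟ x)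

-- l ≤ r gives a ≤ b as soon as b − a = r − l; the equation is a ring identity.
≤-by : ∀ {a b l r} → l ℚ.≤ r → a ℚ.+ r ≡ b ℚ.+ l → a ℚ.≤ b
≤-by {a} {b} {l} {r} l≤r eq = begin
  a                     ≡⟨ ((∀ a l → a ≡ a ℚ.+ l ℚ.- l) ∋ solve-∀ ℚ-ring) a l ⟩
  a ℚ.+ l ℚ.- l         ≤⟨ ℚ.+-monoˡ-≤ (ℚ.- l) (ℚ.+-monoʳ-≤ a l≤r) ⟩
  a ℚ.+ r ℚ.- l         ≡⟨ cong (ℚ._- l) eq ⟩
  b ℚ.+ l ℚ.- l         ≡⟨ ((∀ b l → b ℚ.+ l ℚ.- l ≡ b) ∋ solve-∀ ℚ-ring) b l ⟩
  b                     ∎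
  where open ℚ.≤-Reasoning

≡≤ : ∀ {a b c} → a ≡ b → b ℚ.≤ c → a ℚ.≤ c
≡≤ refl b≤c = b≤c

≤≡ : ∀ {a b c} → a ℚ.≤ b → b ≡ c → a ℚ.≤ c
≤≡ a≤b refl = a≤b

infixl 6 _+≤_
_+≤_ : ∀ {a b c d} → a ℚ.≤ b → c ℚ.≤ d → a ℚ.+ c ℚ.≤ b ℚ.+ d
_+≤_ = ℚ.+-mono-≤

*≤ : ∀ {c a b} → 0ℚ ℚ.≤ c → a ℚ.≤ b → c ℚ.* a ℚ.≤ c ℚ.* b
*≤ {c} 0≤c a≤b = ℚ.*-monoˡ-≤-nonNeg c {{ℚ.nonNegative 0≤c}} a≤b

≤* : ∀ {c a b} → 0ℚ ℚ.≤ c → a ℚ.≤ b → a ℚ.* c ℚ.≤ b ℚ.* c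
≤* {c} 0≤c a≤b = ℚ.*-monoʳ-≤-nonNeg c {{ℚ.nonNegative 0≤c}} a≤b

*≤* : ∀ {a b c d} → 0ℚ ℚ.≤ c → 0ℚ ℚ.≤ b → a ℚ.≤ b → c ℚ.≤ d → a ℚ.* c ℚ.≤ b ℚ.* d
*≤* 0≤c 0≤b a≤b c≤d = ℚ.≤-trans (≤* 0≤c a≤b) (*≤ 0≤b c≤d)

0≤* : ∀ {a b} → 0ℚ ℚ.≤ a → 0ℚ ℚ.≤ b → 0ℚ ℚ.≤ a ℚ.* b
0≤* {a} {b} 0≤a 0≤b = subst (ℚ._≤ a ℚ.* b) (ℚ.*-zeroʳ a) (*≤ 0≤a 0≤b)

0≤+ : ∀ {a b} → 0ℚ ℚ.≤ a → 0ℚ ℚ.≤ b → 0ℚ ℚ.≤ a ℚ.+ b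
0≤+ 0≤a 0≤b = 0≤a +≤ 0≤b

0≤1 : 0ℚ ℚ.≤ 1ℚ
0≤1 = ℚ.nonNegative⁻¹ 1ℚ

0≤b-a : ∀ {a b} → a ℚ.≤ b → 0ℚ ℚ.≤ b ℚ.- a
0≤b-a {a} {b} a≤b = ≤-by a≤b (((∀ a b → 0ℚ ℚ.+ b ≡ b ℚ.- a ℚ.+ a) ∋ solve-∀ ℚ-ring) a b)

*-cancelˡ-≤ : ∀ {c a b} → 0ℚ ℚ.< c → c ℚ.* a ℚ.≤ c ℚ.* b → a ℚ.≤ b
*-cancelˡ-≤ {c} 0<c = ℚ.*-cancelˡ-≤-pos c {{ℚ.positive 0<c}}

fromℕ-mkℚ : ∀ m → fromℕ m ≡ ℚ.mkℚ (ℤ.+ m) 0 (Coprimality.sym (1-coprimeTo m))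
fromℕ-mkℚ m = ℚ.↥p/↧p≡p (ℚ.mkℚ (ℤ.+ m) 0 (Coprimality.sym (1-coprimeTo m)))

-- Opaque, so that unification can read m off ι m.
opaque
  ι : ℕ → ℚ
  ι = fromℕ

  ι≡fromℕ : ∀ m → ι m ≡ fromℕ m
  ι≡fromℕ m = refl

  ι-0 : ι 0 ≡ 0ℚ
  ι-0 = refl

  ι-1 : ι 1 ≡ 1ℚ
  ι-1 = refl

  ι-+ : ∀ m n → ι (m + n) ≡ ι m ℚ.+ ι n
  ι-+ m n rewrite fromℕ-mkℚ (m + n) | fromℕ-mkℚ m | fromℕ-mkℚ n =
    sym (trans (cong (ℚ._/ 1) (cong₂ ℤ._+_ (ℤ.*-identityʳ (ℤ.+ m)) (ℤ.*-identityʳ (ℤ.+ n)))) (fromℕ-mkℚ (m + n)))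

  ι-* : ∀ m n → ι (m * n) ≡ ι m ℚ.* ι n
  ι-* m n rewrite fromℕ-mkℚ (m * n) | fromℕ-mkℚ m | fromℕ-mkℚ n =
    sym (trans (cong (ℚ._/ 1) (sym (ℤ.pos-* m n))) (fromℕ-mkℚ (m * n)))

  ι-mono : ∀ {m n} → m ≤ n → ι m ℚ.≤ ι n
  ι-mono {m} {n} m≤n rewrite fromℕ-mkℚ m | fromℕ-mkℚ n =
    ℚ.*≤* (ℤ.*-monoʳ-≤-nonNeg (ℤ.+ 1) (ℤ.+≤+ m≤n))

  ι-cancel-≤ : ∀ {m n} → ι m ℚ.≤ ι n → m ≤ n
  ι-cancel-≤ {m} {n} p rewrite fromℕ-mkℚ m | fromℕ-mkℚ n with p
  ... | ℚ.*≤* q = ℤ.drop‿+≤+ (ℤ.*-cancelʳ-≤-pos (ℤ.+ m) (ℤ.+ n) (ℤ.+ 1) q)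

ι-suc : ∀ m → ι (suc m) ≡ 1ℚ ℚ.+ ι m
ι-suc m = trans (ι-+ 1 m) (cong (ℚ._+ ι m) ι-1)

0≤ι : ∀ m → 0ℚ ℚ.≤ ι m
0≤ι m = subst (ℚ._≤ ι m) ι-0 (ι-mono z≤n)

1≤ι : ∀ m .{{_ : NonZero m}} → 1ℚ ℚ.≤ ι m
1≤ι (suc m) = subst (ℚ._≤ ι (suc m)) ι-1 (ι-mono (s≤s z≤n))

0<ι : ∀ m .{{_ : NonZero m}} → 0ℚ ℚ.< ι m
0<ι m = ℚ.<-≤-trans (ℚ.positive⁻¹ 1ℚ) (1≤ι m)

opaque
  1/ℕ : ℕ → ℚ
  1/ℕ k = ℤ.+ 1 ℚ./ suc k

  1/ℕ-def : ∀ k → ℤ.+ 1 ℚ./ suc k ≡ 1/ℕ k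
  1/ℕ-def k = refl

opaque
  unfolding 1/ℕ ι

  1/ℕ-inverse : ∀ k → 1/ℕ k ℚ.* ι (suc k) ≡ 1ℚ
  1/ℕ-inverse k rewrite fromℕ-mkℚ (suc k) = begin
    (ℤ.+ 1 ℚ./ suc k) ℚ.* sk ≡⟨ cong (ℚ._* sk) (ℚ.↥p/↧p≡p 1/sk) ⟩
    1/sk ℚ.* sk            ≡⟨ ℚ.*-inverseˡ sk ⟩
    1ℚ                     ∎
    where
    open ≡-Reasoning
    sk 1/sk : ℚ
    sk   = ℚ.mkℚ (ℤ.+ suc k) 0 (Coprimality.sym (1-coprimeTo (suc k)))
    1/sk = ℚ.mkℚ (ℤ.+ 1) k (1-coprimeTo (suc k))

0≤1/ℕ : ∀ k → 0ℚ ℚ.≤ 1/ℕ k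
0≤1/ℕ k = *-cancelˡ-≤ (0<ι (suc k)) (begin
  ι (suc k) ℚ.* 0ℚ      ≡⟨ ℚ.*-zeroʳ (ι (suc k)) ⟩
  0ℚ                    ≤⟨ 0≤1 ⟩
  1ℚ                    ≡⟨ sym (trans (ℚ.*-comm (ι (suc k)) _) (1/ℕ-inverse k)) ⟩
  ι (suc k) ℚ.* 1/ℕ k   ∎)
  where open ℚ.≤-Reasoning

1/ℕ≤1 : ∀ k → 1/ℕ k ℚ.≤ 1ℚ
1/ℕ≤1 k = *-cancelˡ-≤ (0<ι (suc k)) (begin
  ι (suc k) ℚ.* 1/ℕ k ≡⟨ trans (ℚ.*-comm (ι (suc k)) _) (1/ℕ-inverse k) ⟩
  1ℚ                  ≤⟨ 1≤ι (suc k) ⟩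
  ι (suc k)           ≡⟨ sym (ℚ.*-identityʳ (ι (suc k))) ⟩
  ι (suc k) ℚ.* 1ℚ    ∎)
  where open ℚ.≤-Reasoning

infixr 8 _^ℚ_
_^ℚ_ : ℚ → ℕ → ℚ
x ^ℚ zero  = 1ℚ
x ^ℚ suc k = x ℚ.* x ^ℚ k

0≤^ : ∀ {x} k → 0ℚ ℚ.≤ x → 0ℚ ℚ.≤ x ^ℚ k
0≤^ zero    0≤x = 0≤1
0≤^ (suc k) 0≤x = 0≤* 0≤x (0≤^ k 0≤x)

^≤1 : ∀ {x} k → 0ℚ ℚ.≤ x → x ℚ.≤ 1ℚ → x ^ℚ k ℚ.≤ 1ℚ
^≤1 zero    0≤x x≤1 = ℚ.≤-refl
^≤1 (suc k) 0≤x x≤1 = *≤* (0≤^ k 0≤x) 0≤1 x≤1 (^≤1 k 0≤x x≤1)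

^-mono : ∀ {x y} k → 0ℚ ℚ.≤ x → x ℚ.≤ y → x ^ℚ k ℚ.≤ y ^ℚ k
^-mono zero    0≤x x≤y = ℚ.≤-refl
^-mono (suc k) 0≤x x≤y = *≤* (0≤^ k 0≤x) (ℚ.≤-trans 0≤x x≤y) x≤y (^-mono k 0≤x x≤y)

ι-^ : ∀ m k → ι (m ^ k) ≡ ι m ^ℚ k
ι-^ m zero    = ι-1
ι-^ m (suc k) = trans (ι-* m (m ^ k)) (cong (ι m ℚ.*_) (ι-^ m k))

^-distrib-* : ∀ x y k → (x ℚ.* y) ^ℚ k ≡ x ^ℚ k ℚ.* y ^ℚ k
^-distrib-* x y zero    = refl
^-distrib-* x y (suc k) = trans (cong (x ℚ.* y ℚ.*_) (^-distrib-* x y k))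
  (((∀ x y a b → x ℚ.* y ℚ.* (a ℚ.* b) ≡ x ℚ.* a ℚ.* (y ℚ.* b)) ∋ solve-∀ ℚ-ring) x y (x ^ℚ k) (y ^ℚ k))

⟦_⟧ : Bool → ℚ
⟦ true ⟧  = 1ℚ
⟦ false ⟧ = 0ℚ

0≤⟦_⟧ : ∀ b → 0ℚ ℚ.≤ ⟦ b ⟧
0≤⟦ true ⟧  = 0≤1
0≤⟦ false ⟧ = ℚ.≤-refl

⟦_⟧≤1 : ∀ b → ⟦ b ⟧ ℚ.≤ 1ℚ
⟦ true ⟧≤1  = ℚ.≤-refl
⟦ false ⟧≤1 = 0≤1

⟦_⟧*≤ : ∀ b {x} → 0ℚ ℚ.≤ x → ⟦ b ⟧ ℚ.* x ℚ.≤ x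
⟦_⟧*≤ b {x} 0≤x = subst (⟦ b ⟧ ℚ.* x ℚ.≤_) (ℚ.*-identityˡ x) (≤* 0≤x ⟦ b ⟧≤1)

∑ : ∀ {A : Set} → List A → (A → ℚ) → ℚ
∑ []       f = 0ℚ
∑ (x ∷ xs) f = f x ℚ.+ ∑ xs f

module _ {A : Set} where

  ∑-cong∈ : ∀ (xs : List A) {f g} → (∀ {x} → x ∈ xs → f x ≡ g x) → ∑ xs f ≡ ∑ xs g
  ∑-cong∈ []       eq = refl
  ∑-cong∈ (x ∷ xs) eq = cong₂ ℚ._+_ (eq (here refl)) (∑-cong∈ xs (eq ∘ there))

  ∑-cong : ∀ (xs : List A) {f g} → (∀ x → f x ≡ g x) → ∑ xs f ≡ ∑ xs g
  ∑-cong xs eq = ∑-cong∈ xs λ {x} _ → eq x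

  ∑-mono∈ : ∀ (xs : List A) {f g} → (∀ {x} → x ∈ xs → f x ℚ.≤ g x) → ∑ xs f ℚ.≤ ∑ xs g
  ∑-mono∈ []       le = ℚ.≤-refl
  ∑-mono∈ (x ∷ xs) le = le (here refl) +≤ ∑-mono∈ xs (le ∘ there)

  ∑-mono : ∀ (xs : List A) {f g} → (∀ x → f x ℚ.≤ g x) → ∑ xs f ℚ.≤ ∑ xs g
  ∑-mono xs le = ∑-mono∈ xs λ {x} _ → le x

  0≤∑ : ∀ (xs : List A) {f} → (∀ x → 0ℚ ℚ.≤ f x) → 0ℚ ℚ.≤ ∑ xs f
  0≤∑ []       le = ℚ.≤-refl
  0≤∑ (x ∷ xs) le = 0≤+ (le x) (0≤∑ xs le)

  ∑-+ : ∀ (xs : List A) f g → ∑ xs (λ x → f x ℚ.+ g x) ≡ ∑ xs f ℚ.+ ∑ xs g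
  ∑-+ []       f g = refl
  ∑-+ (x ∷ xs) f g = trans (cong (f x ℚ.+ g x ℚ.+_) (∑-+ xs f g))
    (((∀ a b c d → a ℚ.+ b ℚ.+ (c ℚ.+ d) ≡ a ℚ.+ c ℚ.+ (b ℚ.+ d)) ∋ solve-∀ ℚ-ring) (f x) (g x) (∑ xs f) (∑ xs g))

  ∑-*ˡ : ∀ (xs : List A) c f → ∑ xs (λ x → c ℚ.* f x) ≡ c ℚ.* ∑ xs f
  ∑-*ˡ []       c f = sym (ℚ.*-zeroʳ c)
  ∑-*ˡ (x ∷ xs) c f = trans (cong (c ℚ.* f x ℚ.+_) (∑-*ˡ xs c f)) (sym (ℚ.*-distribˡ-+ c (f x) (∑ xs f)))

  ∑-*ʳ : ∀ (xs : List A) c f → ∑ xs (λ x → f x ℚ.* c) ≡ ∑ xs f ℚ.* c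
  ∑-*ʳ xs c f = trans (∑-cong xs λ x → ℚ.*-comm (f x) c) (trans (∑-*ˡ xs c f) (ℚ.*-comm c _))

  ∑-++ : ∀ (xs ys : List A) f → ∑ (xs ++ ys) f ≡ ∑ xs f ℚ.+ ∑ ys f
  ∑-++ []       ys f = sym (ℚ.+-identityˡ _)
  ∑-++ (x ∷ xs) ys f = trans (cong (f x ℚ.+_) (∑-++ xs ys f)) (sym (ℚ.+-assoc (f x) _ _))

  ∑-0 : ∀ (xs : List A) → ∑ xs (λ _ → 0ℚ) ≡ 0ℚ
  ∑-0 []       = refl
  ∑-0 (x ∷ xs) = trans (ℚ.+-identityˡ _) (∑-0 xs)

  ∑-const : ∀ (xs : List A) c → ∑ xs (λ _ → c) ≡ ι (length xs) ℚ.* c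
  ∑-const []       c = sym (trans (cong (ℚ._* c) ι-0) (ℚ.*-zeroˡ c))
  ∑-const (x ∷ xs) c = begin
    c ℚ.+ ∑ xs (λ _ → c)                 ≡⟨ cong (c ℚ.+_) (∑-const xs c) ⟩
    c ℚ.+ ι (length xs) ℚ.* c        ≡⟨ ((∀ c l → c ℚ.+ l ℚ.* c ≡ (1ℚ ℚ.+ l) ℚ.* c) ∋ solve-∀ ℚ-ring) c (ι (length xs)) ⟩
    (1ℚ ℚ.+ ι (length xs)) ℚ.* c     ≡⟨ cong (ℚ._* c) (sym (ι-suc (length xs))) ⟩
    ι (suc (length xs)) ℚ.* c        ∎
    where open ≡-Reasoning

  ∑-one : ∀ (xs : List A) → ∑ xs (λ _ → 1ℚ) ≡ ι (length xs)
  ∑-one xs = trans (∑-const xs 1ℚ) (ℚ.*-identityʳ _)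

  ∑-filter : ∀ (p : A → Bool) xs f → ∑ (filterᵇ p xs) f ≡ ∑ xs (λ x → ⟦ p x ⟧ ℚ.* f x)
  ∑-filter p []       f = refl
  ∑-filter p (x ∷ xs) f with p x
  ... | true  = cong₂ ℚ._+_ (sym (ℚ.*-identityˡ (f x))) (∑-filter p xs f)
  ... | false = trans (∑-filter p xs f) (trans (sym (ℚ.+-identityˡ _)) (cong (ℚ._+ _) (sym (ℚ.*-zeroˡ (f x)))))

  count-filter : ∀ (p : A → Bool) xs → ι (length (filterᵇ p xs)) ≡ ∑ xs (λ x → ⟦ p x ⟧)
  count-filter p xs = trans (sym (∑-one (filterᵇ p xs)))
    (trans (∑-filter p xs (λ _ → 1ℚ)) (∑-cong xs λ x → ℚ.*-identityʳ _))

  ∑-↭ : ∀ {xs ys : List A} f → xs ↭ ys → ∑ xs f ≡ ∑ ys f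
  ∑-↭ f ↭.refl          = refl
  ∑-↭ f (↭.prep x p)    = cong (f x ℚ.+_) (∑-↭ f p)
  ∑-↭ f (↭.swap {xs} {ys} x y p) = trans (cong (λ s → f x ℚ.+ (f y ℚ.+ s)) (∑-↭ f p))
    (((∀ a b c → a ℚ.+ (b ℚ.+ c) ≡ b ℚ.+ (a ℚ.+ c)) ∋ solve-∀ ℚ-ring) (f x) (f y) (∑ ys f))
  ∑-↭ f (↭.trans p q)   = trans (∑-↭ f p) (∑-↭ f q)

  ≤∑ : ∀ {xs : List A} {x f} → (∀ x → 0ℚ ℚ.≤ f x) → x ∈ xs → f x ℚ.≤ ∑ xs f
  ≤∑ {x ∷ xs} {f = f} 0≤f (here refl) = ℚ.≤-trans (ℚ.≤-reflexive (sym (ℚ.+-identityʳ (f x)))) (ℚ.+-monoʳ-≤ (f x) (0≤∑ xs 0≤f))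
  ≤∑ {y ∷ xs} {f = f} 0≤f (there x∈)  = ℚ.≤-trans (≤∑ 0≤f x∈) (ℚ.≤-trans (ℚ.≤-reflexive (sym (ℚ.+-identityˡ _))) (ℚ.+-monoˡ-≤ _ (0≤f y)))

module _ {A B : Set} where

  ∑-map : ∀ (h : A → B) xs f → ∑ (map h xs) f ≡ ∑ xs (f ∘ h)
  ∑-map h []       f = refl
  ∑-map h (x ∷ xs) f = cong (f (h x) ℚ.+_) (∑-map h xs f)

  ∑-concatMap : ∀ (h : A → List B) xs f → ∑ (concatMap h xs) f ≡ ∑ xs (λ x → ∑ (h x) f)
  ∑-concatMap h []       f = refl
  ∑-concatMap h (x ∷ xs) f = trans (∑-++ (h x) (concatMap h xs) f) (cong (∑ (h x) f ℚ.+_) (∑-concatMap h xs f))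

  ∑-swap : ∀ (xs : List A) (ys : List B) (f : A → B → ℚ) → ∑ xs (λ x → ∑ ys (f x)) ≡ ∑ ys (λ y → ∑ xs (λ x → f x y))
  ∑-swap []       ys f = sym (∑-0 ys)
  ∑-swap (x ∷ xs) ys f = trans (cong (∑ ys (f x) ℚ.+_) (∑-swap xs ys f)) (sym (∑-+ ys (f x) (λ y → ∑ xs (λ x → f x y))))

∑-cartesian : ∀ {A B : Set} (xs : List A) (ys : List B) f → ∑ (cartesianProduct xs ys) f ≡ ∑ xs (λ x → ∑ ys (λ y → f (x , y)))
∑-cartesian []       ys f = refl
∑-cartesian (x ∷ xs) ys f = trans (∑-++ (map (x ,_) ys) _ f) (cong₂ ℚ._+_ (∑-map (x ,_) ys f) (∑-cartesian xs ys f))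

∑-sum : ∀ {A : Set} (xs : List A) f → ι (sum (map f xs)) ≡ ∑ xs (ι ∘ f)
∑-sum []       f = ι-0
∑-sum (x ∷ xs) f = trans (ι-+ (f x) _) (cong (ι (f x) ℚ.+_) (∑-sum xs f))

module _ {x} (0≤x : 0ℚ ℚ.≤ x) (x≤1 : x ℚ.≤ 1ℚ) where

  private
    0≤1-x : 0ℚ ℚ.≤ 1ℚ ℚ.- x
    0≤1-x = 0≤b-a x≤1

    1-x≤1 : 1ℚ ℚ.- x ℚ.≤ 1ℚ
    1-x≤1 = ≤-by 0≤x (((∀ x → 1ℚ ℚ.- x ℚ.+ x ≡ 1ℚ ℚ.+ 0ℚ) ∋ solve-∀ ℚ-ring) x)

  -- Bernoulli's inequality.
  1-Nx≤[1-x]^N : ∀ N → 1ℚ ℚ.- ι N ℚ.* x ℚ.≤ (1ℚ ℚ.- x) ^ℚ N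
  1-Nx≤[1-x]^N zero    = ℚ.≤-reflexive (trans (cong (λ s → 1ℚ ℚ.- s ℚ.* x) ι-0) (((∀ x → 1ℚ ℚ.- 0ℚ ℚ.* x ≡ 1ℚ) ∋ solve-∀ ℚ-ring) x))
  1-Nx≤[1-x]^N (suc N) = ≤-by (*≤ 0≤1-x (1-Nx≤[1-x]^N N) +≤ 0≤* (0≤ι N) (0≤* 0≤x 0≤x))
    (trans (cong (λ s → 1ℚ ℚ.- s ℚ.* x ℚ.+ ((1ℚ ℚ.- x) ℚ.* (1ℚ ℚ.- x) ^ℚ N ℚ.+ ι N ℚ.* (x ℚ.* x))) (ι-suc N))
      (((∀ n x p → 1ℚ ℚ.- (1ℚ ℚ.+ n) ℚ.* x ℚ.+ ((1ℚ ℚ.- x) ℚ.* p ℚ.+ n ℚ.* (x ℚ.* x)) ≡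
         (1ℚ ℚ.- x) ℚ.* p ℚ.+ ((1ℚ ℚ.- x) ℚ.* (1ℚ ℚ.- n ℚ.* x) ℚ.+ 0ℚ)) ∋ solve-∀ ℚ-ring) (ι N) x ((1ℚ ℚ.- x) ^ℚ N)))

  -- The right side is x times the sum of (1 - x)^k over k < N, and each summand is at least (1 -
  -- x)^N. For N draws that hit with probability x: the expected number of hits times the chance of
  -- none is at most the chance of some.
  Nx[1-x]^N≤1-[1-x]^N : ∀ N → ι N ℚ.* x ℚ.* (1ℚ ℚ.- x) ^ℚ N ℚ.≤ 1ℚ ℚ.- (1ℚ ℚ.- x) ^ℚ N
  Nx[1-x]^N≤1-[1-x]^N zero    = ℚ.≤-reflexive (trans (cong (λ s → s ℚ.* x ℚ.* 1ℚ) ι-0) (((∀ x → 0ℚ ℚ.* x ℚ.* 1ℚ ≡ 1ℚ ℚ.- 1ℚ) ∋ solve-∀ ℚ-ring) x))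
  Nx[1-x]^N≤1-[1-x]^N (suc N) = ≤-by (*≤ 0≤1-x (Nx[1-x]^N≤1-[1-x]^N N) +≤ *≤ 0≤x (*≤* 0≤p 0≤1 1-x≤1 p≤1))
    (trans (cong (λ s → s ℚ.* x ℚ.* ((1ℚ ℚ.- x) ℚ.* p) ℚ.+ ((1ℚ ℚ.- x) ℚ.* (1ℚ ℚ.- p) ℚ.+ x ℚ.* (1ℚ ℚ.* 1ℚ))) (ι-suc N))
      (((∀ n x p → (1ℚ ℚ.+ n) ℚ.* x ℚ.* ((1ℚ ℚ.- x) ℚ.* p) ℚ.+ ((1ℚ ℚ.- x) ℚ.* (1ℚ ℚ.- p) ℚ.+ x ℚ.* (1ℚ ℚ.* 1ℚ)) ≡
         1ℚ ℚ.- (1ℚ ℚ.- x) ℚ.* p ℚ.+ ((1ℚ ℚ.- x) ℚ.* (n ℚ.* x ℚ.* p) ℚ.+ x ℚ.* ((1ℚ ℚ.- x) ℚ.* p))) ∋ solve-∀ ℚ-ring) (ι N) x p))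
    where
    p = (1ℚ ℚ.- x) ^ℚ N
    0≤p : 0ℚ ℚ.≤ p
    0≤p = 0≤^ N 0≤1-x
    p≤1 : p ℚ.≤ 1ℚ
    p≤1 = ^≤1 N 0≤1-x 1-x≤1

-- Expectations over query algorithms

fins : ∀ n → List (Fin n)
fins zero    = []
fins (suc n) = zero ∷ map suc (fins n)

∈-fins : ∀ {n} (i : Fin n) → i ∈ fins n
∈-fins zero    = here refl
∈-fins (suc i) = there (∈.∈-map⁺ suc (∈-fins i))

∑-fins-suc : ∀ n (f : Fin (suc n) → ℚ) → ∑ (fins (suc n)) f ≡ f zero ℚ.+ ∑ (fins n) (f ∘ suc)
∑-fins-suc n f = cong (f zero ℚ.+_) (∑-map suc (fins n) f)

length-fins : ∀ n → length (fins n) ≡ n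
length-fins zero    = refl
length-fins (suc n) = cong suc (trans (List.length-map suc (fins n)) (length-fins n))

vfoldr-∑ : ∀ {n} (f : Fin n → ℚ) → vfoldr ℚ._+_ 0ℚ f ≡ ∑ (fins n) f
vfoldr-∑ {zero}  f = refl
vfoldr-∑ {suc n} f = trans (cong (f zero ℚ.+_) (vfoldr-∑ (f ∘ suc))) (sym (∑-fins-suc n f))

avg : ∀ k → (Fin (suc k) → ℚ) → ℚ
avg k f = ∑ (fins (suc k)) f ℚ.* 1/ℕ k

avg-mono : ∀ k {f g} → (∀ i → f i ℚ.≤ g i) → avg k f ℚ.≤ avg k g
avg-mono k le = ≤* (0≤1/ℕ k) (∑-mono (fins (suc k)) le)

avg-cong : ∀ k {f g} → (∀ i → f i ≡ g i) → avg k f ≡ avg k g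
avg-cong k eq = cong (ℚ._* 1/ℕ k) (∑-cong (fins (suc k)) eq)

avg-+ : ∀ k f g → avg k (λ i → f i ℚ.+ g i) ≡ avg k f ℚ.+ avg k g
avg-+ k f g = trans (cong (ℚ._* 1/ℕ k) (∑-+ (fins (suc k)) f g)) (ℚ.*-distribʳ-+ (1/ℕ k) (∑ (fins (suc k)) f) _)

avg-*ˡ : ∀ k c f → avg k (λ i → c ℚ.* f i) ≡ c ℚ.* avg k f
avg-*ˡ k c f = trans (cong (ℚ._* 1/ℕ k) (∑-*ˡ (fins (suc k)) c f)) (ℚ.*-assoc c _ _)

avg-const : ∀ k c → avg k (λ _ → c) ≡ c
avg-const k c = begin
  ∑ (fins (suc k)) (λ _ → c) ℚ.* 1/ℕ k               ≡⟨ cong (ℚ._* 1/ℕ k) (∑-const (fins (suc k)) c) ⟩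
  ι (length (fins (suc k))) ℚ.* c ℚ.* 1/ℕ k          ≡⟨ cong (λ l → ι l ℚ.* c ℚ.* 1/ℕ k) (length-fins (suc k)) ⟩
  ι (suc k) ℚ.* c ℚ.* 1/ℕ k                          ≡⟨ ((∀ a b c → a ℚ.* b ℚ.* c ≡ (c ℚ.* a) ℚ.* b) ∋ solve-∀ ℚ-ring) (ι (suc k)) c (1/ℕ k) ⟩
  1/ℕ k ℚ.* ι (suc k) ℚ.* c                          ≡⟨ cong (ℚ._* c) (1/ℕ-inverse k) ⟩
  1ℚ ℚ.* c                                           ≡⟨ ℚ.*-identityˡ c ⟩
  c                                                  ∎
  where open ≡-Reasoning

infixl 1 _>>=_
_>>=_ : ∀ {n} {A B : Set} → QueryAlg n A → (A → QueryAlg n B) → QueryAlg n B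
return x    >>= k = k x
query u v f >>= k = query u v (λ x → f x >>= k)
random j f  >>= k = random j (λ i → f i >>= k)

module _ {n} (w : Weights n) where

  E : ∀ {A : Set} → QueryAlg n A → (A → ℚ) → ℚ
  E (return x)    φ = φ x
  E (query u v f) φ = E (f (w u v)) φ
  E (random k f)  φ = avg k λ i → E (f i) φ

  E[queries] : ∀ {A : Set} → QueryAlg n A → ℚ
  E[queries] (return x)    = 0ℚ
  E[queries] (query u v f) = 1ℚ ℚ.+ E[queries] (f (w u v))
  E[queries] (random k f)  = avg k λ i → E[queries] (f i)

  P[true] : QueryAlg n Bool → ℚ
  P[true] m = E m ⟦_⟧

module _ {n} {w : Weights n} where

  E-cong : ∀ {A : Set} (m : QueryAlg n A) {φ ψ} → (∀ x → φ x ≡ ψ x) → E w m φ ≡ E w m ψ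
  E-cong (return x)    eq = eq x
  E-cong (query u v f) eq = E-cong (f (w u v)) eq
  E-cong (random k f)  eq = avg-cong k λ i → E-cong (f i) eq

  E-mono : ∀ {A : Set} (m : QueryAlg n A) {φ ψ} → (∀ x → φ x ℚ.≤ ψ x) → E w m φ ℚ.≤ E w m ψ
  E-mono (return x)    le = le x
  E-mono (query u v f) le = E-mono (f (w u v)) le
  E-mono (random k f)  le = avg-mono k λ i → E-mono (f i) le

  E-const : ∀ {A : Set} (m : QueryAlg n A) c → E w m (λ _ → c) ≡ c
  E-const (return x)    c = refl
  E-const (query u v f) c = E-const (f (w u v)) c
  E-const (random k f)  c = trans (avg-cong k λ i → E-const (f i) c) (avg-const k c)

  E-+ : ∀ {A : Set} (m : QueryAlg n A) φ ψ → E w m (λ x → φ x ℚ.+ ψ x) ≡ E w m φ ℚ.+ E w m ψ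
  E-+ (return x)    φ ψ = refl
  E-+ (query u v f) φ ψ = E-+ (f (w u v)) φ ψ
  E-+ (random k f)  φ ψ = trans (avg-cong k λ i → E-+ (f i) φ ψ) (avg-+ k (λ i → E w (f i) φ) (λ i → E w (f i) ψ))

  E-*ˡ : ∀ {A : Set} (m : QueryAlg n A) c φ → E w m (λ x → c ℚ.* φ x) ≡ c ℚ.* E w m φ
  E-*ˡ (return x)    c φ = refl
  E-*ˡ (query u v f) c φ = E-*ˡ (f (w u v)) c φ
  E-*ˡ (random k f)  c φ = trans (avg-cong k λ i → E-*ˡ (f i) c φ) (avg-*ˡ k c _)

  0≤E : ∀ {A : Set} (m : QueryAlg n A) {φ} → (∀ x → 0ℚ ℚ.≤ φ x) → 0ℚ ℚ.≤ E w m φ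
  0≤E m 0≤φ = ≡≤ (sym (E-const m 0ℚ)) (E-mono m 0≤φ)

  E-bind : ∀ {A B : Set} (m : QueryAlg n A) (k : A → QueryAlg n B) φ →
           E w (m >>= k) φ ≡ E w m (λ x → E w (k x) φ)
  E-bind (return x)    k φ = refl
  E-bind (query u v f) k φ = E-bind (f (w u v)) k φ
  E-bind (random j f)  k φ = avg-cong j λ i → E-bind (f i) k φ

  E[queries]-bind : ∀ {A B : Set} (m : QueryAlg n A) (k : A → QueryAlg n B) →
                    E[queries] w (m >>= k) ≡ E[queries] w m ℚ.+ E w m (λ x → E[queries] w (k x))
  E[queries]-bind (return x)    k = sym (ℚ.+-identityˡ _)
  E[queries]-bind (query u v f) k = trans (cong (1ℚ ℚ.+_) (E[queries]-bind (f (w u v)) k)) (sym (ℚ.+-assoc 1ℚ (E[queries] w (f (w u v))) _))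
  E[queries]-bind (random j f)  k = trans (avg-cong j λ i → E[queries]-bind (f i) k) (avg-+ j (λ i → E[queries] w (f i)) (λ i → E w (f i) (λ x → E[queries] w (k x))))

  0≤E[queries] : ∀ {A : Set} (m : QueryAlg n A) → 0ℚ ℚ.≤ E[queries] w m
  0≤E[queries] (return x)    = ℚ.≤-refl
  0≤E[queries] (query u v f) = 0≤+ 0≤1 (0≤E[queries] (f (w u v)))
  0≤E[queries] (random k f)  = ≡≤ (sym (avg-const k 0ℚ)) (avg-mono k λ i → 0≤E[queries] (f i))

  0≤P : ∀ (m : QueryAlg n Bool) → 0ℚ ℚ.≤ P[true] w m
  0≤P m = 0≤E m 0≤⟦_⟧

  P≤1 : ∀ (m : QueryAlg n Bool) → P[true] w m ℚ.≤ 1ℚ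
  P≤1 m = subst (P[true] w m ℚ.≤_) (E-const m 1ℚ) (E-mono m ⟦_⟧≤1)

  Pr≡E : ∀ {A : Set} {ℓ} {P : Pred A ℓ} (P? : Decidable P) (m : QueryAlg n A) →
         Pr w P? m ≡ E w m (λ x → ⟦ does (P? x) ⟧)
  Pr≡E P? (return x) with does (P? x)
  ... | true  = refl
  ... | false = refl
  Pr≡E P? (query u v f) = Pr≡E P? (f (w u v))
  Pr≡E P? (random k f)  = cong₂ ℚ._*_
    (trans (vfoldr-∑ (λ i → Pr w P? (f i))) (∑-cong (fins (suc k)) λ i → Pr≡E P? (f i))) (1/ℕ-def k)

  queries-random-≤ : ∀ {k b} (g : Fin k → ℕ) → (∀ i → g i ≤ b) → vfoldr _⊔_ 0 g ≤ b
  queries-random-≤ {zero}  g le = z≤n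
  queries-random-≤ {suc k} g le = ℕ.⊔-lub (le zero) (queries-random-≤ (g ∘ suc) (le ∘ suc))

  ≤-queries-random : ∀ {k} (g : Fin k → ℕ) i → g i ≤ vfoldr _⊔_ 0 g
  ≤-queries-random g zero    = ℕ.m≤m⊔n _ _
  ≤-queries-random g (suc i) = ℕ.≤-trans (≤-queries-random (g ∘ suc) i) (ℕ.m≤n⊔m _ _)

  queries-bind : ∀ {A B : Set} (m : QueryAlg n A) (k : A → QueryAlg n B) b →
                 (∀ x → queries w (k x) ≤ b) → queries w (m >>= k) ≤ queries w m + b
  queries-bind (return x)    k b le = le x
  queries-bind (query u v f) k b le = s≤s (queries-bind (f (w u v)) k b le)
  queries-bind (random j f)  k b le = queries-random-≤ _ λ i →
    ℕ.≤-trans (queries-bind (f i) k b le) (ℕ.+-monoˡ-≤ b (≤-queries-random (λ i → queries w (f i)) i))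

E-not : ∀ {n} {w : Weights n} {A : Set} (m : QueryAlg n A) (p : A → Bool) → E w m (λ x → ⟦ not (p x) ⟧) ≡ 1ℚ ℚ.- E w m (λ x → ⟦ p x ⟧)
E-not {w = w} m p = begin
  E w m (λ x → ⟦ not (p x) ⟧)                        ≡⟨ E-cong m (λ x → flipped-sign (p x)) ⟩
  E w m (λ x → 1ℚ ℚ.+ (ℚ.- 1ℚ) ℚ.* ⟦ p x ⟧)          ≡⟨ trans (E-+ m (λ _ → 1ℚ) (λ x → (ℚ.- 1ℚ) ℚ.* ⟦ p x ⟧)) (cong₂ ℚ._+_ (E-const m 1ℚ) (E-*ˡ m (ℚ.- 1ℚ) (λ x → ⟦ p x ⟧))) ⟩
  1ℚ ℚ.+ (ℚ.- 1ℚ) ℚ.* E w m (λ x → ⟦ p x ⟧)          ≡⟨ ((∀ x → 1ℚ ℚ.+ (ℚ.- 1ℚ) ℚ.* x ≡ 1ℚ ℚ.- x) ∋ solve-∀ ℚ-ring) (E w m (λ x → ⟦ p x ⟧)) ⟩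
  1ℚ ℚ.- E w m (λ x → ⟦ p x ⟧)                       ∎
  where
  open ≡-Reasoning
  flipped-sign : ∀ c → ⟦ not c ⟧ ≡ 1ℚ ℚ.+ (ℚ.- 1ℚ) ℚ.* ⟦ c ⟧
  flipped-sign true  = refl
  flipped-sign false = refl

capped : ∀ {n} {A : Set} → ℕ → QueryAlg n A → QueryAlg n (Maybe A)
capped b       (return x)    = return (just x)
capped zero    (query u v f) = return nothing
capped (suc b) (query u v f) = query u v λ x → capped b (f x)
capped b       (random k f)  = random k λ i → capped b (f i)

module _ {n} {w : Weights n} where

  queries-capped : ∀ {A : Set} b (m : QueryAlg n A) → queries w (capped b m) ≤ b
  queries-capped b       (return x)    = z≤n
  queries-capped zero    (query u v f) = z≤n
  queries-capped (suc b) (query u v f) = s≤s (queries-capped b (f (w u v)))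
  queries-capped b       (random k f)  = queries-random-≤ {w = w} _ λ i → queries-capped b (f i)

  -- Markov's inequality: where the capped run ends in `nothing`, query number b + 1 was due, so `m`
  -- makes at least b + 1 queries there.
  markov : ∀ {A : Set} b (m : QueryAlg n A) →
           ι (suc b) ℚ.* E w (capped b m) (maybe (λ _ → 0ℚ) 1ℚ) ℚ.≤ E[queries] w m
  markov b       (return x)    = ℚ.≤-reflexive (ℚ.*-zeroʳ (ι (suc b)))
  markov zero    (query u v f) = begin
    ι 1 ℚ.* 1ℚ                        ≡⟨ trans (ℚ.*-identityʳ (ι 1)) ι-1 ⟩
    1ℚ                                ≤⟨ ≤-by (0≤E[queries] (f (w u v))) (((∀ x y → x ℚ.+ y ≡ (x ℚ.+ y) ℚ.+ 0ℚ) ∋ solve-∀ ℚ-ring) 1ℚ (E[queries] w (f (w u v)))) ⟩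
    1ℚ ℚ.+ E[queries] w (f (w u v))   ∎
    where open ℚ.≤-Reasoning
  markov (suc b) (query u v f) = begin
    ι (2 + b) ℚ.* p                     ≡⟨ cong (ℚ._* p) (ι-suc (suc b)) ⟩
    (1ℚ ℚ.+ ι (suc b)) ℚ.* p            ≡⟨ ((∀ b p → (1ℚ ℚ.+ b) ℚ.* p ≡ p ℚ.+ b ℚ.* p) ∋ solve-∀ ℚ-ring) (ι (suc b)) p ⟩
    p ℚ.+ ι (suc b) ℚ.* p               ≤⟨ p≤1 +≤ markov b (f (w u v)) ⟩
    1ℚ ℚ.+ E[queries] w (f (w u v))     ∎
    where
    open ℚ.≤-Reasoning
    p : ℚ
    p = E w (capped b (f (w u v))) (maybe (λ _ → 0ℚ) 1ℚ)
    p≤1 : p ℚ.≤ 1ℚ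
    p≤1 = subst (p ℚ.≤_) (E-const (capped b (f (w u v))) 1ℚ)
      (E-mono (capped b (f (w u v))) λ { (just _) → 0≤1 ; nothing → ℚ.≤-refl })
  markov b (random k f) = ≡≤ (sym (avg-*ˡ k (ι (suc b)) (λ i → E w (capped b (f i)) (maybe (λ _ → 0ℚ) 1ℚ)))) (avg-mono k λ i → markov b (f i))

  -- On every branch the capped run agrees with `m` or aborts. Aborted outcomes count 0 here; the
  -- converse bound below adds the probability of an abort.
  E-capped-≤ : ∀ {A : Set} b (m : QueryAlg n A) {φ} → (∀ x → 0ℚ ℚ.≤ φ x) →
               E w (capped b m) (maybe φ 0ℚ) ℚ.≤ E w m φ
  E-capped-≤ b       (return x)    0≤φ = ℚ.≤-refl
  E-capped-≤ zero    (query u v f) 0≤φ = 0≤E (f (w u v)) 0≤φ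
  E-capped-≤ (suc b) (query u v f) 0≤φ = E-capped-≤ b (f (w u v)) 0≤φ
  E-capped-≤ b       (random k f)  0≤φ = avg-mono k λ i → E-capped-≤ b (f i) 0≤φ

  E-≤-capped : ∀ {A : Set} b (m : QueryAlg n A) {φ} → (∀ x → φ x ℚ.≤ 1ℚ) →
               E w m φ ℚ.≤ E w (capped b m) (maybe φ 0ℚ) ℚ.+ E w (capped b m) (maybe (λ _ → 0ℚ) 1ℚ)
  E-≤-capped b       (return x)    φ≤1 = ℚ.≤-reflexive (sym (ℚ.+-identityʳ _))
  E-≤-capped zero    (query u v f) φ≤1 = ≤≡ (E-mono (f (w u v)) φ≤1) (trans (E-const (f (w u v)) 1ℚ) (sym (ℚ.+-identityˡ 1ℚ)))
  E-≤-capped (suc b) (query u v f) φ≤1 = E-≤-capped b (f (w u v)) φ≤1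
  E-≤-capped b       (random k f)  φ≤1 = ≤≡ (avg-mono k λ i → E-≤-capped b (f i) φ≤1) (avg-+ k (λ i → E w (capped b (f i)) (maybe _ 0ℚ)) (λ i → E w (capped b (f i)) (maybe (λ _ → 0ℚ) 1ℚ)))

nth : ∀ {A : Set} → List A → ℕ → Maybe A
nth []       i       = nothing
nth (x ∷ xs) zero    = just x
nth (x ∷ xs) (suc i) = nth xs i

-- A uniform element of xs padded with `nothing` to length suc k.
draw : ∀ {n} {A : Set} → ℕ → List A → QueryAlg n (Maybe A)
draw k xs = random k λ i → return (nth xs (toℕ i))

∑-nth : ∀ {A : Set} N (xs : List A) φ → length xs ≤ N →
        ∑ (fins N) (λ i → maybe φ 0ℚ (nth xs (toℕ i))) ≡ ∑ xs φ
∑-nth N       []       φ le       = ∑-0 (fins N)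
∑-nth (suc N) (x ∷ xs) φ (s≤s le) =
  trans (∑-fins-suc N (λ i → maybe φ 0ℚ (nth (x ∷ xs) (toℕ i)))) (cong (φ x ℚ.+_) (∑-nth N xs φ le))

-- Both E and E[queries] of `draw k xs >>= h` unfold to such an average.
avg-nth : ∀ {A : Set} k (xs : List A) (φ : Maybe A → ℚ) (ψ : A → ℚ) → length xs ≤ suc k →
          (∀ x → φ (just x) ≡ ψ x) → φ nothing ≡ 0ℚ → avg k (λ i → φ (nth xs (toℕ i))) ≡ ∑ xs ψ ℚ.* 1/ℕ k
avg-nth k xs φ ψ le φ-just φ-nothing = cong (ℚ._* 1/ℕ k)
  (trans (∑-cong (fins (suc k)) λ i → lemma (nth xs (toℕ i))) (∑-nth (suc k) xs ψ le))
  where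
  lemma : ∀ x → φ x ≡ maybe ψ 0ℚ x
  lemma (just x) = φ-just x
  lemma nothing  = φ-nothing

avg-≤ : ∀ k (f : Fin (suc k) → ℚ) {b} → (∀ i → f i ℚ.≤ b) → avg k f ℚ.≤ b
avg-≤ k f {b} le = ≤≡ (avg-mono k le) (avg-const k b)

reading : ∀ {n} {A : Set} → List (Fin n × Fin n) → (List ℕ → QueryAlg n A) → QueryAlg n A
reading []             k = k []
reading ((u , v) ∷ ps) k = query u v λ x → reading ps (k ∘ (x ∷_))

module _ {n} {w : Weights n} {A : Set} where

  E-reading : ∀ ps (k : List ℕ → QueryAlg n A) φ → E w (reading ps k) φ ≡ E w (k (map (uncurry w) ps)) φ
  E-reading []             k φ = refl
  E-reading ((u , v) ∷ ps) k φ = E-reading ps (k ∘ (w u v ∷_)) φ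

  queries-reading : ∀ ps (k : List ℕ → QueryAlg n A) →
                    queries w (reading ps k) ≡ length ps + queries w (k (map (uncurry w) ps))
  queries-reading []             k = refl
  queries-reading ((u , v) ∷ ps) k = cong suc (queries-reading ps (k ∘ (w u v ∷_)))

infixr 3 _and_
_and_ : ∀ {n} → QueryAlg n Bool → QueryAlg n Bool → QueryAlg n Bool
m and m′ = m >>= λ b → if b then m′ else return false

allOf : ∀ {n} → ℕ → QueryAlg n Bool → QueryAlg n Bool
allOf zero    m = return true
allOf (suc k) m = m and allOf k m

countTrue : ∀ {n} → ℕ → QueryAlg n Bool → QueryAlg n ℕ
countTrue zero    m = return 0
countTrue (suc k) m = m >>= λ b → countTrue k m >>= λ c → return (if b then suc c else c)

module _ {n} {w : Weights n} where

  P-and : ∀ (m m′ : QueryAlg n Bool) → P[true] w (m and m′) ≡ P[true] w m ℚ.* P[true] w m′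
  P-and m m′ = begin
    E w (m and m′) ⟦_⟧                                        ≡⟨ E-bind m _ ⟦_⟧ ⟩
    E w m (λ b → E w (if b then m′ else return false) ⟦_⟧)    ≡⟨ E-cong m (λ { true → sym (ℚ.*-identityʳ _) ; false → sym (ℚ.*-zeroʳ (P[true] w m′)) }) ⟩
    E w m (λ b → P[true] w m′ ℚ.* ⟦ b ⟧)                      ≡⟨ E-*ˡ m (P[true] w m′) ⟦_⟧ ⟩
    P[true] w m′ ℚ.* P[true] w m                              ≡⟨ ℚ.*-comm (P[true] w m′) (P[true] w m) ⟩
    P[true] w m ℚ.* P[true] w m′                              ∎
    where open ≡-Reasoning

  E[queries]-and : ∀ (m m′ : QueryAlg n Bool) →
                   E[queries] w (m and m′) ≡ E[queries] w m ℚ.+ P[true] w m ℚ.* E[queries] w m′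
  E[queries]-and m m′ = trans (E[queries]-bind m _) (cong (E[queries] w m ℚ.+_) (begin
    E w m (λ b → E[queries] w (if b then m′ else return false))  ≡⟨ E-cong m (λ { true → sym (ℚ.*-identityʳ _) ; false → sym (ℚ.*-zeroʳ (E[queries] w m′)) }) ⟩
    E w m (λ b → E[queries] w m′ ℚ.* ⟦ b ⟧)                      ≡⟨ E-*ˡ m (E[queries] w m′) ⟦_⟧ ⟩
    E[queries] w m′ ℚ.* P[true] w m                              ≡⟨ ℚ.*-comm (E[queries] w m′) _ ⟩
    P[true] w m ℚ.* E[queries] w m′                              ∎))
    where open ≡-Reasoning

  P-allOf : ∀ k (m : QueryAlg n Bool) → P[true] w (allOf k m) ≡ P[true] w m ^ℚ k
  P-allOf zero    m = refl
  P-allOf (suc k) m = trans (P-and m (allOf k m)) (cong (P[true] w m ℚ.*_) (P-allOf k m))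

  E[queries]-allOf : ∀ k (m : QueryAlg n Bool) → E[queries] w (allOf k m) ℚ.≤ ι k ℚ.* E[queries] w m
  E[queries]-allOf zero    m = ℚ.≤-reflexive (sym (trans (cong (ℚ._* E[queries] w m) ι-0) (ℚ.*-zeroˡ (E[queries] w m))))
  E[queries]-allOf (suc k) m = begin
    E[queries] w (m and allOf k m)       ≡⟨ E[queries]-and m (allOf k m) ⟩
    c ℚ.+ P[true] w m ℚ.* E[queries] w (allOf k m) ≤⟨ ℚ.+-monoʳ-≤ c (*≤* (0≤E[queries] (allOf k m)) 0≤1 (P≤1 m) (E[queries]-allOf k m)) ⟩
    c ℚ.+ 1ℚ ℚ.* (ι k ℚ.* c)             ≡⟨ ((∀ c k → c ℚ.+ 1ℚ ℚ.* (k ℚ.* c) ≡ (1ℚ ℚ.+ k) ℚ.* c) ∋ solve-∀ ℚ-ring) c (ι k) ⟩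
    (1ℚ ℚ.+ ι k) ℚ.* c                   ≡⟨ cong (ℚ._* c) (sym (ι-suc k)) ⟩
    ι (suc k) ℚ.* c                      ∎
    where
    open ℚ.≤-Reasoning
    c : ℚ
    c = E[queries] w m

  -- The generating function of a sum of independent trials is a product.
  E-countTrue : ∀ k (m : QueryAlg n Bool) x →
                E w (countTrue k m) (x ^ℚ_) ≡ E w m (λ b → if b then x else 1ℚ) ^ℚ k
  E-countTrue zero    m x = refl
  E-countTrue (suc k) m x = begin
    E w (countTrue (suc k) m) (x ^ℚ_)
      ≡⟨ E-bind m _ _ ⟩
    E w m (λ b → E w (countTrue k m >>= λ c → return (if b then suc c else c)) (x ^ℚ_))
      ≡⟨ E-cong m (λ b → trans (E-bind (countTrue k m) _ _) (step b)) ⟩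
    E w m (λ b → e ℚ.* (if b then x else 1ℚ))
      ≡⟨ E-*ˡ m e _ ⟩
    e ℚ.* E w m (λ b → if b then x else 1ℚ)
      ≡⟨ trans (ℚ.*-comm e _) (cong (E w m (λ b → if b then x else 1ℚ) ℚ.*_) (E-countTrue k m x)) ⟩
    E w m (λ b → if b then x else 1ℚ) ^ℚ suc k ∎
    where
    open ≡-Reasoning
    e : ℚ
    e = E w (countTrue k m) (x ^ℚ_)
    step : ∀ b → E w (countTrue k m) (λ c → x ^ℚ (if b then suc c else c)) ≡ e ℚ.* (if b then x else 1ℚ)
    step true  = trans (E-*ˡ (countTrue k m) x (x ^ℚ_)) (ℚ.*-comm x e)
    step false = sym (ℚ.*-identityʳ e)

  queries-countTrue : ∀ k (m : QueryAlg n Bool) → queries w (countTrue k m) ≤ k * queries w m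
  queries-countTrue zero    m = z≤n
  queries-countTrue (suc k) m = queries-bind m _ _ λ b →
    ℕ.≤-trans (queries-bind (countTrue k m) _ 0 (λ c → z≤n)) (ℕ.≤-trans (ℕ.≤-reflexive (ℕ.+-identityʳ _)) (queries-countTrue k m))

-- The random test

-- The survival probabilities of the random test.  An element q survives round i when none of
-- N i random windows g ∋ q, each drawn with probability inv, is active; a window is active in
-- round i when, for every k ≤ i, t random elements of g have all survived the rounds before k.
-- Thus a i q, p i g and e i g are the probabilities that q survives i rounds, that a random
-- element of g does, and that g is active in round i.
module Rounds
  {Elem Win : Set} (windows : List Win) (elems : Win → List Elem) (inc : Elem → Win → Bool)
  (inv : ℚ) (N : ℕ → ℕ) (t : ℕ)
  where

  a : ℕ → Elem → ℚ
  μ : ℕ → Elem → ℚ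
  e : ℕ → Win → ℚ
  p : ℕ → Win → ℚ
  a zero    q = 1ℚ
  a (suc i) q = a i q ℚ.* (1ℚ ℚ.- μ i q) ^ℚ N i
  μ i q = inv ℚ.* ∑ windows λ g → ⟦ inc q g ⟧ ℚ.* e i g
  e zero    g = 1ℚ
  e (suc i) g = e i g ℚ.* p (suc i) g ^ℚ t
  p i g = ∑ (elems g) (a i) ℚ.* 1/ℕ (length (elems g) ∸ 1)

  size : Win → ℚ
  size g = ι (length (elems g))

  -- The expected number of active windows among the draws at q, over the rounds that q enters
  -- alive.
  load : ℕ → Elem → ℚ
  load J q = ∑ (downFrom J) λ i → a i q ℚ.* (ι (N i) ℚ.* μ i q)

  module Analysis
    (c : ℕ) (N-suc : ∀ i → N (suc i) ≡ c * N i)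
    (0≤inv : 0ℚ ℚ.≤ inv)
    (nonempty : ∀ {g} → g ∈ windows → NonZero (length (elems g)))
    (few : ∀ q → inv ℚ.* ∑ windows (λ g → ⟦ inc q g ⟧) ℚ.≤ 1ℚ)
    where

    p*size : ∀ i g → p i g ℚ.* size g ≡ ∑ (elems g) (a i)
    p*size i g with elems g
    ... | []     = trans (cong (0ℚ ℚ.* 1/ℕ 0 ℚ.*_) ι-0) (ℚ.*-zeroʳ (0ℚ ℚ.* 1/ℕ 0))
    ... | q ∷ qs = trans (ℚ.*-assoc (∑ (q ∷ qs) (a i)) (1/ℕ (length qs)) (ι (suc (length qs))))
      (trans (cong (∑ (q ∷ qs) (a i) ℚ.*_) (1/ℕ-inverse (length qs))) (ℚ.*-identityʳ _))

    p≤ : ∀ i g {x} → 0ℚ ℚ.≤ x → (∀ {q} → q ∈ elems g → a i q ℚ.≤ x) → p i g ℚ.≤ x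
    p≤ i g {x} 0≤x a≤ with elems g
    ... | []     = ≡≤ (ℚ.*-zeroˡ (1/ℕ 0)) 0≤x
    ... | q ∷ qs = begin
      ∑ (q ∷ qs) (a i) ℚ.* 1/ℕ k         ≤⟨ ≤* (0≤1/ℕ k) (∑-mono∈ (q ∷ qs) a≤) ⟩
      ∑ (q ∷ qs) (λ _ → x) ℚ.* 1/ℕ k     ≡⟨ cong (ℚ._* 1/ℕ k) (∑-const (q ∷ qs) x) ⟩
      ι (suc k) ℚ.* x ℚ.* 1/ℕ k          ≡⟨ ((∀ s x v → s ℚ.* x ℚ.* v ≡ v ℚ.* s ℚ.* x) ∋ solve-∀ ℚ-ring) (ι (suc k)) x (1/ℕ k) ⟩
      1/ℕ k ℚ.* ι (suc k) ℚ.* x          ≡⟨ trans (cong (ℚ._* x) (1/ℕ-inverse k)) (ℚ.*-identityˡ x) ⟩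
      x                                  ∎
      where
      open ℚ.≤-Reasoning
      k = length qs

    p-mono : ∀ {i j} g → (∀ q → a i q ℚ.≤ a j q) → p i g ℚ.≤ p j g
    p-mono g a≤ = ≤* (0≤1/ℕ (length (elems g) ∸ 1)) (∑-mono (elems g) a≤)

    0≤a : ∀ i q → 0ℚ ℚ.≤ a i q
    a≤1 : ∀ i q → a i q ℚ.≤ 1ℚ
    0≤p : ∀ i g → 0ℚ ℚ.≤ p i g
    p≤1 : ∀ i g → p i g ℚ.≤ 1ℚ
    0≤e : ∀ i g → 0ℚ ℚ.≤ e i g
    e≤1 : ∀ i g → e i g ℚ.≤ 1ℚ
    0≤μ : ∀ i q → 0ℚ ℚ.≤ μ i q
    μ≤1 : ∀ i q → μ i q ℚ.≤ 1ℚ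
    0≤1-μ : ∀ i q → 0ℚ ℚ.≤ 1ℚ ℚ.- μ i q
    1-μ≤1 : ∀ i q → 1ℚ ℚ.- μ i q ℚ.≤ 1ℚ

    0≤a zero    q = 0≤1
    0≤a (suc i) q = 0≤* (0≤a i q) (0≤^ (N i) (0≤1-μ i q))
    a≤1 zero    q = ℚ.≤-refl
    a≤1 (suc i) q = *≤* (0≤^ (N i) (0≤1-μ i q)) 0≤1 (a≤1 i q) (^≤1 (N i) (0≤1-μ i q) (1-μ≤1 i q))
    0≤p i g = 0≤* (0≤∑ (elems g) (0≤a i)) (0≤1/ℕ (length (elems g) ∸ 1))
    p≤1 i g = p≤ i g 0≤1 (λ {q} _ → a≤1 i q)
    0≤e zero    g = 0≤1
    0≤e (suc i) g = 0≤* (0≤e i g) (0≤^ t (0≤p (suc i) g))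
    e≤1 zero    g = ℚ.≤-refl
    e≤1 (suc i) g = *≤* (0≤^ t (0≤p (suc i) g)) 0≤1 (e≤1 i g) (^≤1 t (0≤p (suc i) g) (p≤1 (suc i) g))
    0≤μ i q = 0≤* 0≤inv (0≤∑ windows λ g → 0≤* 0≤⟦ inc q g ⟧ (0≤e i g))
    μ≤1 i q = ℚ.≤-trans (*≤ 0≤inv (∑-mono windows λ g →
      ≤≡ (*≤ 0≤⟦ inc q g ⟧ (e≤1 i g)) (ℚ.*-identityʳ _))) (few q)
    0≤1-μ i q = 0≤b-a (μ≤1 i q)
    1-μ≤1 i q = ≤-by (0≤μ i q) (((∀ x → 1ℚ ℚ.- x ℚ.+ x ≡ 1ℚ ℚ.+ 0ℚ) ∋ solve-∀ ℚ-ring) (μ i q))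

    a-step : ∀ i q → a (suc i) q ℚ.≤ a i q
    a-step i q = ≤≡ (*≤ (0≤a i q) (^≤1 (N i) (0≤1-μ i q) (1-μ≤1 i q))) (ℚ.*-identityʳ (a i q))

    a-mono′ : ∀ {i j} → i ≤′ j → ∀ q → a j q ℚ.≤ a i q
    a-mono′ ≤′-refl                q = ℚ.≤-refl
    a-mono′ {j = suc j} (≤′-step i≤j) q = ℚ.≤-trans (a-step j q) (a-mono′ i≤j q)

    a-mono : ∀ {i j} → i ≤ j → ∀ q → a j q ℚ.≤ a i q
    a-mono i≤j = a-mono′ (ℕ.≤⇒≤′ i≤j)

    e-step : ∀ i g → e (suc i) g ℚ.≤ e i g
    e-step i g = ≤≡ (*≤ (0≤e i g) (^≤1 t (0≤p (suc i) g) (p≤1 (suc i) g))) (ℚ.*-identityʳ (e i g))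

    μ-step : ∀ i q → μ (suc i) q ℚ.≤ μ i q
    μ-step i q = *≤ 0≤inv (∑-mono windows λ g → *≤ 0≤⟦ inc q g ⟧ (e-step i g))

    N-suc-ι : ∀ i → ι (N (suc i)) ≡ ι c ℚ.* ι (N i)
    N-suc-ι i = trans (cong ι (N-suc i)) (ι-* c (N i))

    rate-step : ∀ i q → ι (N (suc i)) ℚ.* μ (suc i) q ℚ.≤ ι c ℚ.* (ι (N i) ℚ.* μ i q)
    rate-step i q = begin
      ι (N (suc i)) ℚ.* μ (suc i) q        ≤⟨ *≤ (0≤ι (N (suc i))) (μ-step i q) ⟩
      ι (N (suc i)) ℚ.* μ i q              ≡⟨ cong (ℚ._* μ i q) (N-suc-ι i) ⟩
      ι c ℚ.* ι (N i) ℚ.* μ i q            ≡⟨ ℚ.*-assoc (ι c) (ι (N i)) (μ i q) ⟩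
      ι c ℚ.* (ι (N i) ℚ.* μ i q)          ∎
      where open ℚ.≤-Reasoning

    -- A decrease of a by the factor r = (1 − μ)^N pays for a rate N μ in the next round.
    a-suc-rate : ∀ i q → a (suc i) q ℚ.* (ι (N i) ℚ.* μ i q) ℚ.≤ a i q ℚ.- a (suc i) q
    a-suc-rate i q = begin
      a i q ℚ.* r ℚ.* (ι (N i) ℚ.* μ i q)  ≡⟨ ((∀ a r x → a ℚ.* r ℚ.* x ≡ a ℚ.* (x ℚ.* r)) ∋ solve-∀ ℚ-ring) (a i q) r (ι (N i) ℚ.* μ i q) ⟩
      a i q ℚ.* (ι (N i) ℚ.* μ i q ℚ.* r)  ≤⟨ *≤ (0≤a i q) (Nx[1-x]^N≤1-[1-x]^N (0≤μ i q) (μ≤1 i q) (N i)) ⟩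
      a i q ℚ.* (1ℚ ℚ.- r)                 ≡⟨ ((∀ a r → a ℚ.* (1ℚ ℚ.- r) ≡ a ℚ.- a ℚ.* r) ∋ solve-∀ ℚ-ring) (a i q) r ⟩
      a i q ℚ.- a (suc i) q                ∎
      where
      open ℚ.≤-Reasoning
      r : ℚ
      r = (1ℚ ℚ.- μ i q) ^ℚ N i

    -- The first round contributes at most `N 0`. In a later round the rate is at most c times the
    -- previous one, since `μ` only decreases, and `a-suc-rate` pays for that with the drop of `a`;
    -- the drops telescope.
    load-≤-aux : ∀ J q → load (suc J) q ℚ.≤ ι (N 0) ℚ.+ ι c ℚ.* (1ℚ ℚ.- a J q)
    load-≤-aux zero q = begin
      1ℚ ℚ.* (ι (N 0) ℚ.* μ 0 q) ℚ.+ 0ℚ         ≡⟨ ((∀ n m → 1ℚ ℚ.* (n ℚ.* m) ℚ.+ 0ℚ ≡ n ℚ.* m) ∋ solve-∀ ℚ-ring) (ι (N 0)) (μ 0 q) ⟩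
      ι (N 0) ℚ.* μ 0 q                         ≤⟨ *≤ (0≤ι (N 0)) (μ≤1 0 q) ⟩
      ι (N 0) ℚ.* 1ℚ                            ≡⟨ ((∀ n c → n ℚ.* 1ℚ ≡ n ℚ.+ c ℚ.* (1ℚ ℚ.- 1ℚ)) ∋ solve-∀ ℚ-ring) (ι (N 0)) (ι c) ⟩
      ι (N 0) ℚ.+ ι c ℚ.* (1ℚ ℚ.- 1ℚ)           ∎
      where open ℚ.≤-Reasoning
    load-≤-aux (suc J) q = begin
      a (suc J) q ℚ.* (ι (N (suc J)) ℚ.* μ (suc J) q) ℚ.+ load (suc J) q
        ≤⟨ *≤ (0≤a (suc J) q) (rate-step J q) +≤ load-≤-aux J q ⟩
      a (suc J) q ℚ.* (ι c ℚ.* (ι (N J) ℚ.* μ J q)) ℚ.+ (ι (N 0) ℚ.+ ι c ℚ.* (1ℚ ℚ.- a J q))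
        ≤⟨ ≤-by (*≤ (0≤ι c) (a-suc-rate J q)) (((∀ a′ c x n a → a′ ℚ.* (c ℚ.* x) ℚ.+ (n ℚ.+ c ℚ.* (1ℚ ℚ.- a)) ℚ.+ c ℚ.* (a ℚ.- a′)
             ≡ n ℚ.+ c ℚ.* (1ℚ ℚ.- a′) ℚ.+ c ℚ.* (a′ ℚ.* x)) ∋ solve-∀ ℚ-ring) (a (suc J) q) (ι c) (ι (N J) ℚ.* μ J q) (ι (N 0)) (a J q)) ⟩
      ι (N 0) ℚ.+ ι c ℚ.* (1ℚ ℚ.- a (suc J) q) ∎
      where open ℚ.≤-Reasoning

    load-≤ : ∀ J q → load J q ℚ.≤ ι (N 0) ℚ.+ ι c
    load-≤ zero    q = 0≤+ (0≤ι (N 0)) (0≤ι c)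
    load-≤ (suc J) q = ℚ.≤-trans (load-≤-aux J q) (≤-by (0≤* (0≤ι c) (0≤a J q))
      (((∀ n c a → n ℚ.+ c ℚ.* (1ℚ ℚ.- a) ℚ.+ c ℚ.* a ≡ n ℚ.+ c ℚ.+ 0ℚ) ∋ solve-∀ ℚ-ring) (ι (N 0)) (ι c) (a J q)))

    -- A union bound in each round: the chance to die is at most the expected number of active
    -- draws.
    1-a≤load : ∀ J q → 1ℚ ℚ.- a J q ℚ.≤ load J q
    1-a≤load zero    q = ℚ.≤-refl
    1-a≤load (suc J) q = ≤-by (1-a≤load J q +≤ *≤ (0≤a J q) (1-Nx≤[1-x]^N (0≤μ J q) (μ≤1 J q) (N J)))
      (((∀ a r y l → 1ℚ ℚ.- a ℚ.* r ℚ.+ (l ℚ.+ a ℚ.* r) ≡ a ℚ.* y ℚ.+ l ℚ.+ (1ℚ ℚ.- a ℚ.+ a ℚ.* (1ℚ ℚ.- y))) ∋ solve-∀ ℚ-ring)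
        (a J q) ((1ℚ ℚ.- μ J q) ^ℚ N J) (ι (N J) ℚ.* μ J q) (load J q))

    0≤load : ∀ J q → 0ℚ ℚ.≤ load J q
    0≤load J q = 0≤∑ (downFrom J) λ i → 0≤* (0≤a i q) (0≤* (0≤ι (N i)) (0≤μ i q))

    load-≤-rate : ∀ J q → load J q ℚ.≤ ∑ (downFrom J) λ i → ι (N i) ℚ.* μ i q
    load-≤-rate J q = ∑-mono (downFrom J) λ i → ≤≡ (≤* (0≤* (0≤ι (N i)) (0≤μ i q)) (a≤1 i q)) (ℚ.*-identityˡ _)

    -- Up to constant factors, `rate J g` is the weight of g in the fractional certificate, hence
    -- its cost, while `gain J g` times the size of g is the load that g puts on elements still
    -- alive, hence its benefit.
    rate gain : ℕ → Win → ℚ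
    rate J g = ∑ (downFrom J) λ i → ι (N i) ℚ.* e i g
    gain J g = ∑ (downFrom J) λ i → ι (N i) ℚ.* e i g ℚ.* p i g

    -- As long as p i g ≥ p₁ the gain of g keeps up with its rate; afterwards the rate decays
    -- geometrically because c * p₁ ^ t is small.
    module _ {p₁ ν} (0≤p₁ : 0ℚ ℚ.≤ p₁) (p₁≤1 : p₁ ℚ.≤ 1ℚ) (0≤ν : 0ℚ ℚ.≤ ν) (decay : ι c ℚ.* p₁ ^ℚ t ℚ.≤ ν) where

      private
        G : ℕ → Win → ℚ
        G i g = ι (N i) ℚ.* e i g

        0≤G : ∀ i g → 0ℚ ℚ.≤ G i g
        0≤G i g = 0≤* (0≤ι (N i)) (0≤e i g)

        term : ∀ i g → p₁ ℚ.* G (suc i) g ℚ.≤ G (suc i) g ℚ.* p (suc i) g ℚ.+ p₁ ℚ.* ν ℚ.* G i g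
        term i g with ℚ.≤-total p₁ (p (suc i) g)
        ... | inj₁ p₁≤p = ≤-by (*≤ (0≤G (suc i) g) p₁≤p +≤ 0≤* (0≤* 0≤p₁ 0≤ν) (0≤G i g))
          (((∀ p₁ G p y → p₁ ℚ.* G ℚ.+ (G ℚ.* p ℚ.+ y) ≡ G ℚ.* p ℚ.+ y ℚ.+ (G ℚ.* p₁ ℚ.+ 0ℚ)) ∋ solve-∀ ℚ-ring) p₁ (G (suc i) g) (p (suc i) g) (p₁ ℚ.* ν ℚ.* G i g))
        ... | inj₂ p≤p₁ = begin
          p₁ ℚ.* G (suc i) g
            ≡⟨ cong (λ n → p₁ ℚ.* (n ℚ.* (e i g ℚ.* P))) (N-suc-ι i) ⟩
          p₁ ℚ.* (ι c ℚ.* ι (N i) ℚ.* (e i g ℚ.* P))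
            ≡⟨ ((∀ p₁ c n e P → p₁ ℚ.* (c ℚ.* n ℚ.* (e ℚ.* P)) ≡ p₁ ℚ.* ((n ℚ.* e) ℚ.* (c ℚ.* P))) ∋ solve-∀ ℚ-ring) p₁ (ι c) (ι (N i)) (e i g) P ⟩
          p₁ ℚ.* (G i g ℚ.* (ι c ℚ.* P))
            ≤⟨ *≤ 0≤p₁ (*≤ (0≤G i g) (ℚ.≤-trans (*≤ (0≤ι c) (^-mono t (0≤p (suc i) g) p≤p₁)) decay)) ⟩
          p₁ ℚ.* (G i g ℚ.* ν)
            ≤⟨ ≤-by (0≤* (0≤G (suc i) g) (0≤p (suc i) g)) (((∀ p₁ g ν x → p₁ ℚ.* (g ℚ.* ν) ℚ.+ x ≡ x ℚ.+ p₁ ℚ.* ν ℚ.* g ℚ.+ 0ℚ) ∋ solve-∀ ℚ-ring) p₁ (G i g) ν (G (suc i) g ℚ.* p (suc i) g)) ⟩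
          G (suc i) g ℚ.* p (suc i) g ℚ.+ p₁ ℚ.* ν ℚ.* G i g ∎
          where
          open ℚ.≤-Reasoning
          P : ℚ
          P = p (suc i) g ^ℚ t

        p0 : ∀ {g} → g ∈ windows → p 0 g ≡ 1ℚ
        p0 {g} g∈ with length (elems g) | nonempty g∈ | ∑-one (elems g)
        ... | suc k | _ | eq = trans (cong (ℚ._* 1/ℕ k) eq) (trans (ℚ.*-comm (ι (suc k)) (1/ℕ k)) (1/ℕ-inverse k))

        aux : ∀ J {g} → g ∈ windows → p₁ ℚ.* rate (suc J) g ℚ.≤ gain (suc J) g ℚ.+ p₁ ℚ.* ν ℚ.* rate J g
        aux zero {g} g∈ = begin
          p₁ ℚ.* (G 0 g ℚ.+ 0ℚ)                              ≡⟨ ((∀ p G → p ℚ.* (G ℚ.+ 0ℚ) ≡ p ℚ.* G) ∋ solve-∀ ℚ-ring) p₁ (G 0 g) ⟩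
          p₁ ℚ.* G 0 g                                       ≤⟨ ≤* (0≤G 0 g) p₁≤1 ⟩
          1ℚ ℚ.* G 0 g                                       ≡⟨ ((∀ G y → 1ℚ ℚ.* G ≡ G ℚ.* 1ℚ ℚ.+ 0ℚ ℚ.+ y ℚ.* 0ℚ) ∋ solve-∀ ℚ-ring) (G 0 g) (p₁ ℚ.* ν) ⟩
          G 0 g ℚ.* 1ℚ ℚ.+ 0ℚ ℚ.+ p₁ ℚ.* ν ℚ.* 0ℚ            ≡⟨ cong (λ x → G 0 g ℚ.* x ℚ.+ 0ℚ ℚ.+ p₁ ℚ.* ν ℚ.* 0ℚ) (sym (p0 g∈)) ⟩
          G 0 g ℚ.* p 0 g ℚ.+ 0ℚ ℚ.+ p₁ ℚ.* ν ℚ.* 0ℚ         ∎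
          where open ℚ.≤-Reasoning
        aux (suc J) {g} g∈ = ≤-by (term J g +≤ aux J g∈)
          (((∀ p₁ x r y pν rJ gJ z → p₁ ℚ.* (x ℚ.+ r) ℚ.+ (y ℚ.+ pν ℚ.* z ℚ.+ (gJ ℚ.+ pν ℚ.* rJ)) ≡ y ℚ.+ gJ ℚ.+ pν ℚ.* (z ℚ.+ rJ) ℚ.+ (p₁ ℚ.* x ℚ.+ p₁ ℚ.* r)) ∋ solve-∀ ℚ-ring)
            p₁ (G (suc J) g) (rate (suc J) g) (G (suc J) g ℚ.* p (suc J) g) (p₁ ℚ.* ν) (rate J g) (gain (suc J) g) (G J g))

      rate-≤-gain : ∀ J {g} → g ∈ windows → p₁ ℚ.* (1ℚ ℚ.- ν) ℚ.* rate J g ℚ.≤ gain J g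
      rate-≤-gain zero    g∈ = ℚ.≤-reflexive (ℚ.*-zeroʳ (p₁ ℚ.* (1ℚ ℚ.- ν)))
      rate-≤-gain (suc J) {g} g∈ = ≤-by (aux J g∈ +≤ 0≤* (0≤* 0≤p₁ 0≤ν) (0≤G J g))
        (((∀ p₁ ν x r gn → p₁ ℚ.* (1ℚ ℚ.- ν) ℚ.* (x ℚ.+ r) ℚ.+ (gn ℚ.+ p₁ ℚ.* ν ℚ.* r ℚ.+ p₁ ℚ.* ν ℚ.* x) ≡ gn ℚ.+ (p₁ ℚ.* (x ℚ.+ r) ℚ.+ 0ℚ)) ∋ solve-∀ ℚ-ring)
          p₁ ν (G J g) (rate J g) (gain (suc J) g))

    module _ (units : List Elem)
             (regroup : ∀ {g} → g ∈ windows → ∀ φ → ∑ units (λ q → ⟦ inc q g ⟧ ℚ.* φ q) ≡ ∑ (elems g) φ) where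

      -- Double counting of the incidences between units and windows.
      ∑-load : ∀ J → ∑ units (load J) ≡ inv ℚ.* ∑ windows λ g → gain J g ℚ.* size g
      ∑-load J = begin
        ∑ units (load J)
          ≡⟨ ∑-swap units (downFrom J) _ ⟩
        ∑ (downFrom J) (λ i → ∑ units λ q → a i q ℚ.* (ι (N i) ℚ.* μ i q))
          ≡⟨ ∑-cong (downFrom J) (λ i → round i) ⟩
        ∑ (downFrom J) (λ i → inv ℚ.* ∑ windows λ g → ι (N i) ℚ.* e i g ℚ.* p i g ℚ.* size g)
          ≡⟨ ∑-*ˡ (downFrom J) inv _ ⟩
        inv ℚ.* ∑ (downFrom J) (λ i → ∑ windows λ g → ι (N i) ℚ.* e i g ℚ.* p i g ℚ.* size g)
          ≡⟨ cong (inv ℚ.*_) (∑-swap (downFrom J) windows _) ⟩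
        inv ℚ.* ∑ windows (λ g → ∑ (downFrom J) λ i → ι (N i) ℚ.* e i g ℚ.* p i g ℚ.* size g)
          ≡⟨ cong (inv ℚ.*_) (∑-cong windows λ g → ∑-*ʳ (downFrom J) (size g) _) ⟩
        inv ℚ.* ∑ windows (λ g → gain J g ℚ.* size g) ∎
        where
        open ≡-Reasoning
        round : ∀ i → ∑ units (λ q → a i q ℚ.* (ι (N i) ℚ.* μ i q)) ≡ inv ℚ.* ∑ windows λ g → ι (N i) ℚ.* e i g ℚ.* p i g ℚ.* size g
        round i = begin
          ∑ units (λ q → a i q ℚ.* (ι (N i) ℚ.* μ i q))
            ≡⟨ ∑-cong units (λ q → trans (((∀ a n v s → a ℚ.* (n ℚ.* (v ℚ.* s)) ≡ v ℚ.* ((a ℚ.* n) ℚ.* s)) ∋ solve-∀ ℚ-ring) (a i q) (ι (N i)) inv (∑ windows λ g → ⟦ inc q g ⟧ ℚ.* e i g))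
                 (cong (inv ℚ.*_) (sym (∑-*ˡ windows (a i q ℚ.* ι (N i)) _)))) ⟩
          ∑ units (λ q → inv ℚ.* ∑ windows λ g → a i q ℚ.* ι (N i) ℚ.* (⟦ inc q g ⟧ ℚ.* e i g))
            ≡⟨ ∑-*ˡ units inv _ ⟩
          inv ℚ.* ∑ units (λ q → ∑ windows λ g → a i q ℚ.* ι (N i) ℚ.* (⟦ inc q g ⟧ ℚ.* e i g))
            ≡⟨ cong (inv ℚ.*_) (∑-swap units windows _) ⟩
          inv ℚ.* ∑ windows (λ g → ∑ units λ q → a i q ℚ.* ι (N i) ℚ.* (⟦ inc q g ⟧ ℚ.* e i g))
            ≡⟨ cong (inv ℚ.*_) (∑-cong∈ windows λ {g} g∈ → window g g∈) ⟩
          inv ℚ.* ∑ windows (λ g → ι (N i) ℚ.* e i g ℚ.* p i g ℚ.* size g) ∎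
          where
          window : ∀ g → g ∈ windows → ∑ units (λ q → a i q ℚ.* ι (N i) ℚ.* (⟦ inc q g ⟧ ℚ.* e i g)) ≡ ι (N i) ℚ.* e i g ℚ.* p i g ℚ.* size g
          window g g∈ = begin
            ∑ units (λ q → a i q ℚ.* ι (N i) ℚ.* (⟦ inc q g ⟧ ℚ.* e i g))
              ≡⟨ ∑-cong units (λ q → ((∀ a n b e → a ℚ.* n ℚ.* (b ℚ.* e) ≡ (n ℚ.* e) ℚ.* (b ℚ.* a)) ∋ solve-∀ ℚ-ring) (a i q) (ι (N i)) ⟦ inc q g ⟧ (e i g)) ⟩
            ∑ units (λ q → ι (N i) ℚ.* e i g ℚ.* (⟦ inc q g ⟧ ℚ.* a i q))
              ≡⟨ ∑-*ˡ units (ι (N i) ℚ.* e i g) _ ⟩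
            ι (N i) ℚ.* e i g ℚ.* ∑ units (λ q → ⟦ inc q g ⟧ ℚ.* a i q)
              ≡⟨ cong (ι (N i) ℚ.* e i g ℚ.*_) (trans (regroup g∈ (a i)) (sym (p*size i g))) ⟩
            ι (N i) ℚ.* e i g ℚ.* (p i g ℚ.* size g)
              ≡⟨ sym (ℚ.*-assoc (ι (N i) ℚ.* e i g) (p i g) (size g)) ⟩
            ι (N i) ℚ.* e i g ℚ.* p i g ℚ.* size g ∎

    -- If nearly all elements of g survived, g would have been active at a rate that kills
    -- three quarters of them in the last round.
    module _ (inc-elems : ∀ {q g} → q ∈ elems g → inc q g ≡ true) (0<t : NonZero t)
             (J : ℕ) (late : ι 3 ℚ.≤ ι (N J) ℚ.* inv ℚ.* ½ ^ℚ J) where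

      private
        0≤½ : 0ℚ ℚ.≤ ½
        0≤½ = ℚ.*≤* (ℤ.+≤+ z≤n)

        -- Survival only decreases, so the last factor p ^ t bounds all earlier ones from below.
        e-large : ∀ g → ½ ℚ.≤ p (suc J) g ^ℚ t → ∀ i → i ≤ J → ½ ^ℚ i ℚ.≤ e i g
        e-large g ½≤ zero    i≤J = ℚ.≤-refl
        e-large g ½≤ (suc i) i≤J = begin
          ½ ℚ.* ½ ^ℚ i               ≡⟨ ℚ.*-comm ½ (½ ^ℚ i) ⟩
          ½ ^ℚ i ℚ.* ½               ≤⟨ *≤* 0≤½ (0≤e i g) (e-large g ½≤ i (ℕ.≤-trans (ℕ.n≤1+n i) i≤J))
                                            (ℚ.≤-trans ½≤ (^-mono t (0≤p (suc J) g) (p-mono {suc J} {suc i} g (a-mono (ℕ.≤-trans i≤J (ℕ.n≤1+n J)))))) ⟩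
          e i g ℚ.* p (suc i) g ^ℚ t ∎
          where open ℚ.≤-Reasoning

        ¼ : ℚ
        ¼ = ½ ℚ.* ½

        a-small : ∀ {g} → g ∈ windows → ½ ℚ.≤ p (suc J) g ^ℚ t → ∀ {q} → q ∈ elems g → a (suc J) q ℚ.≤ ¼
        a-small {g} g∈ ½≤ {q} q∈ = begin
          a J q ℚ.* r  ≤⟨ ≤* (0≤^ (N J) (0≤1-μ J q)) (a≤1 J q) ⟩
          1ℚ ℚ.* r     ≤⟨ ≤-by (*≤ (0≤* 0≤½ 0≤½) bound) (((∀ r → 1ℚ ℚ.* r ℚ.+ ½ ℚ.* ½ ℚ.* (1ℚ ℚ.- r) ≡ ½ ℚ.* ½ ℚ.+ ½ ℚ.* ½ ℚ.* ((1ℚ ℚ.+ 1ℚ ℚ.+ 1ℚ) ℚ.* r)) ∋ solve-∀ ℚ-ring) r) ⟩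
          ¼            ∎
          where
          open ℚ.≤-Reasoning
          r : ℚ
          r = (1ℚ ℚ.- μ J q) ^ℚ N J
          μ-large : inv ℚ.* ½ ^ℚ J ℚ.≤ μ J q
          μ-large = *≤ 0≤inv (begin
            ½ ^ℚ J                    ≤⟨ e-large g ½≤ J ℕ.≤-refl ⟩
            e J g                     ≡⟨ sym (trans (cong (λ b → ⟦ b ⟧ ℚ.* e J g) (inc-elems q∈)) (ℚ.*-identityˡ (e J g))) ⟩
            ⟦ inc q g ⟧ ℚ.* e J g     ≤⟨ ≤∑ {f = λ g → ⟦ inc q g ⟧ ℚ.* e J g} (λ g → 0≤* 0≤⟦ inc q g ⟧ (0≤e J g)) g∈ ⟩
            ∑ windows (λ g → ⟦ inc q g ⟧ ℚ.* e J g) ∎)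
          3≤ : 1ℚ ℚ.+ 1ℚ ℚ.+ 1ℚ ℚ.≤ ι (N J) ℚ.* μ J q
          3≤ = begin
            1ℚ ℚ.+ 1ℚ ℚ.+ 1ℚ              ≡⟨ sym (trans (ι-+ 2 1) (cong₂ ℚ._+_ (trans (ι-+ 1 1) (cong₂ ℚ._+_ ι-1 ι-1)) ι-1)) ⟩
            ι 3                           ≤⟨ late ⟩
            ι (N J) ℚ.* inv ℚ.* ½ ^ℚ J    ≡⟨ ℚ.*-assoc (ι (N J)) inv _ ⟩
            ι (N J) ℚ.* (inv ℚ.* ½ ^ℚ J)  ≤⟨ *≤ (0≤ι (N J)) μ-large ⟩
            ι (N J) ℚ.* μ J q             ∎
          -- With N μ at least 3, the inequality N μ r ≤ 1 - r becomes 3 r ≤ 1 - r, so r is at most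
          -- ¼.
          bound : (1ℚ ℚ.+ 1ℚ ℚ.+ 1ℚ) ℚ.* r ℚ.≤ 1ℚ ℚ.- r
          bound = ℚ.≤-trans (≤* (0≤^ (N J) (0≤1-μ J q)) 3≤) (Nx[1-x]^N≤1-[1-x]^N (0≤μ J q) (μ≤1 J q) (N J))

        p^t-small : ∀ {g} → g ∈ windows → ¬ ½ ℚ.≤ p (suc J) g ^ℚ t
        p^t-small {g} g∈ ½≤ = contradiction (ℚ.≤-trans ½≤ p^t≤¼) λ { (ℚ.*≤* (ℤ.+≤+ (s≤s (s≤s ())))) }
          where
          p≤¼ : p (suc J) g ℚ.≤ ¼
          p≤¼ = p≤ (suc J) g (0≤* 0≤½ 0≤½) (a-small g∈ ½≤)
          pow : ∀ k → NonZero k → p (suc J) g ^ℚ k ℚ.≤ ¼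
          pow (suc k) _ = ≤≡ (*≤* (0≤^ k (0≤p (suc J) g)) (0≤* 0≤½ 0≤½) p≤¼ (^≤1 k (0≤p (suc J) g) (p≤1 (suc J) g))) (ℚ.*-identityʳ ¼)
          p^t≤¼ : p (suc J) g ^ℚ t ℚ.≤ ¼
          p^t≤¼ = pow t 0<t

      many-dead : ∀ {g} → g ∈ windows → size g ℚ.≤ (1ℚ ℚ.+ 1ℚ) ℚ.* ι t ℚ.* ∑ (elems g) (λ q → 1ℚ ℚ.- a (suc J) q)
      many-dead {g} g∈ = begin
        size g                                     ≡⟨ ((∀ s → s ≡ (1ℚ ℚ.+ 1ℚ) ℚ.* (s ℚ.* ½)) ∋ solve-∀ ℚ-ring) (size g) ⟩
        (1ℚ ℚ.+ 1ℚ) ℚ.* (size g ℚ.* ½)             ≤⟨ *≤ (0≤+ 0≤1 0≤1) (*≤ (0≤ι _) few-alive) ⟩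
        (1ℚ ℚ.+ 1ℚ) ℚ.* (size g ℚ.* (ι t ℚ.* (1ℚ ℚ.- P))) ≡⟨ ((∀ s t P → (1ℚ ℚ.+ 1ℚ) ℚ.* (s ℚ.* (t ℚ.* (1ℚ ℚ.- P))) ≡ (1ℚ ℚ.+ 1ℚ) ℚ.* t ℚ.* (s ℚ.* 1ℚ ℚ.+ (ℚ.- 1ℚ) ℚ.* (P ℚ.* s))) ∋ solve-∀ ℚ-ring) (size g) (ι t) P ⟩
        (1ℚ ℚ.+ 1ℚ) ℚ.* ι t ℚ.* (size g ℚ.* 1ℚ ℚ.+ (ℚ.- 1ℚ) ℚ.* (P ℚ.* size g))
          ≡⟨ cong ((1ℚ ℚ.+ 1ℚ) ℚ.* ι t ℚ.*_) (cong₂ ℚ._+_ (sym (∑-const (elems g) 1ℚ)) (trans (cong ((ℚ.- 1ℚ) ℚ.*_) (p*size (suc J) g)) (sym (∑-*ˡ (elems g) (ℚ.- 1ℚ) (a (suc J)))))) ⟩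
        (1ℚ ℚ.+ 1ℚ) ℚ.* ι t ℚ.* (∑ (elems g) (λ _ → 1ℚ) ℚ.+ ∑ (elems g) (λ q → (ℚ.- 1ℚ) ℚ.* a (suc J) q))
          ≡⟨ cong ((1ℚ ℚ.+ 1ℚ) ℚ.* ι t ℚ.*_) (trans (sym (∑-+ (elems g) (λ _ → 1ℚ) (λ q → (ℚ.- 1ℚ) ℚ.* a (suc J) q)))
               (∑-cong (elems g) λ q → ((∀ a → 1ℚ ℚ.+ (ℚ.- 1ℚ) ℚ.* a ≡ 1ℚ ℚ.- a) ∋ solve-∀ ℚ-ring) (a (suc J) q))) ⟩
        (1ℚ ℚ.+ 1ℚ) ℚ.* ι t ℚ.* ∑ (elems g) (λ q → 1ℚ ℚ.- a (suc J) q) ∎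
        where
        open ℚ.≤-Reasoning
        P : ℚ
        P = p (suc J) g
        -- P ^ t is below ½ by `p^t-small`, and at least 1 - t (1 - P) by Bernoulli's inequality.
        few-alive : ½ ℚ.≤ ι t ℚ.* (1ℚ ℚ.- P)
        few-alive with ℚ.≤-total ½ (ι t ℚ.* (1ℚ ℚ.- P))
        ... | inj₁ ½≤ = ½≤
        ... | inj₂ ≤½ = contradiction (≤-by (≤½ +≤ 1-Nx≤[1-x]^N (0≤b-a (p≤1 (suc J) g)) 1-P≤1 t)
            (trans (cong (λ x → ½ ℚ.+ (½ ℚ.+ x)) (cong (_^ℚ t) 1-[1-P])) (((∀ y x → ½ ℚ.+ (½ ℚ.+ x) ≡ x ℚ.+ (y ℚ.+ (1ℚ ℚ.- y))) ∋ solve-∀ ℚ-ring) (ι t ℚ.* (1ℚ ℚ.- P)) (P ^ℚ t)))) (p^t-small g∈)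
          where
          1-[1-P] : 1ℚ ℚ.- (1ℚ ℚ.- P) ≡ P
          1-[1-P] = ((∀ P → 1ℚ ℚ.- (1ℚ ℚ.- P) ≡ P) ∋ solve-∀ ℚ-ring) P
          1-P≤1 : 1ℚ ℚ.- P ℚ.≤ 1ℚ
          1-P≤1 = ≤-by (0≤p (suc J) g) (((∀ x → 1ℚ ℚ.- x ℚ.+ x ≡ 1ℚ ℚ.+ 0ℚ) ∋ solve-∀ ℚ-ring) P)

-- The simulation of `Rounds`. The windows of a pair depend on its distance, so a pair is first
-- drawn among those that `near` admits on the evidence of the tree alone, and only then queried. No
-- outcome is remembered: every recursive call uses fresh randomness, which is why the probabilities
-- in `Rounds` are plain products.
module RandomTest
  {n} {Elem : Set}
  (near : Elem → Fin n × Fin n → Bool)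
  (wins : Fin n × Fin n → ℕ → List (List Elem))
  (mem : Elem → List Elem → Bool)
  (l₁ k₁ : ℕ) (N : ℕ → ℕ) (t : ℕ)
  where

  pairs : List (Fin n × Fin n)
  pairs = cartesianProduct (fins n) (fins n)

  alive   : ℕ → Elem → QueryAlg n Bool
  passive : ℕ → Elem → QueryAlg n Bool
  active  : ℕ → List Elem → QueryAlg n Bool

  passive-in : ℕ → Elem → Maybe (Fin n × Fin n) → QueryAlg n Bool
  idle       : ℕ → Maybe (List Elem) → QueryAlg n Bool
  alive-one  : ℕ → Maybe Elem → QueryAlg n Bool

  alive zero    q = return true
  alive (suc i) q = alive i q and allOf (N i) (passive i q)

  passive i q = draw l₁ (filterᵇ (near q) pairs) >>= passive-in i q

  passive-in i q nothing        = return true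
  passive-in i q (just (u , v)) = query u v λ x → draw k₁ (filterᵇ (mem q) (wins (u , v) x)) >>= idle i

  idle i nothing  = return true
  idle i (just g) = active i g >>= λ b → return (not b)

  active zero    g = return true
  -- The levels are tested in increasing order, and `and` stops at the first failure, so the costly
  -- late levels are reached only with probability `e i g`. The cost bound rests on this.
  active (suc i) g = active i g and allOf t (draw (length g ∸ 1) g >>= alive-one (suc i))

  alive-one j nothing  = return false
  alive-one j (just q) = alive j q

  module Semantics (d : Weights n) where

    Win : Set
    Win = (Fin n × Fin n) × List Elem

    windows : List Win
    windows = concatMap (λ f → map (f ,_) (wins f (uncurry d f))) pairs

    inc : Elem → Win → Bool
    inc q g = mem q (proj₂ g)

    -- The probability that a given window through q is drawn. Padding both draws makes it the same
    -- for all units and windows; otherwise it could not be taken out of the sums when units and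
    -- windows are exchanged in `∑-load`.
    inv : ℚ
    inv = 1/ℕ l₁ ℚ.* 1/ℕ k₁

    0≤inv : 0ℚ ℚ.≤ inv
    0≤inv = 0≤* (0≤1/ℕ l₁) (0≤1/ℕ k₁)

    open Rounds windows proj₂ inc inv N t public

    ∑-windows : ∀ f → ∑ windows f ≡ ∑ pairs (λ uv → ∑ (wins uv (uncurry d uv)) λ g → f (uv , g))
    ∑-windows f = trans (∑-concatMap _ pairs f) (∑-cong pairs λ uv → ∑-map (uv ,_) (wins uv (uncurry d uv)) f)

    module Correctness
      (near-mem : ∀ f q {g} → g ∈ wins f (uncurry d f) → mem q g ≡ true → near q f ≡ true)
      (few-pairs : ∀ q → length (filterᵇ (near q) pairs) ≤ suc l₁)
      (few-wins : ∀ f q → length (filterᵇ (mem q) (wins f (uncurry d f))) ≤ suc k₁)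
      where

      -- The double padded draw weighs each window through q by inv.
      drawn : ∀ q (ψ : List Elem → ℚ) →
        ∑ (filterᵇ (near q) pairs) (λ f → ∑ (filterᵇ (mem q) (wins f (uncurry d f))) ψ ℚ.* 1/ℕ k₁) ℚ.* 1/ℕ l₁
        ≡ inv ℚ.* ∑ windows (λ g → ⟦ inc q g ⟧ ℚ.* ψ (proj₂ g))
      drawn q ψ = begin
        ∑ (filterᵇ (near q) pairs) (λ f → ∑ (filterᵇ (mem q) (wins f (uncurry d f))) ψ ℚ.* 1/ℕ k₁) ℚ.* 1/ℕ l₁
          ≡⟨ cong (ℚ._* 1/ℕ l₁) (∑-filter (near q) pairs _) ⟩
        ∑ pairs (λ f → ⟦ near q f ⟧ ℚ.* (∑ (filterᵇ (mem q) (wins f (uncurry d f))) ψ ℚ.* 1/ℕ k₁)) ℚ.* 1/ℕ l₁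
          ≡⟨ cong (ℚ._* 1/ℕ l₁) (∑-cong pairs λ f → trans (sym (ℚ.*-assoc ⟦ near q f ⟧ (∑ (filterᵇ (mem q) (wins f (uncurry d f))) ψ) (1/ℕ k₁))) (cong (ℚ._* 1/ℕ k₁) (pair f))) ⟩
        ∑ pairs (λ f → ∑ (wins f (uncurry d f)) (λ g → ⟦ mem q g ⟧ ℚ.* ψ g) ℚ.* 1/ℕ k₁) ℚ.* 1/ℕ l₁
          ≡⟨ cong (ℚ._* 1/ℕ l₁) (∑-*ʳ pairs (1/ℕ k₁) _) ⟩
        ∑ pairs (λ f → ∑ (wins f (uncurry d f)) (λ g → ⟦ mem q g ⟧ ℚ.* ψ g)) ℚ.* 1/ℕ k₁ ℚ.* 1/ℕ l₁
          ≡⟨ cong (λ s → s ℚ.* 1/ℕ k₁ ℚ.* 1/ℕ l₁) (sym (∑-windows _)) ⟩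
        ∑ windows (λ g → ⟦ inc q g ⟧ ℚ.* ψ (proj₂ g)) ℚ.* 1/ℕ k₁ ℚ.* 1/ℕ l₁
          ≡⟨ ((∀ s k l → s ℚ.* k ℚ.* l ≡ l ℚ.* k ℚ.* s) ∋ solve-∀ ℚ-ring) (∑ windows (λ g → ⟦ inc q g ⟧ ℚ.* ψ (proj₂ g))) (1/ℕ k₁) (1/ℕ l₁) ⟩
        inv ℚ.* ∑ windows (λ g → ⟦ inc q g ⟧ ℚ.* ψ (proj₂ g)) ∎
        where
        open ≡-Reasoning
        win : ∀ f {g} → g ∈ wins f (uncurry d f) → ⟦ near q f ⟧ ℚ.* (⟦ mem q g ⟧ ℚ.* ψ g) ≡ ⟦ mem q g ⟧ ℚ.* ψ g
        win f {g} g∈ with mem q g in eq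
        ... | true  = trans (cong (λ b → ⟦ b ⟧ ℚ.* (1ℚ ℚ.* ψ g)) (near-mem f q g∈ eq)) (ℚ.*-identityˡ _)
        ... | false = trans (cong (⟦ near q f ⟧ ℚ.*_) (ℚ.*-zeroˡ (ψ g))) (trans (ℚ.*-zeroʳ ⟦ near q f ⟧) (sym (ℚ.*-zeroˡ (ψ g))))
        pair : ∀ f → ⟦ near q f ⟧ ℚ.* ∑ (filterᵇ (mem q) (wins f (uncurry d f))) ψ ≡ ∑ (wins f (uncurry d f)) (λ g → ⟦ mem q g ⟧ ℚ.* ψ g)
        pair f = trans (cong (⟦ near q f ⟧ ℚ.*_) (∑-filter (mem q) (wins f (uncurry d f)) ψ))
          (trans (sym (∑-*ˡ (wins f (uncurry d f)) ⟦ near q f ⟧ _)) (∑-cong∈ (wins f (uncurry d f)) (win f)))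

      1/ℕ-count : ∀ k m → m ≤ suc k → ι m ℚ.* 1/ℕ k ℚ.≤ 1ℚ
      1/ℕ-count k m m≤ = ≤≡ (≤* (0≤1/ℕ k) (ι-mono m≤)) (trans (ℚ.*-comm (ι (suc k)) (1/ℕ k)) (1/ℕ-inverse k))

      few : ∀ q → inv ℚ.* ∑ windows (λ g → ⟦ inc q g ⟧) ℚ.≤ 1ℚ
      few q = begin
        inv ℚ.* ∑ windows (λ g → ⟦ inc q g ⟧)
          ≡⟨ cong (inv ℚ.*_) (∑-cong windows λ g → sym (ℚ.*-identityʳ ⟦ inc q g ⟧)) ⟩
        inv ℚ.* ∑ windows (λ g → ⟦ inc q g ⟧ ℚ.* 1ℚ)
          ≡⟨ sym (drawn q (λ _ → 1ℚ)) ⟩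
        ∑ (filterᵇ (near q) pairs) (λ f → ∑ (filterᵇ (mem q) (wins f (uncurry d f))) (λ _ → 1ℚ) ℚ.* 1/ℕ k₁) ℚ.* 1/ℕ l₁
          ≤⟨ ≤* (0≤1/ℕ l₁) (∑-mono (filterᵇ (near q) pairs) λ f →
               ≡≤ (cong (ℚ._* 1/ℕ k₁) (∑-one (filterᵇ (mem q) (wins f (uncurry d f))))) (1/ℕ-count k₁ _ (few-wins f q))) ⟩
        ∑ (filterᵇ (near q) pairs) (λ f → 1ℚ) ℚ.* 1/ℕ l₁
          ≡⟨ cong (ℚ._* 1/ℕ l₁) (∑-one (filterᵇ (near q) pairs)) ⟩
        ι (length (filterᵇ (near q) pairs)) ℚ.* 1/ℕ l₁
          ≤⟨ 1/ℕ-count l₁ _ (few-pairs q) ⟩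
        1ℚ ∎
        where open ℚ.≤-Reasoning

      P-alive   : ∀ i q → P[true] d (alive i q) ≡ a i q
      P-passive : ∀ i q → P[true] d (passive i q) ≡ 1ℚ ℚ.- μ i q
      P-active  : ∀ i f g → P[true] d (active i g) ≡ e i (f , g)

      P-alive zero    q = refl
      P-alive (suc i) q = trans (P-and (alive i q) (allOf (N i) (passive i q)))
        (cong₂ ℚ._*_ (P-alive i q) (trans (P-allOf (N i) (passive i q)) (cong (_^ℚ N i) (P-passive i q))))

      P-active zero    f g = refl
      P-active (suc i) f g = trans (P-and (active i g) (allOf t (draw (length g ∸ 1) g >>= alive-one (suc i))))
        (cong₂ ℚ._*_ (P-active i f g) (trans (P-allOf t (draw (length g ∸ 1) g >>= alive-one (suc i))) (cong (_^ℚ t)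
          (avg-nth (length g ∸ 1) g (λ x → P[true] d (alive-one (suc i) x)) (a (suc i)) (suc-pred-≤ g) (P-alive (suc i)) refl))))
        where
        suc-pred-≤ : ∀ (g : List Elem) → length g ≤ suc (length g ∸ 1)
        suc-pred-≤ []      = z≤n
        suc-pred-≤ (x ∷ g) = ℕ.≤-refl

      P-passive i q = begin
        E d (passive i q) ⟦_⟧
          ≡⟨ trans (E-cong (passive i q) (λ { true → refl ; false → refl })) (E-not (passive i q) not) ⟩
        1ℚ ℚ.- E d (passive i q) (λ b → ⟦ not b ⟧)
          ≡⟨ cong (λ x → 1ℚ ℚ.- x) (avg-nth l₁ (filterᵇ (near q) pairs) (λ x → E d (passive-in i q x) (λ b → ⟦ not b ⟧)) _ (few-pairs q) in-pair refl) ⟩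
        1ℚ ℚ.- ∑ (filterᵇ (near q) pairs) (λ f → ∑ (filterᵇ (mem q) (wins f (uncurry d f))) (λ g → P[true] d (active i g)) ℚ.* 1/ℕ k₁) ℚ.* 1/ℕ l₁
          ≡⟨ cong (λ x → 1ℚ ℚ.- x) (trans (drawn q (λ g → P[true] d (active i g))) (cong (inv ℚ.*_) (∑-cong windows λ g → cong (⟦ inc q g ⟧ ℚ.*_) (P-active i (proj₁ g) (proj₂ g))))) ⟩
        1ℚ ℚ.- μ i q ∎
        where
        open ≡-Reasoning
        in-win : ∀ g → E d (idle i (just g)) (λ b → ⟦ not b ⟧) ≡ P[true] d (active i g)
        in-win g = trans (E-bind (active i g) _ (λ b → ⟦ not b ⟧)) (E-cong (active i g) λ { true → refl ; false → refl })
        in-pair : ∀ f → E d (passive-in i q (just f)) (λ b → ⟦ not b ⟧)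
                      ≡ ∑ (filterᵇ (mem q) (wins f (uncurry d f))) (λ g → P[true] d (active i g)) ℚ.* 1/ℕ k₁
        in-pair f = avg-nth k₁ (filterᵇ (mem q) (wins f (uncurry d f))) (λ x → E d (idle i x) (λ b → ⟦ not b ⟧)) (λ g → P[true] d (active i g)) (few-wins f q) in-win refl

      -- Counting recursive calls alone, the cost would grow by about `N i` per round. But the
      -- recursion of an active window goes on only while its units survive, and the draws of round
      -- i are made only for a unit that is still alive. Since a (i + 1) · N i · μ i is at most 1,
      -- survival pays for the growth of `N`, and the cost grows by the constant factor D = c (t +
      -- 2) per round.
      module Cost (c : ℕ) (N-suc : ∀ i → N (suc i) ≡ c * N i)
                  (nonempty : ∀ {g} → g ∈ windows → NonZero (length (proj₂ g)))
                  (2≤c : ι 2 ℚ.≤ ι c) where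

        open Analysis c N-suc 0≤inv nonempty few

        private
          D : ℚ
          D = ι c ℚ.* (ι t ℚ.+ ι 2)

          B : ℕ → ℚ
          B i = ι (N 0) ℚ.* D ^ℚ i

          B-suc : ∀ i → B (suc i) ≡ D ℚ.* B i
          B-suc i = ((∀ n d x → n ℚ.* (d ℚ.* x) ≡ d ℚ.* (n ℚ.* x)) ∋ solve-∀ ℚ-ring) (ι (N 0)) D (D ^ℚ i)

          2≤t+2 : ι 2 ℚ.≤ ι t ℚ.+ ι 2
          2≤t+2 = ≤-by (0≤ι t) (((∀ x t → x ℚ.+ t ≡ t ℚ.+ x ℚ.+ 0ℚ) ∋ solve-∀ ℚ-ring) (ι 2) (ι t))

          1≤t+2 : 1ℚ ℚ.≤ ι t ℚ.+ ι 2
          1≤t+2 = ℚ.≤-trans (1≤ι 2) 2≤t+2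

          c≤D : ι c ℚ.≤ D
          c≤D = ≡≤ (sym (ℚ.*-identityʳ (ι c))) (*≤ (0≤ι c) 1≤t+2)

          0≤D : 0ℚ ℚ.≤ D
          0≤D = ℚ.≤-trans (0≤ι c) c≤D

          0≤B : ∀ i → 0ℚ ℚ.≤ B i
          0≤B i = 0≤* (0≤ι (N 0)) (0≤^ i 0≤D)

          N≤B : ∀ i → ι (N i) ℚ.≤ B i
          N≤B zero    = ℚ.≤-reflexive (sym (ℚ.*-identityʳ (ι (N 0))))
          N≤B (suc i) = ≤≡ (≡≤ (N-suc-ι i) (*≤* (0≤ι (N i)) 0≤D c≤D (N≤B i))) (sym (B-suc i))

          S : ℕ → ℚ
          S zero    = 0ℚ
          S (suc i) = ι c ℚ.* (S i ℚ.+ B (suc i))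

          S-≤ : ∀ i → (ι t ℚ.+ 1ℚ) ℚ.* S i ℚ.≤ D ℚ.* B i
          S-≤ zero    = ≡≤ (ℚ.*-zeroʳ (ι t ℚ.+ 1ℚ)) (0≤* 0≤D (0≤B 0))
          S-≤ (suc i) = begin
            (ι t ℚ.+ 1ℚ) ℚ.* (ι c ℚ.* (S i ℚ.+ B (suc i)))
              ≤⟨ ≤-by (*≤ (0≤ι c) (≤≡ (S-≤ i) (sym (B-suc i)))) (((∀ t c s b → (t ℚ.+ 1ℚ) ℚ.* (c ℚ.* (s ℚ.+ b)) ℚ.+ c ℚ.* b ≡ c ℚ.* (t ℚ.+ (1ℚ ℚ.+ 1ℚ)) ℚ.* b ℚ.+ c ℚ.* ((t ℚ.+ 1ℚ) ℚ.* s)) ∋ solve-∀ ℚ-ring) (ι t) (ι c) (S i) (B (suc i))) ⟩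
            ι c ℚ.* (ι t ℚ.+ (1ℚ ℚ.+ 1ℚ)) ℚ.* B (suc i)
              ≡⟨ cong (λ x → ι c ℚ.* (ι t ℚ.+ x) ℚ.* B (suc i)) (sym (trans (ι-+ 1 1) (cong₂ ℚ._+_ ι-1 ι-1))) ⟩
            D ℚ.* B (suc i) ∎
            where open ℚ.≤-Reasoning

          -- Up to the factor t, the bound on the cost of `active i g`: level k + 1, of cost at most
          -- `B (suc k)` per sample, is reached with probability `e k g`. Below, `Y i q` is its
          -- weighted sum over the windows through q, as drawn.
          X : ℕ → Win → ℚ
          X zero    g = 0ℚ
          X (suc i) g = X i g ℚ.+ e i g ℚ.* B (suc i)

          Y : ℕ → Elem → ℚ
          Y i q = inv ℚ.* ∑ windows λ g → ⟦ inc q g ⟧ ℚ.* X i g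

          Y-zero : ∀ q → Y 0 q ≡ 0ℚ
          Y-zero q = trans (cong (inv ℚ.*_) (trans (∑-cong windows λ g → ℚ.*-zeroʳ ⟦ inc q g ⟧) (∑-0 windows))) (ℚ.*-zeroʳ inv)

          Y-suc : ∀ i q → Y (suc i) q ≡ Y i q ℚ.+ μ i q ℚ.* B (suc i)
          Y-suc i q = begin
            inv ℚ.* ∑ windows (λ g → ⟦ inc q g ⟧ ℚ.* (X i g ℚ.+ e i g ℚ.* b))
              ≡⟨ cong (inv ℚ.*_) (∑-cong windows λ g → ((∀ i x e b → i ℚ.* (x ℚ.+ e ℚ.* b) ≡ i ℚ.* x ℚ.+ i ℚ.* e ℚ.* b) ∋ solve-∀ ℚ-ring) ⟦ inc q g ⟧ (X i g) (e i g) b) ⟩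
            inv ℚ.* ∑ windows (λ g → ⟦ inc q g ⟧ ℚ.* X i g ℚ.+ ⟦ inc q g ⟧ ℚ.* e i g ℚ.* b)
              ≡⟨ cong (inv ℚ.*_) (trans (∑-+ windows (λ g → ⟦ inc q g ⟧ ℚ.* X i g) (λ g → ⟦ inc q g ⟧ ℚ.* e i g ℚ.* b)) (cong (x ℚ.+_) (∑-*ʳ windows b (λ g → ⟦ inc q g ⟧ ℚ.* e i g)))) ⟩
            inv ℚ.* (x ℚ.+ y ℚ.* b)
              ≡⟨ ((∀ v x y b → v ℚ.* (x ℚ.+ y ℚ.* b) ≡ v ℚ.* x ℚ.+ v ℚ.* y ℚ.* b) ∋ solve-∀ ℚ-ring) inv x y b ⟩
            Y i q ℚ.+ μ i q ℚ.* b ∎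
            where
            open ≡-Reasoning
            b x y : ℚ
            b = B (suc i)
            x = ∑ windows λ g → ⟦ inc q g ⟧ ℚ.* X i g
            y = ∑ windows λ g → ⟦ inc q g ⟧ ℚ.* e i g

          0≤X : ∀ i g → 0ℚ ℚ.≤ X i g
          0≤X zero    g = ℚ.≤-refl
          0≤X (suc i) g = 0≤+ (0≤X i g) (0≤* (0≤e i g) (0≤B (suc i)))

          0≤Y : ∀ i q → 0ℚ ℚ.≤ Y i q
          0≤Y i q = 0≤* 0≤inv (0≤∑ windows λ g → 0≤* 0≤⟦ inc q g ⟧ (0≤X i g))

          -- From one round to the next `Y` gains μ i · B (i + 1). Multiplied by a (i + 1) and N (i
          -- + 1) = c N i, this is at most c B (i + 1), because `a-suc-rate` bounds a (i + 1) · N i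
          -- · μ i by 1.
          aNY-≤ : ∀ i q → a i q ℚ.* (ι (N i) ℚ.* Y i q) ℚ.≤ S i
          aNY-≤ zero    q = ℚ.≤-reflexive (trans (cong (λ y → 1ℚ ℚ.* (ι (N 0) ℚ.* y)) (Y-zero q)) (((∀ n → 1ℚ ℚ.* (n ℚ.* 0ℚ) ≡ 0ℚ) ∋ solve-∀ ℚ-ring) (ι (N 0))))
          aNY-≤ (suc i) q = begin
            a (suc i) q ℚ.* (ι (N (suc i)) ℚ.* Y (suc i) q)
              ≡⟨ cong₂ (λ x y → a (suc i) q ℚ.* (x ℚ.* y)) (N-suc-ι i) (Y-suc i q) ⟩
            a (suc i) q ℚ.* (ι c ℚ.* ι (N i) ℚ.* (Y i q ℚ.+ μ i q ℚ.* B (suc i)))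
              ≡⟨ ((∀ a c n y m b → a ℚ.* (c ℚ.* n ℚ.* (y ℚ.+ m ℚ.* b)) ≡ c ℚ.* (a ℚ.* (n ℚ.* y) ℚ.+ a ℚ.* (n ℚ.* m) ℚ.* b)) ∋ solve-∀ ℚ-ring) (a (suc i) q) (ι c) (ι (N i)) (Y i q) (μ i q) (B (suc i)) ⟩
            ι c ℚ.* (a (suc i) q ℚ.* (ι (N i) ℚ.* Y i q) ℚ.+ a (suc i) q ℚ.* (ι (N i) ℚ.* μ i q) ℚ.* B (suc i))
              ≤⟨ *≤ (0≤ι c) (ℚ.≤-trans (≤* (0≤* (0≤ι (N i)) (0≤Y i q)) (a-step i q)) (aNY-≤ i q)
                   +≤ ≤≡ (≤* (0≤B (suc i)) a-suc-rate≤1) (ℚ.*-identityˡ (B (suc i)))) ⟩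
            ι c ℚ.* (S i ℚ.+ B (suc i)) ∎
            where
            open ℚ.≤-Reasoning
            a-suc-rate≤1 : a (suc i) q ℚ.* (ι (N i) ℚ.* μ i q) ℚ.≤ 1ℚ
            a-suc-rate≤1 = ℚ.≤-trans (a-suc-rate i q) (≤-by (a≤1 i q +≤ 0≤a (suc i) q)
              (((∀ a b → a ℚ.- b ℚ.+ (1ℚ ℚ.+ b) ≡ 1ℚ ℚ.+ (a ℚ.+ 0ℚ)) ∋ solve-∀ ℚ-ring) (a i q) (a (suc i) q)))

          arith : ∀ i → B i ℚ.+ (B i ℚ.+ ι t ℚ.* S i) ℚ.≤ B (suc i)
          arith i = *-cancelˡ-≤ (ℚ.<-≤-trans (ℚ.positive⁻¹ 1ℚ) 1≤t+1) (begin
            (ι t ℚ.+ 1ℚ) ℚ.* (b ℚ.+ (b ℚ.+ ι t ℚ.* S i))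
              ≡⟨ ((∀ t b s → (t ℚ.+ 1ℚ) ℚ.* (b ℚ.+ (b ℚ.+ t ℚ.* s)) ≡ (1ℚ ℚ.+ 1ℚ) ℚ.* (t ℚ.+ 1ℚ) ℚ.* b ℚ.+ t ℚ.* ((t ℚ.+ 1ℚ) ℚ.* s)) ∋ solve-∀ ℚ-ring) (ι t) b (S i) ⟩
            (1ℚ ℚ.+ 1ℚ) ℚ.* (ι t ℚ.+ 1ℚ) ℚ.* b ℚ.+ ι t ℚ.* ((ι t ℚ.+ 1ℚ) ℚ.* S i)
              ≤⟨ ≤* (0≤B i) 2[t+1]≤D +≤ *≤ (0≤ι t) (S-≤ i) ⟩
            D ℚ.* b ℚ.+ ι t ℚ.* (D ℚ.* b)
              ≡⟨ ((∀ t x → x ℚ.+ t ℚ.* x ≡ (t ℚ.+ 1ℚ) ℚ.* x) ∋ solve-∀ ℚ-ring) (ι t) (D ℚ.* b) ⟩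
            (ι t ℚ.+ 1ℚ) ℚ.* (D ℚ.* b)
              ≡⟨ cong ((ι t ℚ.+ 1ℚ) ℚ.*_) (sym (B-suc i)) ⟩
            (ι t ℚ.+ 1ℚ) ℚ.* B (suc i) ∎)
            where
            open ℚ.≤-Reasoning
            b : ℚ
            b = B i
            1≤t+1 : 1ℚ ℚ.≤ ι t ℚ.+ 1ℚ
            1≤t+1 = ≤-by (0≤ι t) (((∀ t → 1ℚ ℚ.+ t ≡ t ℚ.+ 1ℚ ℚ.+ 0ℚ) ∋ solve-∀ ℚ-ring) (ι t))
            2≡ : ι 2 ≡ 1ℚ ℚ.+ 1ℚ
            2≡ = trans (ι-+ 1 1) (cong₂ ℚ._+_ ι-1 ι-1)
            2[t+1]≤D : (1ℚ ℚ.+ 1ℚ) ℚ.* (ι t ℚ.+ 1ℚ) ℚ.≤ D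
            2[t+1]≤D = *≤* (0≤+ (0≤ι t) 0≤1) (0≤ι c) (≡≤ (sym 2≡) 2≤c) (ℚ.+-monoʳ-≤ (ι t) (1≤ι 2))

          Q : ∀ {A : Set} → QueryAlg n A → ℚ
          Q = E[queries] d

          cost-one : ∀ j g → (∀ q → Q (alive j q) ℚ.≤ B j) → Q (draw (length g ∸ 1) g >>= alive-one j) ℚ.≤ B j
          cost-one j g cost = avg-≤ (length g ∸ 1) (λ i → Q (alive-one j (nth g (toℕ i)))) λ i → bound (nth g (toℕ i))
            where
            bound : ∀ x → Q (alive-one j x) ℚ.≤ B j
            bound nothing  = 0≤B j
            bound (just q) = cost q

        cost-alive   : ∀ i q → E[queries] d (alive i q) ℚ.≤ ι (N 0) ℚ.* (ι c ℚ.* (ι t ℚ.+ ι 2)) ^ℚ i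
        cost-passive : ∀ i q → E[queries] d (passive i q) ℚ.≤ 1ℚ ℚ.+ ι t ℚ.* Y i q
        cost-active  : ∀ i f g → E[queries] d (active i g) ℚ.≤ ι t ℚ.* X i (f , g)

        cost-alive zero    q = 0≤B 0
        cost-alive (suc i) q = begin
          Q (alive i q and allOf (N i) (passive i q))
            ≡⟨ E[queries]-and (alive i q) (allOf (N i) (passive i q)) ⟩
          Q (alive i q) ℚ.+ P[true] d (alive i q) ℚ.* Q (allOf (N i) (passive i q))
            ≤⟨ cost-alive i q +≤ ≡≤ (cong (ℚ._* Q (allOf (N i) (passive i q))) (P-alive i q))
                 (*≤ (0≤a i q) (ℚ.≤-trans (E[queries]-allOf (N i) (passive i q)) (*≤ (0≤ι (N i)) (cost-passive i q)))) ⟩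
          B i ℚ.+ a i q ℚ.* (ι (N i) ℚ.* (1ℚ ℚ.+ ι t ℚ.* Y i q))
            ≡⟨ ((∀ b a n t y → b ℚ.+ a ℚ.* (n ℚ.* (1ℚ ℚ.+ t ℚ.* y)) ≡ b ℚ.+ (a ℚ.* n ℚ.+ t ℚ.* (a ℚ.* (n ℚ.* y)))) ∋ solve-∀ ℚ-ring) (B i) (a i q) (ι (N i)) (ι t) (Y i q) ⟩
          B i ℚ.+ (a i q ℚ.* ι (N i) ℚ.+ ι t ℚ.* (a i q ℚ.* (ι (N i) ℚ.* Y i q)))
            ≤⟨ ℚ.+-monoʳ-≤ (B i) (ℚ.≤-trans (≤≡ (≤* (0≤ι (N i)) (a≤1 i q)) (ℚ.*-identityˡ (ι (N i)))) (N≤B i) +≤ *≤ (0≤ι t) (aNY-≤ i q)) ⟩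
          B i ℚ.+ (B i ℚ.+ ι t ℚ.* S i)
            ≤⟨ arith i ⟩
          B (suc i) ∎
          where open ℚ.≤-Reasoning

        cost-active zero    f g = ℚ.≤-reflexive (sym (ℚ.*-zeroʳ (ι t)))
        cost-active (suc i) f g = begin
          Q (active i g and allOf t one)
            ≡⟨ E[queries]-and (active i g) (allOf t one) ⟩
          Q (active i g) ℚ.+ P[true] d (active i g) ℚ.* Q (allOf t one)
            ≤⟨ cost-active i f g +≤ ≡≤ (cong (ℚ._* Q (allOf t one)) (P-active i f g))
                 (*≤ (0≤e i (f , g)) (ℚ.≤-trans (E[queries]-allOf t one) (*≤ (0≤ι t) (cost-one (suc i) g (cost-alive (suc i)))))) ⟩
          ι t ℚ.* X i (f , g) ℚ.+ e i (f , g) ℚ.* (ι t ℚ.* B (suc i))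
            ≡⟨ ((∀ t x e b → t ℚ.* x ℚ.+ e ℚ.* (t ℚ.* b) ≡ t ℚ.* (x ℚ.+ e ℚ.* b)) ∋ solve-∀ ℚ-ring) (ι t) (X i (f , g)) (e i (f , g)) (B (suc i)) ⟩
          ι t ℚ.* X (suc i) (f , g) ∎
          where
          open ℚ.≤-Reasoning
          one : QueryAlg n Bool
          one = draw (length g ∸ 1) g >>= alive-one (suc i)

        cost-passive i q = begin
          Q (passive i q)
            ≤⟨ avg-mono l₁ (λ j → in-pair (nth cs (toℕ j))) ⟩
          avg l₁ (λ j → 1ℚ ℚ.+ ψ (nth cs (toℕ j)))
            ≡⟨ trans (avg-+ l₁ (λ _ → 1ℚ) (λ j → ψ (nth cs (toℕ j)))) (cong₂ ℚ._+_ (avg-const l₁ 1ℚ) (avg-nth l₁ cs ψ (ψ ∘ just) (few-pairs q) (λ _ → refl) refl)) ⟩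
          1ℚ ℚ.+ ∑ cs (ψ ∘ just) ℚ.* 1/ℕ l₁
            ≤⟨ ℚ.+-monoʳ-≤ 1ℚ (≡≤ (drawn q (λ g → Q (active i g))) (*≤ 0≤inv (∑-mono windows λ g → *≤ 0≤⟦ inc q g ⟧ (cost-active i (proj₁ g) (proj₂ g))))) ⟩
          1ℚ ℚ.+ inv ℚ.* ∑ windows (λ g → ⟦ inc q g ⟧ ℚ.* (ι t ℚ.* X i g))
            ≡⟨ cong (λ s → 1ℚ ℚ.+ inv ℚ.* s) (trans (∑-cong windows λ g → ((∀ b t x → b ℚ.* (t ℚ.* x) ≡ t ℚ.* (b ℚ.* x)) ∋ solve-∀ ℚ-ring) ⟦ inc q g ⟧ (ι t) (X i g)) (∑-*ˡ windows (ι t) _)) ⟩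
          1ℚ ℚ.+ inv ℚ.* (ι t ℚ.* ∑ windows (λ g → ⟦ inc q g ⟧ ℚ.* X i g))
            ≡⟨ cong (1ℚ ℚ.+_) (((∀ v t x → v ℚ.* (t ℚ.* x) ≡ t ℚ.* (v ℚ.* x)) ∋ solve-∀ ℚ-ring) inv (ι t) (∑ windows λ g → ⟦ inc q g ⟧ ℚ.* X i g)) ⟩
          1ℚ ℚ.+ ι t ℚ.* Y i q ∎
          where
          open ℚ.≤-Reasoning
          cs : List (Fin n × Fin n)
          cs = filterᵇ (near q) pairs
          ψ : Maybe (Fin n × Fin n) → ℚ
          ψ nothing  = 0ℚ
          ψ (just f) = ∑ (filterᵇ (mem q) (wins f (uncurry d f))) (λ g → Q (active i g)) ℚ.* 1/ℕ k₁
          in-win : ∀ g → Q (idle i (just g)) ≡ Q (active i g)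
          in-win g = trans (E[queries]-bind (active i g) _) (trans (cong (Q (active i g) ℚ.+_) (E-const (active i g) 0ℚ)) (ℚ.+-identityʳ _))
          in-pair : ∀ x → Q (passive-in i q x) ℚ.≤ 1ℚ ℚ.+ ψ x
          in-pair nothing  = 0≤1
          in-pair (just f) = ℚ.≤-reflexive (cong (1ℚ ℚ.+_) (avg-nth k₁ (filterᵇ (mem q) (wins f (uncurry d f))) (λ x → Q (idle i x)) (λ g → Q (active i g)) (few-wins f q) in-win refl))

-- Tours from a tree and additional pairs

𝔹-ring : ACR.AlmostCommutativeRing _ _
𝔹-ring = ACR.fromCommutativeRing Bool.xor-∧-commutativeRing λ x → dec⇒maybe (false Bool.≟ x)

-- Rooted trees grown leaf by leaf, with m edges.  In `attach p T` the new leaf is vertex zero and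
-- hangs below vertex p of T, whose vertices and edges are shifted by suc.  The edge above vertex
-- inject₁ e is edge e; the root is fromℕ m.
data RTree : ℕ → Set where
  leaf   : RTree 0
  attach : ∀ {m} → Fin (suc m) → RTree m → RTree (suc m)

parent : ∀ {m} → RTree m → Fin m → Fin (suc m)
parent (attach p T) zero    = suc p
parent (attach p T) (suc e) = suc (parent T e)

below : ∀ {m} → RTree m → Fin m → Fin (suc m) → Bool
below (attach p T) zero    zero    = true
below (attach p T) zero    (suc v) = false
below (attach p T) (suc e) zero    = below T e p
below (attach p T) (suc e) (suc v) = below T e v

cross : ∀ {m} → RTree m → Fin (suc m) × Fin (suc m) → Fin m → Bool
cross T (u , v) e = below T e u xor below T e v

odd : ∀ {m} → RTree m → List (Fin (suc m) × Fin (suc m)) → Fin m → Bool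
odd T []       e = false
odd T (f ∷ fs) e = cross T f e xor odd T fs e

multiplicity : Bool → ℕ
multiplicity b = if b then 1 else 2

module Routes {V : Set} (δ : V → V → ℕ) (δ-refl : ∀ x → δ x x ≡ 0) (δ-sym : ∀ x y → δ x y ≡ δ y x) where

  pathCost : V → List V → V → ℕ
  pathCost x []       y = δ x y
  pathCost x (v ∷ vs) y = δ x v + pathCost v vs y

  pathCost-++ : ∀ x us y vs z → pathCost x (us ++ y ∷ vs) z ≡ pathCost x us y + pathCost y vs z
  pathCost-++ x []       y vs z = refl
  pathCost-++ x (u ∷ us) y vs z = trans (cong (δ x u +_) (pathCost-++ u us y vs z)) (sym (ℕ.+-assoc (δ x u) _ _))

  pathCost-reverse : ∀ x vs y → pathCost y (reverse vs) x ≡ pathCost x vs y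
  pathCost-reverse x []       y = δ-sym y x
  pathCost-reverse x (v ∷ vs) y = begin
    pathCost y (reverse (v ∷ vs)) x                ≡⟨ cong (λ us → pathCost y us x) (List.unfold-reverse v vs) ⟩
    pathCost y (reverse vs ∷ʳ v) x                 ≡⟨ pathCost-++ y (reverse vs) v [] x ⟩
    pathCost y (reverse vs) v + δ v x              ≡⟨ cong₂ _+_ (pathCost-reverse v vs y) (δ-sym v x) ⟩
    pathCost v vs y + δ x v                        ≡⟨ ℕ.+-comm _ (δ x v) ⟩
    δ x v + pathCost v vs y                        ∎
    where open ≡-Reasoning

  -- Only an upper bound on the cost and a set of points certainly visited are kept, so that routes
  -- can be composed and reversed without following their vertices.
  record Route (x y : V) (P : V → Set) (c : ℕ) : Set where
    constructor route
    field
      via    : List V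
      cost   : pathCost x via y ≤ c
      visits : ∀ {v} → P v → v ∈ x ∷ via ++ y ∷ []

  stay : ∀ x → Route x x (_≡ x) 0
  stay x = route [] (ℕ.≤-reflexive (δ-refl x)) λ { refl → here refl }

  step : ∀ x y → Route x y (λ _ → ⊥) (δ x y)
  step x y = route [] ℕ.≤-refl λ ()

  infixr 5 _⨾_
  _⨾_ : ∀ {x y z P Q c c′} → Route x y P c → Route y z Q c′ → Route x z (λ v → P v ⊎ Q v) (c + c′)
  _⨾_ {x} {y} {z} {P} {Q} (route us c us∋) (route vs c′ vs∋) =
    route (us ++ y ∷ vs) (ℕ.≤-trans (ℕ.≤-reflexive (pathCost-++ x us y vs z)) (ℕ.+-mono-≤ c c′)) visits
    where
    shape : x ∷ (us ++ y ∷ vs) ++ z ∷ [] ≡ (x ∷ us) ++ (y ∷ vs ++ z ∷ [])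
    shape = cong (x ∷_) (List.++-assoc us (y ∷ vs) (z ∷ []))
    visits : ∀ {v} → P v ⊎ Q v → v ∈ x ∷ (us ++ y ∷ vs) ++ z ∷ []
    visits {v} (inj₂ v∈Q) = subst (v ∈_) (sym shape) (∈.∈-++⁺ʳ (x ∷ us) (vs∋ v∈Q))
    visits {v} (inj₁ v∈P) with ∈.∈-++⁻ (x ∷ us) (us∋ v∈P)
    ... | inj₁ v∈us        = subst (v ∈_) (sym shape) (∈.∈-++⁺ˡ v∈us)
    ... | inj₂ (here refl) = subst (y ∈_) (sym shape) (∈.∈-++⁺ʳ (x ∷ us) (here refl))

  flipped : ∀ {x y P c} → Route x y P c → Route y x P c
  flipped {x} {y} {P} (route us c us∋) = route (reverse us) (ℕ.≤-trans (ℕ.≤-reflexive (pathCost-reverse x us y)) c) visits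
    where
    visits : ∀ {v} → P v → v ∈ y ∷ reverse us ++ x ∷ []
    visits v∈ with us∋ v∈
    ... | here refl = ∈.∈-++⁺ʳ (y ∷ reverse us) (here refl)
    ... | there v∈′ with ∈.∈-++⁻ us v∈′
    ...   | inj₁ v∈us        = there (∈.∈-++⁺ˡ (Any.reverse⁺ v∈us))
    ...   | inj₂ (here refl) = here refl

  weaken : ∀ {x y P Q c c′} → c ≤ c′ → (∀ {v} → Q v → P v) → Route x y P c → Route x y Q c′
  weaken c≤ Q⊆P (route us c us∋) = route us (ℕ.≤-trans c c≤) (us∋ ∘ Q⊆P)

  -- An item stands for a pair of the remaining tree, but its trip may already run through vertices
  -- that have been removed.
  record Item {m} (pos : Fin (suc m) → V) : Set₁ where
    constructor item
    field
      {src dst} : Fin (suc m)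
      {points}  : V → Set
      {weight}  : ℕ
      trip      : Route (pos src) (pos dst) points weight

  open Item

  ends : ∀ {m} {pos : Fin (suc m) → V} → List (Item pos) → List (Fin (suc m) × Fin (suc m))
  ends = map λ i → src i , dst i

  totalWeight : ∀ {m} {pos : Fin (suc m) → V} → List (Item pos) → ℕ
  totalWeight []       = 0
  totalWeight (i ∷ is) = weight i + totalWeight is

  Visited : ∀ {m} {pos : Fin (suc m) → V} → List (Item pos) → V → Set
  Visited []       v = ⊥
  Visited (i ∷ is) v = points i v ⊎ Visited is v

  doubledTree : ∀ {m} → RTree m → (Fin (suc m) → V) → (Fin m → Bool) → ℕ
  doubledTree leaf         pos odd? = 0
  doubledTree (attach p T) pos odd? =
    δ (pos zero) (pos (suc p)) * multiplicity (odd? zero) + doubledTree T (pos ∘ suc) (odd? ∘ suc)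

  doubledTree-cong : ∀ {m} (T : RTree m) pos {f g} → (∀ e → f e ≡ g e) → doubledTree T pos f ≡ doubledTree T pos g
  doubledTree-cong leaf         pos eq = refl
  doubledTree-cong (attach p T) pos eq =
    cong₂ (λ b s → δ (pos zero) (pos (suc p)) * multiplicity b + s) (eq zero) (doubledTree-cong T (pos ∘ suc) (eq ∘ suc))

  -- Removing the leaf zero.  The trips ending at the leaf are joined in pairs; at most one of
  -- them, `pending`, is left over, and exactly when an odd number of trips ends there.
  module RemoveLeaf {m} (p : Fin (suc m)) (T : RTree m) (pos : Fin (suc (suc m)) → V) where

    private
      pos′ : Fin (suc m) → V
      pos′ = pos ∘ suc

      T⁺ : RTree (suc m)
      T⁺ = attach p T

    data Pending : Bool → (V → Set) → ℕ → Set₁ where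
      none : Pending false (λ _ → ⊥) 0
      some : ∀ {P c} x → Route (pos′ x) (pos zero) P c → Pending true P c

    -- The pending trip counts as if it were already prolonged to p: for the edges above the leaf it
    -- acts like the pair (x , p).
    crossPending : ∀ {b P c} → Pending b P c → Fin m → Bool
    crossPending none       e = false
    crossPending (some x _) e = below T e x xor below T e p

    record State (is : List (Item pos)) : Set₁ where
      constructor state
      field
        done         : List (Item pos′)
        {P Q}        : V → Set
        {c c′}       : ℕ
        {parity}     : Bool
        loop         : Route (pos zero) (pos zero) P c
        pending      : Pending parity Q c′
        parity-leaf  : odd T⁺ (ends is) zero ≡ parity
        parity-above : ∀ e → odd T⁺ (ends is) (suc e) ≡ odd T (ends done) e xor crossPending pending e
        weights      : totalWeight done + (c + c′) ≤ totalWeight is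
        visits       : ∀ {v} → v ≡ pos zero ⊎ Visited is v → Visited done v ⊎ P v ⊎ Q v

    start : State []
    start = record
      { done = [] ; loop = stay (pos zero) ; pending = none ; parity-leaf = refl
      ; parity-above = λ _ → refl ; weights = z≤n ; visits = λ { (inj₁ v≡) → inj₂ (inj₁ v≡) } }

    private
      regroup₁ : ∀ d r c c′ → r + d + (c + c′) ≡ r + (d + (c + c′))
      regroup₁ = ℕ-solve-∀
      regroup₂ : ∀ d r c c′ → d + (r + c + c′) ≡ r + (d + (c + c′))
      regroup₂ = ℕ-solve-∀
      regroup₃ : ∀ d r c → d + (c + r) ≡ r + (d + (c + 0))
      regroup₃ = ℕ-solve-∀
      regroup₄ : ∀ d r c c′ → (c′ + r) + d + (c + 0) ≡ r + (d + (c + c′))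
      regroup₄ = ℕ-solve-∀

    addEnd : ∀ {is} a {R r} → Route (pos′ a) (pos zero) R r →
             (i : Item pos) → weight i ≡ r → (∀ {v} → points i v → R v) →
             cross T⁺ (src i , dst i) zero ≡ true →
             (∀ e → cross T⁺ (src i , dst i) (suc e) ≡ below T e a xor below T e p) →
             State is → State (i ∷ is)
    addEnd a {R} {r} t i refl pts at-leaf above (state done {P = P} {c = c} loop none pl pa wt vs) = record
      { done = done ; loop = loop ; pending = some a t
      ; parity-leaf = cong₂ _xor_ at-leaf pl
      ; parity-above = λ e → trans (cong₂ _xor_ (above e) (pa e))
          (((∀ a o → a xor (o xor false) ≡ o xor a) ∋ solve-∀ 𝔹-ring) (below T e a xor below T e p) (odd T (ends done) e))
      ; weights = ℕ.≤-trans (ℕ.≤-reflexive (regroup₃ (totalWeight done) r c)) (ℕ.+-monoʳ-≤ r wt)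
      ; visits = λ { (inj₁ v≡) → keep (vs (inj₁ v≡)) ; (inj₂ (inj₁ v∈)) → inj₂ (inj₂ (pts v∈)) ; (inj₂ (inj₂ v∈)) → keep (vs (inj₂ v∈)) } }
      where
      keep : ∀ {v} → Visited done v ⊎ P v ⊎ ⊥ → Visited done v ⊎ P v ⊎ R v
      keep (inj₁ v∈)        = inj₁ v∈
      keep (inj₂ (inj₁ v∈)) = inj₂ (inj₁ v∈)
    addEnd a {R} {r} t i refl pts at-leaf above (state done {P = P} {Q = Q} {c = c} {c′ = c′} loop (some x u) pl pa wt vs) = record
      { done = item (u ⨾ flipped t) ∷ done ; loop = loop ; pending = none
      ; parity-leaf = cong₂ _xor_ at-leaf pl
      ; parity-above = λ e → trans (cong₂ _xor_ (above e) (pa e))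
          (((∀ a p o x → (a xor p) xor (o xor (x xor p)) ≡ ((x xor a) xor o) xor false) ∋ solve-∀ 𝔹-ring) (below T e a) (below T e p) (odd T (ends done) e) (below T e x))
      ; weights = ℕ.≤-trans (ℕ.≤-reflexive (regroup₄ (totalWeight done) r c c′)) (ℕ.+-monoʳ-≤ r wt)
      ; visits = λ { (inj₁ v≡) → keep (vs (inj₁ v≡)) ; (inj₂ (inj₁ v∈)) → inj₁ (inj₁ (inj₂ (pts v∈))) ; (inj₂ (inj₂ v∈)) → keep (vs (inj₂ v∈)) } }
      where
      keep : ∀ {v} → Visited done v ⊎ P v ⊎ Q v → ((Q v ⊎ R v) ⊎ Visited done v) ⊎ P v ⊎ ⊥
      keep (inj₁ v∈)        = inj₁ (inj₂ v∈)
      keep (inj₂ (inj₁ v∈)) = inj₂ (inj₁ v∈)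
      keep (inj₂ (inj₂ v∈)) = inj₁ (inj₁ (inj₁ v∈))

    add : ∀ {is} (i : Item pos) → State is → State (i ∷ is)
    add (item {suc a} {suc b} {R} {r} t) s = record
      { done = item t ∷ done ; loop = loop ; pending = pending
      ; parity-leaf = parity-leaf
      ; parity-above = λ e → trans (cong (cross T (a , b) e xor_) (parity-above e)) (sym (Bool.xor-assoc (cross T (a , b) e) (odd T (ends done) e) (crossPending pending e)))
      ; weights = ℕ.≤-trans (ℕ.≤-reflexive (regroup₁ (totalWeight done) r c c′)) (ℕ.+-monoʳ-≤ r weights)
      ; visits = λ { (inj₁ v≡) → keep (visits (inj₁ v≡)) ; (inj₂ (inj₁ v∈)) → inj₁ (inj₁ v∈) ; (inj₂ (inj₂ v∈)) → keep (visits (inj₂ v∈)) } }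
      where
      open State s
      keep : ∀ {v} → Visited done v ⊎ P v ⊎ Q v → (R v ⊎ Visited done v) ⊎ P v ⊎ Q v
      keep (inj₁ v∈) = inj₁ (inj₂ v∈)
      keep (inj₂ v∈) = inj₂ v∈
    add {is} (item {zero} {zero} {R} {r} t) s = record
      { done = done ; loop = t ⨾ loop ; pending = pending
      ; parity-leaf = parity-leaf
      ; parity-above = λ e → trans (cong (_xor odd T⁺ (ends is) (suc e)) (Bool.xor-same (below T e p))) (parity-above e)
      ; weights = ℕ.≤-trans (ℕ.≤-reflexive (regroup₂ (totalWeight done) r c c′)) (ℕ.+-monoʳ-≤ r weights)
      ; visits = λ { (inj₁ v≡) → keep (visits (inj₁ v≡)) ; (inj₂ (inj₁ v∈)) → inj₂ (inj₁ (inj₁ v∈)) ; (inj₂ (inj₂ v∈)) → keep (visits (inj₂ v∈)) } }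
      where
      open State s
      keep : ∀ {v} → Visited done v ⊎ P v ⊎ Q v → Visited done v ⊎ (R v ⊎ P v) ⊎ Q v
      keep (inj₁ v∈)        = inj₁ v∈
      keep (inj₂ (inj₁ v∈)) = inj₂ (inj₁ (inj₂ v∈))
      keep (inj₂ (inj₂ v∈)) = inj₂ (inj₂ v∈)
    add i@(item {suc a} {zero} t) s = addEnd a t i refl id refl (λ e → refl) s
    add i@(item {zero} {suc a} t) s = addEnd a (flipped t) i refl id refl (λ e → Bool.xor-comm (below T e p) (below T e a)) s

    addAll : ∀ is → State is
    addAll []       = start
    addAll (i ∷ is) = add i (addAll is)

    record Reduced (is : List (Item pos)) : Set₁ where
      field
        items   : List (Item pos′)
        parity  : ∀ e → odd T (ends items) e ≡ odd T⁺ (ends is) (suc e)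
        weights : totalWeight items ≤ totalWeight is + δ (pos zero) (pos′ p) * multiplicity (odd T⁺ (ends is) zero)
        visits  : ∀ {v} → v ≡ pos zero ⊎ Visited is v → Visited items v

    finish : ∀ {is} → State is → Reduced is
    -- An even number of ends: the edge is taken down and back with the loop in between, which gives
    -- a closed item at p.
    finish {is} (state done {P = P} {c = c} loop none pl pa wt vs) = record
      { items = item (step (pos′ p) (pos zero) ⨾ loop ⨾ step (pos zero) (pos′ p)) ∷ done
      ; parity = λ e → trans (((∀ x o → (x xor x) xor o ≡ o xor false) ∋ solve-∀ 𝔹-ring) (below T e p) (odd T (ends done) e)) (sym (pa e))
      ; weights = bound
      ; visits = λ v∈ → keep (vs v∈) }
      where
      w : ℕ
      w = δ (pos zero) (pos′ p)
      arith : ∀ w c d → w + (c + w) + d ≡ d + (c + 0) + w * 2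
      arith = ℕ-solve-∀
      bound : δ (pos′ p) (pos zero) + (c + w) + totalWeight done ≤ totalWeight is + w * multiplicity (odd T⁺ (ends is) zero)
      bound rewrite pl | δ-sym (pos′ p) (pos zero) = ℕ.≤-trans (ℕ.≤-reflexive (arith w c (totalWeight done))) (ℕ.+-monoˡ-≤ (w * 2) wt)
      keep : ∀ {v} → Visited done v ⊎ P v ⊎ ⊥ → (⊥ ⊎ P v ⊎ ⊥) ⊎ Visited done v
      keep (inj₁ v∈)        = inj₂ v∈
      keep (inj₂ (inj₁ v∈)) = inj₁ (inj₂ (inj₁ v∈))
    -- An odd number of ends: the pending trip goes around the loop and then along the edge to p,
    -- which is used once.
    finish {is} (state done {P = P} {Q = Q} {c = c} {c′ = c′} loop (some x u) pl pa wt vs) = record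
      { items = item (u ⨾ loop ⨾ step (pos zero) (pos′ p)) ∷ done
      ; parity = λ e → trans (Bool.xor-comm (below T e x xor below T e p) (odd T (ends done) e)) (sym (pa e))
      ; weights = bound
      ; visits = λ v∈ → keep (vs v∈) }
      where
      w : ℕ
      w = δ (pos zero) (pos′ p)
      arith : ∀ w c c′ d → c′ + (c + w) + d ≡ d + (c + c′) + w * 1
      arith = ℕ-solve-∀
      bound : c′ + (c + w) + totalWeight done ≤ totalWeight is + w * multiplicity (odd T⁺ (ends is) zero)
      bound rewrite pl = ℕ.≤-trans (ℕ.≤-reflexive (arith w c c′ (totalWeight done))) (ℕ.+-monoˡ-≤ (w * 1) wt)
      keep : ∀ {v} → Visited done v ⊎ P v ⊎ Q v → (Q v ⊎ P v ⊎ ⊥) ⊎ Visited done v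
      keep (inj₁ v∈)        = inj₂ v∈
      keep (inj₂ (inj₁ v∈)) = inj₁ (inj₂ (inj₁ v∈))
      keep (inj₂ (inj₂ v∈)) = inj₁ (inj₁ v∈)

  tour : ∀ {m} (T : RTree m) (pos : Fin (suc m) → V) (is : List (Item pos)) →
         Route (pos (Fin.fromℕ m)) (pos (Fin.fromℕ m)) (λ v → (∃[ i ] v ≡ pos i) ⊎ Visited is v)
               (totalWeight is + doubledTree T pos (odd T (ends is)))
  tour leaf pos [] = weaken z≤n (λ { (inj₁ (zero , v≡)) → v≡ }) (stay (pos zero))
  tour leaf pos (item {zero} {zero} {weight = r} t ∷ is) =
    weaken (ℕ.≤-reflexive (sym (ℕ.+-assoc r _ 0)))
      (λ { (inj₁ v≡) → inj₂ (inj₁ v≡) ; (inj₂ (inj₁ v∈)) → inj₁ v∈ ; (inj₂ (inj₂ v∈)) → inj₂ (inj₂ v∈) })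
      (t ⨾ tour leaf pos is)
  tour (attach p T) pos is = weaken bound
    (λ { (inj₁ (zero , v≡)) → inj₂ (visits (inj₁ v≡)) ; (inj₁ (suc i , v≡)) → inj₁ (i , v≡) ; (inj₂ v∈) → inj₂ (visits (inj₂ v∈)) })
    (tour T (pos ∘ suc) items)
    where
    open RemoveLeaf p T pos
    open Reduced (finish (addAll is))
    bound : totalWeight items + doubledTree T (pos ∘ suc) (odd T (ends items)) ≤
            totalWeight is + doubledTree (attach p T) pos (odd (attach p T) (ends is))
    bound = ℕ.≤-trans (ℕ.+-mono-≤ weights (ℕ.≤-reflexive (doubledTree-cong T (pos ∘ suc) parity)))
      (ℕ.≤-reflexive (ℕ.+-assoc (totalWeight is) _ _))

  module _ (triangle : ∀ x y z → δ x z ≤ δ x y + δ y z) where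

    pathCost-triangle : ∀ x v vs z → pathCost x vs z ≤ δ x v + pathCost v vs z
    pathCost-triangle x v []       z = triangle x v z
    pathCost-triangle x v (u ∷ vs) z = ℕ.≤-trans (ℕ.+-monoˡ-≤ _ (triangle x v u)) (ℕ.≤-reflexive (ℕ.+-assoc (δ x v) _ _))

    pathCost-⊆ : ∀ x {us vs} z → us ⊆ vs → pathCost x us z ≤ pathCost x vs z
    pathCost-⊆ x z []              = ℕ.≤-refl
    pathCost-⊆ x {us} z (v ∷ˢ us⊆vs) = ℕ.≤-trans (pathCost-triangle x v us z) (ℕ.+-monoʳ-≤ (δ x v) (pathCost-⊆ v z us⊆vs))
    pathCost-⊆ x z (refl ∷ us⊆vs)   = ℕ.+-monoʳ-≤ (δ x _) (pathCost-⊆ _ z us⊆vs)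

∑-⊆ : ∀ {A : Set} {xs ys : List A} f → (∀ x → 0ℚ ℚ.≤ f x) → Unique xs → (∀ {x} → x ∈ xs → x ∈ ys) → ∑ xs f ℚ.≤ ∑ ys f
∑-⊆ {xs = []}     {ys} f 0≤f []        xs⊆ys = 0≤∑ ys 0≤f
∑-⊆ {xs = x ∷ xs} {ys} f 0≤f (x∉ ∷ uq) xs⊆ys with ∈.∈-∃++ (xs⊆ys (here refl))
... | us , vs , refl = ≤≡ (ℚ.+-monoʳ-≤ (f x) (∑-⊆ f 0≤f uq rest)) (sym (∑-↭ f (↭.shift x us vs)))
  where
  rest : ∀ {y} → y ∈ xs → y ∈ us ++ vs
  rest y∈ with ∈-resp-↭ (↭.shift x us vs) (xs⊆ys (there y∈))
  ... | here refl = contradiction refl (All.lookup x∉ y∈)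
  ... | there y∈′ = y∈′

length-⊆ : ∀ {A : Set} {xs ys : List A} → Unique xs → (∀ {x} → x ∈ xs → x ∈ ys) → length xs ≤ length ys
length-⊆ {xs = xs} {ys} uq xs⊆ys = ι-cancel-≤ (≤≡ (≡≤ (sym (∑-one xs)) (∑-⊆ (λ _ → 1ℚ) (λ _ → 0≤1) uq xs⊆ys)) (∑-one ys))

Unique-fins : ∀ n → Unique (fins n)
Unique-fins zero    = []
Unique-fins (suc n) = All.map⁺ (All.tabulate λ _ ()) ∷ Unique.map⁺ Fin.suc-injective (Unique-fins n)

closedSteps-sum : ∀ {V : Set} (δ : V → V → ℕ) (δ-refl : ∀ x → δ x x ≡ 0) (δ-sym : ∀ x y → δ x y ≡ δ y x) x vs z →
                  sum (map (uncurry δ) (zip (x ∷ vs) (vs ∷ʳ z))) ≡ Routes.pathCost δ δ-refl δ-sym x vs z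
closedSteps-sum δ r s x []       z = ℕ.+-identityʳ (δ x z)
closedSteps-sum δ r s x (v ∷ vs) z = cong (δ x v +_) (closedSteps-sum δ r s v vs z)

steps-distinct : ∀ {V : Set} (x : V) vs z → Unique (x ∷ vs) → All (_≢ z) (x ∷ vs) → All (uncurry _≢_) (zip (x ∷ vs) (vs ∷ʳ z))
steps-distinct x []       z _                    (x≢z ∷ _)   = x≢z ∷ []
steps-distinct x (v ∷ vs) z ((x≢v ∷ _) ∷ unique) (_ ∷ vs≢z) = x≢v ∷ steps-distinct v vs z unique vs≢z

closedSteps-distinct : ∀ {V : Set} (vs : List V) → 3 ≤ length vs → Unique vs → All (uncurry _≢_) (closedSteps vs)
closedSteps-distinct (x ∷ v ∷ vs) _ (x≢@(x≢v ∷ _) ∷ unique) =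
  x≢v ∷ steps-distinct v vs x unique (All.map (λ x≢ v≡ → x≢ (sym v≡)) x≢)
closedSteps-distinct (_ ∷ []) (s≤s ()) _

module Tours {n} (d : Weights n) (metric : IsMetric _≡_ d) (3≤n : 3 ≤ n) where

  d-refl : ∀ x → d x x ≡ 0
  d-refl x = IsMetric.≈⇒0 metric refl

  d-sym : ∀ x y → d x y ≡ d y x
  d-sym = IsMetric.sym metric

  triangle : ∀ x y z → d x z ≤ d x y + d y z
  triangle x y z = IsMetric.triangle metric x y z

  d-pos : ∀ {x y} → x ≢ y → NonZero (d x y)
  d-pos {x} {y} x≢y = ≢-nonZero λ d≡0 → x≢y (IsMetric.0⇒≈ metric d≡0)

  open Routes d d-refl d-sym public

  deduplicate-⊆ : ∀ (vs : List (Fin n)) → deduplicate Fin._≟_ vs ⊆ vs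
  deduplicate-⊆ []       = []
  deduplicate-⊆ (v ∷ vs) = refl ∷ Sublist.⊆-trans (Sublist.filter-⊆ _ (deduplicate Fin._≟_ vs)) (deduplicate-⊆ vs)

  -- Shortcutting a closed walk through all points.
  closed⇒Hamiltonian : ∀ {r P c} → Route r r P c → (∀ v → P v) →
                       ∃[ vs ] IsHamiltonianCycle vs × cycleWeight d vs ≤ c
  closed⇒Hamiltonian {r} {P} {c} (route via cost visits) P-all =
    vs , ((3≤length , unique , closedSteps-distinct vs 3≤length unique) , all∈) , weight
    where
    vs : List (Fin n)
    vs = deduplicate Fin._≟_ (r ∷ via)
    unique : Unique vs
    unique = deduplicate-! Fin._≟_ (r ∷ via)
    in-walk : ∀ v → v ∈ r ∷ via
    in-walk v with ∈.∈-++⁻ (r ∷ via) (visits (P-all v))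
    ... | inj₁ v∈          = v∈
    ... | inj₂ (here refl) = here refl
    all∈ : ∀ v → v ∈ vs
    all∈ v = ∈.∈-deduplicate⁺ Fin._≟_ (in-walk v)
    3≤length : 3 ≤ length vs
    3≤length = ℕ.≤-trans 3≤n (ℕ.≤-trans (ℕ.≤-reflexive (sym (length-fins n))) (length-⊆ (Unique-fins n) (λ {v} _ → all∈ v)))
    tail⊆ : ∀ {us} → r ∷ us ⊆ r ∷ via → us ⊆ via
    tail⊆ = Sublist.∷⁻
    weight : cycleWeight d vs ≤ c
    weight = ℕ.≤-trans (ℕ.≤-reflexive (closedSteps-sum d d-refl d-sym r (drop 1 vs) r))
      (ℕ.≤-trans (pathCost-⊆ triangle r r (tail⊆ (deduplicate-⊆ (r ∷ via)))) cost)

  Tour : ℕ → Set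
  Tour c = ∃[ vs ] IsHamiltonianCycle vs × cycleWeight d vs ≤ c

module TreeValue {m} (T : RTree m) (len : Fin m → ℕ) where

  Pair : Set
  Pair = Fin (suc m) × Fin (suc m)

  -- The weight of the closed walk that takes every pair of S once and every tree edge
  -- once or twice, whichever makes all degrees even.
  value : (Pair → ℚ) → List Pair → ℚ
  value κ S = ∑ S κ ℚ.+ ∑ (fins m) λ e → ι (len e) ℚ.* ι (multiplicity (odd T S e))

  M : ℚ
  M = ∑ (fins m) (ι ∘ len)

-- The lengths are a parameter because the algorithm knows them only as a table.
module TreeTours {m} (d : Weights (suc m)) (metric : IsMetric _≡_ d) (3≤n : 3 ≤ suc m) (T : RTree m)
                 (len : Fin m → ℕ) (len≡ : ∀ e → len e ≡ d (Fin.inject₁ e) (parent T e)) where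

  open Tours d metric 3≤n public
  open TreeValue T len public

  ∑-doubledTree : ∀ {k} (S : RTree k) (pos : Fin (suc k) → Fin (suc m)) odd? →
    ι (doubledTree S pos odd?) ≡ ∑ (fins k) λ e → ι (d (pos (Fin.inject₁ e)) (pos (parent S e))) ℚ.* ι (multiplicity (odd? e))
  ∑-doubledTree leaf               pos odd? = ι-0
  ∑-doubledTree {suc k} (attach p S) pos odd? = begin
    ι (d (pos zero) (pos (suc p)) * multiplicity (odd? zero) + doubledTree S (pos ∘ suc) (odd? ∘ suc))
      ≡⟨ trans (ι-+ (d (pos zero) (pos (suc p)) * multiplicity (odd? zero)) _) (cong₂ ℚ._+_ (ι-* (d (pos zero) (pos (suc p))) _) (∑-doubledTree S (pos ∘ suc) (odd? ∘ suc))) ⟩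
    _ ≡⟨ sym (∑-fins-suc k (λ e → ι (d (pos (Fin.inject₁ e)) (pos (parent (attach p S) e))) ℚ.* ι (multiplicity (odd? e)))) ⟩
    _ ∎
    where open ≡-Reasoning

  tour-≤-value : ∀ S → ∃[ c ] Tour c × ι c ≡ value (ι ∘ uncurry d) S
  tour-≤-value S = totalWeight items + doubledTree T id (odd T (ends items)) , closed⇒Hamiltonian (tour T id items) (λ v → inj₁ (v , refl)) ,
    trans (ι-+ (totalWeight items) _) (cong₂ ℚ._+_ (weights S) (trans (∑-doubledTree T id _)
      (∑-cong (fins m) λ e → cong₂ (λ l fs → ι l ℚ.* ι (multiplicity (odd T fs e))) (sym (len≡ e)) (ends-items S))))
    where
    toItem : Pair → Item id
    toItem (u , v) = item (step u v)
    items : List (Item id)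
    items = map toItem S
    weights : ∀ S → ι (totalWeight (map toItem S)) ≡ ∑ S (ι ∘ uncurry d)
    weights []            = ι-0
    weights ((u , v) ∷ S) = trans (ι-+ (d u v) _) (cong (ι (d u v) ℚ.+_) (weights S))
    ends-items : ∀ S → ends (map toItem S) ≡ S
    ends-items []      = refl
    ends-items (f ∷ S) = cong (f ∷_) (ends-items S)

  sign : Bool → ℚ
  sign true  = ℚ.- 1ℚ
  sign false = 1ℚ

  sign-xor : ∀ x y → sign (x xor y) ≡ sign x ℚ.* sign y
  sign-xor true  true  = refl
  sign-xor true  false = refl
  sign-xor false true  = refl
  sign-xor false false = refl

  miss : Fin m → List (Pair × ℚ) → ℚ
  miss e []             = 1ℚ
  miss e ((f , s) ∷ fs) = (1ℚ ℚ.- (s ℚ.+ s) ℚ.* ⟦ cross T f e ⟧) ℚ.* miss e fs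

  -- The ½ is that of multiplicity = 3/2 + ½ sign. In `derandomise`, σ carries the signs of the
  -- pairs already decided and τ those of the rest.
  signed : (Fin m → ℚ) → (Fin m → ℚ) → ℚ
  signed σ τ = ½ ℚ.* ∑ (fins m) λ e → ι (len e) ℚ.* (σ e ℚ.* τ e)

  signed-cong : ∀ σ τ σ′ τ′ → (∀ e → σ e ℚ.* τ e ≡ σ′ e ℚ.* τ′ e) → signed σ τ ≡ signed σ′ τ′
  signed-cong σ τ σ′ τ′ eq = cong (½ ℚ.*_) (∑-cong (fins m) λ e → cong (ι (len e) ℚ.*_) (eq e))

  signed-mix : ∀ a b σ τ υ → signed σ (λ e → a ℚ.* τ e ℚ.+ b ℚ.* υ e) ≡ a ℚ.* signed σ τ ℚ.+ b ℚ.* signed σ υ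
  signed-mix a b σ τ υ = begin
    ½ ℚ.* ∑ (fins m) (λ e → l e ℚ.* (σ e ℚ.* (a ℚ.* τ e ℚ.+ b ℚ.* υ e)))
      ≡⟨ cong (½ ℚ.*_) (∑-cong (fins m) λ e → ((∀ l s a t b u → l ℚ.* (s ℚ.* (a ℚ.* t ℚ.+ b ℚ.* u)) ≡ a ℚ.* (l ℚ.* (s ℚ.* t)) ℚ.+ b ℚ.* (l ℚ.* (s ℚ.* u))) ∋ solve-∀ ℚ-ring) (l e) (σ e) a (τ e) b (υ e)) ⟩
    ½ ℚ.* ∑ (fins m) (λ e → a ℚ.* (l e ℚ.* (σ e ℚ.* τ e)) ℚ.+ b ℚ.* (l e ℚ.* (σ e ℚ.* υ e)))
      ≡⟨ cong (½ ℚ.*_) (trans (∑-+ (fins m) (λ e → a ℚ.* (l e ℚ.* (σ e ℚ.* τ e))) (λ e → b ℚ.* (l e ℚ.* (σ e ℚ.* υ e))))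
           (cong₂ ℚ._+_ (∑-*ˡ (fins m) a (λ e → l e ℚ.* (σ e ℚ.* τ e))) (∑-*ˡ (fins m) b (λ e → l e ℚ.* (σ e ℚ.* υ e))))) ⟩
    ½ ℚ.* (a ℚ.* ∑ (fins m) (λ e → l e ℚ.* (σ e ℚ.* τ e)) ℚ.+ b ℚ.* ∑ (fins m) (λ e → l e ℚ.* (σ e ℚ.* υ e)))
      ≡⟨ ((∀ h a x b y → h ℚ.* (a ℚ.* x ℚ.+ b ℚ.* y) ≡ a ℚ.* (h ℚ.* x) ℚ.+ b ℚ.* (h ℚ.* y)) ∋ solve-∀ ℚ-ring) ½ a (∑ (fins m) (λ e → l e ℚ.* (σ e ℚ.* τ e))) b (∑ (fins m) (λ e → l e ℚ.* (σ e ℚ.* υ e))) ⟩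
    a ℚ.* signed σ τ ℚ.+ b ℚ.* signed σ υ ∎
    where
    open ≡-Reasoning
    l : Fin m → ℚ
    l e = ι (len e)

  -- Keeping each pair f independently with probability s, the expected sign of an edge is
  -- `miss`; some outcome is at most the expectation.
  derandomise : ∀ (κ : Pair → ℚ) fs → All (λ f → 0ℚ ℚ.≤ proj₂ f × proj₂ f ℚ.≤ 1ℚ) fs → ∀ σ →
    ∃[ S ] length S ≤ length fs ×
      ∑ S κ ℚ.+ signed σ (λ e → sign (odd T S e)) ℚ.≤ ∑ fs (λ f → proj₂ f ℚ.* κ (proj₁ f)) ℚ.+ signed σ (λ e → miss e fs)
  derandomise κ []             []                      σ = [] , z≤n , ℚ.≤-refl
  derandomise κ ((f , s) ∷ fs) ((0≤s , s≤1) ∷ 0≤fs≤1) σ = choose (ℚ.≤-total X total) (ℚ.≤-total (κ f ℚ.+ Y) total)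
    where
    σ′ : Fin m → ℚ
    σ′ e = σ e ℚ.* sign (cross T f e)
    R X Y total : ℚ
    R = ∑ fs (λ f → proj₂ f ℚ.* κ (proj₁ f))
    X = R ℚ.+ signed σ (λ e → miss e fs)
    Y = R ℚ.+ signed σ′ (λ e → miss e fs)
    total = s ℚ.* κ f ℚ.+ R ℚ.+ signed σ (λ e → miss e ((f , s) ∷ fs))
    -- Dropping f leads to X and keeping it to κ f + Y; the expectation is their average with
    -- weights 1 - s and s.
    mean : total ≡ (1ℚ ℚ.- s) ℚ.* X ℚ.+ s ℚ.* (κ f ℚ.+ Y)
    mean = trans (cong (s ℚ.* κ f ℚ.+ R ℚ.+_) (trans (signed-cong σ (λ e → miss e ((f , s) ∷ fs)) (λ _ → 1ℚ) (λ e → (1ℚ ℚ.- s) ℚ.* (σ e ℚ.* miss e fs) ℚ.+ s ℚ.* (σ′ e ℚ.* miss e fs)) λ e → mix (cross T f e) (σ e) (miss e fs))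
        (trans (signed-mix (1ℚ ℚ.- s) s (λ _ → 1ℚ) (λ e → σ e ℚ.* miss e fs) (λ e → σ′ e ℚ.* miss e fs))
          (cong₂ (λ x y → (1ℚ ℚ.- s) ℚ.* x ℚ.+ s ℚ.* y) (signed-cong (λ _ → 1ℚ) (λ e → σ e ℚ.* miss e fs) σ (λ e → miss e fs) λ e → ℚ.*-identityˡ (σ e ℚ.* miss e fs)) (signed-cong (λ _ → 1ℚ) (λ e → σ′ e ℚ.* miss e fs) σ′ (λ e → miss e fs) λ e → ℚ.*-identityˡ (σ′ e ℚ.* miss e fs))))))
      (((∀ s k R x y → s ℚ.* k ℚ.+ R ℚ.+ ((1ℚ ℚ.- s) ℚ.* x ℚ.+ s ℚ.* y) ≡ (1ℚ ℚ.- s) ℚ.* (R ℚ.+ x) ℚ.+ s ℚ.* (k ℚ.+ (R ℚ.+ y))) ∋ solve-∀ ℚ-ring)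
        s (κ f) R (signed σ (λ e → miss e fs)) (signed σ′ (λ e → miss e fs)))
      where
      mix : ∀ c σ μ → σ ℚ.* ((1ℚ ℚ.- (s ℚ.+ s) ℚ.* ⟦ c ⟧) ℚ.* μ) ≡ 1ℚ ℚ.* ((1ℚ ℚ.- s) ℚ.* (σ ℚ.* μ) ℚ.+ s ℚ.* (σ ℚ.* sign c ℚ.* μ))
      mix true  σ μ = ((∀ s σ μ → σ ℚ.* ((1ℚ ℚ.- (s ℚ.+ s) ℚ.* 1ℚ) ℚ.* μ) ≡ 1ℚ ℚ.* ((1ℚ ℚ.- s) ℚ.* (σ ℚ.* μ) ℚ.+ s ℚ.* (σ ℚ.* (ℚ.- 1ℚ) ℚ.* μ))) ∋ solve-∀ ℚ-ring) s σ μ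
      mix false σ μ = ((∀ s σ μ → σ ℚ.* ((1ℚ ℚ.- (s ℚ.+ s) ℚ.* 0ℚ) ℚ.* μ) ≡ 1ℚ ℚ.* ((1ℚ ℚ.- s) ℚ.* (σ ℚ.* μ) ℚ.+ s ℚ.* (σ ℚ.* 1ℚ ℚ.* μ))) ∋ solve-∀ ℚ-ring) s σ μ
    include : κ f ℚ.+ Y ℚ.≤ total → _
    include le with derandomise κ fs 0≤fs≤1 σ′
    ... | S , short , S≤ = f ∷ S , s≤s short , ℚ.≤-trans (≡≤ eq (ℚ.+-monoʳ-≤ (κ f) S≤)) le
      where
      eq : κ f ℚ.+ ∑ S κ ℚ.+ signed σ (λ e → sign (odd T (f ∷ S) e)) ≡ κ f ℚ.+ (∑ S κ ℚ.+ signed σ′ (λ e → sign (odd T S e)))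
      eq = trans (cong (κ f ℚ.+ ∑ S κ ℚ.+_) (signed-cong σ (λ e → sign (odd T (f ∷ S) e)) σ′ (λ e → sign (odd T S e)) λ e →
          trans (cong (σ e ℚ.*_) (sign-xor (cross T f e) (odd T S e))) (sym (ℚ.*-assoc (σ e) (sign (cross T f e)) (sign (odd T S e))))))
        (ℚ.+-assoc (κ f) (∑ S κ) _)
    exclude : X ℚ.≤ total → _
    exclude le with derandomise κ fs 0≤fs≤1 σ
    ... | S , short , S≤ = S , ℕ.≤-trans short (ℕ.n≤1+n _) , ℚ.≤-trans S≤ le
    choose : X ℚ.≤ total ⊎ total ℚ.≤ X → κ f ℚ.+ Y ℚ.≤ total ⊎ total ℚ.≤ κ f ℚ.+ Y → _
    choose (inj₁ X≤)   _          = exclude X≤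
    choose (inj₂ _)    (inj₁ Y≤)  = include Y≤
    choose (inj₂ ≤X)   (inj₂ ≤Y)  with ℚ.≤-total X (κ f ℚ.+ Y)
    -- Both alternatives are at least the mean here; the smaller one is still at most the mean.
    ... | inj₁ X≤Y = exclude (≤-by (*≤ 0≤s X≤Y) (trans (cong (X ℚ.+_) (ℚ.*-distribˡ-+ s (κ f) Y))
          (trans (((∀ s X k Y → X ℚ.+ (s ℚ.* k ℚ.+ s ℚ.* Y) ≡ (1ℚ ℚ.- s) ℚ.* X ℚ.+ s ℚ.* (k ℚ.+ Y) ℚ.+ s ℚ.* X) ∋ solve-∀ ℚ-ring) s X (κ f) Y) (cong (ℚ._+ s ℚ.* X) (sym mean)))))
    ... | inj₂ Y≤X = include (≤-by (*≤ (0≤b-a s≤1) Y≤X)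
          (trans (((∀ s X Z → Z ℚ.+ (1ℚ ℚ.- s) ℚ.* X ≡ (1ℚ ℚ.- s) ℚ.* X ℚ.+ s ℚ.* Z ℚ.+ (1ℚ ℚ.- s) ℚ.* Z) ∋ solve-∀ ℚ-ring) s X (κ f ℚ.+ Y)) (cong (ℚ._+ (1ℚ ℚ.- s) ℚ.* (κ f ℚ.+ Y)) (sym mean))))

  multiplicity-sign : ∀ b → ι (multiplicity b) ≡ (1ℚ ℚ.+ ½) ℚ.+ ½ ℚ.* sign b
  multiplicity-sign true  = ι-1
  multiplicity-sign false = trans (ι-+ 1 1) (cong₂ ℚ._+_ ι-1 ι-1)

  value-signed : ∀ κ S → value κ S ≡ ∑ S κ ℚ.+ ((1ℚ ℚ.+ ½) ℚ.* M ℚ.+ signed (λ _ → 1ℚ) (λ e → sign (odd T S e)))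
  value-signed κ S = cong (∑ S κ ℚ.+_) (begin
    ∑ (fins m) (λ e → ι (len e) ℚ.* ι (multiplicity (odd T S e)))
      ≡⟨ ∑-cong (fins m) (λ e → trans (cong (ι (len e) ℚ.*_) (multiplicity-sign (odd T S e)))
           (((∀ l c h s → l ℚ.* (c ℚ.+ h ℚ.* s) ≡ c ℚ.* l ℚ.+ h ℚ.* (l ℚ.* (1ℚ ℚ.* s))) ∋ solve-∀ ℚ-ring) (ι (len e)) (1ℚ ℚ.+ ½) ½ (sign (odd T S e)))) ⟩
    ∑ (fins m) (λ e → (1ℚ ℚ.+ ½) ℚ.* ι (len e) ℚ.+ ½ ℚ.* (ι (len e) ℚ.* (1ℚ ℚ.* sign (odd T S e))))
      ≡⟨ trans (∑-+ (fins m) (λ e → (1ℚ ℚ.+ ½) ℚ.* ι (len e)) (λ e → ½ ℚ.* (ι (len e) ℚ.* (1ℚ ℚ.* sign (odd T S e)))))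
           (cong₂ ℚ._+_ (∑-*ˡ (fins m) (1ℚ ℚ.+ ½) (ι ∘ len)) (∑-*ˡ (fins m) ½ (λ e → ι (len e) ℚ.* (1ℚ ℚ.* sign (odd T S e))))) ⟩
    (1ℚ ℚ.+ ½) ℚ.* M ℚ.+ signed (λ _ → 1ℚ) (λ e → sign (odd T S e)) ∎)
    where open ≡-Reasoning

  -- Without pairs the tree is doubled, at cost 2 M. An edge of expected sign μ is taken 3/2 + μ/2 =
  -- 2 - (1 - μ)/2 times on average.
  cheap-value : ∀ κ fs → All (λ f → 0ℚ ℚ.≤ proj₂ f × proj₂ f ℚ.≤ 1ℚ) fs →
    ∃[ S ] length S ≤ length fs × value κ S ℚ.≤ (1ℚ ℚ.+ 1ℚ) ℚ.* M ℚ.+ ∑ fs (λ f → proj₂ f ℚ.* κ (proj₁ f))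
                                                ℚ.- ½ ℚ.* ∑ (fins m) (λ e → ι (len e) ℚ.* (1ℚ ℚ.- miss e fs))
  cheap-value κ fs 0≤fs≤1 with derandomise κ fs 0≤fs≤1 (λ _ → 1ℚ)
  ... | S , short , S≤ = S , short , ≡≤ (value-signed κ S) (≤-by S≤ (begin
    x ℚ.+ (c ℚ.+ y) ℚ.+ (z ℚ.+ signed (λ _ → 1ℚ) (λ e → miss e fs))
      ≡⟨ cong (λ s → x ℚ.+ (c ℚ.+ y) ℚ.+ (z ℚ.+ ½ ℚ.* s)) (∑-cong (fins m) λ e → ((∀ l t → l ℚ.* (1ℚ ℚ.* t) ≡ l ℚ.+ (ℚ.- 1ℚ) ℚ.* (l ℚ.* (1ℚ ℚ.- t))) ∋ solve-∀ ℚ-ring) (ι (len e)) (miss e fs)) ⟩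
    x ℚ.+ (c ℚ.+ y) ℚ.+ (z ℚ.+ ½ ℚ.* ∑ (fins m) (λ e → ι (len e) ℚ.+ (ℚ.- 1ℚ) ℚ.* (ι (len e) ℚ.* (1ℚ ℚ.- miss e fs))))
      ≡⟨ cong (λ s → x ℚ.+ (c ℚ.+ y) ℚ.+ (z ℚ.+ ½ ℚ.* s)) (trans (∑-+ (fins m) (ι ∘ len) (λ e → (ℚ.- 1ℚ) ℚ.* (ι (len e) ℚ.* (1ℚ ℚ.- miss e fs)))) (cong (M ℚ.+_) (∑-*ˡ (fins m) (ℚ.- 1ℚ) (λ e → ι (len e) ℚ.* (1ℚ ℚ.- miss e fs))))) ⟩
    x ℚ.+ (c ℚ.+ y) ℚ.+ (z ℚ.+ ½ ℚ.* (M ℚ.+ (ℚ.- 1ℚ) ℚ.* u))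
      ≡⟨ ((∀ x y z M u → x ℚ.+ ((1ℚ ℚ.+ ½) ℚ.* M ℚ.+ y) ℚ.+ (z ℚ.+ ½ ℚ.* (M ℚ.+ (ℚ.- 1ℚ) ℚ.* u)) ≡ (1ℚ ℚ.+ 1ℚ) ℚ.* M ℚ.+ z ℚ.- ½ ℚ.* u ℚ.+ (x ℚ.+ y)) ∋ solve-∀ ℚ-ring) x y z M u ⟩
    (1ℚ ℚ.+ 1ℚ) ℚ.* M ℚ.+ z ℚ.- ½ ℚ.* u ℚ.+ (x ℚ.+ y) ∎))
    where
    open ≡-Reasoning
    x y z c u : ℚ
    x = ∑ S κ
    y = signed (λ _ → 1ℚ) (λ e → sign (odd T S e))
    z = ∑ fs (λ f → proj₂ f ℚ.* κ (proj₁ f))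
    c = (1ℚ ℚ.+ ½) ℚ.* M
    u = ∑ (fins m) (λ e → ι (len e) ℚ.* (1ℚ ℚ.- miss e fs))

-- Cutting a tree by marked edges

below-child : ∀ {m} (T : RTree m) e → below T e (Fin.inject₁ e) ≡ true
below-child (attach p T) zero    = refl
below-child (attach p T) (suc e) = below-child T e

below-root : ∀ {m} (T : RTree m) e → below T e (Fin.fromℕ m) ≡ false
below-root (attach p T) zero    = refl
below-root (attach p T) (suc e) = below-root T e

below-trans : ∀ {m} (T : RTree m) {e e′ x} → below T e x ≡ true → below T e′ (Fin.inject₁ e) ≡ true → below T e′ x ≡ true
below-trans (attach p T) {zero}  {e′}     {zero}  b b′ = b′
below-trans (attach p T) {suc e} {suc e′} {zero}  b b′ = below-trans T b b′
below-trans (attach p T) {suc e} {suc e′} {suc x} b b′ = below-trans T b b′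

below-chain : ∀ {m} (T : RTree m) {e e′ x} → below T e x ≡ true → below T e′ x ≡ true →
              below T e′ (Fin.inject₁ e) ≡ true ⊎ below T e (Fin.inject₁ e′) ≡ true
below-chain (attach p T) {zero}  {zero}   {zero}  b b′ = inj₁ refl
below-chain (attach p T) {zero}  {suc e′} {zero}  b b′ = inj₁ b′
below-chain (attach p T) {suc e} {zero}   {zero}  b b′ = inj₂ b
below-chain (attach p T) {suc e} {suc e′} {zero}  b b′ = below-chain T b b′
below-chain (attach p T) {suc e} {suc e′} {suc x} b b′ = below-chain T b b′

∑-delta : ∀ {n} (p : Fin n) (f : Fin n → ℚ) → ∑ (fins n) (λ v → ⟦ ⌊ v Fin.≟ p ⌋ ⟧ ℚ.* f v) ≡ f p
∑-delta {suc n} zero f = begin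
  1ℚ ℚ.* f zero ℚ.+ ∑ (map suc (fins n)) g  ≡⟨ cong₂ ℚ._+_ (ℚ.*-identityˡ (f zero)) (trans (∑-map suc (fins n) g) (trans (∑-cong (fins n) λ v → ℚ.*-zeroˡ (f (suc v))) (∑-0 (fins n)))) ⟩
  f zero ℚ.+ 0ℚ                             ≡⟨ ℚ.+-identityʳ (f zero) ⟩
  f zero                                    ∎
  where
  open ≡-Reasoning
  g : Fin (suc n) → ℚ
  g v = ⟦ ⌊ v Fin.≟ zero ⌋ ⟧ ℚ.* f v
∑-delta {suc n} (suc p) f = begin
  0ℚ ℚ.* f zero ℚ.+ ∑ (map suc (fins n)) g                          ≡⟨ cong₂ ℚ._+_ (ℚ.*-zeroˡ (f zero)) (∑-map suc (fins n) g) ⟩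
  0ℚ ℚ.+ ∑ (fins n) (g ∘ suc)                                       ≡⟨ trans (ℚ.+-identityˡ _) (∑-cong (fins n) λ v → cong (λ b → ⟦ b ⟧ ℚ.* f (suc v)) (same v)) ⟩
  ∑ (fins n) (λ v → ⟦ ⌊ v Fin.≟ p ⌋ ⟧ ℚ.* f (suc v))               ≡⟨ ∑-delta p (f ∘ suc) ⟩
  f (suc p)                                                         ∎
  where
  open ≡-Reasoning
  g : Fin (suc n) → ℚ
  g v = ⟦ ⌊ v Fin.≟ suc p ⌋ ⟧ ℚ.* f v
  same : ∀ v → ⌊ suc v Fin.≟ suc p ⌋ ≡ ⌊ v Fin.≟ p ⌋
  same v with v Fin.≟ p
  ... | yes refl = refl
  ... | no  _    = refl

-- Masses are accumulated from the leaves towards the root; an edge whose accumulated mass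
-- reaches τ is marked, and its mass is not passed on.
carry : ∀ {m} → Bool → Fin (suc m) → (Fin (suc (suc m)) → ℚ) → Fin (suc m) → ℚ
carry marked p μ v = μ (suc v) ℚ.+ ⟦ ⌊ v Fin.≟ p ⌋ ⟧ ℚ.* (⟦ not marked ⟧ ℚ.* μ zero)

mark : ∀ {m} → RTree m → ℚ → (Fin (suc m) → ℚ) → Fin m → Bool
mark (attach p T) τ μ zero    = ⌊ τ ℚ.≤? μ zero ⌋
mark (attach p T) τ μ (suc e) = mark T τ (carry ⌊ τ ℚ.≤? μ zero ⌋ p μ) e

carry-≥0 : ∀ {m} b p (μ : Fin (suc (suc m)) → ℚ) → (∀ v → 0ℚ ℚ.≤ μ v) → ∀ v → 0ℚ ℚ.≤ carry b p μ v
carry-≥0 b p μ 0≤μ v = 0≤+ (0≤μ (suc v)) (0≤* 0≤⟦ ⌊ v Fin.≟ p ⌋ ⟧ (0≤* 0≤⟦ not b ⟧ (0≤μ zero)))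

carry-∑ : ∀ {m} b p (μ : Fin (suc (suc m)) → ℚ) (g : Fin (suc m) → ℚ) →
          ∑ (fins (suc m)) (λ v → g v ℚ.* carry b p μ v) ≡ ∑ (fins (suc m)) (λ v → g v ℚ.* μ (suc v)) ℚ.+ g p ℚ.* (⟦ not b ⟧ ℚ.* μ zero)
carry-∑ {m} b p μ g = begin
  ∑ (fins (suc m)) (λ v → g v ℚ.* carry b p μ v)
    ≡⟨ ∑-cong (fins (suc m)) (λ v → ((∀ g x d y → g ℚ.* (x ℚ.+ d ℚ.* y) ≡ g ℚ.* x ℚ.+ d ℚ.* (g ℚ.* y)) ∋ solve-∀ ℚ-ring) (g v) (μ (suc v)) ⟦ ⌊ v Fin.≟ p ⌋ ⟧ (⟦ not b ⟧ ℚ.* μ zero)) ⟩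
  ∑ (fins (suc m)) (λ v → g v ℚ.* μ (suc v) ℚ.+ ⟦ ⌊ v Fin.≟ p ⌋ ⟧ ℚ.* (g v ℚ.* (⟦ not b ⟧ ℚ.* μ zero)))
    ≡⟨ ∑-+ (fins (suc m)) (λ v → g v ℚ.* μ (suc v)) (λ v → ⟦ ⌊ v Fin.≟ p ⌋ ⟧ ℚ.* (g v ℚ.* (⟦ not b ⟧ ℚ.* μ zero))) ⟩
  ∑ (fins (suc m)) (λ v → g v ℚ.* μ (suc v)) ℚ.+ ∑ (fins (suc m)) (λ v → ⟦ ⌊ v Fin.≟ p ⌋ ⟧ ℚ.* (g v ℚ.* (⟦ not b ⟧ ℚ.* μ zero)))
    ≡⟨ cong (∑ (fins (suc m)) (λ v → g v ℚ.* μ (suc v)) ℚ.+_) (∑-delta p (λ v → g v ℚ.* (⟦ not b ⟧ ℚ.* μ zero))) ⟩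
  ∑ (fins (suc m)) (λ v → g v ℚ.* μ (suc v)) ℚ.+ g p ℚ.* (⟦ not b ⟧ ℚ.* μ zero) ∎
  where open ≡-Reasoning

mark-count : ∀ {m} (T : RTree m) τ μ → (∀ v → 0ℚ ℚ.≤ μ v) → τ ℚ.* ∑ (fins m) (λ e → ⟦ mark T τ μ e ⟧) ℚ.≤ ∑ (fins (suc m)) μ
mark-count leaf τ μ 0≤μ = ≡≤ (ℚ.*-zeroʳ τ) (0≤∑ (fins 1) 0≤μ)
mark-count {suc m} (attach p T) τ μ 0≤μ = begin
  τ ℚ.* ∑ (fins (suc m)) (λ e → ⟦ mark (attach p T) τ μ e ⟧)    ≡⟨ cong (τ ℚ.*_) (∑-fins-suc m (λ e → ⟦ mark (attach p T) τ μ e ⟧)) ⟩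
  τ ℚ.* (⟦ b ⟧ ℚ.+ ∑ (fins m) (λ e → ⟦ mark T τ μ′ e ⟧))        ≡⟨ ((∀ τ b s → τ ℚ.* (b ℚ.+ s) ≡ b ℚ.* τ ℚ.+ τ ℚ.* s) ∋ solve-∀ ℚ-ring) τ ⟦ b ⟧ (∑ (fins m) (λ e → ⟦ mark T τ μ′ e ⟧)) ⟩
  ⟦ b ⟧ ℚ.* τ ℚ.+ τ ℚ.* ∑ (fins m) (λ e → ⟦ mark T τ μ′ e ⟧)    ≤⟨ marked +≤ mark-count T τ μ′ (carry-≥0 b p μ 0≤μ) ⟩
  ⟦ b ⟧ ℚ.* μ zero ℚ.+ ∑ (fins (suc m)) μ′                      ≡⟨ cong (⟦ b ⟧ ℚ.* μ zero ℚ.+_) (∑-cong (fins (suc m)) λ v → sym (ℚ.*-identityˡ (μ′ v))) ⟩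
  ⟦ b ⟧ ℚ.* μ zero ℚ.+ ∑ (fins (suc m)) (λ v → 1ℚ ℚ.* μ′ v)     ≡⟨ cong (⟦ b ⟧ ℚ.* μ zero ℚ.+_) (carry-∑ b p μ (λ _ → 1ℚ)) ⟩
  ⟦ b ⟧ ℚ.* μ zero ℚ.+ (∑ (fins (suc m)) (λ v → 1ℚ ℚ.* μ (suc v)) ℚ.+ 1ℚ ℚ.* (⟦ not b ⟧ ℚ.* μ zero))
    ≡⟨ cong (λ s → ⟦ b ⟧ ℚ.* μ zero ℚ.+ (s ℚ.+ 1ℚ ℚ.* (⟦ not b ⟧ ℚ.* μ zero))) (∑-cong (fins (suc m)) λ v → ℚ.*-identityˡ (μ (suc v))) ⟩
  ⟦ b ⟧ ℚ.* μ zero ℚ.+ (∑ (fins (suc m)) (μ ∘ suc) ℚ.+ 1ℚ ℚ.* (⟦ not b ⟧ ℚ.* μ zero))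
    ≡⟨ complement b (μ zero) (∑ (fins (suc m)) (μ ∘ suc)) ⟩
  μ zero ℚ.+ ∑ (fins (suc m)) (μ ∘ suc)                         ≡⟨ sym (∑-fins-suc (suc m) μ) ⟩
  ∑ (fins (suc (suc m))) μ                                      ∎
  where
  open ℚ.≤-Reasoning
  b : Bool
  b = ⌊ τ ℚ.≤? μ zero ⌋
  μ′ : Fin (suc m) → ℚ
  μ′ = carry b p μ
  marked : ⟦ b ⟧ ℚ.* τ ℚ.≤ ⟦ b ⟧ ℚ.* μ zero
  marked with τ ℚ.≤? μ zero
  ... | yes τ≤ = *≤ 0≤1 τ≤
  ... | no  _  = ℚ.≤-reflexive (trans (ℚ.*-zeroˡ τ) (sym (ℚ.*-zeroˡ (μ zero))))
  complement : ∀ b x s → ⟦ b ⟧ ℚ.* x ℚ.+ (s ℚ.+ 1ℚ ℚ.* (⟦ not b ⟧ ℚ.* x)) ≡ x ℚ.+ s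
  complement true  = (∀ x s → 1ℚ ℚ.* x ℚ.+ (s ℚ.+ 1ℚ ℚ.* (0ℚ ℚ.* x)) ≡ x ℚ.+ s) ∋ solve-∀ ℚ-ring
  complement false = (∀ x s → 0ℚ ℚ.* x ℚ.+ (s ℚ.+ 1ℚ ℚ.* (1ℚ ℚ.* x)) ≡ x ℚ.+ s) ∋ solve-∀ ℚ-ring

-- No marked edge lies on the path from the vertex up to, and including, the edge.
local : ∀ {m} → RTree m → (Fin m → Bool) → Fin m → Fin (suc m) → Bool
local (attach p T) mk zero    zero    = not (mk zero)
local (attach p T) mk zero    (suc v) = false
local (attach p T) mk (suc e) zero    = not (mk zero) ∧ local T (mk ∘ suc) e p
local (attach p T) mk (suc e) (suc v) = local T (mk ∘ suc) e v

⟦∧⟧ : ∀ a b → ⟦ a ∧ b ⟧ ≡ ⟦ a ⟧ ℚ.* ⟦ b ⟧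
⟦∧⟧ true  b = sym (ℚ.*-identityˡ ⟦ b ⟧)
⟦∧⟧ false b = sym (ℚ.*-zeroˡ ⟦ b ⟧)

-- For an unmarked e this sum is exactly the mass accumulated at e, which did not reach τ; for a
-- marked e no vertex is local.
local-mass : ∀ {m} (T : RTree m) τ μ → 0ℚ ℚ.≤ τ → ∀ e → ∑ (fins (suc m)) (λ v → ⟦ local T (mark T τ μ) e v ⟧ ℚ.* μ v) ℚ.≤ τ
local-mass {suc m} (attach p T) τ μ 0≤τ zero =
  ≡≤ (trans (∑-cong (fins (2 + m)) pointwise) (∑-delta zero (λ v → ⟦ not b ⟧ ℚ.* μ v))) unmarked
  where
  b : Bool
  b = ⌊ τ ℚ.≤? μ zero ⌋
  pointwise : ∀ v → ⟦ local (attach p T) (mark (attach p T) τ μ) zero v ⟧ ℚ.* μ v ≡ ⟦ ⌊ v Fin.≟ zero ⌋ ⟧ ℚ.* (⟦ not b ⟧ ℚ.* μ v)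
  pointwise zero    = sym (ℚ.*-identityˡ (⟦ not b ⟧ ℚ.* μ zero))
  pointwise (suc v) = trans (ℚ.*-zeroˡ (μ (suc v))) (sym (ℚ.*-zeroˡ (⟦ not b ⟧ ℚ.* μ (suc v))))
  unmarked : ⟦ not b ⟧ ℚ.* μ zero ℚ.≤ τ
  unmarked with τ ℚ.≤? μ zero
  ... | yes _  = ≡≤ (ℚ.*-zeroˡ (μ zero)) 0≤τ
  ... | no τ≰  = ≡≤ (ℚ.*-identityˡ (μ zero)) (ℚ.<⇒≤ (ℚ.≰⇒> τ≰))
local-mass {suc m} (attach p T) τ μ 0≤τ (suc e) = begin
  ⟦ not b ∧ L p ⟧ ℚ.* μ zero ℚ.+ ∑ (map suc (fins (suc m))) h           ≡⟨ cong₂ ℚ._+_ (cong (ℚ._* μ zero) (⟦∧⟧ (not b) (L p))) (∑-map suc (fins (suc m)) h) ⟩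
  ⟦ not b ⟧ ℚ.* ⟦ L p ⟧ ℚ.* μ zero ℚ.+ ∑ (fins (suc m)) (λ v → ⟦ L v ⟧ ℚ.* μ (suc v)) ≡⟨ ((∀ a b c d → a ℚ.* b ℚ.* c ℚ.+ d ≡ d ℚ.+ b ℚ.* (a ℚ.* c)) ∋ solve-∀ ℚ-ring) ⟦ not b ⟧ ⟦ L p ⟧ (μ zero) (∑ (fins (suc m)) (λ v → ⟦ L v ⟧ ℚ.* μ (suc v))) ⟩
  ∑ (fins (suc m)) (λ v → ⟦ L v ⟧ ℚ.* μ (suc v)) ℚ.+ ⟦ L p ⟧ ℚ.* (⟦ not b ⟧ ℚ.* μ zero) ≡⟨ sym (carry-∑ b p μ (λ v → ⟦ L v ⟧)) ⟩
  ∑ (fins (suc m)) (λ v → ⟦ L v ⟧ ℚ.* carry b p μ v)                    ≤⟨ local-mass T τ (carry b p μ) 0≤τ e ⟩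
  τ                                                                     ∎
  where
  open ℚ.≤-Reasoning
  b : Bool
  b = ⌊ τ ℚ.≤? μ zero ⌋
  L : Fin (suc m) → Bool
  L = local T (mark T τ (carry b p μ)) e
  h : Fin (suc (suc m)) → ℚ
  h v = ⟦ local (attach p T) (mark (attach p T) τ μ) (suc e) v ⟧ ℚ.* μ v

nearest : ∀ {m} → RTree m → (Fin m → Bool) → Fin (suc m) → Fin (suc m)
nearest leaf         mk v       = v
nearest (attach p T) mk zero    = if mk zero then zero else suc (nearest T (mk ∘ suc) p)
nearest (attach p T) mk (suc v) = suc (nearest T (mk ∘ suc) v)

-- The length of the path from v up to `nearest v`, where ℓ v is the length of the edge above v.
climb : ∀ {m} → RTree m → (Fin m → Bool) → (Fin (suc m) → ℚ) → Fin (suc m) → ℚ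
climb leaf         mk ℓ v       = 0ℚ
climb (attach p T) mk ℓ zero    = if mk zero then 0ℚ else ℓ zero ℚ.+ climb T (mk ∘ suc) (ℓ ∘ suc) p
climb (attach p T) mk ℓ (suc v) = climb T (mk ∘ suc) (ℓ ∘ suc) v

-- All edges climbed are unmarked, so their masses are passed on. The topmost has accumulated at
-- least the mass `μ v` of the bottom edge and the lengths c - ℓ v of the others; being unmarked, it
-- stays below τ.
climb-≤-aux : ∀ {m} (T : RTree m) τ μ ℓ → 0ℚ ℚ.≤ τ → (∀ v → 0ℚ ℚ.≤ ℓ v) → (∀ v → ℓ v ℚ.≤ μ v) → ∀ v →
              let c = climb T (mark T τ μ) ℓ v in c ≡ 0ℚ ⊎ μ v ℚ.+ c ℚ.≤ τ ℚ.+ ℓ v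
climb-≤-aux leaf         τ μ ℓ 0≤τ 0≤ℓ ℓ≤μ v = inj₁ refl
climb-≤-aux (attach p T) τ μ ℓ 0≤τ 0≤ℓ ℓ≤μ zero with τ ℚ.≤? μ zero
... | yes _ = inj₁ refl
... | no τ≰ = inj₂ (case climb-≤-aux T τ (carry false p μ) (ℓ ∘ suc) 0≤τ (0≤ℓ ∘ suc) ℓ≤carry p of λ
  { (inj₁ c≡0) → ≤-by (ℚ.<⇒≤ (ℚ.≰⇒> τ≰)) (trans (cong (λ c → μ zero ℚ.+ (ℓ zero ℚ.+ c) ℚ.+ τ) c≡0) (((∀ μ ℓ τ → μ ℚ.+ (ℓ ℚ.+ 0ℚ) ℚ.+ τ ≡ τ ℚ.+ ℓ ℚ.+ μ) ∋ solve-∀ ℚ-ring) (μ zero) (ℓ zero) τ))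
  ; (inj₂ le)  → ≤-by (≡≤ (cong (ℚ._+ climb T (mark T τ (carry false p μ)) (ℓ ∘ suc) p) (sym carry-p)) le +≤ ℓ≤μ (suc p))
      (((∀ μ ℓ τ c m′ ℓ′ → μ ℚ.+ (ℓ ℚ.+ c) ℚ.+ (τ ℚ.+ ℓ′ ℚ.+ m′) ≡ τ ℚ.+ ℓ ℚ.+ (m′ ℚ.+ μ ℚ.+ c ℚ.+ ℓ′)) ∋ solve-∀ ℚ-ring) (μ zero) (ℓ zero) τ (climb T (mark T τ (carry false p μ)) (ℓ ∘ suc) p) (μ (suc p)) (ℓ (suc p))) })
  where
  ℓ≤carry : ∀ v → ℓ (suc v) ℚ.≤ carry false p μ v
  ℓ≤carry v = ℚ.≤-trans (ℓ≤μ (suc v)) (≤-by (0≤* 0≤⟦ ⌊ v Fin.≟ p ⌋ ⟧ (0≤* 0≤1 (ℚ.≤-trans (0≤ℓ zero) (ℓ≤μ zero))))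
    (((∀ x y → x ℚ.+ y ≡ x ℚ.+ y ℚ.+ 0ℚ) ∋ solve-∀ ℚ-ring) (μ (suc v)) (⟦ ⌊ v Fin.≟ p ⌋ ⟧ ℚ.* (1ℚ ℚ.* μ zero))))
  carry-p : carry false p μ p ≡ μ (suc p) ℚ.+ μ zero
  carry-p with p Fin.≟ p
  ... | yes _  = cong (μ (suc p) ℚ.+_) (trans (ℚ.*-identityˡ _) (ℚ.*-identityˡ (μ zero)))
  ... | no p≢p = contradiction refl p≢p
climb-≤-aux (attach p T) τ μ ℓ 0≤τ 0≤ℓ ℓ≤μ (suc v) =
  Sum.map₂ (λ le → ℚ.≤-trans (ℚ.+-monoˡ-≤ _ (μ≤carry v)) le) (climb-≤-aux T τ (carry b p μ) (ℓ ∘ suc) 0≤τ (0≤ℓ ∘ suc) (λ v → ℚ.≤-trans (ℓ≤μ (suc v)) (μ≤carry v)) v)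
  where
  b : Bool
  b = ⌊ τ ℚ.≤? μ zero ⌋
  μ≤carry : ∀ v → μ (suc v) ℚ.≤ carry b p μ v
  μ≤carry v = ≤-by (0≤* 0≤⟦ ⌊ v Fin.≟ p ⌋ ⟧ (0≤* 0≤⟦ not b ⟧ (ℚ.≤-trans (0≤ℓ zero) (ℓ≤μ zero))))
    (((∀ x y → x ℚ.+ y ≡ x ℚ.+ y ℚ.+ 0ℚ) ∋ solve-∀ ℚ-ring) (μ (suc v)) (⟦ ⌊ v Fin.≟ p ⌋ ⟧ ℚ.* (⟦ not b ⟧ ℚ.* μ zero)))

climb-≤ : ∀ {m} (T : RTree m) τ ℓ → 0ℚ ℚ.≤ τ → (∀ v → 0ℚ ℚ.≤ ℓ v) → ∀ v → climb T (mark T τ ℓ) ℓ v ℚ.≤ τ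
climb-≤ T τ ℓ 0≤τ 0≤ℓ v with climb-≤-aux T τ ℓ ℓ 0≤τ 0≤ℓ (λ _ → ℚ.≤-refl) v
... | inj₁ c≡0 = ≡≤ c≡0 0≤τ
... | inj₂ le  = ≤-by le (((∀ c τ ℓ → c ℚ.+ (τ ℚ.+ ℓ) ≡ τ ℚ.+ (ℓ ℚ.+ c)) ∋ solve-∀ ℚ-ring) (climb T (mark T τ ℓ) ℓ v) τ (ℓ v))

module _ {V : Set} (δ : V → V → ℕ) (δ-refl : ∀ x → δ x x ≡ 0) (triangle : ∀ x y z → δ x z ≤ δ x y + δ y z) where

  nearest-≤-climb : ∀ {m} (T : RTree m) mk (pos : Fin (suc m) → V) ℓ →
    (∀ e → ι (δ (pos (Fin.inject₁ e)) (pos (parent T e))) ℚ.≤ ℓ (Fin.inject₁ e)) →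
    ∀ v → ι (δ (pos v) (pos (nearest T mk v))) ℚ.≤ climb T mk ℓ v
  nearest-≤-climb leaf         mk pos ℓ ℓ≥ v = ℚ.≤-reflexive (trans (cong ι (δ-refl (pos v))) ι-0)
  nearest-≤-climb (attach p T) mk pos ℓ ℓ≥ zero with mk zero
  ... | true  = ℚ.≤-reflexive (trans (cong ι (δ-refl (pos zero))) ι-0)
  ... | false = ℚ.≤-trans (≤≡ (ι-mono (triangle (pos zero) (pos (suc p)) _)) (ι-+ (δ (pos zero) (pos (suc p))) _))
                  (ℓ≥ zero +≤ nearest-≤-climb T (mk ∘ suc) (pos ∘ suc) (ℓ ∘ suc) (ℓ≥ ∘ suc) p)
  nearest-≤-climb (attach p T) mk pos ℓ ℓ≥ (suc v) = nearest-≤-climb T (mk ∘ suc) (pos ∘ suc) (ℓ ∘ suc) (ℓ≥ ∘ suc) v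

-- The possible values of `nearest`: the lower ends of marked edges, and the root, where a climb
-- that meets no mark ends.
netPoints : ∀ {m} → (Fin m → Bool) → List (Fin (suc m))
netPoints {m} mk = Fin.fromℕ m ∷ map Fin.inject₁ (filterᵇ mk (fins m))

∈-filterᵇ⁺ : ∀ {A : Set} (p : A → Bool) {x xs} → x ∈ xs → p x ≡ true → x ∈ filterᵇ p xs
∈-filterᵇ⁺ p {x} {xs = _ ∷ _} (here refl) px with p x
∈-filterᵇ⁺ p                  (here refl) refl | true = here refl
∈-filterᵇ⁺ p {xs = y ∷ _} (there x∈) px with p y
... | true  = there (∈-filterᵇ⁺ p x∈ px)
... | false = ∈-filterᵇ⁺ p x∈ px

∈-filterᵇ⁻ : ∀ {A : Set} (p : A → Bool) xs {x} → x ∈ filterᵇ p xs → x ∈ xs × p x ≡ true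
∈-filterᵇ⁻ p (y ∷ xs) x∈ with p y in eq
∈-filterᵇ⁻ p (y ∷ xs) (here refl) | true = here refl , eq
∈-filterᵇ⁻ p (y ∷ xs) (there x∈)  | true with ∈-filterᵇ⁻ p xs x∈
... | x∈′ , px = there x∈′ , px
∈-filterᵇ⁻ p (y ∷ xs) x∈          | false with ∈-filterᵇ⁻ p xs x∈
... | x∈′ , px = there x∈′ , px

nearest-∈-net : ∀ {m} (T : RTree m) mk v → nearest T mk v ∈ netPoints mk
nearest-∈-net {m} T mk v with cases T mk v
  where
  cases : ∀ {m} (T : RTree m) mk v → nearest T mk v ≡ Fin.fromℕ m ⊎ ∃[ e ] mk e ≡ true × nearest T mk v ≡ Fin.inject₁ e
  cases leaf         mk zero = inj₁ refl
  cases (attach p T) mk zero with mk zero in eq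
  ... | true  = inj₂ (zero , eq , refl)
  ... | false = Sum.map (cong suc) (λ { (e , me , eq) → suc e , me , cong suc eq }) (cases T (mk ∘ suc) p)
  cases (attach p T) mk (suc v) = Sum.map (cong suc) (λ { (e , me , eq) → suc e , me , cong suc eq }) (cases T (mk ∘ suc) v)
... | inj₁ eq            = here eq
... | inj₂ (e , me , eq) = there (subst (_∈ map Fin.inject₁ (filterᵇ mk (fins m))) (sym eq) (∈.∈-map⁺ Fin.inject₁ (∈-filterᵇ⁺ mk (∈-fins e) me)))

length-netPoints : ∀ {m} (mk : Fin m → Bool) → ι (length (netPoints mk)) ≡ 1ℚ ℚ.+ ∑ (fins m) (λ e → ⟦ mk e ⟧)
length-netPoints {m} mk = trans (ι-suc _) (cong (1ℚ ℚ.+_)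
  (trans (cong ι (List.length-map Fin.inject₁ (filterᵇ mk (fins m)))) (count-filter mk (fins m))))

-- The local edges above v, from bottom to top.
upward : ∀ {m} → RTree m → (Fin m → Bool) → Fin (suc m) → List (Fin m)
upward leaf         mk v       = []
upward (attach p T) mk zero    = if mk zero then [] else zero ∷ map suc (upward T (mk ∘ suc) p)
upward (attach p T) mk (suc v) = map suc (upward T (mk ∘ suc) v)

upward-local : ∀ {m} (T : RTree m) mk v {e} → e ∈ upward T mk v → local T mk e v ≡ true
upward-local (attach p T) mk zero e∈ with mk zero in eq
upward-local (attach p T) mk zero (here refl) | false = cong not eq
upward-local (attach p T) mk zero (there e∈)  | false with ∈.∈-map⁻ suc e∈
... | e , e∈′ , refl = cong₂ _∧_ (cong not eq) (upward-local T (mk ∘ suc) p e∈′)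
upward-local (attach p T) mk (suc v) e∈ with ∈.∈-map⁻ suc e∈
... | e , e∈′ , refl = upward-local T (mk ∘ suc) v e∈′

local-upward : ∀ {m} (T : RTree m) mk v {e} → local T mk e v ≡ true → e ∈ upward T mk v
local-upward (attach p T) mk zero    {zero}  l with mk zero
... | false = here refl
local-upward (attach p T) mk zero    {suc e} l with mk zero
... | false = there (∈.∈-map⁺ suc (local-upward T (mk ∘ suc) p l))
local-upward (attach p T) mk (suc v) {suc e} l = ∈.∈-map⁺ suc (local-upward T (mk ∘ suc) v l)

local-below : ∀ {m} (T : RTree m) mk {e v} → local T mk e v ≡ true → below T e v ≡ true
local-below (attach p T) mk {zero}  {zero}  l = refl
local-below (attach p T) mk {suc e} {zero}  l with mk zero
... | false = local-below T (mk ∘ suc) l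
local-below (attach p T) mk {suc e} {suc v} l = local-below T (mk ∘ suc) l

blocked : ∀ {m} (T : RTree m) mk {e v} → below T e v ≡ true → local T mk e v ≡ false →
          ∃[ e′ ] mk e′ ≡ true × below T e′ v ≡ true × below T e (Fin.inject₁ e′) ≡ true
blocked (attach p T) mk {zero}  {zero}  b l with mk zero in eq
... | true  = zero , eq , refl , refl
blocked (attach p T) mk {suc e} {zero}  b l with mk zero in eq
... | true  = zero , eq , refl , b
... | false with blocked T (mk ∘ suc) b l
...   | e′ , me , b′ , b″ = suc e′ , me , b′ , b″
blocked (attach p T) mk {suc e} {suc v} b l with blocked T (mk ∘ suc) b l
... | e′ , me , b′ , b″ = suc e′ , me , b′ , b″

upward-ordered : ∀ {m} (T : RTree m) mk v → AllPairs (λ e e′ → below T e′ (Fin.inject₁ e) ≡ true) (upward T mk v)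
upward-ordered leaf         mk v    = []
upward-ordered (attach p T) mk zero with mk zero
... | true  = []
... | false = All.map⁺ (All.tabulate λ {e} e∈ → local-below T (mk ∘ suc) (upward-local T (mk ∘ suc) p e∈)) ∷ AllPairs.map⁺ (upward-ordered T (mk ∘ suc) p)
upward-ordered (attach p T) mk (suc v) = AllPairs.map⁺ (upward-ordered T (mk ∘ suc) v)

upward-unique : ∀ {m} (T : RTree m) mk v → Unique (upward T mk v)
upward-unique leaf         mk v    = []
upward-unique (attach p T) mk zero with mk zero
... | true  = []
... | false = All.map⁺ (All.tabulate λ _ ()) ∷ Unique.map⁺ Fin.suc-injective (upward-unique T (mk ∘ suc) p)
upward-unique (attach p T) mk (suc v) = Unique.map⁺ Fin.suc-injective (upward-unique T (mk ∘ suc) v)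

-- Windows on local tree paths

∈-take : ∀ {A : Set} {x : A} k {xs} → x ∈ take k xs → x ∈ xs
∈-take (suc k) {_ ∷ _} (here eq)  = here eq
∈-take (suc k) {_ ∷ _} (there x∈) = there (∈-take k x∈)

∈-drop : ∀ {A : Set} {x : A} k {xs} → x ∈ drop k xs → x ∈ xs
∈-drop zero            x∈ = x∈
∈-drop (suc k) {_ ∷ _} x∈ = there (∈-drop k x∈)

∈-take⇒nth : ∀ {A : Set} {x : A} k {xs} → x ∈ take k xs → ∃[ i ] i < k × nth xs i ≡ just x
∈-take⇒nth (suc k) {_ ∷ _} (here refl) = 0 , s≤s z≤n , refl
∈-take⇒nth (suc k) {_ ∷ _} (there x∈) with ∈-take⇒nth k x∈
... | i , i<k , eq = suc i , s≤s i<k , eq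

nth-drop : ∀ {A : Set} j (xs : List A) i → nth (drop j xs) i ≡ nth xs (j + i)
nth-drop zero    xs       i = refl
nth-drop (suc j) []       i = refl
nth-drop (suc j) (_ ∷ xs) i = nth-drop j xs i

nth-∈ : ∀ {A : Set} {x : A} xs i → nth xs i ≡ just x → x ∈ xs
nth-∈ (y ∷ xs) zero    refl = here refl
nth-∈ (y ∷ xs) (suc i) eq   = there (nth-∈ xs i eq)

nth-injective : ∀ {A : Set} {x : A} {xs} → Unique xs → ∀ i j → nth xs i ≡ just x → nth xs j ≡ just x → i ≡ j
nth-injective {xs = _ ∷ _}  _          zero    zero    _    _    = refl
nth-injective {xs = _ ∷ xs} (x∉ ∷ _)   zero    (suc j) refl eq   = contradiction refl (All.lookup x∉ (nth-∈ xs j eq))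
nth-injective {xs = _ ∷ xs} (x∉ ∷ _)   (suc i) zero    eq   refl = contradiction refl (All.lookup x∉ (nth-∈ xs i eq))
nth-injective {xs = _ ∷ _}  (_ ∷ uniq) (suc i) (suc j) eq   eq′  = cong suc (nth-injective uniq i j eq eq′)

Unique-reverse : ∀ {A : Set} {xs : List A} → Unique xs → Unique (reverse xs)
Unique-reverse {A} {xs} = ↭ₛ.Unique-resp-↭ (≡.setoid A) (↭.↭⇒↭ₛ (↭-sym (↭.↭-reverse xs)))

length-concatMap-≡ : ∀ {A B : Set} (h : A → List B) xs → ι (length (concatMap h xs)) ≡ ∑ xs (λ x → ι (length (h x)))
length-concatMap-≡ h xs = trans (sym (∑-one (concatMap h xs))) (trans (∑-concatMap h xs _) (∑-cong xs λ x → ∑-one (h x)))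

-- Lengths are measured in thirds of a unit, and a window spans four thirds of the distance it
-- is tested against.
resolution span : ℕ
resolution = 3
span       = 4

module Lines {m} (T : RTree m) (mk : Fin m → Bool) (ℓ : Fin m → ℕ) where

  Elem : Set
  Elem = Fin m × ℕ

  open DecMembership (≡-dec (Fin._≟_ {m}) ℕ._≟_) public using (_∈?_)

  unitsOf : Fin m → List Elem
  unitsOf e = map (e ,_) (upTo (resolution * ℓ e))

  units : List Elem
  units = concatMap unitsOf (fins m)

  climbing : Fin (suc m) → Fin (suc m) → List (Fin m)
  climbing u v = filterᵇ (λ e → not (below T e v)) (upward T mk u)

  -- The line runs from the top down to v and goes on from u up to the top, so the two bottom ends
  -- meet in the middle. The edges assigned to a pair are closed downwards on both sides
  -- (`assigned-below`); in this order they form a single interval.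
  lineEdges : Fin (suc m) × Fin (suc m) → List (Fin m)
  lineEdges (u , v) = reverse (climbing v u) ++ climbing u v

  line : Fin (suc m) × Fin (suc m) → List Elem
  line f = concatMap unitsOf (lineEdges f)

  -- Windows start on a grid of step w, a third of the distance in units of a third. A coarse grid
  -- lets a unit lie in at most `span` windows of a pair, at the price of one extra cell in
  -- `interval`.
  window : Fin (suc m) × Fin (suc m) → ℕ → ℕ → List Elem
  window f w i = take (span * w) (drop (i * w) (line f))

  fits : Fin (suc m) × Fin (suc m) → ℕ → ℕ → Bool
  fits f w i = ⌊ i * w + span * w ℕ.≤? length (line f) ⌋

  wins : Fin (suc m) × Fin (suc m) → ℕ → List (List Elem)
  wins f w = map (window f w) (filterᵇ (fits f w) (upTo (length (line f))))

  mem : Elem → List Elem → Bool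
  mem q g = ⌊ q ∈? g ⌋

  -- A condition for a unit to lie in a window of the pair that does not involve the distance, so it
  -- can be tested before the query.
  near : Elem → Fin (suc m) × Fin (suc m) → Bool
  near (e , _) (u , v) = local T mk e u ∨ local T mk e v

  mem⁺ : ∀ {q g} → q ∈ g → mem q g ≡ true
  mem⁺ {q} {g} q∈ with q ∈? g
  ... | yes _  = refl
  ... | no q∉ = contradiction q∈ q∉

  mem⁻ : ∀ {q g} → mem q g ≡ true → q ∈ g
  mem⁻ {q} {g} eq with q ∈? g
  ... | yes q∈ = q∈

  ∈-unitsOf : ∀ {e q} → q ∈ unitsOf e → proj₁ q ≡ e
  ∈-unitsOf {e} q∈ with ∈.∈-map⁻ (e ,_) q∈
  ... | _ , _ , refl = refl

  ∈-concatMap-unitsOf : ∀ es {q} → q ∈ concatMap unitsOf es → proj₁ q ∈ es × q ∈ unitsOf (proj₁ q)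
  ∈-concatMap-unitsOf es q∈ = Any.map (λ q∈e → ∈-unitsOf q∈e) any , own any
    where
    any = ∈.∈-concatMap⁻ unitsOf {xs = es} q∈
    own : ∀ {es q} → Any (λ e → q ∈ unitsOf e) es → q ∈ unitsOf (proj₁ q)
    own (here {x = e} q∈e) = subst (λ e → _ ∈ unitsOf e) (sym (∈-unitsOf q∈e)) q∈e
    own (there a)  = own a

  concatMap-unitsOf-∈ : ∀ {es q} → proj₁ q ∈ es → q ∈ unitsOf (proj₁ q) → q ∈ concatMap unitsOf es
  concatMap-unitsOf-∈ {es} e∈ q∈ = ∈.∈-concatMap⁺ unitsOf {xs = es} (Any.map (λ { refl → q∈ }) e∈)

  unitsOf-unique : ∀ e → Unique (unitsOf e)
  unitsOf-unique e = Unique.map⁺ (λ { refl → refl }) (Unique.upTo⁺ _)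

  concatMap-unitsOf-unique : ∀ {es} → Unique es → Unique (concatMap unitsOf es)
  concatMap-unitsOf-unique {es} unique = Unique.concat⁺ (All.map⁺ (All.tabulate λ _ → unitsOf-unique _))
    (AllPairs.map⁺ (AllPairs.map disjoint unique))
    where
    disjoint : ∀ {e e′} → e ≢ e′ → ∀ {q} → ¬ (q ∈ unitsOf e × q ∈ unitsOf e′)
    disjoint e≢e′ (q∈ , q∈′) = e≢e′ (trans (sym (∈-unitsOf q∈)) (∈-unitsOf q∈′))

  climbing⁻ : ∀ u v {e} → e ∈ climbing u v → local T mk e u ≡ true × below T e v ≡ false
  climbing⁻ u v e∈ with ∈-filterᵇ⁻ (λ e → not (below T e v)) (upward T mk u) e∈
  ... | e∈′ , nb = upward-local T mk u e∈′ , not-true nb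
    where
    not-true : ∀ {b} → not b ≡ true → b ≡ false
    not-true {false} _ = refl

  lineEdges⁻ : ∀ f {e} → e ∈ lineEdges f → cross T f e ≡ true × (∀ j → near (e , j) f ≡ true)
  lineEdges⁻ (u , v) {e} e∈ with ∈.∈-++⁻ (reverse (climbing v u)) e∈
  ... | inj₂ e∈′ with climbing⁻ u v e∈′
  ...   | l , b rewrite l | local-below T mk l | b = refl , λ _ → refl
  lineEdges⁻ (u , v) {e} e∈ | inj₁ e∈′ with climbing⁻ v u (Any.reverse⁻ e∈′)
  ...   | l , b rewrite l | local-below T mk l | b = refl , λ _ → Bool.∨-zeroʳ (local T mk e u)

  climbing-unique : ∀ u v → Unique (climbing u v)
  climbing-unique u v = Unique.filter⁺ _ (upward-unique T mk u)

  lineEdges-unique : ∀ f → Unique (lineEdges f)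
  lineEdges-unique (u , v) = Unique.++⁺ (Unique-reverse (climbing-unique v u)) (climbing-unique u v) disjoint
    where
    disjoint : ∀ {e} → e ∈ reverse (climbing v u) × e ∈ climbing u v → ⊥
    disjoint (e∈ , e∈′) with climbing⁻ v u (Any.reverse⁻ e∈) | climbing⁻ u v e∈′
    ... | l , _ | _ , b = contradiction (trans (sym (local-below T mk l)) b) λ ()

  line-unique : ∀ f → Unique (line f)
  line-unique f = concatMap-unitsOf-unique (lineEdges-unique f)

  units-unique : Unique units
  units-unique = concatMap-unitsOf-unique (Unique-fins m)

  line⊆units : ∀ f {q} → q ∈ line f → q ∈ units
  line⊆units f q∈ = concatMap-unitsOf-∈ (∈-fins _) (proj₂ (∈-concatMap-unitsOf (lineEdges f) q∈))

  window⊆line : ∀ f w i {q} → q ∈ window f w i → q ∈ line f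
  window⊆line f w i q∈ = ∈-drop (i * w) (∈-take (span * w) q∈)

  fits⁻ : ∀ f w i → fits f w i ≡ true → i * w + span * w ≤ length (line f)
  fits⁻ f w i eq with i * w + span * w ℕ.≤? length (line f)
  ... | yes le = le

  window-length : ∀ f w i → i * w + span * w ≤ length (line f) → length (window f w i) ≡ span * w
  window-length f w i le = trans (List.length-take (span * w) (drop (i * w) (line f)))
    (trans (cong (span * w ℕ.⊓_) (List.length-drop (i * w) (line f)))
      (ℕ.m≤n⇒m⊓n≡m (ℕ.≤-trans (ℕ.≤-reflexive (sym (ℕ.m+n∸m≡n (i * w) (span * w)))) (ℕ.∸-monoˡ-≤ (i * w) le))))

  wins⁻ : ∀ f w {g} → g ∈ wins f w → ∃[ i ] g ≡ window f w i × length g ≡ span * w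
  wins⁻ f w g∈ with ∈.∈-map⁻ (window f w) g∈
  ... | i , i∈ , refl = i , refl , window-length f w i (fits⁻ f w i (proj₂ (∈-filterᵇ⁻ (fits f w) (upTo (length (line f))) i∈)))

  wins⁺ : ∀ f w .{{_ : NonZero w}} i → i * w + span * w ≤ length (line f) → window f w i ∈ wins f w
  wins⁺ f w i le = ∈.∈-map⁺ (window f w) (∈-filterᵇ⁺ (fits f w) (∈.∈-upTo⁺ i<) fit)
    where
    fit : fits f w i ≡ true
    fit with i * w + span * w ℕ.≤? length (line f)
    ... | yes _ = refl
    ... | no ≰  = contradiction le ≰
    i< : i < length (line f)
    i< = ℕ.≤-trans (ℕ.≤-trans (s≤s (ℕ.m≤m*n i w)) (ℕ.≤-trans (ℕ.≤-reflexive (ℕ.+-comm 1 (i * w)))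
      (ℕ.+-monoʳ-≤ (i * w) (ℕ.≤-trans (s≤s z≤n) (ℕ.m≤m*n span w))))) le

  near-mem : ∀ f w q {g} → g ∈ wins f w → mem q g ≡ true → near q f ≡ true
  near-mem f w q g∈ q∈ with wins⁻ f w g∈
  ... | i , refl , _ = proj₂ (lineEdges⁻ f (proj₁ (∈-concatMap-unitsOf (lineEdges f) (window⊆line f w i (mem⁻ q∈))))) (proj₂ q)

  wins-unique : ∀ f w {g} → g ∈ wins f w → Unique g
  wins-unique f w g∈ with wins⁻ f w g∈
  ... | i , refl , _ = Unique.take⁺ (span * w) (Unique.drop⁺ (i * w) (line-unique f))

  wins⊆units : ∀ f w {g} → g ∈ wins f w → ∀ {q} → q ∈ g → q ∈ units
  wins⊆units f w g∈ q∈ with wins⁻ f w g∈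
  ... | i , refl , _ = line⊆units f (window⊆line f w i q∈)

  wins-cross : ∀ f w {g} → g ∈ wins f w → ∀ {q} → q ∈ g → cross T f (proj₁ q) ≡ true
  wins-cross f w g∈ q∈ with wins⁻ f w g∈
  ... | i , refl , _ = proj₁ (lineEdges⁻ f (proj₁ (∈-concatMap-unitsOf (lineEdges f) (window⊆line f w i q∈))))

  -- The windows containing a fixed position j are those with j / w ∸ 4 < i ≤ j / w.
  few-wins : ∀ f w .{{_ : NonZero w}} q → length (filterᵇ (mem q) (wins f w)) ≤ span
  few-wins f w q = ℕ.≤-trans (ℕ.≤-reflexive (ι-injective length-map-filter)) (bound is (filterᵇ-unique (Unique.filter⁺ (Bool.T? ∘ fits f w) (Unique.upTo⁺ (length (line f))))) λ i∈ → mem⁻ (proj₂ (∈-filterᵇ⁻ (mem q ∘ window f w) js i∈)))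
    where
    js is : List ℕ
    js = filterᵇ (fits f w) (upTo (length (line f)))
    is = filterᵇ (mem q ∘ window f w) js
    filterᵇ-unique : Unique js → Unique is
    filterᵇ-unique = Unique.filter⁺ _
    length-map-filter : ι (length (filterᵇ (mem q) (map (window f w) js))) ≡ ι (length is)
    length-map-filter = trans (count-filter (mem q) (map (window f w) js))
      (trans (∑-map (window f w) js (λ g → ⟦ mem q g ⟧)) (sym (count-filter (mem q ∘ window f w) js)))
    ι-injective : ∀ {a b} → ι a ≡ ι b → a ≡ b
    ι-injective eq = ℕ.≤-antisym (ι-cancel-≤ (ℚ.≤-reflexive eq)) (ι-cancel-≤ (ℚ.≤-reflexive (sym eq)))
    position : ∀ i → q ∈ window f w i → ∃[ j ] nth (line f) j ≡ just q × i * w ≤ j × j < (i + span) * w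
    position i q∈ with ∈-take⇒nth (span * w) q∈
    ... | k , k< , eq = i * w + k , trans (sym (nth-drop (i * w) (line f) k)) eq , ℕ.m≤m+n (i * w) k ,
      ℕ.≤-trans (ℕ.+-monoʳ-< (i * w) k<) (ℕ.≤-reflexive (sym (ℕ.*-distribʳ-+ w i span)))
    bound : ∀ is → Unique is → (∀ {i} → i ∈ is → q ∈ window f w i) → length is ≤ span
    bound []          _      _  = z≤n
    bound is@(i₀ ∷ _) unique q∈ with position i₀ (q∈ (here refl))
    ... | j , at-j , _ , _ = ℕ.≤-trans (length-⊆ unique inside) (ℕ.≤-reflexive (trans (List.length-map (λ r → j ℕ./ w ∸ r) (upTo span)) refl))
      where
      inside : ∀ {i} → i ∈ is → i ∈ map (λ r → j ℕ./ w ∸ r) (upTo span)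
      inside {i} i∈ with position i (q∈ i∈)
      ... | j′ , at-j′ , i*w≤ , <i+4 with nth-injective (line-unique f) j j′ at-j at-j′
      ...   | refl = subst (_∈ map (λ r → j ℕ./ w ∸ r) (upTo span)) (ℕ.m∸[m∸n]≡n i≤)
              (∈.∈-map⁺ (λ r → j ℕ./ w ∸ r) (∈.∈-upTo⁺ {i = j ℕ./ w ∸ i} (ℕ.m<n+o⇒m∸n<o (j ℕ./ w) i (ℕ.m<n*o⇒m/o<n <i+4))))
        where
        i≤ : i ≤ j ℕ./ w
        i≤ = ℕ.≤-trans (ℕ.≤-reflexive (sym (ℕ.m*n/n≡m i w))) (ℕ./-monoˡ-≤ w i*w≤)

  regroup : ∀ {g} → Unique g → (∀ {q} → q ∈ g → q ∈ units) → ∀ φ → ∑ units (λ q → ⟦ mem q g ⟧ ℚ.* φ q) ≡ ∑ g φ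
  regroup {g} unique g⊆ φ = trans (sym (∑-filter (λ q → mem q g) units φ))
    (∑-same φ (Unique.filter⁺ _ units-unique) unique
      (λ q∈ → mem⁻ (proj₂ (∈-filterᵇ⁻ (λ q → mem q g) units q∈))) (λ q∈ → ∈-filterᵇ⁺ (λ q → mem q g) (g⊆ q∈) (mem⁺ q∈)))
    where
    ∑-same : ∀ {xs ys : List Elem} f → Unique xs → Unique ys → (∀ {x} → x ∈ xs → x ∈ ys) → (∀ {x} → x ∈ ys → x ∈ xs) → ∑ xs f ≡ ∑ ys f
    ∑-same {[]}     {[]}     f _ _ _ _ = refl
    ∑-same {[]}     {y ∷ ys} f _ _ _ ⊇ = case ⊇ (here refl) of λ ()
    ∑-same {x ∷ xs} {ys} f (x∉ ∷ uxs) uys ⊆ ⊇ with ∈.∈-∃++ (⊆ (here refl))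
    ... | us , vs , refl with ↭ₛ.Unique-resp-↭ (≡.setoid Elem) (↭.↭⇒↭ₛ (↭.shift x us vs)) uys
    ...   | x∉′ ∷ uys′ = trans (cong (f x ℚ.+_) (∑-same f uxs uys′ sub sup)) (sym (∑-↭ f (↭.shift x us vs)))
      where
      sub : ∀ {y} → y ∈ xs → y ∈ us ++ vs
      sub y∈ with ∈-resp-↭ (↭.shift x us vs) (⊆ (there y∈))
      ... | here refl = contradiction refl (All.lookup x∉ y∈)
      ... | there y∈′ = y∈′
      sup : ∀ {y} → y ∈ us ++ vs → y ∈ xs
      sup y∈ with ⊇ (∈-resp-↭ (↭-sym (↭.shift x us vs)) (there y∈))
      ... | here refl = contradiction refl (All.lookup x∉′ y∈)
      ... | there y∈′ = y∈′

  ∑-unitsOf : ∀ e (φ : Fin m → ℚ) → ∑ (unitsOf e) (φ ∘ proj₁) ≡ ι (resolution * ℓ e) ℚ.* φ e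
  ∑-unitsOf e φ = trans (∑-map (e ,_) (upTo (resolution * ℓ e)) (φ ∘ proj₁))
    (trans (∑-const (upTo (resolution * ℓ e)) (φ e)) (cong (λ k → ι k ℚ.* φ e) (List.length-upTo (resolution * ℓ e))))

  ∑-units : ∀ (φ : Fin m → ℚ) → ∑ units (φ ∘ proj₁) ≡ ι resolution ℚ.* ∑ (fins m) (λ e → ι (ℓ e) ℚ.* φ e)
  ∑-units φ = trans (∑-concatMap unitsOf (fins m) (φ ∘ proj₁)) (trans (∑-cong (fins m) λ e → trans (∑-unitsOf e φ)
    (trans (cong (ℚ._* φ e) (ι-* resolution (ℓ e))) (ℚ.*-assoc (ι resolution) (ι (ℓ e)) (φ e)))) (∑-*ˡ (fins m) (ι resolution) (λ e → ι (ℓ e) ℚ.* φ e)))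

  length-units : ι (length units) ≡ ι resolution ℚ.* ∑ (fins m) (ι ∘ ℓ)
  length-units = trans (sym (∑-one units)) (trans (∑-units (λ _ → 1ℚ)) (cong (ι resolution ℚ.*_) (∑-cong (fins m) λ e → ℚ.*-identityʳ (ι (ℓ e)))))

  -- One end of the pair is among the at most b vertices local to the edge, the other is arbitrary.
  few-pairs : ∀ b → (∀ e → ∑ (fins (suc m)) (λ v → ⟦ local T mk e v ⟧) ℚ.≤ ι b) →
              ∀ q → length (filterᵇ (near q) (cartesianProduct (fins (suc m)) (fins (suc m)))) ≤ 2 * b * suc m
  few-pairs b few q@(e , _) = ι-cancel-≤ (begin
    ι (length (filterᵇ (near q) (cartesianProduct vs vs)))           ≡⟨ count-filter (near q) (cartesianProduct vs vs) ⟩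
    ∑ (cartesianProduct vs vs) (λ f → ⟦ near q f ⟧)                  ≡⟨ ∑-cartesian vs vs (λ f → ⟦ near q f ⟧) ⟩
    ∑ vs (λ u → ∑ vs (λ v → ⟦ near q (u , v) ⟧))                     ≤⟨ ∑-mono vs (λ u → ∑-mono vs λ v → ⟦∨⟧ (L u) (L v)) ⟩
    ∑ vs (λ u → ∑ vs (λ v → ⟦ L u ⟧ ℚ.+ ⟦ L v ⟧))                    ≡⟨ ∑-cong vs (λ u → trans (∑-+ vs (λ _ → ⟦ L u ⟧) (λ v → ⟦ L v ⟧)) (cong (ℚ._+ l) (∑-const vs ⟦ L u ⟧))) ⟩
    ∑ vs (λ u → N ℚ.* ⟦ L u ⟧ ℚ.+ l)                                 ≡⟨ trans (∑-+ vs (λ u → N ℚ.* ⟦ L u ⟧) (λ _ → l)) (cong₂ ℚ._+_ (∑-*ˡ vs N (λ u → ⟦ L u ⟧)) (∑-const vs l)) ⟩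
    N ℚ.* l ℚ.+ N ℚ.* l                                              ≤⟨ *≤ (0≤ι _) (few e) +≤ *≤ (0≤ι _) (few e) ⟩
    N ℚ.* ι b ℚ.+ N ℚ.* ι b                                          ≡⟨ cong (λ k → ι k ℚ.* ι b ℚ.+ ι k ℚ.* ι b) (length-fins (suc m)) ⟩
    ι (suc m) ℚ.* ι b ℚ.+ ι (suc m) ℚ.* ι b                          ≡⟨ sym (trans (cong ι (arith b m)) (trans (ι-+ (suc m * b) (suc m * b)) (cong₂ ℚ._+_ (ι-* (suc m) b) (ι-* (suc m) b)))) ⟩
    ι (2 * b * suc m)                                                ∎)
    where
    open ℚ.≤-Reasoning
    vs : List (Fin (suc m))
    vs = fins (suc m)
    L : Fin (suc m) → Bool
    L = local T mk e
    l N : ℚ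
    l = ∑ vs (λ v → ⟦ L v ⟧)
    N = ι (length vs)
    arith : ∀ b m → 2 * b * suc m ≡ suc m * b + suc m * b
    arith = ℕ-solve-∀
    ⟦∨⟧ : ∀ x y → ⟦ x ∨ y ⟧ ℚ.≤ ⟦ x ⟧ ℚ.+ ⟦ y ⟧
    ⟦∨⟧ true  y = ≡≤ (sym (ℚ.+-identityʳ 1ℚ)) (ℚ.+-monoʳ-≤ 1ℚ 0≤⟦ y ⟧)
    ⟦∨⟧ false y = ℚ.≤-reflexive (sym (ℚ.+-identityˡ ⟦ y ⟧))

-- Cheap tours from active windows

All-concatMap : ∀ {A B : Set} {P : B → Set} (h : A → List B) xs → (∀ x → All P (h x)) → All P (concatMap h xs)
All-concatMap h []       p = []
All-concatMap h (x ∷ xs) p = All.++⁺ (p x) (All-concatMap h xs p)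

-- The bound on μ says that 1 - μ ≥ X / (1 + X) ≥ x / (1 + x), and 1 + x is at most 11/10.
hit-≥ : ∀ {x X μ} → 0ℚ ℚ.≤ μ → 0ℚ ℚ.≤ X → (1ℚ ℚ.+ X) ℚ.* μ ℚ.≤ 1ℚ → x ℚ.≤ X → x ℚ.≤ ℤ.+ 1 ℚ./ 10 → x ℚ.≤ (ℤ.+ 11 ℚ./ 10) ℚ.* (1ℚ ℚ.- μ)
hit-≥ {x} {X} {μ} 0≤μ 0≤X le x≤X x≤ = ≤-by (le +≤ (≤* 0≤μ x≤X +≤ *≤ (0≤b-a μ≤1) x≤)) (equation x X μ)
  where
  μ≤1 : μ ℚ.≤ 1ℚ
  μ≤1 = ℚ.≤-trans (≤-by (0≤* 0≤X 0≤μ) (((∀ X μ → μ ℚ.+ X ℚ.* μ ≡ (1ℚ ℚ.+ X) ℚ.* μ ℚ.+ 0ℚ) ∋ solve-∀ ℚ-ring) X μ)) le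
  equation : ∀ x X μ → x ℚ.+ (1ℚ ℚ.+ (X ℚ.* μ ℚ.+ (1ℚ ℚ.- μ) ℚ.* (ℤ.+ 1 ℚ./ 10)))
    ≡ (ℤ.+ 11 ℚ./ 10) ℚ.* (1ℚ ℚ.- μ) ℚ.+ ((1ℚ ℚ.+ X) ℚ.* μ ℚ.+ (x ℚ.* μ ℚ.+ (1ℚ ℚ.- μ) ℚ.* x))
  equation = solve-∀ ℚ-ring

-- In terms of the load L, the cost C is at most L / 7.128 and the saving ½ U at least L / 6.6; the
-- difference exceeds L / 100. Here 3.564 = 4 · 0.9 · 0.99 is the span of a window with the losses
-- of `rate-≤-gain`, and 3.3 = 3 · 1.1 is the resolution with the loss of `hit-≥`. A window spanning
-- only its distance would leave no profit.
saving : ∀ v M C U L D → v ℚ.≤ (1ℚ ℚ.+ 1ℚ) ℚ.* M ℚ.+ C ℚ.- ½ ℚ.* U → (ℤ.+ 3564 ℚ./ 1000) ℚ.* C ℚ.≤ ½ ℚ.* L →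
         L ℚ.≤ (ℤ.+ 33 ℚ./ 10) ℚ.* U → 0ℚ ℚ.≤ L → D ℚ.≤ L → v ℚ.+ (ℤ.+ 1 ℚ./ 100) ℚ.* D ℚ.≤ (1ℚ ℚ.+ 1ℚ) ℚ.* M
saving v M C U L D v≤ C≤ U≥ 0≤L D≤L = ≤-by (v≤ +≤ (*≤ 0≤k₁ C≤ +≤ (*≤ 0≤k₂ U≥ +≤ (0≤* 0≤k₃ 0≤L +≤ *≤ 0≤k₄ D≤L)))) (equation v M C U L D)
  where
  k₁ k₂ k₃ k₄ : ℚ
  k₁ = ℤ.+ 1000 ℚ./ 3564
  k₂ = ℤ.+ 5 ℚ./ 33
  k₃ = k₂ ℚ.- k₁ ℚ.* ½ ℚ.- k₄
  k₄ = ℤ.+ 1 ℚ./ 100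
  0≤k₁ : 0ℚ ℚ.≤ k₁
  0≤k₁ = ℚ.*≤* (ℤ.+≤+ z≤n)
  0≤k₂ : 0ℚ ℚ.≤ k₂
  0≤k₂ = ℚ.*≤* (ℤ.+≤+ z≤n)
  0≤k₃ : 0ℚ ℚ.≤ k₃
  0≤k₃ = ℚ.*≤* (ℤ.+≤+ z≤n)
  0≤k₄ : 0ℚ ℚ.≤ k₄
  0≤k₄ = ℚ.*≤* (ℤ.+≤+ z≤n)
  equation : ∀ v M C U L D →
    v ℚ.+ (ℤ.+ 1 ℚ./ 100) ℚ.* D ℚ.+ ((1ℚ ℚ.+ 1ℚ) ℚ.* M ℚ.+ C ℚ.- ½ ℚ.* U ℚ.+ ((ℤ.+ 1000 ℚ./ 3564) ℚ.* (½ ℚ.* L)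
      ℚ.+ ((ℤ.+ 5 ℚ./ 33) ℚ.* ((ℤ.+ 33 ℚ./ 10) ℚ.* U) ℚ.+ (((ℤ.+ 5 ℚ./ 33) ℚ.- (ℤ.+ 1000 ℚ./ 3564) ℚ.* ½ ℚ.- (ℤ.+ 1 ℚ./ 100)) ℚ.* L ℚ.+ (ℤ.+ 1 ℚ./ 100) ℚ.* L))))
    ≡ (1ℚ ℚ.+ 1ℚ) ℚ.* M ℚ.+ (v ℚ.+ ((ℤ.+ 1000 ℚ./ 3564) ℚ.* ((ℤ.+ 3564 ℚ./ 1000) ℚ.* C) ℚ.+ ((ℤ.+ 5 ℚ./ 33) ℚ.* L ℚ.+ (0ℚ ℚ.+ (ℤ.+ 1 ℚ./ 100) ℚ.* D))))
  equation = solve-∀ ℚ-ring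

module LocalTest
  {m} (T : RTree m) (mk : Fin m → Bool) (ℓ : Fin m → ℕ) (b : ℕ) (N : ℕ → ℕ) (t : ℕ) where

  open Lines T mk ℓ public
  -- The lists drawn from are padded to 2 b n + 1 pairs and 3 + 1 = `span` windows.
  open RandomTest near wins mem (2 * b * suc m) 3 N t public

module LocalAnalysis
  {m} (d : Weights (suc m)) (metric : IsMetric _≡_ d) (3≤n : 3 ≤ suc m) (T : RTree m)
  (len : Fin m → ℕ) (len≡ : ∀ e → len e ≡ d (Fin.inject₁ e) (parent T e))
  (mk : Fin m → Bool)
  (b : ℕ) (few-local : ∀ e → ∑ (fins (suc m)) (λ v → ⟦ local T mk e v ⟧) ℚ.≤ ι b)
  (N : ℕ → ℕ) (t c : ℕ) (N-suc : ∀ i → N (suc i) ≡ c * N i)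
  where

  open TreeTours d metric 3≤n T len len≡ public
  open LocalTest T mk len b N t public
  open Semantics d public

  dist : Pair → ℕ
  dist = uncurry d

  -- Disposes of distance 0, where the grid has no step and a window no units.
  no-loop-windows : ∀ u w → wins (u , u) w ≡ []
  no-loop-windows u w with lineEdges (u , u) | (λ {e} → lineEdges⁻ (u , u) {e})
  ... | []     | _ = refl
  ... | e ∷ es | h = contradiction (trans (sym (proj₁ (h (here refl)))) (Bool.xor-same (below T e u))) λ ()

  windows⁻ : ∀ {g} → g ∈ windows → proj₂ g ∈ wins (proj₁ g) (dist (proj₁ g))
  windows⁻ g∈ with Any.satisfied (∈.∈-concatMap⁻ (λ f → map (f ,_) (wins f (dist f))) {xs = pairs} g∈)
  ... | f , g∈f with ∈.∈-map⁻ (f ,_) g∈f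
  ...   | _ , g∈′ , refl = g∈′

  ∈-pairs : ∀ f → f ∈ pairs
  ∈-pairs (u , v) = ∈.∈-cartesianProduct⁺ (∈-fins u) (∈-fins v)

  windows⁺ : ∀ f {g} → g ∈ wins f (dist f) → (f , g) ∈ windows
  windows⁺ f g∈ = ∈.∈-concatMap⁺ (λ f → map (f ,_) (wins f (dist f))) {xs = pairs} (Any.map (λ { refl → ∈.∈-map⁺ (f ,_) g∈ }) (∈-pairs f))

  distinct : ∀ f {g} → g ∈ wins f (dist f) → NonZero (dist f)
  distinct (u , v) g∈ with u Fin.≟ v
  ... | no u≢v   = d-pos u≢v
  ... | yes refl = case subst (_ ∈_) (no-loop-windows u (d u u)) g∈ of λ ()

  few-wins′ : ∀ f q → length (filterᵇ (mem q) (wins f (dist f))) ≤ span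
  few-wins′ (u , v) q with u Fin.≟ v
  ... | no u≢v   = few-wins (u , v) (d u v) {{d-pos u≢v}} q
  ... | yes refl = subst (λ ws → length (filterᵇ (mem q) ws) ≤ span) (sym (no-loop-windows u (d u u))) z≤n

  open Correctness (λ f q → near-mem f (dist f) q) (λ q → ℕ.≤-trans (few-pairs b few-local q) (ℕ.n≤1+n _)) few-wins′ public

  window-size : ∀ {g} → g ∈ windows → length (proj₂ g) ≡ span * dist (proj₁ g)
  window-size {f , g} g∈ = proj₂ (proj₂ (wins⁻ f (dist f) (windows⁻ g∈)))

  nonempty : ∀ {g} → g ∈ windows → NonZero (length (proj₂ g))
  nonempty {f , g} g∈ = subst NonZero (sym (window-size g∈)) (ℕ.m*n≢0 span (dist f) {{_}} {{distinct f (windows⁻ g∈)}})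

  open Analysis c N-suc 0≤inv nonempty few public
  open Cost c N-suc nonempty public using (cost-alive)

  regroup-window : ∀ {g} → g ∈ windows → ∀ φ → ∑ units (λ q → ⟦ inc q g ⟧ ℚ.* φ q) ≡ ∑ (proj₂ g) φ
  regroup-window {f , g} g∈ = regroup (wins-unique f (dist f) (windows⁻ g∈)) (wins⊆units f (dist f) (windows⁻ g∈))

  -- Including every drawn active window with the small probability β covers each unit q almost
  -- β · load q often.
  module Soundness
    (R : ℕ) (β : ℚ) (0≤β : 0ℚ ℚ.≤ β) (β≤1 : β ℚ.≤ 1ℚ) (β-small : β ℚ.* (ι (N 0) ℚ.+ ι c) ℚ.≤ ℤ.+ 1 ℚ./ 10)
    (decay : ι c ℚ.* (ℤ.+ 9 ℚ./ 10) ^ℚ t ℚ.≤ ℤ.+ 1 ℚ./ 100)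
    where

    -- The ½ cancels the 2 in the factors 1 - 2 s of `miss`, so an entry covers a crossed edge with
    -- weight β · inv · e.
    s : Win → ℕ → ℚ
    s g i = ½ ℚ.* (β ℚ.* (inv ℚ.* e i g))

    -- `N i` copies of small probability, since N i · s may exceed 1. Parallel copies in a
    -- certificate are harmless: only parities count.
    entries : List (Pair × ℚ)
    entries = concatMap (λ g → concatMap (λ i → replicate (N i) (proj₁ g , s g i)) (downFrom R)) windows

    ∑-replicate : ∀ {A : Set} k (x : A) φ → ∑ (replicate k x) φ ≡ ι k ℚ.* φ x
    ∑-replicate zero    x φ = sym (trans (cong (ℚ._* φ x) ι-0) (ℚ.*-zeroˡ (φ x)))
    ∑-replicate (suc k) x φ = trans (cong (φ x ℚ.+_) (∑-replicate k x φ))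
      (trans (((∀ x k → x ℚ.+ k ℚ.* x ≡ (1ℚ ℚ.+ k) ℚ.* x) ∋ solve-∀ ℚ-ring) (φ x) (ι k)) (cong (ℚ._* φ x) (sym (ι-suc k))))

    ∑-entries : ∀ φ → ∑ entries φ ≡ ∑ windows λ g → ∑ (downFrom R) λ i → ι (N i) ℚ.* φ (proj₁ g , s g i)
    ∑-entries φ = trans (∑-concatMap _ windows φ) (∑-cong windows λ g →
      trans (∑-concatMap (λ i → replicate (N i) (proj₁ g , s g i)) (downFrom R) φ) (∑-cong (downFrom R) λ i → ∑-replicate (N i) (proj₁ g , s g i) φ))

    0≤½ : 0ℚ ℚ.≤ ½
    0≤½ = ℚ.*≤* (ℤ.+≤+ z≤n)

    0≤s : ∀ g i → 0ℚ ℚ.≤ s g i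
    0≤s g i = 0≤* 0≤½ (0≤* 0≤β (0≤* 0≤inv (0≤e i g)))

    s+s≤1 : ∀ g i → s g i ℚ.+ s g i ℚ.≤ 1ℚ
    s+s≤1 g i = begin
      s g i ℚ.+ s g i            ≡⟨ ((∀ x → ½ ℚ.* x ℚ.+ ½ ℚ.* x ≡ x) ∋ solve-∀ ℚ-ring) (β ℚ.* (inv ℚ.* e i g)) ⟩
      β ℚ.* (inv ℚ.* e i g)      ≤⟨ *≤* (0≤* 0≤inv (0≤e i g)) 0≤1 β≤1 (*≤* (0≤e i g) 0≤1 (*≤* (0≤1/ℕ 3) 0≤1 (1/ℕ≤1 (2 * b * suc m)) (1/ℕ≤1 3)) (e≤1 i g)) ⟩
      1ℚ ℚ.* (1ℚ ℚ.* 1ℚ ℚ.* 1ℚ)  ≡⟨⟩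
      1ℚ                         ∎
      where open ℚ.≤-Reasoning

    entries-All : ∀ {P : Pair × ℚ → Set} → (∀ g i → P (proj₁ g , s g i)) → All P entries
    entries-All {P} p = All-concatMap _ windows λ g → All-concatMap (λ i → replicate (N i) (proj₁ g , s g i)) (downFrom R) λ i → All.replicate⁺ (N i) (p g i)

    0≤entries≤1 : All (λ f → 0ℚ ℚ.≤ proj₂ f × proj₂ f ℚ.≤ 1ℚ) entries
    0≤entries≤1 = entries-All λ g i → 0≤s g i , ≤-by (s+s≤1 g i +≤ 0≤s g i)
      (((∀ s → s ℚ.+ (1ℚ ℚ.+ s) ≡ 1ℚ ℚ.+ (s ℚ.+ s ℚ.+ 0ℚ)) ∋ solve-∀ ℚ-ring) (s g i))

    covered : Fin m → Pair × ℚ → ℚ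
    covered e (f , s) = (s ℚ.+ s) ℚ.* ⟦ cross T f e ⟧

    -- A product of factors 1 - x is at most 1 / (1 + the sum of the x), because (1 - x) (1 + x + X)
    -- ≤ 1 + X.
    miss-bounds : ∀ e fs → All (λ f → 0ℚ ℚ.≤ proj₂ f × proj₂ f ℚ.+ proj₂ f ℚ.≤ 1ℚ) fs →
                  0ℚ ℚ.≤ miss e fs × 0ℚ ℚ.≤ ∑ fs (covered e) × (1ℚ ℚ.+ ∑ fs (covered e)) ℚ.* miss e fs ℚ.≤ 1ℚ
    miss-bounds e []             []                  = 0≤1 , ℚ.≤-refl , ℚ.≤-refl
    miss-bounds e ((f , s) ∷ fs) ((0≤s , s≤½) ∷ all) with miss-bounds e fs all
    ... | 0≤μ , 0≤X , le = 0≤* (0≤b-a x≤1) 0≤μ , 0≤+ 0≤x 0≤X ,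
      ≤-by (le +≤ 0≤* (0≤+ (0≤* 0≤x 0≤x) (0≤* 0≤x 0≤X)) 0≤μ)
        (((∀ x X μ → (1ℚ ℚ.+ (x ℚ.+ X)) ℚ.* ((1ℚ ℚ.- x) ℚ.* μ) ℚ.+ (1ℚ ℚ.+ (x ℚ.* x ℚ.+ x ℚ.* X) ℚ.* μ)
            ≡ 1ℚ ℚ.+ ((1ℚ ℚ.+ X) ℚ.* μ ℚ.+ 0ℚ)) ∋ solve-∀ ℚ-ring) x (∑ fs (covered e)) (miss e fs))
      where
      x : ℚ
      x = (s ℚ.+ s) ℚ.* ⟦ cross T f e ⟧
      0≤x : 0ℚ ℚ.≤ x
      0≤x = 0≤* (0≤+ 0≤s 0≤s) 0≤⟦ cross T f e ⟧
      x≤1 : x ℚ.≤ 1ℚ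
      x≤1 = *≤* 0≤⟦ cross T f e ⟧ 0≤1 s≤½ ⟦ cross T f e ⟧≤1

    -- A pair crosses the edges of all units in its windows, and possibly more; that only helps.
    coverage : ∀ q → β ℚ.* load R q ℚ.≤ ∑ entries (covered (proj₁ q))
    coverage q = begin
      β ℚ.* load R q
        ≤⟨ *≤ 0≤β (load-≤-rate R q) ⟩
      β ℚ.* ∑ (downFrom R) (λ i → ι (N i) ℚ.* μ i q)
        ≡⟨ cong (β ℚ.*_) (∑-cong (downFrom R) λ i → trans (((∀ n v x → n ℚ.* (v ℚ.* x) ≡ (n ℚ.* v) ℚ.* x) ∋ solve-∀ ℚ-ring) (ι (N i)) inv (∑ windows λ g → ⟦ inc q g ⟧ ℚ.* e i g)) (sym (∑-*ˡ windows (ι (N i) ℚ.* inv) _))) ⟩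
      β ℚ.* ∑ (downFrom R) (λ i → ∑ windows λ g → ι (N i) ℚ.* inv ℚ.* (⟦ inc q g ⟧ ℚ.* e i g))
        ≡⟨ trans (cong (β ℚ.*_) (∑-swap (downFrom R) windows _)) (sym (∑-*ˡ windows β _)) ⟩
      ∑ windows (λ g → β ℚ.* ∑ (downFrom R) λ i → ι (N i) ℚ.* inv ℚ.* (⟦ inc q g ⟧ ℚ.* e i g))
        ≤⟨ ∑-mono∈ windows per-window ⟩
      ∑ windows (λ g → ∑ (downFrom R) λ i → ι (N i) ℚ.* covered (proj₁ q) (proj₁ g , s g i))
        ≡⟨ sym (∑-entries (covered (proj₁ q))) ⟩
      ∑ entries (covered (proj₁ q)) ∎
      where
      open ℚ.≤-Reasoning
      per-window : ∀ {g} → g ∈ windows → β ℚ.* ∑ (downFrom R) (λ i → ι (N i) ℚ.* inv ℚ.* (⟦ inc q g ⟧ ℚ.* e i g))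
                                     ℚ.≤ ∑ (downFrom R) λ i → ι (N i) ℚ.* covered (proj₁ q) (proj₁ g , s g i)
      per-window {g} g∈ = ≡≤ (sym (∑-*ˡ (downFrom R) β _)) (∑-mono (downFrom R) λ i → begin
        β ℚ.* (ι (N i) ℚ.* inv ℚ.* (⟦ inc q g ⟧ ℚ.* e i g))
          ≡⟨ ((∀ β n v x e → β ℚ.* (n ℚ.* v ℚ.* (x ℚ.* e)) ≡ n ℚ.* (β ℚ.* (v ℚ.* e) ℚ.* x)) ∋ solve-∀ ℚ-ring) β (ι (N i)) inv ⟦ inc q g ⟧ (e i g) ⟩
        ι (N i) ℚ.* (β ℚ.* (inv ℚ.* e i g) ℚ.* ⟦ inc q g ⟧)
          ≤⟨ *≤ (0≤ι (N i)) (*≤ (0≤* 0≤β (0≤* 0≤inv (0≤e i g))) inc≤cross) ⟩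
        ι (N i) ℚ.* (β ℚ.* (inv ℚ.* e i g) ℚ.* ⟦ cross T (proj₁ g) (proj₁ q) ⟧)
          ≡⟨ ((∀ n x c → n ℚ.* (x ℚ.* c) ≡ n ℚ.* ((½ ℚ.* x ℚ.+ ½ ℚ.* x) ℚ.* c)) ∋ solve-∀ ℚ-ring) (ι (N i)) (β ℚ.* (inv ℚ.* e i g)) ⟦ cross T (proj₁ g) (proj₁ q) ⟧ ⟩
        ι (N i) ℚ.* covered (proj₁ q) (proj₁ g , s g i) ∎)
        where
        inc≤cross : ⟦ inc q g ⟧ ℚ.≤ ⟦ cross T (proj₁ g) (proj₁ q) ⟧
        inc≤cross with inc q g in eq
        ... | true  = ℚ.≤-reflexive (sym (cong ⟦_⟧ (wins-cross (proj₁ g) (dist (proj₁ g)) (windows⁻ g∈) (mem⁻ eq))))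
        ... | false = 0≤⟦ cross T (proj₁ g) (proj₁ q) ⟧

    unit-gain : ∀ q → β ℚ.* load R q ℚ.≤ (ℤ.+ 11 ℚ./ 10) ℚ.* (1ℚ ℚ.- miss (proj₁ q) entries)
    unit-gain q = hit-≥ (proj₁ bounds) (proj₁ (proj₂ bounds)) (proj₂ (proj₂ bounds)) (coverage q) (ℚ.≤-trans (*≤ 0≤β (load-≤ R q)) β-small)
      where
      bounds = miss-bounds (proj₁ q) entries (entries-All λ g i → 0≤s g i , s+s≤1 g i)

    total-load : ℚ
    total-load = ∑ units (load R)

    gain-U : ℚ
    gain-U = ∑ (fins m) (λ e → ι (len e) ℚ.* (1ℚ ℚ.- miss e entries))

    load≤U : β ℚ.* total-load ℚ.≤ (ℤ.+ 33 ℚ./ 10) ℚ.* gain-U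
    load≤U = begin
      β ℚ.* total-load                                                            ≡⟨ sym (∑-*ˡ units β (load R)) ⟩
      ∑ units (λ q → β ℚ.* load R q)                                              ≤⟨ ∑-mono units unit-gain ⟩
      ∑ units (λ q → (ℤ.+ 11 ℚ./ 10) ℚ.* (1ℚ ℚ.- miss (proj₁ q) entries))         ≡⟨ ∑-*ˡ units (ℤ.+ 11 ℚ./ 10) (λ q → 1ℚ ℚ.- miss (proj₁ q) entries) ⟩
      (ℤ.+ 11 ℚ./ 10) ℚ.* ∑ units (λ q → 1ℚ ℚ.- miss (proj₁ q) entries)           ≡⟨ cong ((ℤ.+ 11 ℚ./ 10) ℚ.*_) (∑-units (λ e → 1ℚ ℚ.- miss e entries)) ⟩
      (ℤ.+ 11 ℚ./ 10) ℚ.* (ι resolution ℚ.* gain-U)                               ≡⟨ cong (λ r → (ℤ.+ 11 ℚ./ 10) ℚ.* (r ℚ.* gain-U)) (ι≡fromℕ 3) ⟩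
      (ℤ.+ 11 ℚ./ 10) ℚ.* ((ℤ.+ 3 ℚ./ 1) ℚ.* gain-U)                              ≡⟨ ((∀ u → (ℤ.+ 11 ℚ./ 10) ℚ.* ((ℤ.+ 3 ℚ./ 1) ℚ.* u) ≡ (ℤ.+ 33 ℚ./ 10) ℚ.* u) ∋ solve-∀ ℚ-ring) gain-U ⟩
      (ℤ.+ 33 ℚ./ 10) ℚ.* gain-U                                                  ∎
      where open ℚ.≤-Reasoning

    cost : ℚ
    cost = ∑ entries (λ f → proj₂ f ℚ.* ι (dist (proj₁ f)))

    -- Window by window, rate times distance is compared with gain times size, where the size is
    -- four times the distance; `∑-load` turns the gains into load.
    cost≤load : (ℤ.+ 3564 ℚ./ 1000) ℚ.* cost ℚ.≤ ½ ℚ.* (β ℚ.* total-load)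
    cost≤load = begin
      θ ℚ.* cost
        ≡⟨ cong (θ ℚ.*_) (trans (∑-entries (λ f → proj₂ f ℚ.* ι (dist (proj₁ f)))) (∑-cong windows λ g → per-window g)) ⟩
      θ ℚ.* ∑ windows (λ g → ½ ℚ.* β ℚ.* inv ℚ.* (rate R g ℚ.* ι (dist (proj₁ g))))
        ≡⟨ cong (θ ℚ.*_) (∑-*ˡ windows (½ ℚ.* β ℚ.* inv) _) ⟩
      θ ℚ.* (½ ℚ.* β ℚ.* inv ℚ.* ∑ windows (λ g → rate R g ℚ.* ι (dist (proj₁ g))))
        ≡⟨ trans (((∀ t x s → t ℚ.* (x ℚ.* s) ≡ x ℚ.* (t ℚ.* s)) ∋ solve-∀ ℚ-ring) θ (½ ℚ.* β ℚ.* inv) (∑ windows (λ g → rate R g ℚ.* ι (dist (proj₁ g))))) (cong (½ ℚ.* β ℚ.* inv ℚ.*_) (sym (∑-*ˡ windows θ _))) ⟩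
      ½ ℚ.* β ℚ.* inv ℚ.* ∑ windows (λ g → θ ℚ.* (rate R g ℚ.* ι (dist (proj₁ g))))
        ≤⟨ *≤ (0≤* (0≤* 0≤½ 0≤β) 0≤inv) (∑-mono∈ windows bound) ⟩
      ½ ℚ.* β ℚ.* inv ℚ.* ∑ windows (λ g → gain R g ℚ.* size g)
        ≡⟨ ((∀ β v x → ½ ℚ.* β ℚ.* v ℚ.* x ≡ ½ ℚ.* (β ℚ.* (v ℚ.* x))) ∋ solve-∀ ℚ-ring) β inv (∑ windows (λ g → gain R g ℚ.* size g)) ⟩
      ½ ℚ.* (β ℚ.* (inv ℚ.* ∑ windows (λ g → gain R g ℚ.* size g)))
        ≡⟨ cong (λ x → ½ ℚ.* (β ℚ.* x)) (sym (∑-load units regroup-window R)) ⟩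
      ½ ℚ.* (β ℚ.* total-load) ∎
      where
      open ℚ.≤-Reasoning
      θ p₁ ν : ℚ
      θ = ℤ.+ 3564 ℚ./ 1000
      p₁ = ℤ.+ 9 ℚ./ 10
      ν  = ℤ.+ 1 ℚ./ 100
      per-window : ∀ g → ∑ (downFrom R) (λ i → ι (N i) ℚ.* (s g i ℚ.* ι (dist (proj₁ g)))) ≡ ½ ℚ.* β ℚ.* inv ℚ.* (rate R g ℚ.* ι (dist (proj₁ g)))
      per-window g = trans (∑-cong (downFrom R) λ i → ((∀ n h β v e w → n ℚ.* (h ℚ.* (β ℚ.* (v ℚ.* e)) ℚ.* w) ≡ h ℚ.* β ℚ.* v ℚ.* (n ℚ.* e ℚ.* w)) ∋ solve-∀ ℚ-ring) (ι (N i)) ½ β inv (e i g) (ι (dist (proj₁ g))))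
        (trans (∑-*ˡ (downFrom R) (½ ℚ.* β ℚ.* inv) _) (cong (½ ℚ.* β ℚ.* inv ℚ.*_) (∑-*ʳ (downFrom R) (ι (dist (proj₁ g))) (λ i → ι (N i) ℚ.* e i g))))
      bound : ∀ {g} → g ∈ windows → θ ℚ.* (rate R g ℚ.* ι (dist (proj₁ g))) ℚ.≤ gain R g ℚ.* size g
      bound {g} g∈ = begin
        θ ℚ.* (rate R g ℚ.* w)
          ≡⟨ ((∀ r w → (ℤ.+ 3564 ℚ./ 1000) ℚ.* (r ℚ.* w) ≡ (ℤ.+ 9 ℚ./ 10) ℚ.* (1ℚ ℚ.- (ℤ.+ 1 ℚ./ 100)) ℚ.* r ℚ.* ((ℤ.+ 4 ℚ./ 1) ℚ.* w)) ∋ solve-∀ ℚ-ring) (rate R g) w ⟩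
        p₁ ℚ.* (1ℚ ℚ.- ν) ℚ.* rate R g ℚ.* ((ℤ.+ 4 ℚ./ 1) ℚ.* w)
          ≡⟨ cong (p₁ ℚ.* (1ℚ ℚ.- ν) ℚ.* rate R g ℚ.*_) (trans (cong (ℚ._* w) (sym (ι≡fromℕ 4))) (trans (sym (ι-* span (dist (proj₁ g)))) (cong ι (sym (window-size g∈))))) ⟩
        p₁ ℚ.* (1ℚ ℚ.- ν) ℚ.* rate R g ℚ.* size g
          ≤⟨ ≤* (0≤ι _) (rate-≤-gain {p₁} {ν} (ℚ.*≤* (ℤ.+≤+ z≤n)) (ℚ.*≤* (ℤ.+≤+ (ℕ.m≤m+n 9 1))) (ℚ.*≤* (ℤ.+≤+ z≤n)) decay R g∈) ⟩
        gain R g ℚ.* size g ∎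
        where
        w : ℚ
        w = ι (dist (proj₁ g))

    dead : ℚ
    dead = ∑ units (λ q → 1ℚ ℚ.- a R q)

    soundness : ∃[ S ] value (ι ∘ dist) S ℚ.+ (ℤ.+ 1 ℚ./ 100) ℚ.* (β ℚ.* dead) ℚ.≤ (1ℚ ℚ.+ 1ℚ) ℚ.* M
    soundness = proj₁ cheap , saving (value (ι ∘ dist) (proj₁ cheap)) M cost gain-U (β ℚ.* total-load) (β ℚ.* dead) (proj₂ (proj₂ cheap)) cost≤load load≤U (0≤* 0≤β (0≤∑ units (0≤load R))) (*≤ 0≤β (∑-mono units (1-a≤load R)))
      where
      cheap = cheap-value (ι ∘ dist) entries 0≤entries≤1

-- Tours and the tree edges they cross

zip-split : ∀ {A : Set} (x : A) us y vs z → zip (x ∷ us ++ y ∷ vs) ((us ++ y ∷ vs) ∷ʳ z) ≡ zip (x ∷ us) (us ∷ʳ y) ++ zip (y ∷ vs) (vs ∷ʳ z)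
zip-split x []       y vs z = refl
zip-split x (u ∷ us) y vs z = cong ((x , u) ∷_) (zip-split u us y vs z)

module Crossings {m} (T : RTree m) where

  private
    VPair : Set
    VPair = Fin (suc m) × Fin (suc m)

  both : VPair → Fin m → Bool
  both (u , v) e = below T e u ∧ below T e v

  -- The depth of the meeting point of u and v; sorting by it lists the pairs reaching
  -- highest first.
  depth : VPair → ℕ
  depth f = length (filterᵇ (both f) (fins m))

  crossings : List VPair → Fin m → ℕ
  crossings fs e = length (filterᵇ (λ f → cross T f e) fs)

  ∑-crossings : ∀ fs e → ι (crossings fs e) ≡ ∑ fs (λ f → ⟦ cross T f e ⟧)
  ∑-crossings fs e = count-filter (λ f → cross T f e) fs

  crossings-∷ : ∀ f fs e → crossings (f ∷ fs) e ≡ (if cross T f e then suc (crossings fs e) else crossings fs e)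
  crossings-∷ f fs e with cross T f e
  ... | true  = refl
  ... | false = refl

  -- An edge with both u and v below it lies above e′, as v would otherwise be below e′; hence it
  -- also has a and b below it. The edge e′ counts in addition for (a , b).
  higher : ∀ {u v a b e′} → below T e′ u ≡ true → below T e′ v ≡ false → below T e′ a ≡ true → below T e′ b ≡ true →
           suc (depth (u , v)) ≤ depth (a , b)
  higher {u} {v} {a} {b} {e′} u↓ v↑ a↓ b↓ = ι-cancel-≤ (begin
    ι (suc (depth (u , v)))                                             ≡⟨ trans (ι-suc _) (cong (1ℚ ℚ.+_) (count-filter (both (u , v)) (fins m))) ⟩
    1ℚ ℚ.+ ∑ (fins m) (λ e → ⟦ both (u , v) e ⟧)                        ≡⟨ cong (ℚ._+ ∑ (fins m) (λ e → ⟦ both (u , v) e ⟧)) (sym (∑-delta e′ (λ _ → 1ℚ))) ⟩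
    ∑ (fins m) (λ e → ⟦ ⌊ e Fin.≟ e′ ⌋ ⟧ ℚ.* 1ℚ) ℚ.+ ∑ (fins m) (λ e → ⟦ both (u , v) e ⟧) ≡⟨ sym (∑-+ (fins m) (λ e → ⟦ ⌊ e Fin.≟ e′ ⌋ ⟧ ℚ.* 1ℚ) (λ e → ⟦ both (u , v) e ⟧)) ⟩
    ∑ (fins m) (λ e → ⟦ ⌊ e Fin.≟ e′ ⌋ ⟧ ℚ.* 1ℚ ℚ.+ ⟦ both (u , v) e ⟧) ≤⟨ ∑-mono (fins m) pointwise ⟩
    ∑ (fins m) (λ e → ⟦ both (a , b) e ⟧)                               ≡⟨ sym (count-filter (both (a , b)) (fins m)) ⟩
    ι (depth (a , b))                                                   ∎)
    where
    open ℚ.≤-Reasoning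
    pointwise : ∀ e → ⟦ ⌊ e Fin.≟ e′ ⌋ ⟧ ℚ.* 1ℚ ℚ.+ ⟦ both (u , v) e ⟧ ℚ.≤ ⟦ both (a , b) e ⟧
    pointwise e with e Fin.≟ e′
    ... | yes refl rewrite u↓ | v↑ | a↓ | b↓ = ℚ.≤-refl
    ... | no _ with below T e u in eu | below T e v in ev
    ...   | false | _     = 0≤⟦ both (a , b) e ⟧
    ...   | true  | false = 0≤⟦ both (a , b) e ⟧
    ...   | true  | true with below-chain T eu u↓
    ...     | inj₁ e⊑e′ = contradiction (trans (sym (below-trans T ev e⊑e′)) v↑) λ ()
    ...     | inj₂ e′⊑e rewrite below-trans T a↓ e′⊑e | below-trans T b↓ e′⊑e = ℚ.≤-refl

  -- If f crossed e but not e′, both its ends would be below e′, and `higher` would make f meet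
  -- deeper than (u , v).
  cross-above : ∀ {u v f e e′} → below T e′ u ≡ true → below T e′ v ≡ false → below T e′ (Fin.inject₁ e) ≡ true →
                depth f ≤ depth (u , v) → cross T f e ≡ true → cross T f e′ ≡ true
  cross-above {u} {v} {a , b} {e} {e′} u↓ v↑ e⊑e′ dep c with below T e a in ea | below T e b in eb
  ... | true | false with below T e′ b in e′b
  ...   | false rewrite below-trans T ea e⊑e′ = refl
  ...   | true  = contradiction (ℕ.≤-trans (higher {u} {v} {a} {b} u↓ v↑ (below-trans T ea e⊑e′) e′b) dep) (ℕ.<-irrefl refl)
  cross-above {u} {v} {a , b} {e} {e′} u↓ v↑ e⊑e′ dep c | false | true with below T e′ a in e′a
  ...   | false rewrite below-trans T eb e⊑e′ = refl
  ...   | true  = contradiction (ℕ.≤-trans (higher {u} {v} {a} {b} u↓ v↑ e′a (below-trans T eb e⊑e′)) dep) (ℕ.<-irrefl refl)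

  crossings-above : ∀ {u v e e′} fs → below T e′ u ≡ true → below T e′ v ≡ false → below T e′ (Fin.inject₁ e) ≡ true →
                    All (λ f → depth f ≤ depth (u , v)) fs → crossings fs e ≤ crossings fs e′
  crossings-above {u} {v} {e} {e′} fs u↓ v↑ e⊑e′ high = ι-cancel-≤ (≡≤ (∑-crossings fs e) (≤≡ (∑-mono∈ fs λ {f} f∈ → pointwise f (All.lookup high f∈)) (sym (∑-crossings fs e′))))
    where
    pointwise : ∀ f → depth f ≤ depth (u , v) → ⟦ cross T f e ⟧ ℚ.≤ ⟦ cross T f e′ ⟧
    pointwise f dep with cross T f e in c
    ... | false = 0≤⟦ cross T f e′ ⟧
    ... | true  = ℚ.≤-reflexive (sym (cong ⟦_⟧ (cross-above {u} {v} {f} u↓ v↑ e⊑e′ dep c)))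

  crossings-sym : ∀ {u v} fs → All (λ f → depth f ≤ depth (u , v)) fs → All (λ f → depth f ≤ depth (v , u)) fs
  crossings-sym {u} {v} fs = All.map λ le → ℕ.≤-trans le (ℕ.≤-reflexive (cong length (List.filter-≐ _ _
    ((λ {e} → subst Bool.T (Bool.∧-comm (below T e u) (below T e v))) , (λ {e} → subst Bool.T (Bool.∧-comm (below T e v) (below T e u)))) (fins m))))

  -- A pair is assigned to an edge it crosses when at most one pair crossing that edge came
  -- before it.
  assigned : List VPair → VPair → Fin m → Bool
  assigned before f e = cross T f e ∧ ⌊ crossings before e ℕ.<? 2 ⌋

  history : List VPair → List VPair → List (VPair × List VPair)
  history before []       = []
  history before (f ∷ fs) = (f , before) ∷ history (f ∷ before) fs

  hit : Fin m → VPair × List VPair → ℚ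
  hit e (f , before) = ⟦ assigned before f e ⟧

  -- The invariant of the scan: an edge has been assigned as often as it has been crossed, but at
  -- most twice.
  ∑-assigned : ∀ e before fs → ∑ (history before fs) (hit e) ℚ.+ ι (crossings before e ℕ.⊓ 2) ≡ ι ((crossings before e + crossings fs e) ℕ.⊓ 2)
  ∑-assigned e before [] = trans (ℚ.+-identityˡ _) (cong (λ k → ι (k ℕ.⊓ 2)) (sym (ℕ.+-identityʳ (crossings before e))))
  ∑-assigned e before (f ∷ fs) = next (cross T f e) (crossings before e) (crossings fs e) (∑ (history (f ∷ before) fs) (hit e))
    (crossings-∷ f before e) (crossings-∷ f fs e) (∑-assigned e (f ∷ before) fs)
    where
    first : ∀ k → ⟦ ⌊ k ℕ.<? 2 ⌋ ⟧ ℚ.+ ι (k ℕ.⊓ 2) ≡ ι (suc k ℕ.⊓ 2)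
    first zero          = sym (ι-suc 0)
    first (suc zero)    = sym (ι-suc 1)
    first (suc (suc k)) = trans (ℚ.+-identityˡ _) (cong (λ j → ι (suc (suc j))) (trans (ℕ.⊓-zeroʳ k) (sym (ℕ.⊓-zeroʳ (suc k)))))
    next : ∀ c k r s {k′ r′} → k′ ≡ (if c then suc k else k) → r′ ≡ (if c then suc r else r) →
           s ℚ.+ ι (k′ ℕ.⊓ 2) ≡ ι ((k′ + r) ℕ.⊓ 2) → ⟦ c ∧ ⌊ k ℕ.<? 2 ⌋ ⟧ ℚ.+ s ℚ.+ ι (k ℕ.⊓ 2) ≡ ι ((k + r′) ℕ.⊓ 2)
    next false k r s refl refl ih = trans (cong (ℚ._+ ι (k ℕ.⊓ 2)) (ℚ.+-identityˡ s)) ih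
    next true  k r s refl refl ih = begin
      ⟦ ⌊ k ℕ.<? 2 ⌋ ⟧ ℚ.+ s ℚ.+ ι (k ℕ.⊓ 2)     ≡⟨ ((∀ x s y → x ℚ.+ s ℚ.+ y ≡ s ℚ.+ (x ℚ.+ y)) ∋ solve-∀ ℚ-ring) ⟦ ⌊ k ℕ.<? 2 ⌋ ⟧ s (ι (k ℕ.⊓ 2)) ⟩
      s ℚ.+ (⟦ ⌊ k ℕ.<? 2 ⌋ ⟧ ℚ.+ ι (k ℕ.⊓ 2))   ≡⟨ cong (s ℚ.+_) (first k) ⟩
      s ℚ.+ ι (suc k ℕ.⊓ 2)                      ≡⟨ ih ⟩
      ι ((suc k + r) ℕ.⊓ 2)                      ≡⟨ cong (λ j → ι (j ℕ.⊓ 2)) (sym (ℕ.+-suc k r)) ⟩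
      ι ((k + suc r) ℕ.⊓ 2)                      ∎
      where open ≡-Reasoning

  ∑-assigned-≤2 : ∀ e fs → ∑ (history [] fs) (hit e) ℚ.≤ ι 2
  ∑-assigned-≤2 e fs = ℚ.≤-trans (≡≤ (sym (trans (cong (∑ (history [] fs) (hit e) ℚ.+_) ι-0) (ℚ.+-identityʳ _)))
    (ℚ.≤-reflexive (∑-assigned e [] fs))) (ι-mono (ℕ.m⊓n≤n (crossings fs e) 2))

  ∑-assigned-≡2 : ∀ e fs → 2 ≤ crossings fs e → ∑ (history [] fs) (hit e) ≡ ι 2
  ∑-assigned-≡2 e fs 2≤ = trans (trans (sym (trans (cong (∑ (history [] fs) (hit e) ℚ.+_) ι-0) (ℚ.+-identityʳ _))) (∑-assigned e [] fs))
    (cong ι (ℕ.m≥n⇒m⊓n≡n 2≤))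

  ∑-history : ∀ before fs φ → ∑ (history before fs) (φ ∘ proj₁) ≡ ∑ fs φ
  ∑-history before []       φ = refl
  ∑-history before (f ∷ fs) φ = cong (φ f ℚ.+_) (∑-history (f ∷ before) fs φ)

  history-sorted : ∀ before fs → AllPairs (λ f g → depth f ≤ depth g) fs → All (λ f → All (λ g → depth g ≤ depth f) before) fs →
                   All (λ h → All (λ g → depth g ≤ depth (proj₁ h)) (proj₂ h)) (history before fs)
  history-sorted before []       []            []            = []
  history-sorted before (f ∷ fs) (f≤fs ∷ rest) (b≤f ∷ b≤fs) =
    b≤f ∷ history-sorted (f ∷ before) fs rest (All.tabulate λ g∈ → All.lookup f≤fs g∈ ∷ All.lookup b≤fs g∈)

  history-∈ : ∀ before fs {h} → h ∈ history before fs → proj₁ h ∈ fs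
  history-∈ before (f ∷ fs) (here refl) = here refl
  history-∈ before (f ∷ fs) (there h∈)  = there (history-∈ (f ∷ before) fs h∈)

  open Sort (On.decTotalOrder ℕ.≤-decTotalOrder depth) using (sort; sort-↭; sort-↗)

  byDepth : List VPair → List VPair
  byDepth = sort

  byDepth-↭ : ∀ fs → byDepth fs ↭ fs
  byDepth-↭ = sort-↭

  byDepth-sorted : ∀ fs → AllPairs (λ f g → depth f ≤ depth g) (byDepth fs)
  byDepth-sorted fs = Linked.Linked⇒AllPairs ℕ.≤-trans (sort-↗ fs)

  path-crosses : ∀ e x vs z → below T e x ≢ below T e z → 1 ≤ crossings (zip (x ∷ vs) (vs ∷ʳ z)) e
  path-crosses e x []       z x≢z = ℕ.≤-trans (first (below T e x) (below T e z) x≢z) (ℕ.≤-reflexive (sym (crossings-∷ (x , z) [] e)))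
    where
    first : ∀ a b → a ≢ b → 1 ≤ (if a xor b then 1 else 0)
    first true  true  a≢b = contradiction refl a≢b
    first true  false a≢b = s≤s z≤n
    first false true  a≢b = s≤s z≤n
    first false false a≢b = contradiction refl a≢b
  path-crosses e x (v ∷ vs) z x≢z = ℕ.≤-trans (next (below T e x) (below T e v) (below T e z) x≢z (path-crosses e v vs z))
    (ℕ.≤-reflexive (sym (crossings-∷ (x , v) _ e)))
    where
    next : ∀ a b c {k} → a ≢ c → (b ≢ c → 1 ≤ k) → 1 ≤ (if a xor b then suc k else k)
    next true  true  c a≢c ih = ih a≢c
    next true  false c a≢c ih = s≤s z≤n
    next false true  c a≢c ih = s≤s z≤n
    next false false c a≢c ih = ih a≢c

  crossings-++ : ∀ fs gs e → crossings (fs ++ gs) e ≡ crossings fs e + crossings gs e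
  crossings-++ fs gs e = trans (cong length (List.filter-++ _ fs gs)) (List.length-++ (filterᵇ (λ f → cross T f e) fs))

  tour-crosses : ∀ vs → (∀ v → v ∈ vs) → ∀ e → 2 ≤ crossings (closedSteps vs) e
  tour-crosses []       all∈ e = case all∈ zero of λ ()
  tour-crosses (x ∷ vs) all∈ e with other
    where
    other : ∃[ y ] below T e y ≢ below T e x
    other with below T e x in eq
    ... | true  = Fin.fromℕ m , λ r → contradiction (trans (sym (below-root T e)) r) λ ()
    ... | false = Fin.inject₁ e , λ r → contradiction (trans (sym (below-child T e)) r) λ ()
  ... | y , y≢x with all∈ y
  ...   | here refl = contradiction refl y≢x
  ...   | there y∈ with ∈.∈-∃++ y∈
  -- Split at two vertices on different sides of e, the cycle becomes two paths that each cross e.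
  ...     | us , ws , refl = ℕ.≤-trans (ℕ.+-mono-≤ (path-crosses e x us y (y≢x ∘ sym)) (path-crosses e y ws x y≢x))
              (ℕ.≤-reflexive (sym (trans (cong (λ fs → crossings fs e) (zip-split x us y ws x)) (crossings-++ (zip (x ∷ us) (us ∷ʳ y)) _ e))))

-- If every window Q of the line has weight at most τ · dead(Q), then so does every interval of the
-- line, up to the length of five grid cells.
module Intervals {A : Set} (dead : A → ℚ) (0≤dead : ∀ q → 0ℚ ℚ.≤ dead q) (τ : ℚ) (0≤τ : 0ℚ ℚ.≤ τ)
                 (w : ℕ) .{{_ : NonZero w}} (line : List A)
                 (windows-dead : ∀ i → i * w + span * w ≤ length line →
                                 ι (span * w) ℚ.≤ τ ℚ.* ∑ (take (span * w) (drop (i * w) line)) dead) where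

  private
    take-++ : ∀ k (xs ys : List A) → k ≤ length xs → take k (xs ++ ys) ≡ take k xs
    take-++ zero    xs       ys le       = refl
    take-++ (suc k) (x ∷ xs) ys (s≤s le) = cong (x ∷_) (take-++ k xs ys le)

    drop-++ : ∀ k (xs ys : List A) → k ≤ length xs → drop k (xs ++ ys) ≡ drop k xs ++ ys
    drop-++ zero    xs       ys le       = refl
    drop-++ (suc k) (x ∷ xs) ys (s≤s le) = drop-++ k xs ys le

    drop-length-++ : ∀ (xs ys : List A) k → drop (length xs + k) (xs ++ ys) ≡ drop k ys
    drop-length-++ []       ys k = refl
    drop-length-++ (x ∷ xs) ys k = drop-length-++ xs ys k

  -- Windows are cut off one after another until at most `span` cells remain; k bounds the length
  -- for the recursion.
  aligned : ∀ k i Z Y → length Z ≤ k → drop (i * w) line ≡ Z ++ Y → i * w ≤ length line →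
            ι (length Z) ℚ.≤ ι (span * w) ℚ.+ τ ℚ.* ∑ Z dead
  aligned k i Z Y len≤ eq i≤ with ℕ.≤-total (span * w) (length Z)
  ... | inj₂ Z≤ = ≤-by (ι-mono Z≤ +≤ 0≤* 0≤τ (0≤∑ Z 0≤dead))
    (((∀ a b c → a ℚ.+ (b ℚ.+ c) ≡ b ℚ.+ c ℚ.+ (a ℚ.+ 0ℚ)) ∋ solve-∀ ℚ-ring) (ι (length Z)) (ι (span * w)) (τ ℚ.* ∑ Z dead))
  aligned zero    i Z Y len≤ eq i≤ | inj₁ ≤Z = contradiction (ℕ.≤-trans (ℕ.≤-trans (s≤s z≤n) (ℕ.m≤m*n span w)) (ℕ.≤-trans ≤Z len≤)) λ ()
  aligned (suc k) i Z Y len≤ eq i≤ | inj₁ ≤Z = begin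
    ι (length Z)                                        ≡⟨ trans (cong ι len-split) (ι-+ s (length Z′)) ⟩
    ι s ℚ.+ ι (length Z′)                               ≤⟨ first +≤ aligned k (i + span) Z′ Y shorter eq′ i′≤ ⟩
    τ ℚ.* ∑ (take s Z) dead ℚ.+ (ι s ℚ.+ τ ℚ.* ∑ Z′ dead) ≡⟨ ((∀ t a s b → t ℚ.* a ℚ.+ (s ℚ.+ t ℚ.* b) ≡ s ℚ.+ t ℚ.* (a ℚ.+ b)) ∋ solve-∀ ℚ-ring) τ (∑ (take s Z) dead) (ι s) (∑ Z′ dead) ⟩
    ι s ℚ.+ τ ℚ.* (∑ (take s Z) dead ℚ.+ ∑ Z′ dead)     ≡⟨ cong (λ x → ι s ℚ.+ τ ℚ.* x) (trans (sym (∑-++ (take s Z) Z′ dead)) (cong (λ zs → ∑ zs dead) (List.take++drop≡id s Z))) ⟩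
    ι s ℚ.+ τ ℚ.* ∑ Z dead                              ∎
    where
    open ℚ.≤-Reasoning
    s : ℕ
    s = span * w
    Z′ : List A
    Z′ = drop s Z
    len-split : length Z ≡ s + length Z′
    len-split = trans (sym (ℕ.m+[n∸m]≡n ≤Z)) (cong (s +_) (sym (List.length-drop s Z)))
    1≤s : 1 ≤ s
    1≤s = ℕ.≤-trans (s≤s z≤n) (ℕ.m≤m*n span w)
    shorter : length Z′ ≤ k
    shorter = ℕ.+-cancelˡ-≤ 1 _ _ (ℕ.≤-trans (ℕ.+-monoˡ-≤ (length Z′) 1≤s) (ℕ.≤-trans (ℕ.≤-reflexive (sym len-split)) len≤))
    len-line : length line ≡ i * w + (length Z + length Y)
    len-line = trans (sym (ℕ.m+[n∸m]≡n i≤)) (cong (i * w +_) (trans (sym (List.length-drop (i * w) line)) (trans (cong length eq) (List.length-++ Z))))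
    fit : i * w + s ≤ length line
    fit = ℕ.≤-trans (ℕ.+-monoʳ-≤ (i * w) (ℕ.≤-trans ≤Z (ℕ.m≤m+n _ _))) (ℕ.≤-reflexive (sym len-line))
    i′≤ : (i + span) * w ≤ length line
    i′≤ = ℕ.≤-trans (ℕ.≤-reflexive (ℕ.*-distribʳ-+ w i span)) fit
    eq′ : drop ((i + span) * w) line ≡ Z′ ++ Y
    eq′ = trans (cong (λ j → drop j line) (ℕ.*-distribʳ-+ w i span))
      (trans (sym (List.drop-drop (i * w) s line)) (trans (cong (drop s) eq) (drop-++ s Z Y ≤Z)))
    first : ι s ℚ.≤ τ ℚ.* ∑ (take s Z) dead
    first = ≤≡ (windows-dead i fit) (cong (λ zs → τ ℚ.* ∑ zs dead) (trans (cong (take s) eq) (take-++ s Z Y ≤Z)))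

  -- At most one cell is lost before the first grid point and four behind the last full window,
  -- which makes five.
  interval : ∀ X I Y → line ≡ X ++ I ++ Y → ι (length I) ℚ.≤ ι (5 * w) ℚ.+ τ ℚ.* ∑ I dead
  interval X I Y refl with ℕ.≤-total gap (length I)
    where
    gap : ℕ
    gap = suc (length X ℕ./ w) * w ∸ length X
  ... | inj₂ I≤gap = ≤-by (ι-mono (ℕ.≤-trans I≤gap (ℕ.≤-trans gap≤w (ℕ.m≤m+n w _))) +≤ 0≤* 0≤τ (0≤∑ I 0≤dead))
    (((∀ a b c → a ℚ.+ (b ℚ.+ c) ≡ b ℚ.+ c ℚ.+ (a ℚ.+ 0ℚ)) ∋ solve-∀ ℚ-ring) (ι (length I)) (ι (5 * w)) (τ ℚ.* ∑ I dead))
    where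
    gap≤w : suc (length X ℕ./ w) * w ∸ length X ≤ w
    gap≤w = ℕ.m≤n+o⇒m∸n≤o (suc (length X ℕ./ w) * w) (length X) (ℕ.≤-trans (ℕ.+-monoʳ-≤ w (ℕ.m/n*n≤m (length X) w)) (ℕ.≤-reflexive (ℕ.+-comm w (length X))))
  ... | inj₁ gap≤I = begin
    ι (length I)                                             ≡⟨ cong ι (sym (ℕ.m+[n∸m]≡n gap≤I)) ⟩
    ι (gap + (length I ∸ gap))                               ≡⟨ ι-+ gap _ ⟩
    ι gap ℚ.+ ι (length I ∸ gap)                             ≤⟨ ι-mono gap≤w +≤ ≡≤ (cong ι (sym (List.length-drop gap I))) (aligned (length Z) i Z Y ℕ.≤-refl eq i≤) ⟩
    ι w ℚ.+ (ι (span * w) ℚ.+ τ ℚ.* ∑ Z dead)                ≡⟨ trans (sym (ℚ.+-assoc (ι w) (ι (span * w)) _)) (cong (ℚ._+ τ ℚ.* ∑ Z dead) (sym (ι-+ w (span * w)))) ⟩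
    ι (5 * w) ℚ.+ τ ℚ.* ∑ Z dead                             ≤⟨ ℚ.+-monoʳ-≤ (ι (5 * w)) (*≤ 0≤τ Z≤I) ⟩
    ι (5 * w) ℚ.+ τ ℚ.* ∑ I dead                             ∎
    where
    open ℚ.≤-Reasoning
    i gap : ℕ
    -- The first grid point strictly behind the start: if X already ends on the grid, a whole cell
    -- is given away, which the bound `gap≤w` allows.
    i = suc (length X ℕ./ w)
    gap = i * w ∸ length X
    Z : List A
    Z = drop gap I
    X≤ : length X ≤ i * w
    X≤ = ℕ.<⇒≤ (≡⇒< (ℕ.m≡m%n+[m/n]*n (length X) w))
      where
      ≡⇒< : length X ≡ length X ℕ.% w + length X ℕ./ w * w → length X < w + length X ℕ./ w * w
      ≡⇒< eq = ℕ.≤-trans (ℕ.≤-reflexive (cong suc eq)) (ℕ.+-monoˡ-< _ (ℕ.m%n<n (length X) w))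
    gap≤w : gap ≤ w
    gap≤w = ℕ.m≤n+o⇒m∸n≤o (i * w) (length X) (ℕ.≤-trans (ℕ.+-monoʳ-≤ w (ℕ.m/n*n≤m (length X) w)) (ℕ.≤-reflexive (ℕ.+-comm w (length X))))
    position : i * w ≡ length X + gap
    position = sym (ℕ.m+[n∸m]≡n X≤)
    eq : drop (i * w) (X ++ I ++ Y) ≡ Z ++ Y
    eq = trans (cong (λ j → drop j (X ++ I ++ Y)) position) (trans (drop-length-++ X (I ++ Y) gap) (drop-++ gap I Y gap≤I))
    i≤ : i * w ≤ length (X ++ I ++ Y)
    i≤ = ℕ.≤-trans (ℕ.≤-reflexive position) (ℕ.≤-trans (ℕ.+-monoʳ-≤ (length X) (ℕ.≤-trans gap≤I (ℕ.≤-trans (ℕ.m≤m+n _ _) (ℕ.≤-reflexive (sym (List.length-++ I)))))) (ℕ.≤-reflexive (sym (List.length-++ X))))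
    Z≤I : ∑ Z dead ℚ.≤ ∑ I dead
    Z≤I = ≤≡ (≡≤ (sym (ℚ.+-identityˡ (∑ Z dead))) (ℚ.+-monoˡ-≤ (∑ Z dead) (0≤∑ (take gap I) 0≤dead)))
      (trans (sym (∑-++ (take gap I) Z dead)) (cong (λ zs → ∑ zs dead) (List.take++drop≡id gap I)))

filter-prefix : ∀ {A : Set} (P : A → Bool) xs → AllPairs (λ x y → P y ≡ true → P x ≡ true) xs → ∃[ ys ] xs ≡ filterᵇ P xs ++ ys
filter-prefix P []       []           = [] , refl
filter-prefix P (x ∷ xs) (h ∷ pairs) with P x in eq
... | true  with filter-prefix P xs pairs
...   | ys , eq′ = ys , cong (x ∷_) eq′
filter-prefix P (x ∷ xs) (h ∷ pairs) | false = x ∷ xs , cong (_++ x ∷ xs) (sym (none xs h))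
  where
  none : ∀ ys → All (λ y → P y ≡ true → false ≡ true) ys → filterᵇ P ys ≡ []
  none []       []      = refl
  none (y ∷ ys) (p ∷ ps) with P y
  ... | true  = case p refl of λ ()
  ... | false = none ys ps

-- Lower bounds for tours when far certificates are expensive

module LowerBound
  {m} (d : Weights (suc m)) (metric : IsMetric _≡_ d) (3≤n : 3 ≤ suc m) (T : RTree m)
  (len : Fin m → ℕ) (len≡ : ∀ e → len e ≡ d (Fin.inject₁ e) (parent T e))
  (mk : Fin m → Bool)
  where

  open TreeTours d metric 3≤n T len len≡ public
  open Lines T mk len public
  open Crossings T public

  private
    dist : Pair → ℕ
    dist = uncurry d

  far : Pair → Fin m → Bool
  far (u , v) e = (below T e u ∧ not (local T mk e u)) ∨ (below T e v ∧ not (local T mk e v))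

  -- The pairs assigned to an edge they do not cross locally.
  isFar : Pair × List Pair → Bool
  isFar (f , before) = ⌊ Fin.any? (λ e → (assigned before f e ∧ far f e) Bool.≟ true) ⌋

  Sorted : Pair × List Pair → Set
  Sorted (f , before) = All (λ g → depth g ≤ depth f) before

  private
    ∧-true : ∀ {a b} → a ∧ b ≡ true → a ≡ true × b ≡ true
    ∧-true {true} {true} _ = refl , refl

    xor-true : ∀ {a b} → a xor b ≡ true → (a ≡ true × b ≡ false) ⊎ (a ≡ false × b ≡ true)
    xor-true {true}  {false} _ = inj₁ (refl , refl)
    xor-true {false} {true}  _ = inj₂ (refl , refl)

    <?-true : ∀ {k} → ⌊ k ℕ.<? 2 ⌋ ≡ true → k < 2
    <?-true {k} eq with k ℕ.<? 2
    ... | yes k<2 = k<2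

    <?-intro : ∀ {k} → k < 2 → ⌊ k ℕ.<? 2 ⌋ ≡ true
    <?-intro {k} k<2 with k ℕ.<? 2
    ... | yes _  = refl
    ... | no k≮2 = contradiction k<2 k≮2

    not-false : ∀ {b} → b ≡ false → not b ≡ true
    not-false refl = refl

    not-above : ∀ {e e′ v} → below T e′ v ≡ false → below T e′ (Fin.inject₁ e) ≡ true → below T e v ≡ false
    not-above {e} {e′} {v} v↑ e⊑e′ with below T e v in eq
    ... | true  = trans (sym (below-trans T eq e⊑e′)) v↑
    ... | false = refl

  cross⁺ : ∀ {u v e} → below T e u ≡ true → below T e v ≡ false → cross T (u , v) e ≡ true
  cross⁺ u↓ v↑ rewrite u↓ | v↑ = refl

  cross⁺′ : ∀ {u v e} → below T e u ≡ false → below T e v ≡ true → cross T (u , v) e ≡ true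
  cross⁺′ u↑ v↓ rewrite u↑ | v↓ = refl

  assigned⁻ : ∀ before f {e} → assigned before f e ≡ true → cross T f e ≡ true × crossings before e < 2
  assigned⁻ before f as with ∧-true {cross T f _} as
  ... | c , k = c , <?-true k

  assigned⁺ : ∀ before f {e} → cross T f e ≡ true → crossings before e < 2 → assigned before f e ≡ true
  assigned⁺ before f c k rewrite c = <?-intro k

  -- Going down from e′ to e loses earlier crossings but gains none, by `crossings-above`, so there
  -- are still fewer than two. This is what sorting by depth is for.
  assigned-below : ∀ {u v e e′} before → Sorted ((u , v) , before) → below T e u ≡ true → below T e′ v ≡ false → below T e′ (Fin.inject₁ e) ≡ true →
                   assigned before (u , v) e′ ≡ true → assigned before (u , v) e ≡ true
  assigned-below {u} {v} before sorted u↓ v↑ e⊑e′ as = assigned⁺ before (u , v) (cross⁺ {u} {v} u↓ (not-above {v = v} v↑ e⊑e′))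
    (ℕ.≤-trans (s≤s (crossings-above {u} {v} before (below-trans T u↓ e⊑e′) v↑ e⊑e′ sorted)) (proj₂ (assigned⁻ before (u , v) as)))

  assigned-below′ : ∀ {u v e e′} before → Sorted ((u , v) , before) → below T e v ≡ true → below T e′ u ≡ false → below T e′ (Fin.inject₁ e) ≡ true →
                    assigned before (u , v) e′ ≡ true → assigned before (u , v) e ≡ true
  assigned-below′ {u} {v} before sorted v↓ u↑ e⊑e′ as = assigned⁺ before (u , v) (cross⁺′ {u} {v} (not-above {v = u} u↑ e⊑e′) v↓)
    (ℕ.≤-trans (s≤s (crossings-above {v} {u} before (below-trans T v↓ e⊑e′) u↑ e⊑e′ (crossings-sym {u} {v} before sorted))) (proj₂ (assigned⁻ before (u , v) as)))

  -- The marked edge that makes the assigned edge non-local lies below it on the path of the pair,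
  -- and assignment is inherited downwards.
  far-marked : ∀ h → Sorted h → isFar h ≡ true → ∃[ e ] mk e ≡ true × assigned (proj₂ h) (proj₁ h) e ≡ true
  far-marked ((u , v) , before) sorted eq with Fin.any? (λ e → (assigned before (u , v) e ∧ far (u , v) e) Bool.≟ true)
  ... | yes (e , p) with ∧-true {assigned before (u , v) e} p
  ...   | as , fr with xor-true {below T e u} (proj₁ (assigned⁻ before (u , v) as))
  ...     | inj₁ (u↓ , v↑) with blocked T mk u↓ (non-local fr)
    where
    non-local : far (u , v) e ≡ true → local T mk e u ≡ false
    non-local fr rewrite u↓ | v↑ with local T mk e u
    ... | false = refl
  ...       | e′ , me , e′↓ , e′⊑e = e′ , me , assigned-below {u} {v} before sorted e′↓ v↑ e′⊑e as
  far-marked ((u , v) , before) sorted eq | yes (e , p) | as , fr | inj₂ (u↑ , v↓) with blocked T mk v↓ (non-local fr)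
    where
    non-local : far (u , v) e ≡ true → local T mk e v ≡ false
    non-local fr rewrite u↑ | v↓ with local T mk e v
    ... | false = refl
  ...       | e′ , me , e′↓ , e′⊑e = e′ , me , assigned-below′ {u} {v} before sorted e′↓ u↑ e′⊑e as

  -- Every far pair is one of the two pairs assigned to some marked edge.
  few-far : ∀ fs → All Sorted (history [] fs) → ∑ (history [] fs) (λ h → ⟦ isFar h ⟧) ℚ.≤ ι 2 ℚ.* ∑ (fins m) (λ e → ⟦ mk e ⟧)
  few-far fs sorted = begin
    ∑ hs (λ h → ⟦ isFar h ⟧)                                  ≤⟨ ∑-mono∈ hs (λ {h} h∈ → pointwise h (All.lookup sorted h∈)) ⟩
    ∑ hs (λ h → ∑ (fins m) (λ e → ⟦ mk e ⟧ ℚ.* hit e h))      ≡⟨ ∑-swap hs (fins m) (λ h e → ⟦ mk e ⟧ ℚ.* hit e h) ⟩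
    ∑ (fins m) (λ e → ∑ hs (λ h → ⟦ mk e ⟧ ℚ.* hit e h))      ≡⟨ ∑-cong (fins m) (λ e → ∑-*ˡ hs ⟦ mk e ⟧ (hit e)) ⟩
    ∑ (fins m) (λ e → ⟦ mk e ⟧ ℚ.* ∑ hs (hit e))              ≤⟨ ∑-mono (fins m) (λ e → *≤ 0≤⟦ mk e ⟧ (∑-assigned-≤2 e fs)) ⟩
    ∑ (fins m) (λ e → ⟦ mk e ⟧ ℚ.* ι 2)                       ≡⟨ trans (∑-*ʳ (fins m) (ι 2) (λ e → ⟦ mk e ⟧)) (ℚ.*-comm _ (ι 2)) ⟩
    ι 2 ℚ.* ∑ (fins m) (λ e → ⟦ mk e ⟧)                       ∎
    where
    open ℚ.≤-Reasoning
    hs : List (Pair × List Pair)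
    hs = history [] fs
    pointwise : ∀ h → Sorted h → ⟦ isFar h ⟧ ℚ.≤ ∑ (fins m) (λ e → ⟦ mk e ⟧ ℚ.* hit e h)
    pointwise h sorted with isFar h in eq
    ... | false = 0≤∑ (fins m) λ e → 0≤* 0≤⟦ mk e ⟧ 0≤⟦ assigned (proj₂ h) (proj₁ h) e ⟧
    ... | true with far-marked h sorted eq
    ...   | e , me , as = ≡≤ (sym (cong₂ (λ x y → ⟦ x ⟧ ℚ.* ⟦ y ⟧) me as))
            (≤∑ {f = λ e → ⟦ mk e ⟧ ℚ.* hit e h} (λ e → 0≤* 0≤⟦ mk e ⟧ 0≤⟦ assigned (proj₂ h) (proj₁ h) e ⟧) (∈-fins e))

  -- The edges assigned to a pair that is not far form an interval of its line.
  module Near (u v : Fin (suc m)) (before : List Pair) (sorted : Sorted ((u , v) , before)) where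

    own : Fin m → Bool
    own = assigned before (u , v)

    left right : List (Fin m)
    left  = filterᵇ own (climbing v u)
    right = filterᵇ own (climbing u v)

    segment : List (Fin m)
    segment = reverse left ++ right

    AllPairs-∈ : ∀ {A : Set} {R : A → A → Set} {xs} → AllPairs R xs → AllPairs (λ x y → (x ∈ xs × y ∈ xs) × R x y) xs
    AllPairs-∈ []         = []
    AllPairs-∈ (px ∷ pxs) = All.tabulate (λ y∈ → (here refl , there y∈) , All.lookup px y∈) ∷ AllPairs.map (λ ((x∈ , y∈) , r) → (there x∈ , there y∈) , r) (AllPairs-∈ pxs)

    climbing-ordered : ∀ u v → AllPairs (λ e e′ → (e ∈ climbing u v × e′ ∈ climbing u v) × below T e′ (Fin.inject₁ e) ≡ true) (climbing u v)
    climbing-ordered u v = AllPairs-∈ (AllPairs.filter⁺ _ (upward-ordered T mk u))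

    left-prefix : ∃[ xs ] climbing v u ≡ left ++ xs
    left-prefix = filter-prefix own (climbing v u) (AllPairs.map inherit (climbing-ordered v u))
      where
      inherit : ∀ {e e′} → (e ∈ climbing v u × e′ ∈ climbing v u) × below T e′ (Fin.inject₁ e) ≡ true → own e′ ≡ true → own e ≡ true
      inherit ((e∈ , e′∈) , e⊑e′) = assigned-below′ {u} {v} before sorted (local-below T mk (proj₁ (climbing⁻ v u e∈))) (proj₂ (climbing⁻ v u e′∈)) e⊑e′

    right-prefix : ∃[ xs ] climbing u v ≡ right ++ xs
    right-prefix = filter-prefix own (climbing u v) (AllPairs.map inherit (climbing-ordered u v))
      where
      inherit : ∀ {e e′} → (e ∈ climbing u v × e′ ∈ climbing u v) × below T e′ (Fin.inject₁ e) ≡ true → own e′ ≡ true → own e ≡ true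
      inherit ((e∈ , e′∈) , e⊑e′) = assigned-below {u} {v} before sorted (local-below T mk (proj₁ (climbing⁻ u v e∈))) (proj₂ (climbing⁻ u v e′∈)) e⊑e′

    split : ∃[ xs ] ∃[ ys ] lineEdges (u , v) ≡ xs ++ segment ++ ys
    split with left-prefix | right-prefix
    ... | xs , eq | ys , eq′ = reverse xs , ys , (begin
      reverse (climbing v u) ++ climbing u v        ≡⟨ cong₂ _++_ (trans (cong reverse eq) (List.reverse-++ left xs)) eq′ ⟩
      (reverse xs ++ reverse left) ++ right ++ ys   ≡⟨ List.++-assoc (reverse xs) (reverse left) (right ++ ys) ⟩
      reverse xs ++ reverse left ++ right ++ ys     ≡⟨ cong (reverse xs ++_) (sym (List.++-assoc (reverse left) right ys)) ⟩
      reverse xs ++ segment ++ ys                   ∎)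
      where open ≡-Reasoning

    segment-own : ∀ {e} → e ∈ segment → own e ≡ true
    segment-own e∈ with ∈.∈-++⁻ (reverse left) e∈
    ... | inj₁ e∈′ = proj₂ (∈-filterᵇ⁻ own (climbing v u) (Any.reverse⁻ e∈′))
    ... | inj₂ e∈′ = proj₂ (∈-filterᵇ⁻ own (climbing u v) e∈′)

    segment-unique : Unique segment
    segment-unique with split
    ... | xs , ys , eq = ++-unique segment ys (++-uniqueʳ xs (subst Unique eq (lineEdges-unique (u , v))))
      where
      ++-uniqueʳ : ∀ {A : Set} (xs : List A) {ys} → Unique (xs ++ ys) → Unique ys
      ++-uniqueʳ []       uq       = uq
      ++-uniqueʳ (x ∷ xs) (_ ∷ uq) = ++-uniqueʳ xs uq
      ++-unique : ∀ {A : Set} (xs ys : List A) → Unique (xs ++ ys) → Unique xs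
      ++-unique []       ys _         = []
      ++-unique (x ∷ xs) ys (x∉ ∷ uq) = All.++⁻ˡ xs x∉ ∷ ++-unique xs ys uq

    module _ (near? : isFar ((u , v) , before) ≡ false) where

      private
        near-own : ∀ e → own e ≡ true → far (u , v) e ≡ false
        near-own e as with Fin.any? (λ e → (own e ∧ far (u , v) e) Bool.≟ true)
        ... | no ¬any with far (u , v) e in eq
        ...   | true  = contradiction (e , cong₂ _∧_ as eq) ¬any
        ...   | false = refl

      own-segment : ∀ e → own e ≡ true → e ∈ segment
      own-segment e as with xor-true {below T e u} (proj₁ (assigned⁻ before (u , v) as)) | near-own e as
      ... | inj₁ (u↓ , v↑) | nr = ∈.∈-++⁺ʳ (reverse left) (∈-filterᵇ⁺ own (∈-filterᵇ⁺ (λ e → not (below T e v)) (local-upward T mk u is-local) (not-false v↑)) as)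
        where
        is-local : local T mk e u ≡ true
        is-local rewrite u↓ | v↑ with local T mk e u
        ... | true = refl
      ... | inj₂ (u↑ , v↓) | nr = ∈.∈-++⁺ˡ (Any.reverse⁺ (∈-filterᵇ⁺ own (∈-filterᵇ⁺ (λ e → not (below T e u)) (local-upward T mk v is-local) (not-false u↑)) as))
        where
        is-local : local T mk e v ≡ true
        is-local rewrite u↑ | v↓ with local T mk e v
        ... | true = refl

      own-≤-segment : ∀ φ → (∀ e → 0ℚ ℚ.≤ φ e) → ∑ (fins m) (λ e → ⟦ own e ⟧ ℚ.* φ e) ℚ.≤ ∑ segment φ
      own-≤-segment φ 0≤φ = ≡≤ (sym (∑-filter own (fins m) φ))
        (∑-⊆ φ 0≤φ (Unique.filter⁺ _ (Unique-fins m)) λ {e} e∈ → own-segment e (proj₂ (∈-filterᵇ⁻ own (fins m) e∈)))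

    segment-≤-own : ∀ φ → (∀ e → 0ℚ ℚ.≤ φ e) → ∑ segment φ ℚ.≤ ∑ (fins m) (λ e → ⟦ own e ⟧ ℚ.* φ e)
    segment-≤-own φ 0≤φ = ≤≡ (∑-⊆ φ 0≤φ segment-unique λ {e} e∈ → ∈-filterᵇ⁺ own (∈-fins e) (segment-own e∈)) (∑-filter own (fins m) φ)

-- The chord of the concave function 1 - ½^c between 0 and 2, the possible numbers of far pairs
-- assigned to an edge.
half-power : ∀ c → c ≤ 2 → (ℤ.+ 3 ℚ./ 8) ℚ.* ι c ℚ.≤ 1ℚ ℚ.- ½ ^ℚ c
half-power 0 _ = ≡≤ (cong ((ℤ.+ 3 ℚ./ 8) ℚ.*_) (ι≡fromℕ 0)) (ℚ.*≤* (ℤ.+≤+ z≤n))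
half-power 1 _ = ≡≤ (cong ((ℤ.+ 3 ℚ./ 8) ℚ.*_) (ι≡fromℕ 1)) (ℚ.*≤* (ℤ.+≤+ (ℕ.m≤m+n 6 2)))
half-power 2 _ = ≡≤ (cong ((ℤ.+ 3 ℚ./ 8) ℚ.*_) (ι≡fromℕ 2)) (ℚ.*≤* (ℤ.+≤+ (ℕ.m≤m+n 12 0)))
half-power (suc (suc (suc c))) (s≤s (s≤s ()))

-- The final linear combination: a and b are the lengths assigned to far and to near pairs.
combine : ∀ {M a b W̃ wf wn ε n D η v} →
  a ℚ.+ b ≡ (ℤ.+ 2 ℚ./ 1) ℚ.* M →
  (ℤ.+ 3 ℚ./ 1) ℚ.* b ℚ.≤ (ℤ.+ 5 ℚ./ 1) ℚ.* wn ℚ.+ D →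
  (1ℚ ℚ.+ 1ℚ) ℚ.* M ℚ.- η ℚ.≤ v →
  v ℚ.≤ (1ℚ ℚ.+ 1ℚ) ℚ.* M ℚ.+ (ℤ.+ 1 ℚ./ 4) ℚ.* W̃ ℚ.- ½ ℚ.* ((ℤ.+ 3 ℚ./ 8) ℚ.* a) →
  W̃ ℚ.≤ wf ℚ.+ n ℚ.* ε → 0ℚ ℚ.≤ wf →
  (ℤ.+ 6 ℚ./ 1) ℚ.* M ℚ.≤ (ℤ.+ 5 ℚ./ 1) ℚ.* (wf ℚ.+ wn) ℚ.+ (ℤ.+ 16 ℚ./ 1) ℚ.* η ℚ.+ (ℤ.+ 4 ℚ./ 1) ℚ.* (n ℚ.* ε) ℚ.+ D
combine {M} {a} {b} {W̃} {wf} {wn} {ε} {n} {D} {η} {v} a+b b≤ ≤v v≤ W̃≤ 0≤wf = begin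
  (ℤ.+ 6 ℚ./ 1) ℚ.* M                                   ≡⟨ ((∀ M → (ℤ.+ 6 ℚ./ 1) ℚ.* M ≡ (ℤ.+ 3 ℚ./ 1) ℚ.* ((ℤ.+ 2 ℚ./ 1) ℚ.* M)) ∋ solve-∀ ℚ-ring) M ⟩
  (ℤ.+ 3 ℚ./ 1) ℚ.* ((ℤ.+ 2 ℚ./ 1) ℚ.* M)               ≡⟨ cong ((ℤ.+ 3 ℚ./ 1) ℚ.*_) (sym a+b) ⟩
  -- The bounds on v give 3 a ≤ 4 W̃ + 16 η for the far pairs; with 3 b ≤ 5 wn + D for the near
  -- pairs the sum is 6 M on the left. Far pairs would allow the factor 4; the near ones force 5.
  (ℤ.+ 3 ℚ./ 1) ℚ.* (a ℚ.+ b)                           ≤⟨ ≤-by (b≤ +≤ (*≤ (0≤lit 16) (ℚ.≤-trans ≤v v≤) +≤ (*≤ (0≤lit 4) W̃≤ +≤ 0≤wf))) (equation M a b W̃ wf wn (n ℚ.* ε) D η) ⟩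
  (ℤ.+ 5 ℚ./ 1) ℚ.* (wf ℚ.+ wn) ℚ.+ (ℤ.+ 16 ℚ./ 1) ℚ.* η ℚ.+ (ℤ.+ 4 ℚ./ 1) ℚ.* (n ℚ.* ε) ℚ.+ D ∎
  where
  open ℚ.≤-Reasoning
  0≤lit : ∀ k → 0ℚ ℚ.≤ ℤ.+ k ℚ./ 1
  0≤lit k = subst (0ℚ ℚ.≤_) (ι≡fromℕ k) (0≤ι k)
  equation : ∀ M a b W̃ wf wn e D η →
    (ℤ.+ 3 ℚ./ 1) ℚ.* (a ℚ.+ b) ℚ.+ ((ℤ.+ 5 ℚ./ 1) ℚ.* wn ℚ.+ D ℚ.+ ((ℤ.+ 16 ℚ./ 1) ℚ.* ((1ℚ ℚ.+ 1ℚ) ℚ.* M ℚ.+ (ℤ.+ 1 ℚ./ 4) ℚ.* W̃ ℚ.- ½ ℚ.* ((ℤ.+ 3 ℚ./ 8) ℚ.* a))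
      ℚ.+ ((ℤ.+ 4 ℚ./ 1) ℚ.* (wf ℚ.+ e) ℚ.+ wf)))
    ≡ (ℤ.+ 5 ℚ./ 1) ℚ.* (wf ℚ.+ wn) ℚ.+ (ℤ.+ 16 ℚ./ 1) ℚ.* η ℚ.+ (ℤ.+ 4 ℚ./ 1) ℚ.* e ℚ.+ D
      ℚ.+ ((ℤ.+ 3 ℚ./ 1) ℚ.* b ℚ.+ ((ℤ.+ 16 ℚ./ 1) ℚ.* ((1ℚ ℚ.+ 1ℚ) ℚ.* M ℚ.- η) ℚ.+ ((ℤ.+ 4 ℚ./ 1) ℚ.* W̃ ℚ.+ 0ℚ)))
  equation = solve-∀ ℚ-ring

module LowerBoundSum
  {m} (d : Weights (suc m)) (metric : IsMetric _≡_ d) (3≤n : 3 ≤ suc m) (T : RTree m)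
  (len : Fin m → ℕ) (len≡ : ∀ e → len e ≡ d (Fin.inject₁ e) (parent T e))
  (mk : Fin m → Bool)
  (dead : Fin m × ℕ → ℚ) (0≤dead : ∀ q → 0ℚ ℚ.≤ dead q) (τ : ℚ) (0≤τ : 0ℚ ℚ.≤ τ)
  (windows-dead : ∀ f → NonZero (uncurry d f) → ∀ i → i * uncurry d f + span * uncurry d f ≤ length (Lines.line T mk len f) →
    ι (span * uncurry d f) ℚ.≤ τ ℚ.* ∑ (Lines.window T mk len f (uncurry d f) i) dead)
  (κ : Fin (suc m) × Fin (suc m) → ℚ) (ε η : ℚ) (κ≤ : ∀ f → κ f ℚ.≤ ι (uncurry d f) ℚ.+ ε) (0≤ε : 0ℚ ℚ.≤ ε)
  where

  open LowerBound d metric 3≤n T len len≡ mk public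

  dist : Pair → ℕ
  dist = uncurry d

  deadOn : Fin m → ℚ
  deadOn e = ∑ (unitsOf e) dead

  0≤deadOn : ∀ e → 0ℚ ℚ.≤ deadOn e
  0≤deadOn e = 0≤∑ (unitsOf e) 0≤dead

  assignedLength assignedDead : Pair × List Pair → ℚ
  assignedLength h = ∑ (fins m) λ e → hit e h ℚ.* ι (len e)
  assignedDead   h = ∑ (fins m) λ e → hit e h ℚ.* deadOn e

  near-bound : ∀ h → Sorted h → isFar h ≡ false → NonZero (dist (proj₁ h)) →
               (ℤ.+ 3 ℚ./ 1) ℚ.* assignedLength h ℚ.≤ (ℤ.+ 5 ℚ./ 1) ℚ.* ι (dist (proj₁ h)) ℚ.+ τ ℚ.* assignedDead h
  near-bound ((u , v) , before) sorted near? w≢0 = begin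
    (ℤ.+ 3 ℚ./ 1) ℚ.* assignedLength ((u , v) , before)     ≤⟨ *≤ {ℤ.+ 3 ℚ./ 1} (ℚ.*≤* (ℤ.+≤+ z≤n)) (own-≤-segment near? (ι ∘ len) (0≤ι ∘ len)) ⟩
    (ℤ.+ 3 ℚ./ 1) ℚ.* ∑ segment (ι ∘ len)                   ≡⟨ sym segment-length ⟩
    ι (length I)                                            ≤⟨ interval-bound ⟩
    ι (5 * w) ℚ.+ τ ℚ.* ∑ I dead                            ≡⟨ cong₂ (λ x y → x ℚ.+ τ ℚ.* y) (trans (ι-* 5 w) (cong (ℚ._* ι w) (ι≡fromℕ 5))) (∑-concatMap unitsOf segment dead) ⟩
    (ℤ.+ 5 ℚ./ 1) ℚ.* ι w ℚ.+ τ ℚ.* ∑ segment deadOn        ≤⟨ ℚ.+-monoʳ-≤ ((ℤ.+ 5 ℚ./ 1) ℚ.* ι w) (*≤ 0≤τ (segment-≤-own deadOn 0≤deadOn)) ⟩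
    (ℤ.+ 5 ℚ./ 1) ℚ.* ι w ℚ.+ τ ℚ.* assignedDead ((u , v) , before) ∎
    where
    open ℚ.≤-Reasoning
    open Near u v before sorted
    w : ℕ
    w = d u v
    I : List Elem
    I = concatMap unitsOf segment
    segment-length : ι (length I) ≡ (ℤ.+ 3 ℚ./ 1) ℚ.* ∑ segment (ι ∘ len)
    segment-length = trans (length-concatMap-≡ unitsOf segment) (trans (∑-cong segment λ e →
      trans (cong ι (trans (List.length-map (e ,_) (upTo (resolution * len e))) (List.length-upTo (resolution * len e))))
        (trans (ι-* 3 (len e)) (cong (ℚ._* ι (len e)) (ι≡fromℕ 3)))) (∑-*ˡ segment (ℤ.+ 3 ℚ./ 1) (ι ∘ len)))
    interval-bound : ι (length I) ℚ.≤ ι (5 * w) ℚ.+ τ ℚ.* ∑ I dead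
    interval-bound = Intervals.interval dead 0≤dead τ 0≤τ w {{w≢0}} (line (u , v)) (windows-dead (u , v) w≢0)
      (concatMap unitsOf (proj₁ split)) I (concatMap unitsOf (proj₁ (proj₂ split)))
      (trans (cong (concatMap unitsOf) (proj₂ (proj₂ split))) (trans (List.concatMap-++ unitsOf (proj₁ split) (segment ++ proj₁ (proj₂ split)))
        (cong (concatMap unitsOf (proj₁ split) ++_) (List.concatMap-++ unitsOf segment (proj₁ (proj₂ split))))))

  -- With probability ¼ a pair multiplies `miss e` by 1 - 2 · ¼ = ½ for every edge e it crosses.
  halves : List (Pair × List Pair) → List (Pair × ℚ)
  halves = map λ h → proj₁ h , ℤ.+ 1 ℚ./ 4

  -- Pairs that cross e without being assigned to it also halve `miss e`; they are simply not
  -- counted.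
  miss-≤ : ∀ e hs → ∃[ c ] ∑ hs (hit e) ≡ ι c × 0ℚ ℚ.≤ miss e (halves hs) × miss e (halves hs) ℚ.≤ ½ ^ℚ c
  miss-≤ e []       = 0 , sym ι-0 , 0≤1 , ℚ.≤-refl
  miss-≤ e ((f , before) ∷ hs) with miss-≤ e hs | cross T f e | ⌊ crossings before e ℕ.<? 2 ⌋
  ... | c , eq , 0≤μ , μ≤ | true  | true  = suc c , trans (cong (1ℚ ℚ.+_) eq) (sym (ι-suc c)) , 0≤* {½} 0≤½ 0≤μ , *≤ {½} 0≤½ μ≤
    where
    0≤½ : 0ℚ ℚ.≤ ½
    0≤½ = ℚ.*≤* (ℤ.+≤+ z≤n)
  ... | c , eq , 0≤μ , μ≤ | true  | false = c , trans (ℚ.+-identityˡ _) eq , 0≤* {½} (ℚ.*≤* (ℤ.+≤+ z≤n)) 0≤μ , ℚ.≤-trans (≤≡ (≤* {a = ½} {b = 1ℚ} 0≤μ (ℚ.*≤* (ℤ.+≤+ (s≤s z≤n)))) (ℚ.*-identityˡ _)) μ≤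
  ... | c , eq , 0≤μ , μ≤ | false | _     = c , trans (ℚ.+-identityˡ _) eq , ≤≡ 0≤μ (sym (ℚ.*-identityˡ _)) , ≡≤ (ℚ.*-identityˡ _) μ≤

  module _ (vs : List (Fin (suc m))) (ham : IsHamiltonianCycle vs)
           (N : ℚ) (few-marks : ι 2 ℚ.* ∑ (fins m) (λ e → ⟦ mk e ⟧) ℚ.≤ N)
           (expensive : ∀ S → ι (length S) ℚ.≤ N → (1ℚ ℚ.+ 1ℚ) ℚ.* M ℚ.- η ℚ.≤ value κ S)
           where

    private
      fs : List Pair
      fs = byDepth (closedSteps vs)

      hs farOnes : List (Pair × List Pair)
      hs = history [] fs
      farOnes = filterᵇ isFar hs

      sorted : All Sorted hs
      sorted = history-sorted [] fs (byDepth-sorted (closedSteps vs)) (All.tabulate λ _ → [])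

      crossed : ∀ e → 2 ≤ crossings fs e
      crossed e = ℕ.≤-trans (tour-crosses vs (proj₂ ham) e) (ℕ.≤-reflexive (ι-injective (trans (∑-crossings (closedSteps vs) e)
        (trans (sym (∑-↭ (λ f → ⟦ cross T f e ⟧) (byDepth-↭ (closedSteps vs)))) (sym (∑-crossings fs e))))))
        where
        ι-injective : ∀ {a b} → ι a ≡ ι b → a ≡ b
        ι-injective eq = ℕ.≤-antisym (ι-cancel-≤ (ℚ.≤-reflexive eq)) (ι-cancel-≤ (ℚ.≤-reflexive (sym eq)))

      weight : ι (cycleWeight d vs) ≡ ∑ hs (ι ∘ dist ∘ proj₁)
      weight = trans (∑-sum (closedSteps vs) dist) (trans (sym (∑-↭ (ι ∘ dist) (byDepth-↭ (closedSteps vs)))) (sym (∑-history [] fs (ι ∘ dist))))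

      distinct : ∀ {h} → h ∈ hs → NonZero (dist (proj₁ h))
      distinct h∈ = d-pos (All.lookup (proj₂ (proj₂ (proj₁ ham))) (∈-resp-↭ (byDepth-↭ (closedSteps vs)) (history-∈ [] fs h∈)))

      partition : ∀ φ → ∑ farOnes φ ℚ.+ ∑ hs (λ h → ⟦ not (isFar h) ⟧ ℚ.* φ h) ≡ ∑ hs φ
      partition φ = trans (cong (ℚ._+ ∑ hs (λ h → ⟦ not (isFar h) ⟧ ℚ.* φ h)) (∑-filter isFar hs φ))
        (trans (sym (∑-+ hs (λ h → ⟦ isFar h ⟧ ℚ.* φ h) (λ h → ⟦ not (isFar h) ⟧ ℚ.* φ h))) (∑-cong hs λ h → split (isFar h) (φ h)))
        where
        split : ∀ b x → ⟦ b ⟧ ℚ.* x ℚ.+ ⟦ not b ⟧ ℚ.* x ≡ x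
        split true  = (∀ x → 1ℚ ℚ.* x ℚ.+ 0ℚ ℚ.* x ≡ x) ∋ solve-∀ ℚ-ring
        split false = (∀ x → 0ℚ ℚ.* x ℚ.+ 1ℚ ℚ.* x ≡ x) ∋ solve-∀ ℚ-ring

      farLength nearLength farWeight nearWeight farκ totalDead : ℚ
      farLength  = ∑ farOnes assignedLength
      nearLength = ∑ hs (λ h → ⟦ not (isFar h) ⟧ ℚ.* assignedLength h)
      farWeight  = ∑ farOnes (ι ∘ dist ∘ proj₁)
      nearWeight = ∑ hs (λ h → ⟦ not (isFar h) ⟧ ℚ.* ι (dist (proj₁ h)))
      farκ       = ∑ farOnes (κ ∘ proj₁)
      totalDead  = ∑ units dead

      lengths : farLength ℚ.+ nearLength ≡ (ℤ.+ 2 ℚ./ 1) ℚ.* M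
      lengths = begin
        farLength ℚ.+ nearLength                                       ≡⟨ partition assignedLength ⟩
        ∑ hs (λ h → ∑ (fins m) λ e → hit e h ℚ.* ι (len e))            ≡⟨ ∑-swap hs (fins m) (λ h e → hit e h ℚ.* ι (len e)) ⟩
        ∑ (fins m) (λ e → ∑ hs λ h → hit e h ℚ.* ι (len e))            ≡⟨ ∑-cong (fins m) (λ e → trans (∑-*ʳ hs (ι (len e)) (hit e)) (cong (ℚ._* ι (len e)) (trans (∑-assigned-≡2 e fs (crossed e)) (ι≡fromℕ 2)))) ⟩
        ∑ (fins m) (λ e → (ℤ.+ 2 ℚ./ 1) ℚ.* ι (len e))                 ≡⟨ ∑-*ˡ (fins m) (ℤ.+ 2 ℚ./ 1) (ι ∘ len) ⟩
        (ℤ.+ 2 ℚ./ 1) ℚ.* M                                            ∎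
        where open ≡-Reasoning

      near-sum : (ℤ.+ 3 ℚ./ 1) ℚ.* nearLength ℚ.≤ (ℤ.+ 5 ℚ./ 1) ℚ.* nearWeight ℚ.+ τ ℚ.* ((ℤ.+ 2 ℚ./ 1) ℚ.* totalDead)
      near-sum = begin
        (ℤ.+ 3 ℚ./ 1) ℚ.* nearLength
          ≡⟨ sym (∑-*ˡ hs (ℤ.+ 3 ℚ./ 1) (λ h → ⟦ not (isFar h) ⟧ ℚ.* assignedLength h)) ⟩
        ∑ hs (λ h → (ℤ.+ 3 ℚ./ 1) ℚ.* (⟦ not (isFar h) ⟧ ℚ.* assignedLength h))
          ≤⟨ ∑-mono∈ hs (λ {h} h∈ → pointwise h h∈) ⟩
        ∑ hs (λ h → (ℤ.+ 5 ℚ./ 1) ℚ.* (⟦ not (isFar h) ⟧ ℚ.* ι (dist (proj₁ h))) ℚ.+ τ ℚ.* assignedDead h)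
          ≡⟨ trans (∑-+ hs (λ h → (ℤ.+ 5 ℚ./ 1) ℚ.* (⟦ not (isFar h) ⟧ ℚ.* ι (dist (proj₁ h)))) (λ h → τ ℚ.* assignedDead h))
               (cong₂ ℚ._+_ (∑-*ˡ hs (ℤ.+ 5 ℚ./ 1) (λ h → ⟦ not (isFar h) ⟧ ℚ.* ι (dist (proj₁ h)))) (∑-*ˡ hs τ assignedDead)) ⟩
        (ℤ.+ 5 ℚ./ 1) ℚ.* nearWeight ℚ.+ τ ℚ.* ∑ hs assignedDead
          ≤⟨ ℚ.+-monoʳ-≤ ((ℤ.+ 5 ℚ./ 1) ℚ.* nearWeight) (*≤ 0≤τ dead-sum) ⟩
        (ℤ.+ 5 ℚ./ 1) ℚ.* nearWeight ℚ.+ τ ℚ.* ((ℤ.+ 2 ℚ./ 1) ℚ.* totalDead) ∎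
        where
        open ℚ.≤-Reasoning
        0≤assignedDead : ∀ h → 0ℚ ℚ.≤ assignedDead h
        0≤assignedDead h = 0≤∑ (fins m) λ e → 0≤* 0≤⟦ assigned (proj₂ h) (proj₁ h) e ⟧ (0≤deadOn e)
        pointwise : ∀ h → h ∈ hs → (ℤ.+ 3 ℚ./ 1) ℚ.* (⟦ not (isFar h) ⟧ ℚ.* assignedLength h)
                                    ℚ.≤ (ℤ.+ 5 ℚ./ 1) ℚ.* (⟦ not (isFar h) ⟧ ℚ.* ι (dist (proj₁ h))) ℚ.+ τ ℚ.* assignedDead h
        pointwise h h∈ = byCases (isFar h) refl
          where
          byCases : ∀ b → isFar h ≡ b → (ℤ.+ 3 ℚ./ 1) ℚ.* (⟦ not b ⟧ ℚ.* assignedLength h) ℚ.≤ (ℤ.+ 5 ℚ./ 1) ℚ.* (⟦ not b ⟧ ℚ.* ι (dist (proj₁ h))) ℚ.+ τ ℚ.* assignedDead h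
          byCases true  eq = ≤-by (0≤* 0≤τ (0≤assignedDead h)) (((∀ x y z → (ℤ.+ 3 ℚ./ 1) ℚ.* (0ℚ ℚ.* x) ℚ.+ z ≡ (ℤ.+ 5 ℚ./ 1) ℚ.* (0ℚ ℚ.* y) ℚ.+ z ℚ.+ 0ℚ) ∋ solve-∀ ℚ-ring) (assignedLength h) (ι (dist (proj₁ h))) (τ ℚ.* assignedDead h))
          byCases false eq = ≡≤ (cong ((ℤ.+ 3 ℚ./ 1) ℚ.*_) (ℚ.*-identityˡ (assignedLength h)))
            (≤≡ (near-bound h (All.lookup sorted h∈) eq (distinct h∈)) (cong (λ x → (ℤ.+ 5 ℚ./ 1) ℚ.* x ℚ.+ τ ℚ.* assignedDead h) (sym (ℚ.*-identityˡ (ι (dist (proj₁ h)))))))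
        dead-sum : ∑ hs assignedDead ℚ.≤ (ℤ.+ 2 ℚ./ 1) ℚ.* totalDead
        dead-sum = begin
          ∑ hs (λ h → ∑ (fins m) λ e → hit e h ℚ.* deadOn e)   ≡⟨ ∑-swap hs (fins m) (λ h e → hit e h ℚ.* deadOn e) ⟩
          ∑ (fins m) (λ e → ∑ hs λ h → hit e h ℚ.* deadOn e)   ≤⟨ ∑-mono (fins m) (λ e → ≡≤ (∑-*ʳ hs (deadOn e) (hit e)) (≤* (0≤deadOn e) (≤≡ (∑-assigned-≤2 e fs) (ι≡fromℕ 2)))) ⟩
          ∑ (fins m) (λ e → (ℤ.+ 2 ℚ./ 1) ℚ.* deadOn e)        ≡⟨ trans (∑-*ˡ (fins m) (ℤ.+ 2 ℚ./ 1) deadOn) (cong ((ℤ.+ 2 ℚ./ 1) ℚ.*_) (sym (∑-concatMap unitsOf (fins m) dead))) ⟩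
          (ℤ.+ 2 ℚ./ 1) ℚ.* totalDead                          ∎

      entries : List (Pair × ℚ)
      entries = halves farOnes

      far-count : ι (length entries) ℚ.≤ N
      far-count = begin
        ι (length (halves farOnes))      ≡⟨ cong ι (List.length-map _ farOnes) ⟩
        ι (length farOnes)               ≡⟨ count-filter isFar hs ⟩
        ∑ hs (λ h → ⟦ isFar h ⟧)         ≤⟨ ℚ.≤-trans (few-far fs sorted) few-marks ⟩
        N                                ∎
        where open ℚ.≤-Reasoning

      covered-far : (ℤ.+ 3 ℚ./ 8) ℚ.* farLength ℚ.≤ ∑ (fins m) (λ e → ι (len e) ℚ.* (1ℚ ℚ.- miss e entries))
      covered-far = begin
        (ℤ.+ 3 ℚ./ 8) ℚ.* ∑ farOnes assignedLength
          ≡⟨ cong ((ℤ.+ 3 ℚ./ 8) ℚ.*_) (trans (∑-swap farOnes (fins m) (λ h e → hit e h ℚ.* ι (len e))) (∑-cong (fins m) λ e → ∑-*ʳ farOnes (ι (len e)) (hit e))) ⟩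
        (ℤ.+ 3 ℚ./ 8) ℚ.* ∑ (fins m) (λ e → ∑ farOnes (hit e) ℚ.* ι (len e))
          ≡⟨ sym (∑-*ˡ (fins m) (ℤ.+ 3 ℚ./ 8) _) ⟩
        ∑ (fins m) (λ e → (ℤ.+ 3 ℚ./ 8) ℚ.* (∑ farOnes (hit e) ℚ.* ι (len e)))
          ≤⟨ ∑-mono (fins m) (λ e → ≡≤ (((∀ k x l → k ℚ.* (x ℚ.* l) ≡ l ℚ.* (k ℚ.* x)) ∋ solve-∀ ℚ-ring) (ℤ.+ 3 ℚ./ 8) (∑ farOnes (hit e)) (ι (len e))) (*≤ (0≤ι (len e)) (edge e))) ⟩
        ∑ (fins m) (λ e → ι (len e) ℚ.* (1ℚ ℚ.- miss e entries)) ∎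
        where
        open ℚ.≤-Reasoning
        edge : ∀ e → (ℤ.+ 3 ℚ./ 8) ℚ.* ∑ farOnes (hit e) ℚ.≤ 1ℚ ℚ.- miss e entries
        edge e = ≡≤ (cong ((ℤ.+ 3 ℚ./ 8) ℚ.*_) eq) (ℚ.≤-trans (half-power c c≤2) (ℚ.+-monoʳ-≤ 1ℚ (ℚ.neg-antimono-≤ μ≤)))
          where
          bounds = miss-≤ e farOnes
          c = proj₁ bounds
          eq = proj₁ (proj₂ bounds)
          μ≤ = proj₂ (proj₂ (proj₂ bounds))
          c≤2 : c ≤ 2
          c≤2 = ι-cancel-≤ (≡≤ (sym eq) (ℚ.≤-trans (≡≤ (∑-filter isFar hs (hit e)) (∑-mono hs λ h → ⟦ isFar h ⟧*≤ 0≤⟦ assigned (proj₂ h) (proj₁ h) e ⟧)) (∑-assigned-≤2 e fs)))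

      far-κ : farκ ℚ.≤ farWeight ℚ.+ N ℚ.* ε
      far-κ = begin
        ∑ farOnes (κ ∘ proj₁)                                       ≤⟨ ∑-mono farOnes (λ h → κ≤ (proj₁ h)) ⟩
        ∑ farOnes (λ h → ι (dist (proj₁ h)) ℚ.+ ε)                  ≡⟨ trans (∑-+ farOnes (ι ∘ dist ∘ proj₁) (λ _ → ε)) (cong (farWeight ℚ.+_) (∑-const farOnes ε)) ⟩
        farWeight ℚ.+ ι (length farOnes) ℚ.* ε                      ≤⟨ ℚ.+-monoʳ-≤ farWeight (≤* 0≤ε (≡≤ (cong ι (sym (List.length-map _ farOnes))) far-count)) ⟩
        farWeight ℚ.+ N ℚ.* ε                                       ∎
        where open ℚ.≤-Reasoning

      cheap = cheap-value κ entries (All.map⁺ (All.tabulate λ _ → ℚ.*≤* (ℤ.+≤+ z≤n) , ℚ.*≤* (ℤ.+≤+ (s≤s z≤n))))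

      cheap≤ : value κ (proj₁ cheap) ℚ.≤ (1ℚ ℚ.+ 1ℚ) ℚ.* M ℚ.+ (ℤ.+ 1 ℚ./ 4) ℚ.* farκ ℚ.- ½ ℚ.* ((ℤ.+ 3 ℚ./ 8) ℚ.* farLength)
      cheap≤ = ℚ.≤-trans (proj₂ (proj₂ cheap)) (ℚ.≤-trans (ℚ.≤-reflexive (cong (λ x → (1ℚ ℚ.+ 1ℚ) ℚ.* M ℚ.+ x ℚ.- ½ ℚ.* ∑ (fins m) (λ e → ι (len e) ℚ.* (1ℚ ℚ.- miss e entries)))
          (trans (∑-map _ farOnes (λ f → proj₂ f ℚ.* κ (proj₁ f))) (∑-*ˡ farOnes (ℤ.+ 1 ℚ./ 4) (κ ∘ proj₁)))))
        (ℚ.+-monoʳ-≤ ((1ℚ ℚ.+ 1ℚ) ℚ.* M ℚ.+ (ℤ.+ 1 ℚ./ 4) ℚ.* farκ) (ℚ.neg-antimono-≤ (*≤ {½} (ℚ.*≤* (ℤ.+≤+ z≤n)) covered-far))))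

    -- Up to errors, a tour costs at least 6/5 M unless a constant fraction of the units is dead.
    -- The dead units count twice because an edge is assigned to at most two pairs.
    tour-≥ : (ℤ.+ 6 ℚ./ 1) ℚ.* M ℚ.≤ (ℤ.+ 5 ℚ./ 1) ℚ.* ι (cycleWeight d vs) ℚ.+ (ℤ.+ 16 ℚ./ 1) ℚ.* η ℚ.+ (ℤ.+ 4 ℚ./ 1) ℚ.* (N ℚ.* ε)
               ℚ.+ τ ℚ.* ((ℤ.+ 2 ℚ./ 1) ℚ.* ∑ units dead)
    tour-≥ = subst (λ W → (ℤ.+ 6 ℚ./ 1) ℚ.* M ℚ.≤ (ℤ.+ 5 ℚ./ 1) ℚ.* W ℚ.+ (ℤ.+ 16 ℚ./ 1) ℚ.* η ℚ.+ (ℤ.+ 4 ℚ./ 1) ℚ.* (N ℚ.* ε) ℚ.+ τ ℚ.* ((ℤ.+ 2 ℚ./ 1) ℚ.* totalDead))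
      (trans (partition (ι ∘ dist ∘ proj₁)) (sym weight))
      (combine {M} {farLength} {nearLength} {farκ} {farWeight} {nearWeight} {ε} {N} {τ ℚ.* ((ℤ.+ 2 ℚ./ 1) ℚ.* totalDead)} {η} {value κ (proj₁ cheap)}
        lengths near-sum (expensive (proj₁ cheap) (ℚ.≤-trans (ι-mono (proj₁ (proj₂ cheap))) far-count)) cheap≤ far-κ (0≤∑ farOnes λ h → 0≤ι (dist (proj₁ h))))

-- Spanning trees

AdjacentIn : ∀ {n} → List (Edge n) → Fin n → Fin n → Set
AdjacentIn es u v = (u , v) ∈ es ⊎ (v , u) ∈ es

parent-above : ∀ {m} (T : RTree m) e → toℕ (Fin.inject₁ e) < toℕ (parent T e)
parent-above (attach p T) zero    = s≤s z≤n
parent-above (attach p T) (suc e) = s≤s (parent-above T e)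

-- Rebuilds the edge list as an `RTree` by attaching one fresh vertex at a time. Every vertex then
-- has a smaller number than its parent, and `pos` gives its original name.
module Growing {n} (es : List (Edge n)) where

  open DecMembership (≡-dec (Fin._≟_ {n}) (Fin._≟_ {n})) using (_∈?_)

  record Grown : Set where
    constructor grown
    field
      {size} : ℕ
      tree   : RTree size
      pos    : Fin (suc size) → Fin n

  open Grown

  Fresh : Grown → Fin n → Set
  Fresh g v = ∀ j → pos g j ≢ v

  Extension : Grown → Set
  Extension g = ∃[ i ] ∃[ v ] Fresh g v × AdjacentIn es (pos g i) v

  extension? : ∀ g → Dec (Extension g)
  extension? g = Fin.any? λ i → Fin.any? λ v → Fin.all? (λ j → ¬? (pos g j Fin.≟ v)) ×-dec (((pos g i , v) ∈? es) ⊎-dec ((v , pos g i) ∈? es))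

  extend : ∀ g → Extension g → Grown
  extend g (i , v , _) = grown (attach i (tree g)) λ { zero → v ; (suc j) → pos g j }

  grow : ℕ → Grown → Grown
  grow zero    g = g
  grow (suc k) g with extension? g
  ... | yes x = grow k (extend g x)
  ... | no  _ = g

  record Sound (g : Grown) : Set where
    field
      injective : ∀ {i j} → pos g i ≡ pos g j → i ≡ j
      adjacent  : ∀ e → AdjacentIn es (pos g (Fin.inject₁ e)) (pos g (parent (tree g) e))

  extend-sound : ∀ g x → Sound g → Sound (extend g x)
  extend-sound g (i , v , fresh , adj) s = record { injective = inj ; adjacent = adj′ }
    where
    inj : ∀ {j k} → pos (extend g (i , v , fresh , adj)) j ≡ pos (extend g (i , v , fresh , adj)) k → j ≡ k
    inj {zero}  {zero}  eq = refl
    inj {zero}  {suc k} eq = contradiction (sym eq) (fresh k)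
    inj {suc j} {zero}  eq = contradiction eq (fresh j)
    inj {suc j} {suc k} eq = cong suc (Sound.injective s eq)
    adj′ : ∀ e → AdjacentIn es (pos (extend g (i , v , fresh , adj)) (Fin.inject₁ e)) (pos (extend g (i , v , fresh , adj)) (parent (attach i (tree g)) e))
    adj′ zero    = Sum.swap adj
    adj′ (suc e) = Sound.adjacent s e

  grow-sound : ∀ k g → Sound g → Sound (grow k g)
  grow-sound zero    g s = s
  grow-sound (suc k) g s with extension? g
  ... | yes x = grow-sound k (extend g x) (extend-sound g x s)
  ... | no  _ = s

  grow-maximal : ∀ k g → ¬ Extension (grow k g) ⊎ k + size g ≤ size (grow k g)
  grow-maximal zero    g = inj₂ ℕ.≤-refl
  grow-maximal (suc k) g with extension? g
  ... | yes x = Sum.map₂ (ℕ.≤-trans (ℕ.≤-reflexive (sym (ℕ.+-suc k (size g))))) (grow-maximal k (extend g x))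
  ... | no ¬x = inj₁ ¬x

  size<n : ∀ g → Sound g → suc (size g) ≤ n
  size<n g s = Fin.injective⇒≤ (Sound.injective s)

  grow-stops : ∀ g → Sound g → ¬ Extension (grow n g)
  grow-stops g s with grow-maximal n g
  ... | inj₁ ¬x = ¬x
  ... | inj₂ le = contradiction (ℕ.≤-trans (ℕ.≤-trans (s≤s (ℕ.m≤m+n n (size g))) (s≤s le)) (size<n (grow n g) (grow-sound n g s))) (ℕ.<-irrefl refl)

  module _ (g : Grown) (stops : ¬ Extension g) (connected : ∀ u v → Star (Adjacent es) u v) where

    private
      Hit : Fin n → Set
      Hit v = ∃[ j ] pos g j ≡ v

      spread : ∀ {u v} → Hit u → Star (Adjacent es) u v → Hit v
      spread hu       ε⋆                 = hu
      spread (i , eq) (_◅_ {j = w} a as) with Fin.any? (λ j → pos g j Fin.≟ w)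
      ... | yes hw = spread hw as
      ... | no ¬hw = contradiction (i , w , (λ j eq′ → ¬hw (j , eq′)) , subst (λ u → AdjacentIn es u w) (sym eq) (adj a)) stops
        where
        adj : ∀ {u v} → Adjacent es u v → AdjacentIn es u v
        adj (fwd uv∈) = inj₁ uv∈
        adj (bwd vu∈) = inj₂ vu∈

    surjective : ∀ v → ∃[ j ] pos g j ≡ v
    surjective v = spread (zero , refl) (connected (pos g zero) v)

  -- The grown tree uses distinct edges of es.
  grown-weight : ∀ (w : Weights n) → (∀ u v → w u v ≡ w v u) → ∀ g → Sound g →
                 ∑ (fins (size g)) (λ e → ι (w (pos g (Fin.inject₁ e)) (pos g (parent (tree g) e)))) ℚ.≤ ι (treeWeight w es)
  grown-weight w w-sym g s = begin
    ∑ (fins (size g)) (λ e → ι (w (child e) (par e)))      ≡⟨ ∑-cong (fins (size g)) (λ e → cong ι (edge-weight e)) ⟩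
    ∑ (fins (size g)) (λ e → ι (uncurry w (edge e)))       ≡⟨ sym (∑-map edge (fins (size g)) (ι ∘ uncurry w)) ⟩
    ∑ (map edge (fins (size g))) (ι ∘ uncurry w)           ≤⟨ ∑-⊆ (ι ∘ uncurry w) (λ f → 0≤ι (uncurry w f)) (Unique.map⁺ edge-injective (Unique-fins (size g))) edge-∈ ⟩
    ∑ es (ι ∘ uncurry w)                                   ≡⟨ sym (∑-sum es (uncurry w)) ⟩
    ι (treeWeight w es)                                    ∎
    where
    open ℚ.≤-Reasoning
    child par : Fin (size g) → Fin n
    child e = pos g (Fin.inject₁ e)
    par e   = pos g (parent (tree g) e)
    edge : Fin (size g) → Edge n
    edge e = [ const (child e , par e) , const (par e , child e) ]′ (Sound.adjacent s e)
    edge-weight : ∀ e → w (child e) (par e) ≡ uncurry w (edge e)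
    edge-weight e with Sound.adjacent s e
    ... | inj₁ _ = refl
    ... | inj₂ _ = w-sym (child e) (par e)
    edge-∈ : ∀ {f} → f ∈ map edge (fins (size g)) → f ∈ es
    edge-∈ f∈ with ∈.∈-map⁻ edge f∈
    ... | e , _ , refl with Sound.adjacent s e
    ...   | inj₁ e∈ = e∈
    ...   | inj₂ e∈ = e∈
    same : ∀ {e e′} → child e ≡ child e′ → e ≡ e′
    same eq = Fin.inject₁-injective (Sound.injective s eq)
    -- Numbers increase from child to parent, so two tree edges cannot be reversals of each other.
    twisted : ∀ {e e′} → child e ≡ par e′ → par e ≡ child e′ → ⊥
    twisted {e} {e′} eq eq′ = ℕ.<-asym
      (subst (λ v → toℕ (Fin.inject₁ e) < toℕ v) (Sound.injective s eq′) (parent-above (tree g) e))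
      (subst (λ v → toℕ (Fin.inject₁ e′) < toℕ v) (sym (Sound.injective s eq)) (parent-above (tree g) e′))
    edge-injective : ∀ {e e′} → edge e ≡ edge e′ → e ≡ e′
    edge-injective {e} {e′} eq with Sound.adjacent s e | Sound.adjacent s e′
    ... | inj₁ _ | inj₁ _ = same (cong proj₁ eq)
    ... | inj₂ _ | inj₂ _ = same (cong proj₂ eq)
    ... | inj₁ _ | inj₂ _ = ⊥-elim (twisted {e} {e′} (cong proj₁ eq) (cong proj₂ eq))
    ... | inj₂ _ | inj₁ _ = ⊥-elim (twisted {e} {e′} (cong proj₂ eq) (cong proj₁ eq))

ordered : ∀ {n} → Fin n → Fin n → Edge n
ordered u v = if ⌊ u Fin.<? v ⌋ then (u , v) else (v , u)

ordered-cases : ∀ {n} (u v : Fin n) → ordered u v ≡ (u , v) ⊎ ordered u v ≡ (v , u)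
ordered-cases u v with u Fin.<? v
... | yes _ = inj₁ refl
... | no  _ = inj₂ refl

ordered-< : ∀ {n} {u v : Fin n} → u ≢ v → uncurry Fin._<_ (ordered u v)
ordered-< {u = u} {v} u≢v with u Fin.<? v
... | yes u<v = u<v
... | no  u≮v = ℕ.≤∧≢⇒< (ℕ.≮⇒≥ u≮v) λ eq → u≢v (sym (Fin.toℕ-injective eq))

pathEdges : ∀ {n} → Fin n → List (Fin n) → List (Edge n)
pathEdges x []       = []
pathEdges x (u ∷ us) = ordered x u ∷ pathEdges u us

module _ {n : ℕ} where

  pathEdges-∈ : ∀ {x : Fin n} us {a b} → (a , b) ∈ pathEdges x us → a ∈ x ∷ us × b ∈ x ∷ us
  pathEdges-∈ {x} (u ∷ us) (here eq) with ordered-cases x u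
  ... | inj₁ eq′ with trans eq eq′
  ...   | refl = here refl , there (here refl)
  pathEdges-∈ {x} (u ∷ us) (here eq) | inj₂ eq′ with trans eq eq′
  ...   | refl = there (here refl) , here refl
  pathEdges-∈ (u ∷ us) (there e∈) with pathEdges-∈ us e∈
  ... | a∈ , b∈ = there a∈ , there b∈

  Adjacent-∈ : ∀ {x : Fin n} us {a b} → Adjacent (pathEdges x us) a b → a ∈ x ∷ us × b ∈ x ∷ us
  Adjacent-∈ us (fwd e∈) = pathEdges-∈ us e∈
  Adjacent-∈ us (bwd e∈) with pathEdges-∈ us e∈
  ... | a∈ , b∈ = b∈ , a∈

  Adjacent-first : ∀ {x u : Fin n} us {a b} → Adjacent (pathEdges x (u ∷ us)) a b →
                   ((a ≡ x × b ≡ u) ⊎ (a ≡ u × b ≡ x)) ⊎ Adjacent (pathEdges u us) a b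
  Adjacent-first {x} {u} us (fwd (there e∈)) = inj₂ (fwd e∈)
  Adjacent-first {x} {u} us (bwd (there e∈)) = inj₂ (bwd e∈)
  Adjacent-first {x} {u} us (fwd (here eq)) with ordered-cases x u
  ... | inj₁ eq′ with trans eq eq′
  ...   | refl = inj₁ (inj₁ (refl , refl))
  Adjacent-first {x} {u} us (fwd (here eq)) | inj₂ eq′ with trans eq eq′
  ...   | refl = inj₁ (inj₂ (refl , refl))
  Adjacent-first {x} {u} us (bwd (here eq)) with ordered-cases x u
  ... | inj₁ eq′ with trans eq eq′
  ...   | refl = inj₁ (inj₂ (refl , refl))
  Adjacent-first {x} {u} us (bwd (here eq)) | inj₂ eq′ with trans eq eq′
  ...   | refl = inj₁ (inj₁ (refl , refl))

  zip-∈ : ∀ (y : Fin n) cs z {a b} → (a , b) ∈ zip (y ∷ cs) (cs ∷ʳ z) → a ∈ y ∷ cs × (b ∈ cs ⊎ b ≡ z)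
  zip-∈ y []       z (here refl) = here refl , inj₂ refl
  zip-∈ y (c ∷ cs) z (here refl) = here refl , inj₁ (here refl)
  zip-∈ y (c ∷ cs) z (there e∈) with zip-∈ c cs z e∈
  ... | a∈ , inj₁ b∈ = there a∈ , inj₁ (there b∈)
  ... | a∈ , inj₂ eq = there a∈ , inj₂ eq

  closedSteps-∈ : ∀ (cs : List (Fin n)) {a b} → (a , b) ∈ closedSteps cs → a ∈ cs × b ∈ cs
  closedSteps-∈ (y ∷ cs) e∈ with zip-∈ y cs y e∈
  ... | a∈ , inj₁ b∈   = a∈ , there b∈
  ... | a∈ , inj₂ refl = a∈ , here refl

  module _ {R : Fin n → Fin n → Set} where

    last-step : ∀ y c cs x → All (uncurry R) (zip (y ∷ c ∷ cs) ((c ∷ cs) ∷ʳ x)) → ∃[ z ] z ∈ c ∷ cs × R z x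
    last-step y c []        x (_ ∷ r ∷ []) = c , here refl , r
    last-step y c (c′ ∷ cs) x (_ ∷ rs) with last-step c c′ cs x rs
    ... | z , z∈ , r = z , there z∈ , r

    two-neighbours : ∀ x cs → 3 ≤ length (x ∷ cs) → Unique (x ∷ cs) → All (uncurry R) (closedSteps (x ∷ cs)) →
                     ∃[ y ] ∃[ z ] y ≢ z × R x y × R z x
    two-neighbours x []       (s≤s ()) _ _
    two-neighbours x (y ∷ []) (s≤s (s≤s ())) _ _
    two-neighbours x (y ∷ c ∷ cs) _ (_ ∷ y∉ ∷ _) (r ∷ rs) with last-step y c cs x rs
    ... | z , z∈ , r′ = y , z , All.lookup y∉ z∈ , r , r′

    -- A cycle may be read from any of its vertices, here from x, whose neighbours on it are then
    -- the second vertex and the last.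
    rotated : ∀ as x bs → 3 ≤ length (as ++ x ∷ bs) → Unique (as ++ x ∷ bs) → All (uncurry R) (closedSteps (as ++ x ∷ bs)) →
              ∃[ y ] ∃[ z ] y ≢ z × R x y × R z x
    rotated []       x bs 3≤ unique rs = two-neighbours x bs 3≤ unique rs
    rotated (a ∷ as) x bs 3≤ unique rs = two-neighbours x (bs ++ a ∷ as)
      (ℕ.≤-trans 3≤ (ℕ.≤-reflexive (↭.↭-length swap)))
      (↭ₛ.Unique-resp-↭ (≡.setoid (Fin n)) (↭.↭⇒↭ₛ swap) unique)
      (subst (All (uncurry R)) (sym (zip-split x bs a as x)) (All.++⁺ (All.++⁻ʳ (zip (a ∷ as) (as ∷ʳ x)) rs′) (All.++⁻ˡ _ rs′)))
      where
      swap : a ∷ as ++ x ∷ bs ↭ x ∷ bs ++ a ∷ as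
      swap = ↭.++-comm (a ∷ as) (x ∷ bs)
      rs′ : All (uncurry R) (zip (a ∷ as) (as ∷ʳ x) ++ zip (x ∷ bs) (bs ∷ʳ a))
      rs′ = subst (All (uncurry R)) (zip-split a as x bs a) rs

  -- A cycle through the first vertex of a path would enter and leave it by the same edge.
  path-acyclic : ∀ (x : Fin n) us → Unique (x ∷ us) → ∀ cs → ¬ IsCycle (Adjacent (pathEdges x us)) cs
  path-acyclic x []       unique (c ∷ c′ ∷ cs) (_ , _ , fwd () ∷ _)
  path-acyclic x []       unique (c ∷ c′ ∷ cs) (_ , _ , bwd () ∷ _)
  path-acyclic x []       unique (c ∷ [])      (s≤s () , _)
  path-acyclic x (u ∷ us) (x∉ ∷ unique) cs (3≤ , ucs , steps) with Any.any? (x Fin.≟_) cs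
  ... | yes x∈ with ∈.∈-∃++ x∈
  ...   | as , bs , refl with rotated as x bs 3≤ ucs steps
  ...     | y , z , y≢z , xy , zx = y≢z (trans (only (inj₁ xy)) (sym (only (inj₂ zx))))
    where
    only : ∀ {y} → Adjacent (pathEdges x (u ∷ us)) x y ⊎ Adjacent (pathEdges x (u ∷ us)) y x → y ≡ u
    only (inj₁ a) with Adjacent-first us a
    ... | inj₁ (inj₁ (_ , y≡u)) = y≡u
    ... | inj₁ (inj₂ (x≡u , _)) = contradiction x≡u (All.head x∉)
    ... | inj₂ a′ = contradiction refl (All.lookup x∉ (proj₁ (Adjacent-∈ us a′)))
    only (inj₂ a) with Adjacent-first us a
    ... | inj₁ (inj₁ (_ , x≡u)) = contradiction x≡u (All.head x∉)
    ... | inj₁ (inj₂ (y≡u , _)) = y≡u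
    ... | inj₂ a′ = contradiction refl (All.lookup x∉ (proj₂ (Adjacent-∈ us a′)))
  path-acyclic x (u ∷ us) (x∉ ∷ unique) cs (3≤ , ucs , steps) | no ¬x∈ =
    path-acyclic u us unique cs (3≤ , ucs , All.tabulate λ {f} f∈ → avoid f f∈ (Adjacent-first us (All.lookup steps f∈)))
    where
    avoid : ∀ f → f ∈ closedSteps cs → ((proj₁ f ≡ x × proj₂ f ≡ u) ⊎ (proj₁ f ≡ u × proj₂ f ≡ x)) ⊎ Adjacent (pathEdges u us) (proj₁ f) (proj₂ f) →
            Adjacent (pathEdges u us) (proj₁ f) (proj₂ f)
    avoid f f∈ (inj₂ a)                   = a
    avoid f f∈ (inj₁ (inj₁ (refl , _)))   = contradiction (proj₁ (closedSteps-∈ cs f∈)) ¬x∈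
    avoid f f∈ (inj₁ (inj₂ (_ , refl)))   = contradiction (proj₂ (closedSteps-∈ cs f∈)) ¬x∈

  path-spanning : ∀ (x : Fin n) us → Unique (x ∷ us) → (∀ v → v ∈ x ∷ us) → IsSpanningTree (pathEdges x us)
  path-spanning x us unique all∈ = record
    { ordered   = increasing x us unique
    ; simple    = simple x us unique
    ; connected = λ u v → reverse-star (reach x us (all∈ u)) ◅◅ reach x us (all∈ v)
    ; acyclic   = path-acyclic x us unique
    }
    where
    increasing : ∀ x us → Unique (x ∷ us) → All (uncurry Fin._<_) (pathEdges x us)
    increasing x []       _                     = []
    increasing x (u ∷ us) ((x≢u ∷ _) ∷ unique) = ordered-< x≢u ∷ increasing u us unique
    simple : ∀ x us → Unique (x ∷ us) → Unique (pathEdges x us)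
    simple x []       _              = []
    simple x (u ∷ us) (x∉ ∷ unique) = All.tabulate (λ {f} f∈ eq → not-in f f∈ eq (ordered-cases x u)) ∷ simple u us unique
      where
      not-in : ∀ f → f ∈ pathEdges u us → ordered x u ≡ f → ordered x u ≡ (x , u) ⊎ ordered x u ≡ (u , x) → ⊥
      not-in f f∈ eq (inj₁ eq′) = All.lookup x∉ (proj₁ (pathEdges-∈ us (subst (_∈ pathEdges u us) (trans (sym eq) eq′) f∈))) refl
      not-in f f∈ eq (inj₂ eq′) = All.lookup x∉ (proj₂ (pathEdges-∈ us (subst (_∈ pathEdges u us) (trans (sym eq) eq′) f∈))) refl
    step-star : ∀ x u us → Adjacent (pathEdges x (u ∷ us)) x u
    step-star x u us with ordered-cases x u
    ... | inj₁ eq = fwd (here (sym eq))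
    ... | inj₂ eq = bwd (here (sym eq))
    later : ∀ {x u us a b} → Adjacent (pathEdges u us) a b → Adjacent (pathEdges x (u ∷ us)) a b
    later (fwd e∈) = fwd (there e∈)
    later (bwd e∈) = bwd (there e∈)
    later-star : ∀ {x u us a b} → Star (Adjacent (pathEdges u us)) a b → Star (Adjacent (pathEdges x (u ∷ us))) a b
    later-star ε⋆        = ε⋆
    later-star (a ◅ as) = later a ◅ later-star as
    reach : ∀ x us {v} → v ∈ x ∷ us → Star (Adjacent (pathEdges x us)) x v
    reach x us       (here refl)         = ε⋆
    reach x (u ∷ us) (there v∈)          = step-star x u us ◅ later-star (reach u us v∈)
    flip-adjacent : ∀ {es : List (Edge n)} {a b} → Adjacent es a b → Adjacent es b a
    flip-adjacent (fwd e∈) = bwd e∈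
    flip-adjacent (bwd e∈) = fwd e∈
    reverse-star : ∀ {es : List (Edge n)} {a b} → Star (Adjacent es) a b → Star (Adjacent es) b a
    reverse-star ε⋆        = ε⋆
    reverse-star (a ◅ as) = reverse-star as ◅◅ (flip-adjacent a ◅ ε⋆)

  path-weight : ∀ (w : Weights n) → (∀ u v → w u v ≡ w v u) → ∀ x us z → treeWeight w (pathEdges x us) ≤ sum (map (uncurry w) (zip (x ∷ us) (us ∷ʳ z)))
  path-weight w w-sym x []       z = z≤n
  path-weight w w-sym x (u ∷ us) z = ℕ.+-mono-≤ (ℕ.≤-reflexive first) (path-weight w w-sym u us z)
    where
    first : uncurry w (ordered x u) ≡ w x u
    first with ordered-cases x u
    ... | inj₁ eq = cong (uncurry w) eq
    ... | inj₂ eq = trans (cong (uncurry w) eq) (w-sym u x)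

  -- A Hamiltonian cycle without its closing step is a spanning tree.
  MST-≤-cycle : ∀ (w : Weights n) → (∀ u v → w u v ≡ w v u) → ∀ es → IsMST w es → ∀ vs → IsHamiltonianCycle vs → treeWeight w es ≤ cycleWeight w vs
  MST-≤-cycle w w-sym es (_ , minimal) (x ∷ us) ((_ , unique , _) , all∈) =
    ℕ.≤-trans (minimal (pathEdges x us) (path-spanning x us unique all∈)) (path-weight w w-sym x us x)

-- Amplification and relabelling

^-+ : ∀ x j k → x ^ℚ (j + k) ≡ x ^ℚ j ℚ.* x ^ℚ k
^-+ x zero    k = sym (ℚ.*-identityˡ (x ^ℚ k))
^-+ x (suc j) k = trans (cong (x ℚ.*_) (^-+ x j k)) (sym (ℚ.*-assoc x (x ^ℚ j) (x ^ℚ k)))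

^-*-assoc : ∀ x k D → x ^ℚ (k * D) ≡ (x ^ℚ D) ^ℚ k
^-*-assoc x zero    D = refl
^-*-assoc x (suc k) D = trans (^-+ x D (k * D)) (cong (x ^ℚ D ℚ.*_) (^-*-assoc x k D))

1≤x^k : ∀ {x} k → 1ℚ ℚ.≤ x → 1ℚ ℚ.≤ x ^ℚ k
1≤x^k zero    1≤x = ℚ.≤-refl
1≤x^k (suc k) 1≤x = *≤* 0≤1 (ℚ.≤-trans 0≤1 1≤x) 1≤x (1≤x^k k 1≤x)

1≤x^k*y^j : ∀ {x y j k} → x ℚ.* y ≡ 1ℚ → 1ℚ ℚ.≤ x → j ≤ k → 1ℚ ℚ.≤ x ^ℚ k ℚ.* y ^ℚ j
1≤x^k*y^j {x} {y} {k = k} xy≡1 1≤x z≤n = ≤≡ (1≤x^k k 1≤x) (sym (ℚ.*-identityʳ (x ^ℚ k)))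
1≤x^k*y^j {x} {y} {suc j} {suc k} xy≡1 1≤x (s≤s j≤k) = ≤≡ (1≤x^k*y^j xy≡1 1≤x j≤k) (begin
  x ^ℚ k ℚ.* y ^ℚ j                     ≡⟨ sym (ℚ.*-identityˡ (x ^ℚ k ℚ.* y ^ℚ j)) ⟩
  1ℚ ℚ.* (x ^ℚ k ℚ.* y ^ℚ j)            ≡⟨ cong (ℚ._* (x ^ℚ k ℚ.* y ^ℚ j)) (sym xy≡1) ⟩
  x ℚ.* y ℚ.* (x ^ℚ k ℚ.* y ^ℚ j)       ≡⟨ ((∀ x y a b → x ℚ.* y ℚ.* (a ℚ.* b) ≡ x ℚ.* a ℚ.* (y ℚ.* b)) ∋ solve-∀ ℚ-ring) x y (x ^ℚ k) (y ^ℚ j) ⟩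
  x ^ℚ suc k ℚ.* y ^ℚ suc j             ∎)
  where open ≡-Reasoning

-- Bounds (1 + x)^N by 1 / (1 - N x) where N x < 1. In the induction, (1 + x) (1 - (N + 1) x) falls
-- short of 1 - N x by (N + 1) x².
[1+x]^N[1-Nx]≤1 : ∀ {x} → 0ℚ ℚ.≤ x → ∀ N → (1ℚ ℚ.+ x) ^ℚ N ℚ.* (1ℚ ℚ.- ι N ℚ.* x) ℚ.≤ 1ℚ
[1+x]^N[1-Nx]≤1 {x} 0≤x zero    = ℚ.≤-reflexive (trans (cong (λ n → 1ℚ ℚ.* (1ℚ ℚ.- n ℚ.* x)) ι-0) (((∀ x → 1ℚ ℚ.* (1ℚ ℚ.- 0ℚ ℚ.* x) ≡ 1ℚ) ∋ solve-∀ ℚ-ring) x))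
[1+x]^N[1-Nx]≤1 {x} 0≤x (suc N) = ≤-by ([1+x]^N[1-Nx]≤1 0≤x N +≤ 0≤* (0≤^ N (0≤+ 0≤1 0≤x)) (0≤* (0≤+ 0≤1 (0≤ι N)) (0≤* 0≤x 0≤x)))
  (trans (cong (λ s → (1ℚ ℚ.+ x) ℚ.* r ℚ.* (1ℚ ℚ.- s ℚ.* x) ℚ.+ (1ℚ ℚ.+ r ℚ.* ((1ℚ ℚ.+ ι N) ℚ.* (x ℚ.* x)))) (ι-suc N))
    (((∀ r n x → (1ℚ ℚ.+ x) ℚ.* r ℚ.* (1ℚ ℚ.- (1ℚ ℚ.+ n) ℚ.* x) ℚ.+ (1ℚ ℚ.+ r ℚ.* ((1ℚ ℚ.+ n) ℚ.* (x ℚ.* x)))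
       ≡ 1ℚ ℚ.+ (r ℚ.* (1ℚ ℚ.- n ℚ.* x) ℚ.+ 0ℚ)) ∋ solve-∀ ℚ-ring) r (ι N) x))
  where
  r : ℚ
  r = (1ℚ ℚ.+ x) ^ℚ N

-- Chernoff bounds for l · D independent trials and the threshold l, by the moments of 4 and ¼
-- to the number of successes.
module _ {n} {w : Weights n} (m : QueryAlg n Bool) (D l : ℕ) where

  private
    p : ℚ
    p = P[true] w m

    4ℚ ¼ : ℚ
    4ℚ = ℤ.+ 4 ℚ./ 1
    ¼  = ℤ.+ 1 ℚ./ 4

    moment : ∀ x → E w (countTrue (l * D) m) (x ^ℚ_) ≡ ((1ℚ ℚ.+ (x ℚ.- 1ℚ) ℚ.* p) ^ℚ D) ^ℚ l
    moment x = trans (E-countTrue (l * D) m x) (trans (cong (_^ℚ (l * D)) (begin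
      E w m (λ b → if b then x else 1ℚ)                  ≡⟨ E-cong m (λ { true → ((∀ x → x ≡ 1ℚ ℚ.+ (x ℚ.- 1ℚ) ℚ.* 1ℚ) ∋ solve-∀ ℚ-ring) x ; false → ((∀ x → 1ℚ ≡ 1ℚ ℚ.+ (x ℚ.- 1ℚ) ℚ.* 0ℚ) ∋ solve-∀ ℚ-ring) x }) ⟩
      E w m (λ b → 1ℚ ℚ.+ (x ℚ.- 1ℚ) ℚ.* ⟦ b ⟧)          ≡⟨ E-+ m (λ _ → 1ℚ) (λ b → (x ℚ.- 1ℚ) ℚ.* ⟦ b ⟧) ⟩
      E w m (λ _ → 1ℚ) ℚ.+ E w m (λ b → (x ℚ.- 1ℚ) ℚ.* ⟦ b ⟧) ≡⟨ cong₂ ℚ._+_ (E-const m 1ℚ) (E-*ˡ m (x ℚ.- 1ℚ) ⟦_⟧) ⟩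
      1ℚ ℚ.+ (x ℚ.- 1ℚ) ℚ.* p                            ∎)) (^-*-assoc (1ℚ ℚ.+ (x ℚ.- 1ℚ) ℚ.* p) l D))
      where open ≡-Reasoning

    tail : ∀ x y → 0ℚ ℚ.≤ x → 0ℚ ℚ.≤ y → 0ℚ ℚ.≤ 1ℚ ℚ.+ (x ℚ.- 1ℚ) ℚ.* p → y ℚ.* (1ℚ ℚ.+ (x ℚ.- 1ℚ) ℚ.* p) ^ℚ D ℚ.≤ ½ → (φ : ℕ → ℚ) →
           (∀ k → φ k ℚ.≤ y ^ℚ l ℚ.* x ^ℚ k) → E w (countTrue (l * D) m) φ ℚ.≤ ½ ^ℚ l
    tail x y 0≤x 0≤y 0≤r bound φ φ≤ = begin
      E w (countTrue (l * D) m) φ                             ≤⟨ E-mono (countTrue (l * D) m) φ≤ ⟩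
      E w (countTrue (l * D) m) (λ k → y ^ℚ l ℚ.* x ^ℚ k)     ≡⟨ trans (E-*ˡ (countTrue (l * D) m) (y ^ℚ l) (x ^ℚ_)) (cong (y ^ℚ l ℚ.*_) (moment x)) ⟩
      y ^ℚ l ℚ.* (r ^ℚ D) ^ℚ l                                ≡⟨ sym (^-distrib-* y (r ^ℚ D) l) ⟩
      (y ℚ.* r ^ℚ D) ^ℚ l                                     ≤⟨ ^-mono l (0≤* 0≤y (0≤^ D 0≤r)) bound ⟩
      ½ ^ℚ l                                                  ∎
      where
      open ℚ.≤-Reasoning
      r : ℚ
      r = 1ℚ ℚ.+ (x ℚ.- 1ℚ) ℚ.* p

    0≤¼ : 0ℚ ℚ.≤ ¼
    0≤¼ = ℚ.*≤* (ℤ.+≤+ z≤n)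

    0≤4 : 0ℚ ℚ.≤ 4ℚ
    0≤4 = ℚ.*≤* (ℤ.+≤+ z≤n)

    1≤4 : 1ℚ ℚ.≤ 4ℚ
    1≤4 = ℚ.*≤* (ℤ.+≤+ (s≤s z≤n))

  few-successes : ℤ.+ 28 ℚ./ 1 ℚ.≤ (ℤ.+ 3 ℚ./ 1) ℚ.* (ι D ℚ.* p) → E w (countTrue (l * D) m) (λ k → ⟦ not ⌊ l ℕ.≤? k ⌋ ⟧) ℚ.≤ ½ ^ℚ l
  few-successes large = tail ¼ 4ℚ 0≤¼ 0≤4 0≤r bound _ pointwise
    where
    y r : ℚ
    y = (ℤ.+ 3 ℚ./ 4) ℚ.* p
    r = 1ℚ ℚ.+ (¼ ℚ.- 1ℚ) ℚ.* p
    0≤y : 0ℚ ℚ.≤ y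
    0≤y = 0≤* {ℤ.+ 3 ℚ./ 4} (ℚ.*≤* (ℤ.+≤+ z≤n)) (0≤P m)
    y≤1 : y ℚ.≤ 1ℚ
    y≤1 = *≤* {ℤ.+ 3 ℚ./ 4} {1ℚ} (0≤P m) 0≤1 (ℚ.*≤* (ℤ.+≤+ (ℕ.m≤m+n 3 1))) (P≤1 m)
    r≡1-y : r ≡ 1ℚ ℚ.- y
    r≡1-y = ((∀ p → 1ℚ ℚ.+ ((ℤ.+ 1 ℚ./ 4) ℚ.- 1ℚ) ℚ.* p ≡ 1ℚ ℚ.- (ℤ.+ 3 ℚ./ 4) ℚ.* p) ∋ solve-∀ ℚ-ring) p
    0≤1-y : 0ℚ ℚ.≤ 1ℚ ℚ.- y
    0≤1-y = 0≤b-a y≤1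
    0≤r : 0ℚ ℚ.≤ r
    0≤r = ≤≡ 0≤1-y (sym r≡1-y)
    s : ℚ
    s = (1ℚ ℚ.- y) ^ℚ D
    7≤Dy : ℤ.+ 7 ℚ./ 1 ℚ.≤ ι D ℚ.* y
    7≤Dy = ≤≡ (*≤ {¼} 0≤¼ large) (((∀ d p → (ℤ.+ 1 ℚ./ 4) ℚ.* ((ℤ.+ 3 ℚ./ 1) ℚ.* (d ℚ.* p)) ≡ d ℚ.* ((ℤ.+ 3 ℚ./ 4) ℚ.* p)) ∋ solve-∀ ℚ-ring) (ι D) p)
    -- With D y at least 7 this gives s ≤ 1/8, so that 4 s is at most ½. The 28 of the hypothesis is
    -- 4 · 7, as y = ¾ p.
    small : (ℤ.+ 7 ℚ./ 1) ℚ.* s ℚ.≤ 1ℚ ℚ.- s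
    small = ℚ.≤-trans (≤* (0≤^ D 0≤1-y) 7≤Dy) (Nx[1-x]^N≤1-[1-x]^N 0≤y y≤1 D)
    bound : 4ℚ ℚ.* r ^ℚ D ℚ.≤ ½
    bound = ≡≤ (cong (λ q → 4ℚ ℚ.* q ^ℚ D) r≡1-y) (≤-by (*≤ {½} (ℚ.*≤* (ℤ.+≤+ z≤n)) small)
      (((∀ s → (ℤ.+ 4 ℚ./ 1) ℚ.* s ℚ.+ ½ ℚ.* (1ℚ ℚ.- s) ≡ ½ ℚ.+ ½ ℚ.* ((ℤ.+ 7 ℚ./ 1) ℚ.* s)) ∋ solve-∀ ℚ-ring) s))
    pointwise : ∀ k → ⟦ not ⌊ l ℕ.≤? k ⌋ ⟧ ℚ.≤ 4ℚ ^ℚ l ℚ.* ¼ ^ℚ k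
    pointwise k with l ℕ.≤? k
    ... | yes _ = 0≤* (0≤^ l 0≤4) (0≤^ k 0≤¼)
    ... | no ≰  = 1≤x^k*y^j {4ℚ} {¼} {k} {l} refl 1≤4 (ℕ.<⇒≤ (ℕ.≰⇒> ≰))

  many-successes : (ℤ.+ 6 ℚ./ 1) ℚ.* (ι D ℚ.* p) ℚ.≤ 1ℚ → E w (countTrue (l * D) m) (λ k → ⟦ ⌊ l ℕ.≤? k ⌋ ⟧) ℚ.≤ ½ ^ℚ l
  many-successes small = tail 4ℚ ¼ 0≤4 0≤¼ 0≤r bound _ pointwise
    where
    y r s : ℚ
    y = (4ℚ ℚ.- 1ℚ) ℚ.* p
    r = 1ℚ ℚ.+ y
    s = r ^ℚ D
    0≤y : 0ℚ ℚ.≤ y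
    0≤y = 0≤* {4ℚ ℚ.- 1ℚ} (ℚ.*≤* (ℤ.+≤+ z≤n)) (0≤P m)
    0≤r : 0ℚ ℚ.≤ r
    0≤r = 0≤+ 0≤1 0≤y
    -- D y = 3 D p is at most ½, so (1 + y)^D is at most 2 and a quarter of it at most ½.
    ½≤ : ½ ℚ.≤ 1ℚ ℚ.- ι D ℚ.* y
    ½≤ = ≤-by (*≤ {½} (ℚ.*≤* (ℤ.+≤+ z≤n)) small)
      (((∀ d p → ½ ℚ.+ ½ ℚ.* 1ℚ ≡ 1ℚ ℚ.- d ℚ.* (((ℤ.+ 4 ℚ./ 1) ℚ.- 1ℚ) ℚ.* p) ℚ.+ ½ ℚ.* ((ℤ.+ 6 ℚ./ 1) ℚ.* (d ℚ.* p))) ∋ solve-∀ ℚ-ring) (ι D) p)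
    s*½≤1 : s ℚ.* ½ ℚ.≤ 1ℚ
    s*½≤1 = ℚ.≤-trans (*≤ (0≤^ D 0≤r) ½≤) ([1+x]^N[1-Nx]≤1 0≤y D)
    bound : ¼ ℚ.* s ℚ.≤ ½
    bound = ≤-by (*≤ {½} (ℚ.*≤* (ℤ.+≤+ z≤n)) s*½≤1) (((∀ s → (ℤ.+ 1 ℚ./ 4) ℚ.* s ℚ.+ ½ ℚ.* 1ℚ ≡ ½ ℚ.+ ½ ℚ.* (s ℚ.* ½)) ∋ solve-∀ ℚ-ring) s)
    pointwise : ∀ k → ⟦ ⌊ l ℕ.≤? k ⌋ ⟧ ℚ.≤ ¼ ^ℚ l ℚ.* 4ℚ ^ℚ k
    pointwise k with l ℕ.≤? k
    ... | yes le = ≤≡ (1≤x^k*y^j {4ℚ} {¼} {l} {k} refl 1≤4 le) (ℚ.*-comm (4ℚ ^ℚ k) (¼ ^ℚ l))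
    ... | no _   = 0≤* (0≤^ l 0≤¼) (0≤^ k 0≤4)

n≤2^⌈log₂n⌉ : ∀ n → n ≤ 2 ^ ⌈log₂ n ⌉
n≤2^⌈log₂n⌉ = <-rec _ λ
  { zero          _   → z≤n
  ; (suc zero)    _   → ℕ.≤-refl
  ; n@(suc (suc k)) rec → begin
      n                              ≤⟨ n≤2*⌈n/2⌉ n ⟩
      2 * ⌈ n /2⌉                    ≤⟨ ℕ.*-monoʳ-≤ 2 (rec (ℕ.⌈n/2⌉<n k)) ⟩
      2 * 2 ^ ⌈log₂ ⌈ n /2⌉ ⌉        ≡⟨ cong (λ e → 2 * 2 ^ e) (⌈log₂⌈n/2⌉⌉≡⌈log₂n⌉∸1 n) ⟩
      2 ^ suc (⌈log₂ n ⌉ ∸ 1)        ≡⟨ cong (2 ^_) (ℕ.m+[n∸m]≡n {1} (⌈log₂⌉-mono-≤ {2} {n} (s≤s (s≤s z≤n)))) ⟩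
      2 ^ ⌈log₂ n ⌉                  ∎ }
  where
  open ℕ.≤-Reasoning
  n≤2*⌈n/2⌉ : ∀ n → n ≤ 2 * ⌈ n /2⌉
  n≤2*⌈n/2⌉ n = ℕ.≤-trans (ℕ.≤-reflexive (sym (ℕ.⌊n/2⌋+⌈n/2⌉≡n n)))
    (ℕ.≤-trans (ℕ.+-monoˡ-≤ ⌈ n /2⌉ (ℕ.⌊n/2⌋≤⌈n/2⌉ n)) (ℕ.≤-reflexive (cong (⌈ n /2⌉ +_) (sym (ℕ.+-identityʳ ⌈ n /2⌉)))))

½^l*2^l≡1 : ∀ l → ½ ^ℚ l ℚ.* ι (2 ^ l) ≡ 1ℚ
½^l*2^l≡1 l = trans (cong (½ ^ℚ l ℚ.*_) (ι-^ 2 l)) (trans (sym (^-distrib-* ½ (ι 2) l))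
  (trans (cong (_^ℚ l) (cong (½ ℚ.*_) (ι≡fromℕ 2))) (1^ l)))
  where
  1^ : ∀ l → 1ℚ ^ℚ l ≡ 1ℚ
  1^ zero    = refl
  1^ (suc l) = trans (ℚ.*-identityˡ (1ℚ ^ℚ l)) (1^ l)

relabel : ∀ {k n} {A : Set} → (Fin k → Fin n) → QueryAlg k A → QueryAlg n A
relabel pos (return x)    = return x
relabel pos (query u v f) = query (pos u) (pos v) λ x → relabel pos (f x)
relabel pos (random j f)  = random j λ i → relabel pos (f i)

module _ {k n} (w : Weights n) (pos : Fin k → Fin n) where

  pulled : Weights k
  pulled u v = w (pos u) (pos v)

  E-relabel : ∀ {A : Set} (m : QueryAlg k A) φ → E w (relabel pos m) φ ≡ E pulled m φ
  E-relabel (return x)    φ = refl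
  E-relabel (query u v f) φ = E-relabel (f (pulled u v)) φ
  E-relabel (random j f)  φ = avg-cong j λ i → E-relabel (f i) φ

  queries-relabel : ∀ {A : Set} (m : QueryAlg k A) → queries w (relabel pos m) ≤ queries pulled m
  queries-relabel (return x)    = z≤n
  queries-relabel (query u v f) = s≤s (queries-relabel (f (pulled u v)))
  queries-relabel (random j f)  = queries-random-≤ {w = w} _ λ i →
    ℕ.≤-trans (queries-relabel (f i)) (≤-queries-random {w = pulled} (λ i → queries pulled (f i)) i)

  module _ (injective : ∀ {i j} → pos i ≡ pos j → i ≡ j) (surjective : ∀ v → ∃[ j ] pos j ≡ v) where

    pulled-metric : IsMetric _≡_ w → IsMetric _≡_ pulled
    pulled-metric metric = record
      { isSemiMetric = record
        { isQuasiSemiMetric = record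
          { isPreMetric = record
            { isProtoMetric = record
              { isPartialOrder = ℕ.≤-isPartialOrder ; ≈-isEquivalence = ≡.isEquivalence
              ; cong = cong₂ pulled ; nonNegative = z≤n }
            ; ≈⇒0 = λ { refl → IsMetric.≈⇒0 metric refl } }
          ; 0⇒≈ = λ eq → injective (IsMetric.0⇒≈ metric eq) }
        ; sym = λ u v → IsMetric.sym metric (pos u) (pos v) }
      ; triangle = λ u v x → IsMetric.triangle metric (pos u) (pos v) (pos x) }

    private
      inv : Fin n → Fin k
      inv v = proj₁ (surjective v)

      pos-inv : ∀ v → pos (inv v) ≡ v
      pos-inv v = proj₂ (surjective v)

      zip-map : ∀ xs ys → zip (map pos xs) (map pos ys) ≡ map (λ f → pos (proj₁ f) , pos (proj₂ f)) (zip xs ys)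
      zip-map []       ys       = refl
      zip-map (x ∷ xs) []       = refl
      zip-map (x ∷ xs) (y ∷ ys) = cong (_ ∷_) (zip-map xs ys)

      closedSteps-map : ∀ vs → closedSteps (map pos vs) ≡ map (λ f → pos (proj₁ f) , pos (proj₂ f)) (closedSteps vs)
      closedSteps-map []       = refl
      closedSteps-map (v ∷ vs) = trans (cong (zip (map pos (v ∷ vs))) (sym (List.map-++ pos vs (v ∷ [])))) (zip-map (v ∷ vs) (vs ∷ʳ v))

      weight-map : ∀ vs → cycleWeight w (map pos vs) ≡ cycleWeight pulled vs
      weight-map vs = cong sum (trans (cong (map (uncurry w)) (closedSteps-map vs)) (sym (List.map-∘ (closedSteps vs))))

      ham-map : ∀ {j l} (h : Fin j → Fin l) → (∀ {u v} → h u ≡ h v → u ≡ v) → (∀ v → ∃[ u ] h u ≡ v) →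
                ∀ vs → IsHamiltonianCycle vs → IsHamiltonianCycle (map h vs)
      ham-map h inj surj vs ((3≤ , unique , _) , all∈) =
        (3≤′ , unique′ , closedSteps-distinct (map h vs) 3≤′ unique′) ,
        λ v → subst (_∈ map h vs) (proj₂ (surj v)) (∈.∈-map⁺ h (all∈ (proj₁ (surj v))))
        where
        3≤′ : 3 ≤ length (map h vs)
        3≤′ = ℕ.≤-trans 3≤ (ℕ.≤-reflexive (sym (List.length-map h vs)))
        unique′ : Unique (map h vs)
        unique′ = Unique.map⁺ inj unique

    pulled-TSP : ∀ {t} → IsTSP w t → IsTSP pulled t
    pulled-TSP ((vs , ham , weight) , minimal) =
      (map inv vs , ham-map inv inv-injective (λ j → pos j , injective (pos-inv (pos j))) vs ham ,
        trans (sym (weight-map (map inv vs))) (trans (cong (cycleWeight w) (trans (sym (List.map-∘ vs)) (trans (List.map-cong pos-inv vs) (List.map-id vs)))) weight)) ,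
      λ us ham′ → ℕ.≤-trans (minimal (map pos us) (ham-map pos injective surjective us ham′)) (ℕ.≤-reflexive (weight-map us))
      where
      inv-injective : ∀ {u v} → inv u ≡ inv v → u ≡ v
      inv-injective {u} {v} eq = trans (sym (pos-inv u)) (trans (cong pos eq) (pos-inv v))

-- The estimator

-- The distances read so far as a total function; 0 is the value for a pair that was not read.
table : ∀ {n} → List (Fin n × Fin n) → List ℕ → Fin n × Fin n → ℕ
table (p ∷ ps) (x ∷ xs) f = if ⌊ ≡-dec Fin._≟_ Fin._≟_ f p ⌋ then x else table ps xs f
table _        _        f = 0

table-map : ∀ {n} (g : Fin n × Fin n → ℕ) ps {f} → f ∈ ps → table ps (map g ps) f ≡ g f
table-map g (p ∷ ps) {f} f∈ with ≡-dec Fin._≟_ Fin._≟_ f p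
table-map g (p ∷ ps) {f} f∈          | yes refl = refl
table-map g (p ∷ ps) {f} (here eq)   | no f≢p   = contradiction eq f≢p
table-map g (p ∷ ps) {f} (there f∈)  | no f≢p   = table-map g ps f∈

-- The length of an edge is charged to its lower end point, which is never the root.
onVertices : ∀ {m} → (Fin m → ℚ) → Fin (suc m) → ℚ
onVertices {zero}  f v       = 0ℚ
onVertices {suc m} f zero    = f zero
onVertices {suc m} f (suc v) = onVertices (f ∘ suc) v

onVertices-inject₁ : ∀ {m} (f : Fin m → ℚ) e → onVertices f (Fin.inject₁ e) ≡ f e
onVertices-inject₁ f zero    = refl
onVertices-inject₁ f (suc e) = onVertices-inject₁ (f ∘ suc) e

0≤onVertices : ∀ {m} (f : Fin m → ℚ) → (∀ e → 0ℚ ℚ.≤ f e) → ∀ v → 0ℚ ℚ.≤ onVertices f v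
0≤onVertices {zero}  f 0≤f v       = ℚ.≤-refl
0≤onVertices {suc m} f 0≤f zero    = 0≤f zero
0≤onVertices {suc m} f 0≤f (suc v) = 0≤onVertices (f ∘ suc) (0≤f ∘ suc) v

∑-onVertices : ∀ {m} (f : Fin m → ℚ) → ∑ (fins (suc m)) (onVertices f) ≡ ∑ (fins m) f
∑-onVertices {zero}  f = refl
∑-onVertices {suc m} f = trans (∑-fins-suc (suc m) (onVertices f)) (trans (cong (f zero ℚ.+_) (∑-onVertices (f ∘ suc))) (sym (∑-fins-suc m f)))

listsUpTo : ∀ {A : Set} → List A → ℕ → List (List A)
listsUpTo xs zero    = [] ∷ []
listsUpTo xs (suc k) = [] ∷ concatMap (λ ys → map (_∷ ys) xs) (listsUpTo xs k)

∈-listsUpTo : ∀ {A : Set} {xs : List A} → (∀ x → x ∈ xs) → ∀ {k} ys → length ys ≤ k → ys ∈ listsUpTo xs k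
∈-listsUpTo all∈ {zero}  []       _        = here refl
∈-listsUpTo all∈ {suc k} []       _        = here refl
∈-listsUpTo {xs = xs} all∈ {suc k} (y ∷ ys) (s≤s le) = there (∈.∈-concatMap⁺ (λ ys → map (_∷ ys) xs) {xs = listsUpTo xs k}
  (Any.map (λ { refl → ∈.∈-map⁺ (_∷ ys) (all∈ y) }) (∈-listsUpTo all∈ ys le)))

^-distribʳ-* : ∀ k x y → (x * y) ^ k ≡ x ^ k * y ^ k
^-distribʳ-* zero    x y = refl
^-distribʳ-* (suc k) x y = trans (cong (x * y *_) (^-distribʳ-* k x y)) (((∀ x y a b → x * y * (a * b) ≡ x * a * (y * b)) ∋ ℕ-solve-∀) x y (x ^ k) (y ^ k))

-- Rounds n^¼ up to a power of z. The scale has to be an exact power z ^ J, because the number of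
-- rounds is tied to it by (c / 2) ^ J = b ^ 5.
scale : ∀ z → 2 ≤ z → ∀ m → ∃[ J ] suc m ≤ (z ^ J) ^ 4 × (z ^ J) ^ 4 ≤ z ^ 4 * suc m
scale z@(suc _) 2≤z zero = 0 , ℕ.≤-refl , ℕ.≤-trans (ℕ.m^n>0 z 4) (ℕ.m≤m*n (z ^ 4) 1)
scale z@(suc _) 2≤z (suc m) with scale z 2≤z m
... | J , lower , upper with suc (suc m) ℕ.≤? (z ^ J) ^ 4
...   | yes le = J , le , ℕ.≤-trans upper (ℕ.*-monoʳ-≤ (z ^ 4) (ℕ.n≤1+n (suc m)))
...   | no ≰   = suc J , lower′ , upper′
  where
  open ℕ.≤-Reasoning
  lower′ : suc (suc m) ≤ (z ^ suc J) ^ 4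
  lower′ = begin
    suc (suc m)            ≤⟨ s≤s (ℕ.m≤n+m (suc m) m) ⟩
    suc m + suc m          ≡⟨ cong (suc m +_) (sym (ℕ.+-identityʳ (suc m))) ⟩
    2 * suc m              ≤⟨ ℕ.*-mono-≤ (ℕ.≤-trans 2≤z (ℕ.m≤m*n z (z ^ 3) {{ℕ.m^n≢0 z 3}})) lower ⟩
    z ^ 4 * (z ^ J) ^ 4    ≡⟨ sym (^-distribʳ-* 4 z (z ^ J)) ⟩
    (z ^ suc J) ^ 4        ∎
  upper′ : (z ^ suc J) ^ 4 ≤ z ^ 4 * suc (suc m)
  upper′ = begin
    (z ^ suc J) ^ 4        ≡⟨ ^-distribʳ-* 4 z (z ^ J) ⟩
    z ^ 4 * (z ^ J) ^ 4    ≤⟨ ℕ.*-monoʳ-≤ (z ^ 4) (ℕ.≤-trans (ℕ.n≤1+n _) (ℕ.≰⇒> ≰)) ⟩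
    z ^ 4 * suc (suc m)    ∎

ι*1/ℕ≤1 : ∀ {j k} → j ≤ suc k → ι j ℚ.* 1/ℕ k ℚ.≤ 1ℚ
ι*1/ℕ≤1 {j} {k} j≤ = ≤≡ (≤* (0≤1/ℕ k) (ι-mono j≤)) (trans (ℚ.*-comm (ι (suc k)) (1/ℕ k)) (1/ℕ-inverse k))

-- A short tour forces many dead units, hence a large success probability of a trial.
success-probability : ∀ {M tsp η₀ Nε t dead L p} → 0ℚ ℚ.< L → 0ℚ ℚ.≤ t → 0ℚ ℚ.≤ M →
  (ℤ.+ 6 ℚ./ 1) ℚ.* M ℚ.≤ (ℤ.+ 5 ℚ./ 1) ℚ.* tsp ℚ.+ (ℤ.+ 16 ℚ./ 1) ℚ.* (η₀ ℚ.* M) ℚ.+ (ℤ.+ 4 ℚ./ 1) ℚ.* Nε ℚ.+ (1ℚ ℚ.+ 1ℚ) ℚ.* t ℚ.* ((ℤ.+ 2 ℚ./ 1) ℚ.* dead) →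
  (ℤ.+ 10 ℚ./ 1) ℚ.* tsp ℚ.≤ (ℤ.+ 11 ℚ./ 1) ℚ.* M → (ℤ.+ 100 ℚ./ 1) ℚ.* η₀ ℚ.≤ 1ℚ → (ℤ.+ 50 ℚ./ 1) ℚ.* Nε ℚ.≤ M →
  L ≡ (ℤ.+ 3 ℚ./ 1) ℚ.* M → (ℤ.+ 96 ℚ./ 1) ℚ.* (t ℚ.* dead) ℚ.≤ (ℤ.+ 96 ℚ./ 1) ℚ.* (t ℚ.* (p ℚ.* L)) ℚ.+ L →
  1ℚ ℚ.≤ (ℤ.+ 96 ℚ./ 1) ℚ.* (t ℚ.* p)
success-probability {M} {tsp} {η₀} {Nε} {t} {dead} {L} {p} 0<L 0≤t 0≤M tour short η₀≤ Nε≤ refl dead≤ =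
  -- The errors leave 6 M ≤ (5.5 + 0.16 + 0.08) M + 4 t dead, so 96 t dead ≥ 24 · 0.26 M = 6.24 M,
  -- more than 2 L = 6 M. One L goes to the aborted runs; the other is the claim.
  *-cancelˡ-≤ {L} 0<L (≤-by (dead≤ +≤ *≤ {ℤ.+ 24 ℚ./ 1} (ℚ.*≤* (ℤ.+≤+ z≤n)) (tour +≤ *≤ {½} (ℚ.*≤* (ℤ.+≤+ z≤n)) short
      +≤ *≤ {ℤ.+ 4 ℚ./ 25} (ℚ.*≤* (ℤ.+≤+ z≤n)) (≤* 0≤M η₀≤) +≤ *≤ {ℤ.+ 2 ℚ./ 25} (ℚ.*≤* (ℤ.+≤+ z≤n)) Nε≤ +≤ *≤ {ℤ.+ 1 ℚ./ 100} (ℚ.*≤* (ℤ.+≤+ z≤n)) 0≤M))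
    (equation M tsp η₀ Nε t dead p))
  where
  equation : ∀ M tsp η₀ Nε t dead p →
    (ℤ.+ 3 ℚ./ 1) ℚ.* M ℚ.* 1ℚ ℚ.+ ((ℤ.+ 96 ℚ./ 1) ℚ.* (t ℚ.* (p ℚ.* ((ℤ.+ 3 ℚ./ 1) ℚ.* M))) ℚ.+ (ℤ.+ 3 ℚ./ 1) ℚ.* M
      ℚ.+ (ℤ.+ 24 ℚ./ 1) ℚ.* ((ℤ.+ 5 ℚ./ 1) ℚ.* tsp ℚ.+ (ℤ.+ 16 ℚ./ 1) ℚ.* (η₀ ℚ.* M) ℚ.+ (ℤ.+ 4 ℚ./ 1) ℚ.* Nε ℚ.+ (1ℚ ℚ.+ 1ℚ) ℚ.* t ℚ.* ((ℤ.+ 2 ℚ./ 1) ℚ.* dead)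
        ℚ.+ ½ ℚ.* ((ℤ.+ 11 ℚ./ 1) ℚ.* M) ℚ.+ (ℤ.+ 4 ℚ./ 25) ℚ.* (1ℚ ℚ.* M) ℚ.+ (ℤ.+ 2 ℚ./ 25) ℚ.* M ℚ.+ (ℤ.+ 1 ℚ./ 100) ℚ.* M))
    ≡ (ℤ.+ 3 ℚ./ 1) ℚ.* M ℚ.* ((ℤ.+ 96 ℚ./ 1) ℚ.* (t ℚ.* p)) ℚ.+ ((ℤ.+ 96 ℚ./ 1) ℚ.* (t ℚ.* dead)
      ℚ.+ (ℤ.+ 24 ℚ./ 1) ℚ.* ((ℤ.+ 6 ℚ./ 1) ℚ.* M ℚ.+ ½ ℚ.* ((ℤ.+ 10 ℚ./ 1) ℚ.* tsp) ℚ.+ (ℤ.+ 4 ℚ./ 25) ℚ.* ((ℤ.+ 100 ℚ./ 1) ℚ.* η₀ ℚ.* M) ℚ.+ (ℤ.+ 2 ℚ./ 25) ℚ.* ((ℤ.+ 50 ℚ./ 1) ℚ.* Nε) ℚ.+ (ℤ.+ 1 ℚ./ 100) ℚ.* 0ℚ))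
  equation = solve-∀ ℚ-ring

-- A large success probability means many dead units, hence a tour of weight at most (2 − η₀) M.
tour-saving : ∀ {M v η₀ D β dead L p} → 0ℚ ℚ.≤ D → 0ℚ ℚ.≤ L → 0ℚ ℚ.≤ η₀ → 0ℚ ℚ.≤ dead →
  v ℚ.+ (ℤ.+ 1 ℚ./ 100) ℚ.* (β ℚ.* dead) ℚ.≤ (1ℚ ℚ.+ 1ℚ) ℚ.* M → L ≡ (ℤ.+ 3 ℚ./ 1) ℚ.* M → p ℚ.* L ℚ.≤ dead →
  1ℚ ℚ.≤ (ℤ.+ 6 ℚ./ 1) ℚ.* (D ℚ.* p) → (ℤ.+ 200 ℚ./ 1) ℚ.* (η₀ ℚ.* D) ℚ.≤ β → v ℚ.≤ (1ℚ ℚ.+ 1ℚ) ℚ.* M ℚ.- η₀ ℚ.* M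
tour-saving {M} {v} {η₀} {D} {β} {dead} {L} {p} 0≤D 0≤L 0≤η₀ 0≤dead sound refl p≤ p≥ η₀≤ =
  -- dead ≥ p L ≥ L / (6 D) = M / (2 D), and β / 100 ≥ 2 η₀ D, so the saving is at least η₀ M.
  ≤-by (sound +≤ *≤ {ℤ.+ 1 ℚ./ 100} (ℚ.*≤* (ℤ.+≤+ z≤n)) (≤* 0≤dead η₀≤) +≤ *≤ {ℤ.+ 1 ℚ./ 3} (ℚ.*≤* (ℤ.+≤+ z≤n)) (*≤ 0≤η₀ (*≤ {ℤ.+ 6 ℚ./ 1} (ℚ.*≤* (ℤ.+≤+ z≤n)) (*≤ 0≤D p≤) +≤ ≤* 0≤L p≥)))
    (equation M v η₀ D β dead p)
  where
  equation : ∀ M v η₀ D β dead p →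
    v ℚ.+ ((1ℚ ℚ.+ 1ℚ) ℚ.* M ℚ.+ (ℤ.+ 1 ℚ./ 100) ℚ.* (β ℚ.* dead) ℚ.+ (ℤ.+ 1 ℚ./ 3) ℚ.* (η₀ ℚ.* ((ℤ.+ 6 ℚ./ 1) ℚ.* (D ℚ.* dead) ℚ.+ (ℤ.+ 6 ℚ./ 1) ℚ.* (D ℚ.* p) ℚ.* ((ℤ.+ 3 ℚ./ 1) ℚ.* M))))
    ≡ (1ℚ ℚ.+ 1ℚ) ℚ.* M ℚ.- η₀ ℚ.* M ℚ.+ (v ℚ.+ (ℤ.+ 1 ℚ./ 100) ℚ.* (β ℚ.* dead) ℚ.+ (ℤ.+ 1 ℚ./ 100) ℚ.* ((ℤ.+ 200 ℚ./ 1) ℚ.* (η₀ ℚ.* D) ℚ.* dead)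
      ℚ.+ (ℤ.+ 1 ℚ./ 3) ℚ.* (η₀ ℚ.* ((ℤ.+ 6 ℚ./ 1) ℚ.* (D ℚ.* (p ℚ.* ((ℤ.+ 3 ℚ./ 1) ℚ.* M))) ℚ.+ 1ℚ ℚ.* ((ℤ.+ 3 ℚ./ 1) ℚ.* M))))
  equation = solve-∀ ℚ-ring

∑-avg : ∀ {A : Set} (xs : List A) f → ∑ xs f ℚ.* 1/ℕ (length xs ∸ 1) ℚ.* ι (length xs) ≡ ∑ xs f
∑-avg []       f = trans (cong (0ℚ ℚ.* 1/ℕ 0 ℚ.*_) ι-0) (ℚ.*-zeroʳ (0ℚ ℚ.* 1/ℕ 0))
∑-avg (x ∷ xs) f = trans (ℚ.*-assoc (∑ (x ∷ xs) f) (1/ℕ (length xs)) (ι (suc (length xs))))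
  (trans (cong (∑ (x ∷ xs) f ℚ.*_) (1/ℕ-inverse (length xs))) (ℚ.*-identityʳ (∑ (x ∷ xs) f)))

module Estimator (t : ℕ) where

  -- c (t + 2) = z⁶ bounds the expected cost of J rounds by O(b⁶), b = z^J, and (c / 2)^J = b⁵ is
  -- what `late` needs.  D, B and K are read off from `success-probability`, `Soundness` and
  -- `tour-saving`.
  z c C₀ D B K : ℕ
  z  = 2 * (t + 2)
  c  = 2 * z ^ 5
  C₀ = 36
  D  = 896 * t
  B  = 10 * (C₀ + c)
  K  = 200 * (suc B * D)

  N : ℕ → ℕ
  N i = C₀ * c ^ i

  β η₀ : ℚ
  β  = 1/ℕ B
  η₀ = 1/ℕ K

  2≤z : 2 ≤ z
  2≤z = ℕ.*-monoʳ-≤ 2 (ℕ.≤-trans (s≤s z≤n) (ℕ.m≤n+m 2 t))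

  module Algorithm {m} (T : RTree m) where

    J b l A X cap : ℕ
    J   = proj₁ (scale z 2≤z m)
    b   = z ^ J
    l   = ⌈log₂ suc m ⌉
    A   = 400 * b ^ 3
    X   = C₀ * (z ^ 6 * b ^ 6)
    cap = 96 * t * X

    -- Every vertex has mass 1: an edge keeps at most b local vertices, and at most n / b edges are
    -- marked.
    portals : Fin m → Bool
    portals = mark T (ι b) (λ _ → 1ℚ)

    module Measured (len : Fin m → ℕ) where

      open TreeValue T len public
      open LocalTest T portals len b N t public

      heights : Fin (suc m) → ℚ
      heights = onVertices (ι ∘ len)

      -- A second marking, now by length: each point is within M / (A + 1) of a net point, and at
      -- most A + 1 edges are marked.
      net : Fin m → Bool
      net = mark T (M ℚ.* 1/ℕ A) heights

      netPairs : List Pair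
      netPairs = cartesianProduct (netPoints net) (netPoints net)

      -- The distance of u and v up to a detour through the nearest net points.
      κ : (Pair → ℕ) → Pair → ℚ
      κ δ (u , v) = climb T net heights u ℚ.+ ι (δ (nearest T net u , nearest T net v)) ℚ.+ climb T net heights v

      low high : ℚ
      low  = (1ℚ ℚ.+ 1ℚ) ℚ.* M ℚ.- η₀ ℚ.* M
      high = (1ℚ ℚ.+ 1ℚ) ℚ.* M

      -- An aborted run counts as alive, so trials never overstate the dead units and understate
      -- them only by the probability of an abort.
      dies : Maybe Elem → QueryAlg (suc m) Bool
      dies nothing  = return false
      dies (just q) = capped cap (alive (suc J) q) >>= λ r → return (maybe not false r)

      trial : QueryAlg (suc m) Bool
      trial = draw (length units ∸ 1) units >>= dies

      -- An exhaustive search over all lists of at most 2 b³ pairs, possible because only queries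
      -- are charged. The lists are as long as far pairs may be numerous.
      Cheap : (Pair → ℕ) → Set
      Cheap δ = Any (λ S → value (κ δ) S ℚ.≤ low) (listsUpTo pairs (2 * b ^ 3))

      cheap? : ∀ δ → Dec (Cheap δ)
      cheap? δ = Any.any? (λ S → value (κ δ) S ℚ.≤? low) (listsUpTo pairs (2 * b ^ 3))

      counts : QueryAlg (suc m) ℕ
      counts = countTrue (l * D) trial

      answer : ℕ → ℚ
      answer k = if ⌊ l ℕ.≤? k ⌋ then low else high

      decide : ∀ δ → Dec (Cheap δ) → QueryAlg (suc m) ℚ
      decide δ (yes _) = return low
      decide δ (no  _) = counts >>= return ∘ answer

      estimate : QueryAlg (suc m) ℚ
      estimate = reading netPairs λ xs → decide (table netPairs xs) (cheap? (table netPairs xs))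

    edgePairs : List (Fin (suc m) × Fin (suc m))
    edgePairs = map (λ e → Fin.inject₁ e , parent T e) (fins m)

    tspEstimate : QueryAlg (suc m) ℚ
    tspEstimate = reading edgePairs λ xs → Measured.estimate λ e → table edgePairs xs (Fin.inject₁ e , parent T e)

    n≤b⁴ : suc m ≤ b ^ 4
    n≤b⁴ = proj₁ (proj₂ (scale z 2≤z m))

    b⁴≤ : b ^ 4 ≤ z ^ 4 * suc m
    b⁴≤ = proj₂ (proj₂ (scale z 2≤z m))

    0<z : NonZero z
    0<z = ℕ.>-nonZero (ℕ.≤-trans (s≤s z≤n) 2≤z)

    0<b : NonZero b
    0<b = ℕ.m^n≢0 z J {{0<z}}

    few-local : ∀ e → ∑ (fins (suc m)) (λ v → ⟦ local T portals e v ⟧) ℚ.≤ ι b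
    few-local e = ≡≤ (∑-cong (fins (suc m)) λ v → sym (ℚ.*-identityʳ ⟦ local T portals e v ⟧)) (local-mass T (ι b) (λ _ → 1ℚ) (0≤ι b) e)

    few-portals : ι 2 ℚ.* ∑ (fins m) (λ e → ⟦ portals e ⟧) ℚ.≤ ι (2 * b ^ 3)
    few-portals = ≤≡ (*≤ (0≤ι 2) (*-cancelˡ-≤ (0<ι b {{0<b}}) (begin
      ι b ℚ.* ∑ (fins m) (λ e → ⟦ portals e ⟧)       ≤⟨ mark-count T (ι b) (λ _ → 1ℚ) (λ _ → 0≤1) ⟩
      ∑ (fins (suc m)) (λ _ → 1ℚ)                    ≡⟨ trans (∑-one (fins (suc m))) (cong ι (length-fins (suc m))) ⟩
      ι (suc m)                                      ≤⟨ ι-mono n≤b⁴ ⟩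
      ι (b ^ 4)                                      ≡⟨ ι-* b (b ^ 3) ⟩
      ι b ℚ.* ι (b ^ 3)                              ∎))) (sym (ι-* 2 (b ^ 3)))
      where open ℚ.≤-Reasoning

    N-suc : ∀ i → N (suc i) ≡ c * N i
    N-suc i = ((∀ C c x → C * (c * x) ≡ c * (C * x)) ∋ ℕ-solve-∀) C₀ c (c ^ i)

    exchange : ∀ k → (z ^ k) ^ J ≡ b ^ k
    exchange k = trans (ℕ.^-*-assoc z k J) (trans (cong (z ^_) (ℕ.*-comm k J)) (sym (ℕ.^-*-assoc z J k)))

    late : ι 3 ℚ.≤ ι (N J) ℚ.* (1/ℕ (2 * b * suc m) ℚ.* 1/ℕ 3) ℚ.* ½ ^ℚ J
    late = begin
      ι 3
        ≡⟨ sym (trans (cong₂ (λ x y → ι 3 ℚ.* (x ℚ.* y)) (1/ℕ-inverse s) (1/ℕ-inverse 3)) (trans (cong (ι 3 ℚ.*_) (ℚ.*-identityˡ 1ℚ)) (ℚ.*-identityʳ (ι 3)))) ⟩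
      ι 3 ℚ.* (u ℚ.* ι (suc s) ℚ.* (v ℚ.* ι 4))
        ≡⟨ ((∀ x u s v y → x ℚ.* (u ℚ.* s ℚ.* (v ℚ.* y)) ≡ s ℚ.* (y ℚ.* x) ℚ.* (u ℚ.* v)) ∋ solve-∀ ℚ-ring) (ι 3) u (ι (suc s)) v (ι 4) ⟩
      ι (suc s) ℚ.* (ι 4 ℚ.* ι 3) ℚ.* (u ℚ.* v)
        ≡⟨ cong (ℚ._* (u ℚ.* v)) (trans (cong (ι (suc s) ℚ.*_) (sym (ι-* 4 3))) (sym (ι-* (suc s) 12))) ⟩
      ι (suc s * 12) ℚ.* (u ℚ.* v)
        ≤⟨ ≤* (0≤* (0≤1/ℕ s) (0≤1/ℕ 3)) (ι-mono count) ⟩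
      ι (C₀ * b ^ 5) ℚ.* (u ℚ.* v)
        ≡⟨ trans (cong (ℚ._* (u ℚ.* v)) (sym (trans (cong (ι (C₀ * b ^ 5) ℚ.*_) (½^l*2^l≡1 J)) (ℚ.*-identityʳ (ι (C₀ * b ^ 5))))))
             (((∀ n h p x → n ℚ.* (h ℚ.* p) ℚ.* x ≡ n ℚ.* p ℚ.* x ℚ.* h) ∋ solve-∀ ℚ-ring) (ι (C₀ * b ^ 5)) (½ ^ℚ J) (ι (2 ^ J)) (u ℚ.* v)) ⟩
      ι (C₀ * b ^ 5) ℚ.* ι (2 ^ J) ℚ.* (u ℚ.* v) ℚ.* ½ ^ℚ J
        ≡⟨ cong (λ x → x ℚ.* (u ℚ.* v) ℚ.* ½ ^ℚ J) (trans (sym (ι-* (C₀ * b ^ 5) (2 ^ J))) (cong ι NJ)) ⟩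
      ι (N J) ℚ.* (u ℚ.* v) ℚ.* ½ ^ℚ J ∎
      where
      open ℚ.≤-Reasoning
      s : ℕ
      s = 2 * b * suc m
      u v : ℚ
      u = 1/ℕ s
      v = 1/ℕ 3
      NJ : C₀ * b ^ 5 * 2 ^ J ≡ N J
      NJ = trans (((∀ C x y → C * x * y ≡ C * (y * x)) ∋ ℕ-solve-∀) C₀ (b ^ 5) (2 ^ J))
        (cong (C₀ *_) (trans (cong (2 ^ J *_) (sym (exchange 5))) (sym (^-distribʳ-* J 2 (z ^ 5)))))
      -- The origin of C₀ = 36: `late` asks for 3, `inv` has the factor 1/4 for the windows of a
      -- pair, and 2 b n + 1 ≤ 3 b⁵.
      count : suc s * 12 ≤ C₀ * b ^ 5
      count = ℕ.≤-trans (ℕ.*-monoˡ-≤ 12 (ℕ.+-mono-≤ (ℕ.m^n>0 b {{0<b}} 5) (ℕ.*-monoʳ-≤ (2 * b) n≤b⁴)))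
        (ℕ.≤-reflexive (((∀ b x → (b * x + 2 * b * x) * 12 ≡ 36 * (b * x)) ∋ ℕ-solve-∀) b (b ^ 4)))

    module Analysis (d : Weights (suc m)) (metric : IsMetric _≡_ d) (3≤n : 3 ≤ suc m)
      (len : Fin m → ℕ) (len≡ : ∀ e → len e ≡ d (Fin.inject₁ e) (parent T e))
      (0<t : NonZero t) (decay : ι c ℚ.* (ℤ.+ 9 ℚ./ 10) ^ℚ t ℚ.≤ ℤ.+ 1 ℚ./ 100) where

      open Measured len using (heights; net; netPairs; κ; low; high; dies; trial; Cheap; cheap?; counts; answer; decide; estimate)
      open LocalAnalysis d metric 3≤n T len len≡ portals b few-local N t c N-suc

      -- Rounds 0 to J: `many-dead` speaks of survival after round J.
      R : ℕ
      R = suc J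

      L σ : ℚ
      L = ι (length units)
      σ = P[true] d trial

      dead : Elem → ℚ
      dead q = 1ℚ ℚ.- a R q

      totalDead : ℚ
      totalDead = ∑ units dead

      0≤dead : ∀ q → 0ℚ ℚ.≤ dead q
      0≤dead q = 0≤b-a (a≤1 R q)

      2≤c : ι 2 ℚ.≤ ι c
      2≤c = ι-mono (ℕ.m≤m*n 2 (z ^ 5) {{ℕ.m^n≢0 z 5 {{0<z}}}})

      1≤len : ∀ e → 1 ≤ len e
      1≤len e = ℕ.≤-trans (ℕ.>-nonZero⁻¹ _ {{d-pos {Fin.inject₁ e} {parent T e} λ eq → ℕ.<-irrefl (cong toℕ eq) (parent-above T e)}}) (ℕ.≤-reflexive (sym (len≡ e)))

      1≤M : 1ℚ ℚ.≤ M
      1≤M = ℚ.≤-trans (≡≤ (sym ι-1) (ι-mono (1≤len e₀))) (≤∑ {f = ι ∘ len} (0≤ι ∘ len) (∈-fins e₀))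
        where
        e₀ : Fin m
        e₀ = Fin.fromℕ< (ℕ.≤-trans (s≤s z≤n) (ℕ.s≤s⁻¹ 3≤n))

      0≤M : 0ℚ ℚ.≤ M
      0≤M = ℚ.≤-trans 0≤1 1≤M

      L≡3M : L ≡ (ℤ.+ 3 ℚ./ 1) ℚ.* M
      L≡3M = trans length-units (cong (ℚ._* M) (ι≡fromℕ 3))

      0<L : 0ℚ ℚ.< L
      0<L = ℚ.<-≤-trans (ℚ.<-≤-trans (ℚ.positive⁻¹ 1ℚ) 1≤M) (≤-by (*≤ {ℤ.+ 2 ℚ./ 1} (ℚ.*≤* (ℤ.+≤+ z≤n)) 0≤M)
        (trans (((∀ M → M ℚ.+ (ℤ.+ 2 ℚ./ 1) ℚ.* M ≡ (ℤ.+ 3 ℚ./ 1) ℚ.* M ℚ.+ (ℤ.+ 2 ℚ./ 1) ℚ.* 0ℚ) ∋ solve-∀ ℚ-ring) M) (cong (ℚ._+ (ℤ.+ 2 ℚ./ 1) ℚ.* 0ℚ) (sym L≡3M))))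

      run : Elem → QueryAlg (suc m) (Maybe Bool)
      run q = capped cap (alive R q)

      found abort : Elem → ℚ
      found q = E d (run q) (maybe (λ x → ⟦ not x ⟧) 0ℚ)
      abort q = E d (run q) (maybe (λ _ → 0ℚ) 1ℚ)

      E-dead : ∀ q → E d (alive R q) (λ x → ⟦ not x ⟧) ≡ dead q
      E-dead q = trans (E-not (alive R q) id) (cong (λ x → 1ℚ ℚ.- x) (P-alive R q))

      found-≤ : ∀ q → found q ℚ.≤ dead q
      found-≤ q = ≤≡ (E-capped-≤ cap (alive R q) λ x → 0≤⟦ not x ⟧) (E-dead q)

      found-≥ : ∀ q → dead q ℚ.≤ found q ℚ.+ abort q
      found-≥ q = ≡≤ (sym (E-dead q)) (E-≤-capped cap (alive R q) λ x → ⟦ not x ⟧≤1)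

      σ*L : σ ℚ.* L ≡ ∑ units found
      σ*L = trans (cong (ℚ._* L) (avg-nth (length units ∸ 1) units (λ x → E d (dies x) ⟦_⟧) found (suc-pred units) found-just refl)) (∑-avg units found)
        where
        suc-pred : ∀ (xs : List Elem) → length xs ≤ suc (length xs ∸ 1)
        suc-pred []       = z≤n
        suc-pred (x ∷ xs) = ℕ.≤-refl
        found-just : ∀ q → E d (dies (just q)) ⟦_⟧ ≡ found q
        found-just q = trans (E-bind (run q) (λ r → return (maybe not false r)) ⟦_⟧) (E-cong (run q) λ { (just x) → refl ; nothing → refl })

      -- Since c (t + 2) = z⁶, the growth over J + 1 rounds is z⁶ · (z ^ J)⁶ = z⁶ b⁶.
      cost : ∀ q → E[queries] d (alive R q) ℚ.≤ ι X
      cost q = ≤≡ (cost-alive 2≤c R q) (begin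
        ι (N 0) ℚ.* (ι c ℚ.* (ι t ℚ.+ ι 2)) ^ℚ R    ≡⟨ cong (λ x → ι (N 0) ℚ.* x ^ℚ R) (trans (cong (ι c ℚ.*_) (sym (ι-+ t 2))) (sym (ι-* c (t + 2)))) ⟩
        ι (N 0) ℚ.* ι (c * (t + 2)) ^ℚ R            ≡⟨ trans (cong (ι (N 0) ℚ.*_) (sym (ι-^ (c * (t + 2)) R))) (sym (ι-* (N 0) ((c * (t + 2)) ^ R))) ⟩
        ι (N 0 * (c * (t + 2)) ^ R)                 ≡⟨ cong ι (cong₂ _*_ (ℕ.*-identityʳ C₀) (trans (cong (_^ R) (((∀ x y → 2 * y * x ≡ 2 * x * y) ∋ ℕ-solve-∀) (t + 2) (z ^ 5))) (cong (z ^ 6 *_) (exchange 6)))) ⟩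
        ι X                                         ∎)
        where open ≡-Reasoning

      0<X : NonZero X
      0<X = ℕ.m*n≢0 C₀ (z ^ 6 * b ^ 6) {{_}} {{ℕ.m*n≢0 (z ^ 6) (b ^ 6) {{ℕ.m^n≢0 z 6 {{0<z}}}} {{ℕ.m^n≢0 b 6 {{0<b}}}}}}

      0≤abort : ∀ q → 0ℚ ℚ.≤ abort q
      0≤abort q = 0≤E (run q) λ { (just x) → ℚ.≤-refl ; nothing → 0≤1 }

      -- The cap is 96 t times the expected cost, so Markov's inequality leaves an abort probability
      -- of 1 / (96 t), the loss that `success-probability` tolerates.
      abort-≤ : ∀ q → ι (96 * t) ℚ.* abort q ℚ.≤ 1ℚ
      abort-≤ q = *-cancelˡ-≤ {ι X} (0<ι X {{0<X}}) (begin
        ι X ℚ.* (ι (96 * t) ℚ.* abort q)    ≡⟨ ((∀ x y a → x ℚ.* (y ℚ.* a) ≡ y ℚ.* x ℚ.* a) ∋ solve-∀ ℚ-ring) (ι X) (ι (96 * t)) (abort q) ⟩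
        ι (96 * t) ℚ.* ι X ℚ.* abort q      ≡⟨ cong (ℚ._* abort q) (sym (ι-* (96 * t) X)) ⟩
        ι cap ℚ.* abort q                   ≤⟨ ≤* (0≤abort q) (ι-mono (ℕ.n≤1+n cap)) ⟩
        ι (suc cap) ℚ.* abort q             ≤⟨ markov cap (alive R q) ⟩
        E[queries] d (alive R q)            ≤⟨ cost q ⟩
        ι X                                 ≡⟨ sym (ℚ.*-identityʳ (ι X)) ⟩
        ι X ℚ.* 1ℚ                          ∎)
        where open ℚ.≤-Reasoning

      σ*L-≤ : σ ℚ.* L ℚ.≤ totalDead
      σ*L-≤ = ≡≤ σ*L (∑-mono units found-≤)

      ι-96t : ∀ x → ι (96 * t) ℚ.* x ≡ (ℤ.+ 96 ℚ./ 1) ℚ.* (ι t ℚ.* x)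
      ι-96t x = trans (cong (ℚ._* x) (trans (ι-* 96 t) (cong (ℚ._* ι t) (ι≡fromℕ 96)))) (ℚ.*-assoc (ℤ.+ 96 ℚ./ 1) (ι t) x)

      σ*L-≥ : (ℤ.+ 96 ℚ./ 1) ℚ.* (ι t ℚ.* totalDead) ℚ.≤ (ℤ.+ 96 ℚ./ 1) ℚ.* (ι t ℚ.* (σ ℚ.* L)) ℚ.+ L
      σ*L-≥ = begin
        (ℤ.+ 96 ℚ./ 1) ℚ.* (ι t ℚ.* totalDead)                          ≡⟨ sym (ι-96t totalDead) ⟩
        ι (96 * t) ℚ.* totalDead                                        ≤⟨ *≤ (0≤ι (96 * t)) (≤≡ (∑-mono units found-≥) (∑-+ units found abort)) ⟩
        ι (96 * t) ℚ.* (∑ units found ℚ.+ ∑ units abort)                ≡⟨ ℚ.*-distribˡ-+ (ι (96 * t)) (∑ units found) (∑ units abort) ⟩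
        ι (96 * t) ℚ.* ∑ units found ℚ.+ ι (96 * t) ℚ.* ∑ units abort   ≤⟨ ℚ.+-monoʳ-≤ (ι (96 * t) ℚ.* ∑ units found) (≡≤ (sym (∑-*ˡ units (ι (96 * t)) abort)) (≤≡ (∑-mono units abort-≤) (∑-one units))) ⟩
        ι (96 * t) ℚ.* ∑ units found ℚ.+ L                              ≡⟨ cong (ℚ._+ L) (trans (cong (ι (96 * t) ℚ.*_) (sym σ*L)) (ι-96t (σ ℚ.* L))) ⟩
        (ℤ.+ 96 ℚ./ 1) ℚ.* (ι t ℚ.* (σ ℚ.* L)) ℚ.+ L                    ∎
        where open ℚ.≤-Reasoning

      β-small : β ℚ.* (ι (N 0) ℚ.+ ι c) ℚ.≤ ℤ.+ 1 ℚ./ 10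
      β-small = ≤-by (*≤ {ℤ.+ 1 ℚ./ 10} (ℚ.*≤* (ℤ.+≤+ z≤n)) (ι*1/ℕ≤1 {10 * (C₀ + c)} {B} (ℕ.n≤1+n B)))
        (trans (cong (λ x → β ℚ.* x ℚ.+ (ℤ.+ 1 ℚ./ 10) ℚ.* 1ℚ) (trans (sym (ι-+ (N 0) c)) (cong (λ k → ι (k + c)) (ℕ.*-identityʳ C₀))))
          (trans (((∀ β y → β ℚ.* y ℚ.+ (ℤ.+ 1 ℚ./ 10) ℚ.* 1ℚ ≡ (ℤ.+ 1 ℚ./ 10) ℚ.+ (ℤ.+ 1 ℚ./ 10) ℚ.* ((ℤ.+ 10 ℚ./ 1) ℚ.* y ℚ.* β)) ∋ solve-∀ ℚ-ring) β (ι (C₀ + c)))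
            (cong (λ x → (ℤ.+ 1 ℚ./ 10) ℚ.+ (ℤ.+ 1 ℚ./ 10) ℚ.* (x ℚ.* β)) (trans (cong (ℚ._* ι (C₀ + c)) (sym (ι≡fromℕ 10))) (sym (ι-* 10 (C₀ + c)))))))

      0≤η₀ : 0ℚ ℚ.≤ η₀
      0≤η₀ = 0≤1/ℕ K

      0<D : NonZero D
      0<D = ℕ.m*n≢0 896 t {{_}} {{0<t}}

      100η₀≤1 : (ℤ.+ 100 ℚ./ 1) ℚ.* η₀ ℚ.≤ 1ℚ
      100η₀≤1 = ≡≤ (cong (ℚ._* η₀) (sym (ι≡fromℕ 100))) (ι*1/ℕ≤1 {100} {K}
        (ℕ.≤-trans (ℕ.m≤m+n 100 100) (ℕ.≤-trans (ℕ.m≤m*n 200 (suc B * D) {{ℕ.m*n≢0 (suc B) D {{_}} {{0<D}}}}) (ℕ.n≤1+n K))))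

      200η₀D≤β : (ℤ.+ 200 ℚ./ 1) ℚ.* (η₀ ℚ.* ι D) ℚ.≤ β
      200η₀D≤β = *-cancelˡ-≤ {ι (suc B)} (0<ι (suc B)) (begin
        ι (suc B) ℚ.* ((ℤ.+ 200 ℚ./ 1) ℚ.* (η₀ ℚ.* ι D))   ≡⟨ ((∀ s k h d → s ℚ.* (k ℚ.* (h ℚ.* d)) ≡ k ℚ.* (s ℚ.* d) ℚ.* h) ∋ solve-∀ ℚ-ring) (ι (suc B)) (ℤ.+ 200 ℚ./ 1) η₀ (ι D) ⟩
        (ℤ.+ 200 ℚ./ 1) ℚ.* (ι (suc B) ℚ.* ι D) ℚ.* η₀     ≡⟨ cong (ℚ._* η₀) (trans (cong₂ ℚ._*_ (sym (ι≡fromℕ 200)) (sym (ι-* (suc B) D))) (sym (ι-* 200 (suc B * D)))) ⟩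
        ι K ℚ.* η₀                                         ≤⟨ ι*1/ℕ≤1 {K} {K} (ℕ.n≤1+n K) ⟩
        1ℚ                                                 ≡⟨ sym (trans (ℚ.*-comm (ι (suc B)) β) (1/ℕ-inverse B)) ⟩
        ι (suc B) ℚ.* β                                    ∎)
        where open ℚ.≤-Reasoning

      radius : ℚ
      radius = M ℚ.* 1/ℕ A

      0≤radius : 0ℚ ℚ.≤ radius
      0≤radius = 0≤* 0≤M (0≤1/ℕ A)

      0≤heights : ∀ v → 0ℚ ℚ.≤ heights v
      0≤heights = 0≤onVertices (ι ∘ len) (0≤ι ∘ len)

      centre : Fin (suc m) → Fin (suc m)
      centre = nearest T net

      rise : Fin (suc m) → ℚ
      rise = climb T net heights

      rise-≤ : ∀ v → rise v ℚ.≤ radius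
      rise-≤ = climb-≤ T radius heights 0≤radius 0≤heights

      centre-≤ : ∀ v → ι (d v (centre v)) ℚ.≤ rise v
      centre-≤ = nearest-≤-climb d d-refl triangle T net id heights λ e →
        ℚ.≤-reflexive (trans (cong ι (sym (len≡ e))) (sym (onVertices-inject₁ (ι ∘ len) e)))

      length-net : length (netPoints net) ≤ 2 + A
      length-net = ι-cancel-≤ (begin
        ι (length (netPoints net))                       ≡⟨ length-netPoints net ⟩
        1ℚ ℚ.+ ∑ (fins m) (λ e → ⟦ net e ⟧)              ≤⟨ ℚ.+-monoʳ-≤ 1ℚ (*-cancelˡ-≤ {M} (ℚ.<-≤-trans (ℚ.positive⁻¹ 1ℚ) 1≤M) few-marks) ⟩
        1ℚ ℚ.+ ι (suc A)                                 ≡⟨ sym (ι-suc (suc A)) ⟩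
        ι (2 + A)                                        ∎)
        where
        open ℚ.≤-Reasoning
        few-marks : M ℚ.* ∑ (fins m) (λ e → ⟦ net e ⟧) ℚ.≤ M ℚ.* ι (suc A)
        few-marks = begin
          M ℚ.* ∑ (fins m) (λ e → ⟦ net e ⟧)
            ≡⟨ trans (sym (ℚ.*-identityˡ _)) (trans (cong (ℚ._* (M ℚ.* ∑ (fins m) (λ e → ⟦ net e ⟧))) (sym (1/ℕ-inverse A)))
                 (((∀ M u s x → u ℚ.* s ℚ.* (M ℚ.* x) ≡ s ℚ.* (M ℚ.* u ℚ.* x)) ∋ solve-∀ ℚ-ring) M (1/ℕ A) (ι (suc A)) (∑ (fins m) (λ e → ⟦ net e ⟧)))) ⟩
          ι (suc A) ℚ.* (radius ℚ.* ∑ (fins m) (λ e → ⟦ net e ⟧))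
            ≤⟨ *≤ (0≤ι (suc A)) (≤≡ (mark-count T radius heights 0≤heights) (∑-onVertices (ι ∘ len))) ⟩
          ι (suc A) ℚ.* M
            ≡⟨ ℚ.*-comm (ι (suc A)) M ⟩
          M ℚ.* ι (suc A) ∎

      windows-dead : ∀ f → NonZero (dist f) → ∀ i → i * dist f + span * dist f ≤ length (line f) →
                     ι (span * dist f) ℚ.≤ (1ℚ ℚ.+ 1ℚ) ℚ.* ι t ℚ.* ∑ (window f (dist f) i) dead
      windows-dead f nz i le = ≡≤ (cong ι (sym (window-length f (dist f) i le)))
        (many-dead (λ {q} {g} → mem⁺ {q} {proj₂ g}) 0<t J late {f , window f (dist f) i} (windows⁺ f (wins⁺ f (dist f) {{nz}} i le)))

      module Verdict (tsp : ℕ) (isTSP : IsTSP d tsp) (M≤tsp : M ℚ.≤ ι tsp)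
                     (δ : Pair → ℕ) (δ≡ : ∀ {f} → f ∈ netPairs → δ f ≡ dist f) where

        tsp≤value : ∀ S → ι tsp ℚ.≤ value (ι ∘ dist) S
        tsp≤value S = ≤≡ (ι-mono (ℕ.≤-trans (proj₂ isTSP (proj₁ tour′) (proj₁ (proj₂ tour′))) (proj₂ (proj₂ tour′)))) (proj₂ (proj₂ (tour-≤-value S)))
          where
          tour′ = proj₁ (proj₂ (tour-≤-value S))

        sound : ∃[ S ] value (ι ∘ dist) S ℚ.+ (ℤ.+ 1 ℚ./ 100) ℚ.* (β ℚ.* totalDead) ℚ.≤ (1ℚ ℚ.+ 1ℚ) ℚ.* M
        sound = Soundness.soundness R β (0≤1/ℕ B) (1/ℕ≤1 B) β-small decay

        0≤totalDead : 0ℚ ℚ.≤ totalDead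
        0≤totalDead = 0≤∑ units 0≤dead

        tsp≤high : ι tsp ℚ.≤ high
        tsp≤high = ℚ.≤-trans (tsp≤value (proj₁ sound)) (≤-by (proj₂ sound +≤ *≤ {ℤ.+ 1 ℚ./ 100} (ℚ.*≤* (ℤ.+≤+ z≤n)) (0≤* (0≤1/ℕ B) 0≤totalDead))
          (((∀ v h x → v ℚ.+ (h ℚ.+ (ℤ.+ 1 ℚ./ 100) ℚ.* x) ≡ h ℚ.+ (v ℚ.+ (ℤ.+ 1 ℚ./ 100) ℚ.* x ℚ.+ (ℤ.+ 1 ℚ./ 100) ℚ.* 0ℚ)) ∋ solve-∀ ℚ-ring) (value (ι ∘ dist) (proj₁ sound)) high (β ℚ.* totalDead)))

        tsp≤low : 1ℚ ℚ.≤ (ℤ.+ 6 ℚ./ 1) ℚ.* (ι D ℚ.* σ) → ι tsp ℚ.≤ low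
        tsp≤low σ≥ = ℚ.≤-trans (tsp≤value (proj₁ sound))
          (tour-saving {M} {value (ι ∘ dist) (proj₁ sound)} {η₀} {ι D} {β} {totalDead} {L} {σ} (0≤ι D) (0≤ι (length units)) 0≤η₀ 0≤totalDead (proj₂ sound) L≡3M σ*L-≤ σ≥ 200η₀D≤β)

        low≤ : low ℚ.≤ (1ℚ ℚ.+ 1ℚ ℚ.- η₀) ℚ.* ι tsp
        low≤ = ≡≤ (((∀ h M → (1ℚ ℚ.+ 1ℚ) ℚ.* M ℚ.- h ℚ.* M ≡ (1ℚ ℚ.+ 1ℚ ℚ.- h) ℚ.* M) ∋ solve-∀ ℚ-ring) η₀ M)
          (*≤ {1ℚ ℚ.+ 1ℚ ℚ.- η₀} (≤-by (1/ℕ≤1 K +≤ 0≤1) (((∀ h → 0ℚ ℚ.+ (1ℚ ℚ.+ 1ℚ) ≡ 1ℚ ℚ.+ 1ℚ ℚ.- h ℚ.+ (h ℚ.+ 0ℚ)) ∋ solve-∀ ℚ-ring) η₀)) M≤tsp)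

        -- 2 M is at most 20/11 of the optimum, and 2 - 20/11 - 1/100 = 189/1100 is left over.
        high≤ : (ℤ.+ 11 ℚ./ 1) ℚ.* M ℚ.≤ (ℤ.+ 10 ℚ./ 1) ℚ.* ι tsp → high ℚ.≤ (1ℚ ℚ.+ 1ℚ ℚ.- η₀) ℚ.* ι tsp
        high≤ long = ≤-by (*≤ {ℤ.+ 2 ℚ./ 11} (ℚ.*≤* (ℤ.+≤+ z≤n)) long +≤ *≤ {ℤ.+ 1 ℚ./ 100} (ℚ.*≤* (ℤ.+≤+ z≤n)) (≤* (0≤ι tsp) 100η₀≤1) +≤ *≤ {ℤ.+ 189 ℚ./ 1100} (ℚ.*≤* (ℤ.+≤+ z≤n)) (0≤ι tsp))
          (((∀ M h x → (1ℚ ℚ.+ 1ℚ) ℚ.* M ℚ.+ ((ℤ.+ 2 ℚ./ 11) ℚ.* ((ℤ.+ 10 ℚ./ 1) ℚ.* x) ℚ.+ (ℤ.+ 1 ℚ./ 100) ℚ.* (1ℚ ℚ.* x) ℚ.+ (ℤ.+ 189 ℚ./ 1100) ℚ.* x)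
             ≡ (1ℚ ℚ.+ 1ℚ ℚ.- h) ℚ.* x ℚ.+ ((ℤ.+ 2 ℚ./ 11) ℚ.* ((ℤ.+ 11 ℚ./ 1) ℚ.* M) ℚ.+ (ℤ.+ 1 ℚ./ 100) ℚ.* ((ℤ.+ 100 ℚ./ 1) ℚ.* h ℚ.* x) ℚ.+ (ℤ.+ 189 ℚ./ 1100) ℚ.* 0ℚ)) ∋ solve-∀ ℚ-ring) M η₀ (ι tsp))

        δ-centres : ∀ u v → δ (centre u , centre v) ≡ d (centre u) (centre v)
        δ-centres u v = δ≡ (∈.∈-cartesianProduct⁺ (nearest-∈-net T net u) (nearest-∈-net T net v))

        -- `κ` never underestimates, so a list that is cheap for `κ` certifies a real tour; `κ≤`
        -- below ensures that few certificates are missed through its error.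
        dist≤κ : ∀ f → ι (dist f) ℚ.≤ κ δ f
        dist≤κ (u , v) = begin
          ι (d u v)
            ≤⟨ ι-mono (ℕ.≤-trans (triangle u (centre v) v) (ℕ.+-monoˡ-≤ (d (centre v) v) (triangle u (centre u) (centre v)))) ⟩
          ι (d u (centre u) + d (centre u) (centre v) + d (centre v) v)
            ≡⟨ trans (ι-+ (d u (centre u) + d (centre u) (centre v)) _) (cong₂ ℚ._+_ (trans (ι-+ (d u (centre u)) _) (cong (λ k → ι (d u (centre u)) ℚ.+ ι k) (sym (δ-centres u v)))) (cong ι (d-sym (centre v) v))) ⟩
          ι (d u (centre u)) ℚ.+ ι (δ (centre u , centre v)) ℚ.+ ι (d v (centre v))
            ≤⟨ centre-≤ u +≤ ℚ.≤-refl +≤ centre-≤ v ⟩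
          κ δ (u , v) ∎
          where open ℚ.≤-Reasoning

        ε : ℚ
        ε = (ℤ.+ 4 ℚ./ 1) ℚ.* radius

        κ≤ : ∀ f → κ δ f ℚ.≤ ι (dist f) ℚ.+ ε
        κ≤ (u , v) = ≤-by (middle +≤ (rise-≤ u +≤ rise-≤ v +≤ (ℚ.≤-trans (centre-≤ u) (rise-≤ u) +≤ ℚ.≤-trans (centre-≤ v) (rise-≤ v))))
          (((∀ cu cv k du dv x r → cu ℚ.+ k ℚ.+ cv ℚ.+ (du ℚ.+ x ℚ.+ dv ℚ.+ (r ℚ.+ r ℚ.+ (r ℚ.+ r))) ≡ x ℚ.+ (ℤ.+ 4 ℚ./ 1) ℚ.* r ℚ.+ (k ℚ.+ (cu ℚ.+ cv ℚ.+ (du ℚ.+ dv)))) ∋ solve-∀ ℚ-ring)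
            (rise u) (rise v) (ι (δ (centre u , centre v))) (ι (d u (centre u))) (ι (d v (centre v))) (ι (d u v)) radius)
          where
          middle : ι (δ (centre u , centre v)) ℚ.≤ ι (d u (centre u)) ℚ.+ ι (d u v) ℚ.+ ι (d v (centre v))
          middle = ≡≤ (cong ι (δ-centres u v)) (≤≡ (ι-mono (ℕ.≤-trans (triangle (centre u) v (centre v)) (ℕ.+-monoˡ-≤ (d v (centre v)) (triangle (centre u) u v))))
            (trans (ι-+ (d (centre u) u + d u v) _) (cong (ℚ._+ ι (d v (centre v))) (trans (ι-+ (d (centre u) u) _) (cong (λ k → ι k ℚ.+ ι (d u v)) (d-sym (centre u) u))))))

        cheap⇒tsp≤low : Cheap δ → ι tsp ℚ.≤ low
        cheap⇒tsp≤low cheap = ℚ.≤-trans (tsp≤value S) (ℚ.≤-trans (ℚ.+-monoˡ-≤ _ (∑-mono S dist≤κ)) (proj₂ (Any.satisfied cheap)))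
          where
          S : List Pair
          S = proj₁ (Any.satisfied cheap)

        expensive : ¬ Cheap δ → ∀ S → ι (length S) ℚ.≤ ι (2 * b ^ 3) → low ℚ.≤ value (κ δ) S
        expensive ¬cheap S short = ℚ.<⇒≤ (ℚ.≰⇒> λ le → ¬cheap (Any.map (λ eq → subst (λ S → value (κ δ) S ℚ.≤ low) eq le) (∈-listsUpTo ∈-pairs S (ι-cancel-≤ short))))

        -- The origin of the factor in `A`: 50 · 2 · 4 = 400, for 2 b³ pairs with an error of four
        -- radii each.
        50Nε≤M : (ℤ.+ 50 ℚ./ 1) ℚ.* (ι (2 * b ^ 3) ℚ.* ε) ℚ.≤ M
        50Nε≤M = begin
          (ℤ.+ 50 ℚ./ 1) ℚ.* (ι (2 * b ^ 3) ℚ.* ε)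
            ≡⟨ cong (λ x → (ℤ.+ 50 ℚ./ 1) ℚ.* (x ℚ.* ε)) (trans (ι-* 2 (b ^ 3)) (cong (ℚ._* ι (b ^ 3)) (ι≡fromℕ 2))) ⟩
          (ℤ.+ 50 ℚ./ 1) ℚ.* ((ℤ.+ 2 ℚ./ 1) ℚ.* ι (b ^ 3) ℚ.* ε)
            ≡⟨ ((∀ x M u → (ℤ.+ 50 ℚ./ 1) ℚ.* ((ℤ.+ 2 ℚ./ 1) ℚ.* x ℚ.* ((ℤ.+ 4 ℚ./ 1) ℚ.* (M ℚ.* u))) ≡ M ℚ.* ((ℤ.+ 400 ℚ./ 1) ℚ.* x ℚ.* u)) ∋ solve-∀ ℚ-ring) (ι (b ^ 3)) M (1/ℕ A) ⟩
          M ℚ.* ((ℤ.+ 400 ℚ./ 1) ℚ.* ι (b ^ 3) ℚ.* 1/ℕ A)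
            ≤⟨ *≤ 0≤M (≡≤ (cong (ℚ._* 1/ℕ A) (trans (cong (ℚ._* ι (b ^ 3)) (sym (ι≡fromℕ 400))) (sym (ι-* 400 (b ^ 3))))) (ι*1/ℕ≤1 {A} {A} (ℕ.n≤1+n A))) ⟩
          M ℚ.* 1ℚ
            ≡⟨ ℚ.*-identityʳ M ⟩
          M ∎
          where open ℚ.≤-Reasoning

        σ-large : ¬ Cheap δ → (ℤ.+ 10 ℚ./ 1) ℚ.* ι tsp ℚ.≤ (ℤ.+ 11 ℚ./ 1) ℚ.* M → 1ℚ ℚ.≤ (ℤ.+ 96 ℚ./ 1) ℚ.* (ι t ℚ.* σ)
        σ-large ¬cheap short = success-probability {M} {ι (cycleWeight d vs)} {η₀} {ι (2 * b ^ 3) ℚ.* ε} {ι t} {totalDead} {L} {σ} 0<L (0≤ι t) 0≤M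
          tour-bound (≡≤ (cong (λ k → (ℤ.+ 10 ℚ./ 1) ℚ.* ι k) (proj₂ (proj₂ (proj₁ isTSP)))) short) 100η₀≤1 50Nε≤M L≡3M σ*L-≥
          where
          vs : List (Fin (suc m))
          vs = proj₁ (proj₁ isTSP)
          tour-bound : (ℤ.+ 6 ℚ./ 1) ℚ.* M ℚ.≤ (ℤ.+ 5 ℚ./ 1) ℚ.* ι (cycleWeight d vs) ℚ.+ (ℤ.+ 16 ℚ./ 1) ℚ.* (η₀ ℚ.* M) ℚ.+ (ℤ.+ 4 ℚ./ 1) ℚ.* (ι (2 * b ^ 3) ℚ.* ε)
                         ℚ.+ (1ℚ ℚ.+ 1ℚ) ℚ.* ι t ℚ.* ((ℤ.+ 2 ℚ./ 1) ℚ.* totalDead)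
          tour-bound = LowerBoundSum.tour-≥ d metric 3≤n T len len≡ portals dead 0≤dead ((1ℚ ℚ.+ 1ℚ) ℚ.* ι t) (0≤* (0≤+ 0≤1 0≤1) (0≤ι t)) windows-dead (κ δ) ε (η₀ ℚ.* M) κ≤ (0≤* {ℤ.+ 4 ℚ./ 1} (ℚ.*≤* (ℤ.+≤+ z≤n)) 0≤radius)
            vs (proj₁ (proj₂ (proj₁ isTSP))) (ι (2 * b ^ 3)) few-portals (expensive ¬cheap)

        module _ (bad : ℚ → ℚ) (bad≤1 : ∀ x → bad x ℚ.≤ 1ℚ)
                 (good : ∀ x → ι tsp ℚ.≤ x → x ℚ.≤ (1ℚ ℚ.+ 1ℚ ℚ.- η₀) ℚ.* ι tsp → bad x ≡ 0ℚ) where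

          private
            0≤½^l : 0ℚ ℚ.≤ ½ ^ℚ l
            0≤½^l = 0≤^ l (ℚ.*≤* {0ℚ} {½} (ℤ.+≤+ z≤n))

            ≤-not : ∀ c x y → bad x ≡ 0ℚ → bad (if c then x else y) ℚ.≤ ⟦ not c ⟧
            ≤-not true  x y eq = ℚ.≤-reflexive eq
            ≤-not false x y eq = bad≤1 y

            ≤-id : ∀ c x y → bad y ≡ 0ℚ → bad (if c then x else y) ℚ.≤ ⟦ c ⟧
            ≤-id true  x y eq = bad≤1 x
            ≤-id false x y eq = ℚ.≤-reflexive eq

            ≤-zero : ∀ c x y → bad x ≡ 0ℚ → bad y ≡ 0ℚ → bad (if c then x else y) ℚ.≤ 0ℚ
            ≤-zero true  x y eq eq′ = ℚ.≤-reflexive eq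
            ≤-zero false x y eq eq′ = ℚ.≤-reflexive eq′

            -- The origin of `D`: 28 · 96 / 3 = 896.
            28Dσ : 1ℚ ℚ.≤ (ℤ.+ 96 ℚ./ 1) ℚ.* (ι t ℚ.* σ) → ℤ.+ 28 ℚ./ 1 ℚ.≤ (ℤ.+ 3 ℚ./ 1) ℚ.* (ι D ℚ.* σ)
            28Dσ σ≥ = ≤≡ (*≤ {ℤ.+ 28 ℚ./ 1} (ℚ.*≤* (ℤ.+≤+ z≤n)) σ≥)
              (trans (((∀ t s → (ℤ.+ 28 ℚ./ 1) ℚ.* ((ℤ.+ 96 ℚ./ 1) ℚ.* (t ℚ.* s)) ≡ (ℤ.+ 3 ℚ./ 1) ℚ.* ((ℤ.+ 896 ℚ./ 1) ℚ.* t ℚ.* s)) ∋ solve-∀ ℚ-ring) (ι t) σ)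
                (cong (λ x → (ℤ.+ 3 ℚ./ 1) ℚ.* (x ℚ.* σ)) (trans (cong (ℚ._* ι t) (sym (ι≡fromℕ 896))) (sym (ι-* 896 t)))))

            bad-low : 1ℚ ℚ.≤ (ℤ.+ 6 ℚ./ 1) ℚ.* (ι D ℚ.* σ) → bad low ≡ 0ℚ
            bad-low σ≥ = good low (tsp≤low σ≥) low≤

            bad-high : (ℤ.+ 11 ℚ./ 1) ℚ.* M ℚ.≤ (ℤ.+ 10 ℚ./ 1) ℚ.* ι tsp → bad high ≡ 0ℚ
            bad-high long = good high tsp≤high (high≤ long)

            short-case : ℤ.+ 28 ℚ./ 1 ℚ.≤ (ℤ.+ 3 ℚ./ 1) ℚ.* (ι D ℚ.* σ) → E d counts (bad ∘ answer) ℚ.≤ ½ ^ℚ l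
            short-case σ≥ = ℚ.≤-trans (E-mono counts (λ k → ≤-not ⌊ l ℕ.≤? k ⌋ low high (bad-low (≤-by (*≤ {ℤ.+ 2 ℚ./ 1} (ℚ.*≤* (ℤ.+≤+ z≤n)) σ≥ +≤ 0≤55)
              (((∀ x → 1ℚ ℚ.+ ((ℤ.+ 2 ℚ./ 1) ℚ.* ((ℤ.+ 3 ℚ./ 1) ℚ.* x) ℚ.+ (ℤ.+ 55 ℚ./ 1)) ≡ (ℤ.+ 6 ℚ./ 1) ℚ.* x ℚ.+ ((ℤ.+ 2 ℚ./ 1) ℚ.* (ℤ.+ 28 ℚ./ 1) ℚ.+ 0ℚ)) ∋ solve-∀ ℚ-ring) (ι D ℚ.* σ)))))) (few-successes trial D l σ≥)
              where
              0≤55 : 0ℚ ℚ.≤ ℤ.+ 55 ℚ./ 1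
              0≤55 = ℚ.*≤* (ℤ.+≤+ z≤n)

            -- `high` is a correct answer here. If σ is not small, `low` is correct as well by
            -- `tsp≤low`; if it is small, `low` is rarely given. Thus the trials need not separate σ
            -- at a sharp threshold.
            long-case : bad high ≡ 0ℚ → 1ℚ ℚ.≤ (ℤ.+ 6 ℚ./ 1) ℚ.* (ι D ℚ.* σ) ⊎ (ℤ.+ 6 ℚ./ 1) ℚ.* (ι D ℚ.* σ) ℚ.≤ 1ℚ → E d counts (bad ∘ answer) ℚ.≤ ½ ^ℚ l
            long-case bh (inj₁ σ≥) = ℚ.≤-trans (≤≡ (E-mono counts {bad ∘ answer} {λ _ → 0ℚ} λ k → ≤-zero ⌊ l ℕ.≤? k ⌋ low high (bad-low σ≥) bh) (E-const counts 0ℚ)) 0≤½^l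
            long-case bh (inj₂ σ≤) = ℚ.≤-trans (E-mono counts (λ k → ≤-id ⌊ l ℕ.≤? k ⌋ low high bh)) (many-successes trial D l σ≤)

            cases : ¬ Cheap δ → (ℤ.+ 10 ℚ./ 1) ℚ.* ι tsp ℚ.≤ (ℤ.+ 11 ℚ./ 1) ℚ.* M ⊎ (ℤ.+ 11 ℚ./ 1) ℚ.* M ℚ.≤ (ℤ.+ 10 ℚ./ 1) ℚ.* ι tsp →
                    E d counts (bad ∘ answer) ℚ.≤ ½ ^ℚ l
            cases ¬cheap (inj₁ short) = short-case (28Dσ (σ-large ¬cheap short))
            cases ¬cheap (inj₂ long)  = long-case (bad-high long) (ℚ.≤-total 1ℚ ((ℤ.+ 6 ℚ./ 1) ℚ.* (ι D ℚ.* σ)))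

          decide-reliable : ∀ x → E d (decide δ x) bad ℚ.≤ ½ ^ℚ l
          decide-reliable (yes cheap) = ≡≤ (good low (cheap⇒tsp≤low cheap) low≤) 0≤½^l
          decide-reliable (no ¬cheap) = ≡≤ {E d (decide δ (no ¬cheap)) bad} {E d counts (bad ∘ answer)} {½ ^ℚ l} (E-bind counts (return ∘ answer) bad) (cases ¬cheap (ℚ.≤-total ((ℤ.+ 10 ℚ./ 1) ℚ.* ι tsp) ((ℤ.+ 11 ℚ./ 1) ℚ.* M)))

      queries-trial : queries d trial ≤ cap
      queries-trial = queries-random-≤ {w = d} {suc (length units ∸ 1)} {cap} (λ i → queries d (dies (nth units (toℕ i)))) λ i → bound (nth units (toℕ i))
        where
        bound : ∀ x → queries d (dies x) ≤ cap
        bound nothing  = z≤n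
        bound (just q) = ℕ.≤-trans (queries-bind (run q) (λ r → return (maybe not false r)) 0 (λ _ → z≤n))
          (ℕ.≤-trans (ℕ.≤-reflexive (ℕ.+-identityʳ _)) (queries-capped cap (alive R q)))

      queries-decide : ∀ δ x → queries d (decide δ x) ≤ l * D * cap
      queries-decide δ (yes _) = z≤n
      queries-decide δ (no  _) = ℕ.≤-trans (queries-bind counts (return ∘ answer) 0 (λ _ → z≤n))
        (ℕ.≤-trans (ℕ.≤-reflexive (ℕ.+-identityʳ _)) (ℕ.≤-trans (queries-countTrue (l * D) trial) (ℕ.*-monoʳ-≤ (l * D) queries-trial)))

-- The choice of constants and the query budget

length-cartesianProduct : ∀ {A B : Set} (xs : List A) (ys : List B) → length (cartesianProduct xs ys) ≡ length xs * length ys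
length-cartesianProduct []       ys = refl
length-cartesianProduct (x ∷ xs) ys = trans (List.length-++ (map (x ,_) ys)) (cong₂ _+_ (List.length-map (x ,_) ys) (length-cartesianProduct xs ys))

0<1/ℕ : ∀ k → 0ℚ ℚ.< 1/ℕ k
0<1/ℕ k = ℚ.≰⇒> λ le → contradiction
  (≡≤ (sym (1/ℕ-inverse k)) (≤≡ (≤* (0≤ι (suc k)) le) (ℚ.*-zeroˡ (ι (suc k))))) λ { (ℚ.*≤* (ℤ.+≤+ ())) }

[9/10]^-≤ : ∀ c t → 100 * c * 9 ^ t ≤ 10 ^ t → ι c ℚ.* (ℤ.+ 9 ℚ./ 10) ^ℚ t ℚ.≤ ℤ.+ 1 ℚ./ 100
[9/10]^-≤ c t le = *-cancelˡ-≤ {ι 100 ℚ.* ι (10 ^ t)} (subst (0ℚ ℚ.<_) (ι-* 100 (10 ^ t)) (0<ι (100 * 10 ^ t) {{ℕ.m*n≢0 100 (10 ^ t) {{_}} {{ℕ.m^n≢0 10 t}}}})) (begin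
  ι 100 ℚ.* ι (10 ^ t) ℚ.* (ι c ℚ.* x)       ≡⟨ ((∀ h p c x → h ℚ.* p ℚ.* (c ℚ.* x) ≡ h ℚ.* c ℚ.* (x ℚ.* p)) ∋ solve-∀ ℚ-ring) (ι 100) (ι (10 ^ t)) (ι c) x ⟩
  ι 100 ℚ.* ι c ℚ.* (x ℚ.* ι (10 ^ t))       ≡⟨ cong₂ ℚ._*_ (sym (ι-* 100 c)) nines ⟩
  ι (100 * c) ℚ.* ι (9 ^ t)                  ≡⟨ sym (ι-* (100 * c) (9 ^ t)) ⟩
  ι (100 * c * 9 ^ t)                        ≤⟨ ι-mono le ⟩
  ι (10 ^ t)                                 ≡⟨ ((∀ p → p ≡ (ℤ.+ 100 ℚ./ 1) ℚ.* p ℚ.* (ℤ.+ 1 ℚ./ 100)) ∋ solve-∀ ℚ-ring) (ι (10 ^ t)) ⟩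
  (ℤ.+ 100 ℚ./ 1) ℚ.* ι (10 ^ t) ℚ.* (ℤ.+ 1 ℚ./ 100) ≡⟨ cong (λ h → h ℚ.* ι (10 ^ t) ℚ.* (ℤ.+ 1 ℚ./ 100)) (sym (ι≡fromℕ 100)) ⟩
  ι 100 ℚ.* ι (10 ^ t) ℚ.* (ℤ.+ 1 ℚ./ 100)   ∎)
  where
  open ℚ.≤-Reasoning
  x : ℚ
  x = (ℤ.+ 9 ℚ./ 10) ^ℚ t
  nines : x ℚ.* ι (10 ^ t) ≡ ι (9 ^ t)
  nines = trans (cong (x ℚ.*_) (ι-^ 10 t)) (trans (sym (^-distrib-* (ℤ.+ 9 ℚ./ 10) (ι 10) t))
    (trans (cong (_^ℚ t) (trans (cong ((ℤ.+ 9 ℚ./ 10) ℚ.*_) (ι≡fromℕ 10)) (sym (ι≡fromℕ 9)))) (sym (ι-^ 9 t))))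

square-bound : ∀ Q z b n l → b ^ 4 ≤ z ^ 4 * n → (Q * (b ^ 6 * l)) ^ 2 ≤ Q ^ 2 * (z ^ 4) ^ 3 * n ^ 3 * l ^ 2
square-bound Q z b n l b⁴≤ = begin
  (Q * (b ^ 6 * l)) ^ 2                    ≡⟨ trans (^-distribʳ-* 2 Q (b ^ 6 * l)) (cong (Q ^ 2 *_) (^-distribʳ-* 2 (b ^ 6) l)) ⟩
  Q ^ 2 * ((b ^ 6) ^ 2 * l ^ 2)            ≡⟨ cong (λ x → Q ^ 2 * (x * l ^ 2)) (trans (ℕ.^-*-assoc b 6 2) (sym (ℕ.^-*-assoc b 4 3))) ⟩
  Q ^ 2 * ((b ^ 4) ^ 3 * l ^ 2)            ≤⟨ ℕ.*-monoʳ-≤ (Q ^ 2) (ℕ.*-monoˡ-≤ (l ^ 2) (ℕ.^-monoˡ-≤ 3 b⁴≤)) ⟩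
  Q ^ 2 * ((z ^ 4 * n) ^ 3 * l ^ 2)        ≡⟨ cong (λ x → Q ^ 2 * (x * l ^ 2)) (^-distribʳ-* 3 (z ^ 4) n) ⟩
  Q ^ 2 * ((z ^ 4) ^ 3 * n ^ 3 * l ^ 2)    ≡⟨ ((∀ q a b c → q * (a * b * c) ≡ q * a * b * c) ∋ ℕ-solve-∀) (Q ^ 2) ((z ^ 4) ^ 3) (n ^ 3) (l ^ 2) ⟩
  Q ^ 2 * (z ^ 4) ^ 3 * n ^ 3 * l ^ 2      ∎
  where open ℕ.≤-Reasoning

query-sum : ∀ m Y x k q r → m ≤ Y → x ≤ k * Y → q ≤ r * Y → m + (x + q) ≤ (1 + k + r) * Y
query-sum m Y x k q r m≤ x≤ q≤ = ℕ.≤-trans (ℕ.+-mono-≤ m≤ (ℕ.+-mono-≤ x≤ q≤))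
  (ℕ.≤-reflexive (((∀ y k r → y + (k * y + r * y) ≡ (1 + k + r) * y) ∋ ℕ-solve-∀) Y k r))

square-≤ : ∀ k y {x Y} → x ≤ k * y → y * y ≤ Y → x * x ≤ k * k * Y
square-≤ k y x≤ y²≤ = ℕ.≤-trans (ℕ.*-mono-≤ x≤ x≤)
  (ℕ.≤-trans (ℕ.≤-reflexive (((∀ k y → k * y * (k * y) ≡ k * k * (y * y)) ∋ ℕ-solve-∀) k y)) (ℕ.*-monoʳ-≤ (k * k) y²≤))

2+400x≤402x : ∀ x → 1 ≤ x → 2 + 400 * x ≤ 402 * x
2+400x≤402x x 1≤x = ℕ.≤-trans (ℕ.+-monoˡ-≤ (400 * x) (ℕ.*-monoʳ-≤ 2 1≤x)) (ℕ.≤-reflexive (sym (ℕ.*-distribʳ-+ x 2 400)))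

regroup-factors : ∀ l D k C x y → l * D * (k * (C * (x * y))) ≡ D * (k * (C * x)) * (y * l)
regroup-factors = ℕ-solve-∀

-- The number t of repetitions must make 9/10 to the power t tiny against z⁻⁵, z = 2 (t + 2).
-- It is opaque so that the constants derived from it are never evaluated.
opaque
  repetitions : ℕ
  repetitions = 400

  repetitions≢0 : NonZero repetitions
  repetitions≢0 = _

  repetitions-suffice : 100 * (2 * (2 * (repetitions + 2)) ^ 5) * 9 ^ repetitions ≤ 10 ^ repetitions
  -- The factor before 9 ^ 400 is below 10 ^ 17, and 9 ^ 400 is below 10 ^ 382.
  repetitions-suffice = ℕ.≤ᵇ⇒≤ (100 * (2 * (2 * (400 + 2)) ^ 5) * 9 ^ 400) (10 ^ 400) _

open Estimator repetitions

opaque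
  Q : ℕ
  Q = 1 + 402 * 402 + D * (96 * repetitions * (C₀ * z ^ 6))

  Q-sum : ∀ {m Y x q} → m ≤ Y → x ≤ 402 * 402 * Y → q ≤ D * (96 * repetitions * (C₀ * z ^ 6)) * Y → m + (x + q) ≤ Q * Y
  Q-sum {m} {Y} {x} {q} = query-sum m Y x (402 * 402) q (D * (96 * repetitions * (C₀ * z ^ 6)))

budget : ℕ → ℕ
budget zero    = 0
budget (suc m) = Q * ((z ^ proj₁ (scale z 2≤z m)) ^ 6 * ⌈log₂ suc m ⌉)

budget-Õ : Õ[n^1·5] budget
budget-Õ = Q ^ 2 * (z ^ 4) ^ 3 , 2 , λ
  { (suc m) _ → square-bound Q z (z ^ proj₁ (scale z 2≤z m)) (suc m) ⌈log₂ suc m ⌉ (proj₂ (proj₂ (scale z 2≤z m))) }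

module _ {m} (T : RTree m) (d : Weights (suc m)) (metric : IsMetric _≡_ d) (3≤n : 3 ≤ suc m) where

  open Algorithm T

  private
    len : Fin m → ℕ
    len e = table edgePairs (map (uncurry d) edgePairs) (Fin.inject₁ e , parent T e)

    len≡ : ∀ e → len e ≡ d (Fin.inject₁ e) (parent T e)
    len≡ e = table-map (uncurry d) edgePairs (∈.∈-map⁺ (λ e → Fin.inject₁ e , parent T e) (∈-fins e))

    open Measured len using (M; netPairs; net; decide; cheap?; estimate)
    open Analysis d metric 3≤n len len≡ repetitions≢0 ([9/10]^-≤ c repetitions repetitions-suffice) using (queries-decide; length-net; module Verdict)

    δ : Fin (suc m) × Fin (suc m) → ℕ
    δ = table netPairs (map (uncurry d) netPairs)

  tspEstimate-reliable : ∀ tsp → IsTSP d tsp → ∑ (fins m) (λ e → ι (d (Fin.inject₁ e) (parent T e))) ℚ.≤ ι tsp →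
    (bad : ℚ → ℚ) → (∀ x → bad x ℚ.≤ 1ℚ) → (∀ x → ι tsp ℚ.≤ x → x ℚ.≤ (1ℚ ℚ.+ 1ℚ ℚ.- η₀) ℚ.* ι tsp → bad x ≡ 0ℚ) →
    E d tspEstimate bad ℚ.≤ ½ ^ℚ l
  tspEstimate-reliable tsp isTSP M≤ bad bad≤1 good =
    ≡≤ (E-reading {w = d} edgePairs (λ xs → Measured.estimate λ e → table edgePairs xs (Fin.inject₁ e , parent T e)) bad)
      (≡≤ (E-reading {w = d} netPairs (λ xs → decide (table netPairs xs) (cheap? (table netPairs xs))) bad)
        (Verdict.decide-reliable tsp isTSP (≡≤ (∑-cong (fins m) (cong ι ∘ len≡)) M≤) δ (table-map (uncurry d) netPairs) bad bad≤1 good (cheap? δ)))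

  queries-tspEstimate : queries d tspEstimate ≤ budget (suc m)
  queries-tspEstimate = ℕ.≤-trans (ℕ.≤-reflexive total) within
    where
    total : queries d tspEstimate ≡ m + (length netPairs + queries d (decide δ (cheap? δ)))
    total = trans (queries-reading {w = d} edgePairs (λ xs → Measured.estimate λ e → table edgePairs xs (Fin.inject₁ e , parent T e)))
      (cong₂ _+_ (trans (List.length-map (λ e → Fin.inject₁ e , parent T e) (fins m)) (length-fins m)) (queries-reading {w = d} netPairs (λ xs → decide (table netPairs xs) (cheap? (table netPairs xs)))))
    Y : ℕ
    Y = b ^ 6 * l
    1≤l : NonZero l
    1≤l = ℕ.>-nonZero (⌈log₂⌉-mono-≤ {2} {suc m} (ℕ.≤-trans (ℕ.n≤1+n 2) 3≤n))
    b⁶≤Y : b ^ 6 ≤ Y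
    b⁶≤Y = ℕ.m≤m*n (b ^ 6) l {{1≤l}}
    m≤Y : m ≤ Y
    m≤Y = ℕ.≤-trans (ℕ.n≤1+n m) (ℕ.≤-trans n≤b⁴ (ℕ.≤-trans (ℕ.^-monoʳ-≤ b {{0<b}} (ℕ.m≤m+n 4 2)) b⁶≤Y))
    trials : l * D * cap ≤ D * (96 * repetitions * (C₀ * z ^ 6)) * Y
    trials = ℕ.≤-reflexive (regroup-factors l D (96 * repetitions) C₀ (z ^ 6) (b ^ 6))
    points : length (netPoints net) ≤ 402 * b ^ 3
    points = ℕ.≤-trans length-net (2+400x≤402x (b ^ 3) (ℕ.m^n>0 b {{0<b}} 3))
    b³b³≤Y : b ^ 3 * b ^ 3 ≤ Y
    b³b³≤Y = ℕ.≤-trans (ℕ.≤-reflexive (sym (ℕ.^-distribˡ-+-* b 3 3))) b⁶≤Y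
    net≤ : length netPairs ≤ 402 * 402 * Y
    net≤ = ℕ.≤-trans (ℕ.≤-reflexive (length-cartesianProduct (netPoints net) (netPoints net))) (square-≤ 402 (b ^ 3) {length (netPoints net)} {Y} points b³b³≤Y)
    within : m + (length netPairs + queries d (decide δ (cheap? δ))) ≤ Q * Y
    within = Q-sum {m} {Y} {length netPairs} {queries d (decide δ (cheap? δ))} m≤Y net≤ (ℕ.≤-trans (queries-decide δ (cheap? δ)) trials)

module Relabelled {n} (es : List (Edge (suc n))) where

  open Growing es
  open Grown

  root : Grown
  root = grown leaf (λ _ → zero)

  root-sound : Sound root
  root-sound = record { injective = λ { {zero} {zero} _ → refl } ; adjacent = λ () }

  -- Opaque, to keep the search for extensions from being evaluated symbolically.
  opaque
    whole : Grown
    whole = grow (suc n) root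

    whole-sound : Sound whole
    whole-sound = grow-sound (suc n) root root-sound

    whole-maximal : ¬ Extension whole
    whole-maximal = grow-stops root root-sound

  estimate : QueryAlg (suc n) ℚ
  estimate = relabel (pos whole) (Algorithm.tspEstimate (tree whole))

  module _ (3≤n : 3 ≤ suc n) (w : Weights (suc n)) (metric : IsMetric _≡_ w) (mst : IsMST w es) where

    private
      k : ℕ
      k = suc (size whole)

      d : Weights k
      d = pulled w (pos whole)

      injective : ∀ {i j} → pos whole i ≡ pos whole j → i ≡ j
      injective = Sound.injective whole-sound

      onto : ∀ v → ∃[ j ] pos whole j ≡ v
      onto = surjective whole whole-maximal (IsSpanningTree.connected (proj₁ mst))

      k≡ : k ≡ suc n
      k≡ = ℕ.≤-antisym (size<n whole whole-sound) (Fin.injective⇒≤ {f = proj₁ ∘ onto} λ {u} {v} eq →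
        trans (sym (proj₂ (onto u))) (trans (cong (pos whole) eq) (proj₂ (onto v))))

      3≤k : 3 ≤ k
      3≤k = ℕ.≤-trans 3≤n (ℕ.≤-reflexive (sym k≡))

      d-metric : IsMetric _≡_ d
      d-metric = pulled-metric w (pos whole) injective onto metric

    queries-estimate : queries w estimate ≤ budget (suc n)
    queries-estimate = ℕ.≤-trans (queries-relabel w (pos whole) (Algorithm.tspEstimate (tree whole)))
      (ℕ.≤-trans (queries-tspEstimate (tree whole) d d-metric 3≤k) (ℕ.≤-reflexive (cong budget k≡)))

    estimate-reliable : ∀ t → IsTSP w t → ∀ {P : ℚ → Set} (P? : Decidable P) →
      (∀ x → ι t ℚ.≤ x → x ℚ.≤ (1ℚ ℚ.+ 1ℚ ℚ.- η₀) ℚ.* ι t → P x) → HighProbability (suc n) (Pr w P? estimate)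
    estimate-reliable t isTSP P? good = begin
      (1ℚ ℚ.- Pr w P? estimate) ℚ.* fromℕ (suc n)    ≡⟨ cong₂ ℚ._*_ (trans (cong (λ x → 1ℚ ℚ.- x) (Pr≡E P? estimate)) (sym (E-not estimate (λ x → does (P? x))))) (sym (ι≡fromℕ (suc n))) ⟩
      E w estimate bad ℚ.* ι (suc n)                 ≤⟨ *≤* (0≤ι (suc n)) (0≤^ l (ℚ.*≤* {0ℚ} {½} (ℤ.+≤+ z≤n))) fails (ι-mono (subst (λ j → j ≤ 2 ^ l) k≡ (n≤2^⌈log₂n⌉ k))) ⟩
      ½ ^ℚ l ℚ.* ι (2 ^ l)                           ≡⟨ ½^l*2^l≡1 l ⟩
      1ℚ                                             ∎
      where
      open ℚ.≤-Reasoning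
      l : ℕ
      l = ⌈log₂ k ⌉
      bad : ℚ → ℚ
      bad x = ⟦ not (does (P? x)) ⟧
      tree≤tsp : treeWeight w es ≤ t
      tree≤tsp = ℕ.≤-trans (MST-≤-cycle w (IsMetric.sym metric) es mst (proj₁ (proj₁ isTSP)) (proj₁ (proj₂ (proj₁ isTSP)))) (ℕ.≤-reflexive (proj₂ (proj₂ (proj₁ isTSP))))
      fails : E w estimate bad ℚ.≤ ½ ^ℚ l
      fails = ≡≤ (E-relabel w (pos whole) (Algorithm.tspEstimate (tree whole)) bad)
        (tspEstimate-reliable (tree whole) d d-metric 3≤k t (pulled-TSP w (pos whole) injective onto isTSP)
          (ℚ.≤-trans (grown-weight w (IsMetric.sym metric) whole whole-sound) (ι-mono tree≤tsp)) bad (λ x → ⟦ not (does (P? x)) ⟧≤1)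
          λ x lower upper → cong (λ c → ⟦ not c ⟧) (dec-true (P? x) (good x lower upper)))

approximate : ∀ n → List (Edge n) → QueryAlg n ℚ
approximate zero    es = return 0ℚ
approximate (suc n) es = Relabelled.estimate es

edges-withWeights : ∀ {n} (w : Weights n) es → map proj₁ (withWeights w es) ≡ es
edges-withWeights w es = trans (sym (List.map-∘ es)) (List.map-id es)

theorem1p8 : ∃[ ε₀ ] 0ℚ ℚ.< ε₀ ×
    Σ[ alg ∈ (∀ n → List (WeightedEdge n) → QueryAlg n ℚ) ]
    ∃[ q ] Õ[n^1·5] q ×
    (∀ n → 3 ≤ n →
    (w : Weights n) → IsMetric _≡_ w →
    (es : List (Edge n)) → IsMST w es →
    queries w (alg n (withWeights w es)) ≤ q n ×
    (∀ t → IsTSP w t →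
    HighProbability n
    (Pr w (λ X → (fromℕ t ℚ.≤? X) ×-dec (X ℚ.≤? (fromℕ 2 ℚ.- ε₀) ℚ.* fromℕ t))
    (alg n (withWeights w es)))))
theorem1p8 = η₀ , 0<1/ℕ K , (λ n wes → approximate n (map proj₁ wes)) , budget , budget-Õ , λ
  { (suc n) 3≤n w metric es mst →
      subst (λ es′ → queries w (approximate (suc n) es′) ≤ budget (suc n)) (sym (edges-withWeights w es)) (Relabelled.queries-estimate es 3≤n w metric mst) ,
      λ t isTSP → subst (λ es′ → HighProbability (suc n) (Pr w (λ X → (fromℕ t ℚ.≤? X) ×-dec (X ℚ.≤? (fromℕ 2 ℚ.- η₀) ℚ.* fromℕ t)) (approximate (suc n) es′)))
        (sym (edges-withWeights w es)) (Relabelled.estimate-reliable es 3≤n w metric mst t isTSP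
          (λ X → (fromℕ t ℚ.≤? X) ×-dec (X ℚ.≤? (fromℕ 2 ℚ.- η₀) ℚ.* fromℕ t))
          λ X lower upper → ≡≤ (sym (ι≡fromℕ t)) lower , ≤≡ upper (cong ((fromℕ 2 ℚ.- η₀) ℚ.*_) (ι≡fromℕ t))) }
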